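{- Let $\mathcal{L}$ be a non-empty set of lines of $\mathrm{PG}(n,q)$. Then $\mathcal{L}$ is the line set of a split Cayley hexagon $\mathbf{H}(q)$ naturally embedded in $\mathrm{PG}(6,q)$ if and only if $\mathcal{L}$ satisfies the conditions (Pt), (Pl), (Sd), (Hp'), and (To).
   Context: The conditions on a non-empty line set $\mathcal{L}$ of $\mathrm{PG}(n,q)$ are: (Pt) every point of $\mathrm{PG}(n,q)$ is incident with either $0$ or $q+1$ elements of $\mathcal{L}$; (Pl) every plane of $\mathrm{PG}(n,q)$ is incident with either $0$, $1$ or $q+1$ elements of $\mathcal{L}$; (Sd) every solid (3-dimensional subspace) of $\mathrm{PG}(n,q)$ is incident with either $0$, $1$, $q+1$ or $2q+1$ elements of $\mathcal{L}$; (Hp') every 5-dimensional subspace of $\mathrm{PG}(n,q)$ is incident with at most $q^4-q^3+3q^2+2q$ elements of $\mathcal{L}$; (To) $|\mathcal{L}| \le q^5+q^4+q^3+q^2+q+1$. The natural embedding of $\mathbf{H}(q)$ in $\mathrm{PG}(6,q)$: points are those of the parabolic quadric $\mathbf{Q}(6,q)$: $x_0x_4+x_1x_5+x_2x_6=x_3^2$, and lines are the lines of $\mathbf{Q}(6,q)$ whose Grassmann coordinates satisfy $p_{12}=p_{34}$, $p_{54}=p_{32}$, $p_{20}=p_{35}$, $p_{65}=p_{30}$, $p_{01}=p_{36}$, $p_{46}=p_{31}$. -}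

module Defs where

open import Level using (0ℓ)
open import Data.Nat using (ℕ; zero; suc; _+_; _∸_; _^_; _≤_)
open import Data.Fin using (Fin; #_)
open import Data.Vec using (Vec; []; _∷_; replicate; zipWith; map; lookup)
open import Data.List using (List; length)
open import Data.List.Membership.Propositional using (_∈_)
open import Data.List.Relation.Unary.Unique.Propositional using (Unique)
open import Data.Vec.Relation.Unary.All using (All)
open import Data.Product using (Σ; ∃; _×_; _,_)
open import Data.Sum using (_⊎_)
open import Relation.Nullary using (¬_; Dec)
open import Relation.Binary.PropositionalEquality using (_≡_)
open import Relation.Binary.Definitions using (DecidableEquality)
open import Algebra.Core using (Op₁; Op₂)
open import Algebra.Structures using (IsCommutativeRing)
open import Function.Bundles using (_⇔_)

record FiniteField : Set₁ where
  infixl 6 _+F_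
  infixl 7 _*F_
  field
    Carrier  : Set
    _+F_     : Op₂ Carrier
    _*F_     : Op₂ Carrier
    -F_      : Op₁ Carrier
    0F       : Carrier
    1F       : Carrier
    isCommutativeRing : IsCommutativeRing _≡_ _+F_ _*F_ -F_ 0F 1F
    0≢1      : ¬ (0F ≡ 1F)
    inverse  : ∀ x → ¬ (x ≡ 0F) → ∃ λ y → x *F y ≡ 1F
    _≟F_     : DecidableEquality Carrier
    elements : List Carrier
    complete : ∀ x → x ∈ elements
    unique   : Unique elements

  order : ℕ
  order = length elements

HasCard : {A : Set} → (A → A → Set) → (A → Set) → ℕ → Set
HasCard {A} _≈_ P m =
  Σ (Vec A m) λ xs →
    All P xs
    × (∀ i j → ¬ (i ≡ j) → ¬ (lookup xs i ≈ lookup xs j))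
    × (∀ a → P a → ∃ λ i → a ≈ lookup xs i)

module _ (F : FiniteField) where
  open FiniteField F

  Vect : ℕ → Set
  Vect N = Vec Carrier N

  zeroV : ∀ N → Vect N
  zeroV N = replicate N 0F

  _⊕_ : ∀ {N} → Vect N → Vect N → Vect N
  _⊕_ = zipWith _+F_

  _·_ : ∀ {N} → Carrier → Vect N → Vect N
  c · v = map (c *F_) v

  lincomb : ∀ {N k} → Vec Carrier k → Vec (Vect N) k → Vect N
  lincomb {N} []       []       = zeroV N
  lincomb     (c ∷ cs) (b ∷ bs) = (c · b) ⊕ lincomb cs bs

  InSpan : ∀ {N k} → Vec (Vect N) k → Vect N → Set
  InSpan B v = ∃ λ cs → lincomb cs B ≡ v

  Independent : ∀ {N k} → Vec (Vect N) k → Set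
  Independent {k = k} B = ∀ cs → lincomb cs B ≡ zeroV _ → cs ≡ replicate k 0F

  SpanEq : ∀ {N k l} → Vec (Vect N) k → Vec (Vect N) l → Set
  SpanEq A B = ∀ v → (InSpan A v → InSpan B v) × (InSpan B v → InSpan A v)

  -- A projective subspace of (projective) dimension d of PG(N-1,q),
  -- i.e. a (d+1)-dimensional subspace of GF(q)^N, given by a basis.
  record Subspace (N d : ℕ) : Set where
    constructor subspace
    field
      basis : Vec (Vect N) (suc d)
      indep : Independent basis
  open Subspace public

  _⊆S_ : ∀ {N d e} → Subspace N d → Subspace N e → Set
  X ⊆S Y = ∀ v → InSpan (basis X) v → InSpan (basis Y) v

  SameSub : ∀ {N d} → Subspace N d → Subspace N d → Set
  SameSub X Y = (X ⊆S Y) × (Y ⊆S X)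

  IsPoint : ∀ {N} → Vect N → Set
  IsPoint {N} p = ¬ (p ≡ zeroV N)

  OnSub : ∀ {N d} → Vect N → Subspace N d → Set
  OnSub p X = InSpan (basis X) p

  Line : ℕ → Set
  Line N = Subspace N 1

  LineCount : ∀ {N} → (Line N → Set) → ℕ → Set
  LineCount S m = HasCard SameSub S m

  module Conds (n : ℕ) (L : Line (suc n) → Set) where
    q : ℕ
    q = order

    Pt : Set
    Pt = ∀ p → IsPoint p →
      let S = λ ℓ → L ℓ × OnSub p ℓ in
      LineCount S 0 ⊎ LineCount S (suc q)

    Pl : Set
    Pl = ∀ (π : Subspace (suc n) 2) →
      let S = λ ℓ → L ℓ × (ℓ ⊆S π) in
      LineCount S 0 ⊎ LineCount S 1 ⊎ LineCount S (suc q)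

    Sd : Set
    Sd = ∀ (σ : Subspace (suc n) 3) →
      let S = λ ℓ → L ℓ × (ℓ ⊆S σ) in
      LineCount S 0 ⊎ LineCount S 1 ⊎ LineCount S (suc q)
        ⊎ LineCount S (suc (2 Data.Nat.* q))

    Hp' : Set
    Hp' = ∀ (Σ₅ : Subspace (suc n) 5) →
      ∃ λ m → LineCount (λ ℓ → L ℓ × (ℓ ⊆S Σ₅)) m
        × m ≤ q ^ 4 ∸ q ^ 3 + 3 Data.Nat.* q ^ 2 + 2 Data.Nat.* q

    To : Set
    To = ∃ λ m → LineCount L m
        × m ≤ q ^ 5 + q ^ 4 + q ^ 3 + q ^ 2 + q + 1

  AllConditions : (n : ℕ) → (Line (suc n) → Set) → Set
  AllConditions n L = Pt × Pl × Sd × Hp' × To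
    where open Conds n L

  _-F_ : Carrier → Carrier → Carrier
  a -F b = a +F (-F b)
  infixl 6 _-F_

  OnQ6 : Vect 7 → Set
  OnQ6 x = ((x ! (# 0)) *F (x ! (# 4))) +F ((x ! (# 1)) *F (x ! (# 5))) +F ((x ! (# 2)) *F (x ! (# 6)))
           ≡ (x ! (# 3)) *F (x ! (# 3))
    where
      _!_ : Vect 7 → Fin 7 → Carrier
      _!_ = lookup

  grass : Vect 7 → Vect 7 → Fin 7 → Fin 7 → Carrier
  grass x y i j = (lookup x i *F lookup y j) -F (lookup x j *F lookup y i)

  GrassCond : Vect 7 → Vect 7 → Set
  GrassCond x y =
      (p (# 1) (# 2) ≡ p (# 3) (# 4))
    × (p (# 5) (# 4) ≡ p (# 3) (# 2))
    × (p (# 2) (# 0) ≡ p (# 3) (# 5))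
    × (p (# 6) (# 5) ≡ p (# 3) (# 0))
    × (p (# 0) (# 1) ≡ p (# 3) (# 6))
    × (p (# 4) (# 6) ≡ p (# 3) (# 1))
    where p = grass x y

  HLine : Line 7 → Set
  HLine (subspace (x ∷ y ∷ []) _) =
    (∀ v → InSpan (x ∷ y ∷ []) v → OnQ6 v) × GrassCond x y

  -- L is the line set of a split Cayley hexagon H(q) naturally embedded
  -- in (a 6-dimensional subspace of) PG(n,q): there is an injective
  -- linear map φ : GF(q)^7 → GF(q)^(n+1) (given by the images of the
  -- standard basis) mapping the line set of the standard H(q) onto L.
  IsHexagonLineSet : (n : ℕ) → (Line (suc n) → Set) → Set
  IsHexagonLineSet n L =
    Σ (Vec (Vect (suc n)) 7) λ φ →
      Independent φ
      × (∀ (m : Line (suc n)) →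
           L m ⇔ (∃ λ (ℓ : Line 7) →
                    HLine ℓ
                    × SpanEq (basis m) (map (λ x → lincomb x φ) (basis ℓ))))

  IsLineSet : (n : ℕ) → (Line (suc n) → Set) → Set
  IsLineSet n L =
    (∀ ℓ → Dec (L ℓ)) × (∀ ℓ ℓ' → SameSub ℓ ℓ' → L ℓ → L ℓ')

{-# OPTIONS --safe #-}
module Submission where

open import Defs
open import Data.Nat using (ℕ)
open import Data.Product using (∃)
open import Function.Bundles using (_⇔_)
open import Data.Nat as ℕ using (zero; suc; z≤n; s≤s)
import Data.Nat.Properties as ℕₚ
open import Data.Fin as Fin using (Fin; zero; suc; #_)
import Data.Fin.Properties as Finₚ
open import Data.Vec as Vec using (Vec; []; _∷_; lookup; replicate; zipWith; _++_)
import Data.Vec.Properties as Vecₚ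
open import Data.Vec.Relation.Unary.All as VAll using ([]; _∷_) renaming (All to VAll)
import Data.Vec.Relation.Unary.All.Properties as VAllₚ
open import Data.List as List using (List; []; _∷_; length; foldr)
import Data.List.Properties as Listₚ
open import Data.List.Membership.Propositional using (_∈_)
import Data.List.Membership.Propositional.Properties as ∈ₚ
open import Data.List.Relation.Unary.Any as Any using (Any; here; there)
import Data.List.Relation.Unary.Any.Properties as Anyₚ
open import Data.List.Relation.Unary.All as All using (All; []; _∷_)
import Data.List.Relation.Unary.All.Properties as Allₚ
open import Data.List.Relation.Unary.AllPairs as AP using (AllPairs; []; _∷_)
import Data.List.Relation.Unary.AllPairs.Properties as APₚ
open import Data.Product using (Σ; ∃₂; _×_; _,_) renaming (proj₁ to fst; proj₂ to snd)
open import Data.Sum using (_⊎_; inj₁; inj₂)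
open import Data.Empty using (⊥; ⊥-elim)
open import Data.Unit using (⊤; tt)
open import Function.Base using (_∘_)
open import Relation.Nullary using (¬_; Dec; yes; no)
open import Relation.Nullary.Decidable using (map′; ¬?; decidable-stable; _×-dec_)
open import Relation.Binary.PropositionalEquality hiding ([_])
open import Data.Product.Properties using (≡-dec)
import Data.Nat.Solver
import Data.Sum
open import Function.Bundles using (mk⇔; module Equivalence)
open import Data.Bool using (Bool; true; false; if_then_else_; not; _xor_)
open import Algebra.Bundles using (CommutativeRing)
open import Level using (0ℓ)
import Algebra.Properties.Ring as RingP

-- Points are nonzero vectors, and x ~ y means that some line of L contains x and y.
--
-- From the conditions to H(q). (Pt), (Pl) and (Sd) make π_x = { y | x ~ y } a 3-space without triangles or
-- quadrangles; a pentagon would force more lines into a 5-space than (Hp') allows, and (To) then gives a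
-- generalised hexagon. An apartment spans dual planes α and β with a ~ b iff a · b = 0, and S = α ⊕ β is a
-- hyperplane of the span of all points. A point off S has neighbours (a , a × u), a · w = 0, in S, where
-- u · w = 1; moving along lines changes u and w by fixed multiples, so that all these points are c + u/μ − w/ν
-- for one vector c. Rescaling the basis turns this into the coordinates of H(q).
--
-- Conversely, x and y are collinear in H(q) iff x y = 0 in the split octonions, x and y of trace zero.
-- The alternative law gives (Pt), (Pl) and (Sd): disjoint lines are joined by a transversal or have dual bases
-- x₁, x₂ and y₁, y₂ with x₁ y₁ = y₂ x₂, which is a regulus. For (To) and (Hp') every line is counted at the flag
-- of α × β determined by its intersection with S; automorphisms bring a hyperplane into general position.

-- Line counts are handled by one-sided bounds: a lower bound is a list of pairwise distinct lines
-- (`Fam`), an upper bound a list of pairs of vectors that covers all lines (`AtMost`). The bound in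
-- (Hp') is one less than the number of lines that a pentagon forces into a 5-space, and the bound
-- in (To) is the number of lines met by non-backtracking paths from a point, so that no line stays
-- out of reach. (Hp') acts a second time: it keeps the lines from all lying in `S`, and so provides
-- points off `S`. The obstacle is linearity: incidence has to yield coordinates that depend
-- linearly on the points, over a field that may have automorphisms. Its source is regularity
-- (`trace`): the points of the plane of `x` that are not opposite a given point opposite `x` form a
-- line. This makes the multipliers of `u` and `w` independent of the direction. Statements about
-- `w` are those about `u` in the dual frame. The characteristic is arbitrary, so quadratic
-- identities such as `sq` are kept apart from their polarised forms such as `alt`.

-- x :: y ends a list: a ∷ x :: y is a ∷ x ∷ y ∷ [].
infixr 5 _::_
pattern _::_ x y = x ∷ y ∷ []
pattern [_] x = x ∷ []

infixr 1 _>>_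
_>>_ : {A : Set} {x y z : A} → x ≡ y → y ≡ z → x ≡ z
_>>_ = trans

-- Families of inequivalent elements

-- Lower bounds on the number of ≈-classes meeting S.
record Fam {A : Set} (_≈_ : A → A → Set) (S : A → Set) (c : ℕ) : Set where
 constructor fam
 field
  list : List A
  len : c ℕ.≤ length list
  all : All S list
  dist : AllPairs (λ a b → ¬ a ≈ b) list

module _ {A : Set} {_≈_ : A → A → Set} where
 fam-map : ∀ {S T c} → (∀ {a} → S a → T a) → Fam _≈_ S c → Fam _≈_ T c
 fam-map f (fam l n a d) = fam l n (All.map f a) d

 fam-≤ : ∀ {S c d} → d ℕ.≤ c → Fam _≈_ S c → Fam _≈_ S d
 fam-≤ le (fam l n a d) = fam l (ℕₚ.≤-trans le n) a d

 fam-one : ∀ {S a} → S a → Fam _≈_ S 1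
 fam-one {a = a} s = fam [ a ] ℕₚ.≤-refl [ s ] [ [] ]

 opaque
  fam-++ : ∀ {S T U c d} → Fam _≈_ S c → Fam _≈_ T d → (∀ {a b} → S a → T b → ¬ a ≈ b) →
       (∀ {a} → S a → U a) → (∀ {a} → T a → U a) → Fam _≈_ U (c ℕ.+ d)
  fam-++ (fam l n a d) (fam l' n' a' d') dis f g = fam (l List.++ l')
   (ℕₚ.≤-trans (ℕₚ.+-mono-≤ n n') (ℕₚ.≤-reflexive (sym (Listₚ.length-++ l))))
   (Allₚ.++⁺ (All.map f a) (All.map g a'))
   (APₚ.++⁺ d d' (All.map (λ s → All.map (dis s) a') a))

 module _ (≈? : ∀ a b → Dec (a ≈ b)) (≈-sym : ∀ {a b} → a ≈ b → b ≈ a) (≈-trans : ∀ {a b c} → a ≈ b → b ≈ c → a ≈ c) where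
  private
   rem : A → List A → List A
   rem b = List.filter (λ a → ¬? (≈? a b))

   rem-none : ∀ b l → All (λ a → ¬ a ≈ b) l → length l ℕ.≤ length (rem b l)
   rem-none b l h = ℕₚ.≤-reflexive (cong length (sym (Listₚ.filter-all (λ a → ¬? (≈? a b)) h)))

   rem-len : ∀ b l → AllPairs (λ a b → ¬ a ≈ b) l → length l ℕ.≤ suc (length (rem b l))
   rem-len b [] _ = z≤n
   rem-len b (a ∷ l) (h ∷ d) with ≈? a b
   ... | yes e = s≤s (rem-none b l (All.map (λ n e' → n (≈-trans e (≈-sym e'))) h))
   ... | no _ = s≤s (rem-len b l d)

  opaque
   -- At most one entry of a list of pairwise inequivalent elements can be equivalent to `b`.
   fam-rem : ∀ {S c} → Fam _≈_ S (suc c) → ∀ b → Fam _≈_ (λ a → S a × ¬ a ≈ b) c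
   fam-rem (fam l n a d) b = fam (rem b l) (ℕₚ.≤-pred (ℕₚ.≤-trans n (rem-len b l d)))
    (All.zip (Allₚ.filter⁺ (λ a → ¬? (≈? a b)) a , Allₚ.all-filter (λ a → ¬? (≈? a b)) l)) (APₚ.filter⁺ (λ a → ¬? (≈? a b)) d)

 pick : ∀ {S c} → Fam _≈_ S (suc c) → ∃ S
 pick (fam (x ∷ _) _ (s ∷ _) _) = x , s

 private
  dist-lookup : ∀ {R : A → A → Set} {l} → AllPairs R l → ∀ {i j} → i Fin.< j → R (List.lookup l i) (List.lookup l j)
  dist-lookup (h ∷ _) {zero} {suc j} _ = All.lookup h (∈ₚ.∈-lookup j)
  dist-lookup (_ ∷ d) {suc i} {suc j} (s≤s lt) = dist-lookup d lt

 -- Pigeonhole: pairwise inequivalent elements, each equivalent to a member of l'.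
 opaque
  fam-bound : ∀ {S c} → (∀ {a b c} → a ≈ b → c ≈ b → a ≈ c) → Fam _≈_ S c → (l' : List A) → (∀ {a} → S a → Any (a ≈_) l') → c ℕ.≤ length l'
  fam-bound tr (fam l n a d) l' cov with length l ℕ.≤? length l'
  ... | yes le = ℕₚ.≤-trans n le
  ... | no nle with Finₚ.pigeonhole (ℕₚ.≰⇒> nle) (λ i → Any.index (cov (All.lookup a (∈ₚ.∈-lookup i))))
  ... | i , j , i<j , e = ⊥-elim (dist-lookup d i<j (tr (Anyₚ.lookup-index (cov (All.lookup a (∈ₚ.∈-lookup i))))
     (subst (λ z → List.lookup l j ≈ List.lookup l' z) (sym e) (Anyₚ.lookup-index (cov (All.lookup a (∈ₚ.∈-lookup j)))))))

module _ {A B : Set} {_≈_ : A → A → Set} {_≋_ : B → B → Set} where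
 opaque
  fam-img : ∀ {S T c} (f : A → B) → Fam _≈_ S c → (∀ {a} → S a → T (f a)) → (∀ {a b} → S a → S b → ¬ a ≈ b → ¬ f a ≋ f b) → Fam _≋_ T c
  fam-img {S} f (fam l n a d) h i = fam (List.map f l) (ℕₚ.≤-trans n (ℕₚ.≤-reflexive (sym (Listₚ.length-map f l))))
    (Allₚ.map⁺ (All.map h a)) (APₚ.map⁺ (go a d))
   where
    go : ∀ {l} → All S l → AllPairs (λ a b → ¬ a ≈ b) l → AllPairs (λ a b → ¬ f a ≋ f b) l
    go [] [] = []
    go (s ∷ a) (h ∷ d) = All.zipWith (λ (s' , n) → i s s' n) (a , h) ∷ go a d

 opaque
  fam-sum : ∀ {S a c} (T : A → B → Set) → Fam _≈_ S a → (∀ x → S x → Fam _≋_ (T x) c) →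
       (∀ {x y b b'} → S x → S y → ¬ x ≈ y → T x b → T y b' → ¬ b ≋ b') → Fam _≋_ (λ b → ∃ λ x → S x × T x b) (a ℕ.* c)
  fam-sum {S} {a₀} {c} T (fam l n a d) f dis = fam-≤ (ℕₚ.*-monoˡ-≤ c n) (fam-map (λ (x , s , t , _) → x , s , t) (go l a d))
   where
    go : ∀ l → All S l → AllPairs (λ a b → ¬ a ≈ b) l → Fam _≋_ (λ b → ∃ λ x → S x × T x b × x ∈ l) (length l ℕ.* c)
    go [] [] [] = fam [] z≤n [] []
    go (x ∷ l) (s ∷ a) (h ∷ d) = fam-++ (f x s) (go l a d)
     (λ { t (y , s' , t' , y∈) → dis s s' (All.lookup h y∈) t t' })
     (λ t → x , s , t , here refl) (λ (y , s , t , y∈) → y , s , t , there y∈)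

-- The two decisive numbers

module Arith where
 open Data.Nat.Solver.+-*-Solver

 bound : ℕ → ℕ
 bound q = q ℕ.^ 4 ℕ.∸ q ℕ.^ 3 ℕ.+ 3 ℕ.* q ℕ.^ 2 ℕ.+ 2 ℕ.* q

 -- The lines that a pentagon forces into a 5-space, with `r` for `q ∸ 1`: `l` lines of its 4-space
 -- disjoint from a certain line `p1 w`, `q + 1` lines through the vertex `p1`, `q` lines through
 -- `w` outside the 4-space, and `q ∸ 1` more for each of the `l` lines.
 tot : ℕ → ℕ → ℕ
 tot q r = let l = (ℕ.pred (q ℕ.* q) ℕ.* r ℕ.+ (q ℕ.+ r)) ℕ.+ (q ℕ.+ q) in l ℕ.+ (suc q ℕ.+ (q ℕ.+ l ℕ.* r))

 opaque
  tot≡ : ∀ r → tot (suc r) r ≡ suc (bound (suc r))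
  tot≡ r = lem r >> cong (λ z → suc (z ℕ.+ 3 ℕ.* suc r ℕ.^ 2 ℕ.+ 2 ℕ.* suc r)) (sym (ℕₚ.m+n∸m≡n (suc r ℕ.^ 3) (r ℕ.* suc r ℕ.^ 3)))
   where
    lem : ∀ r → tot (suc r) r ≡ suc (r ℕ.* suc r ℕ.^ 3 ℕ.+ 3 ℕ.* suc r ℕ.^ 2 ℕ.+ 2 ℕ.* suc r)
    lem = solve 1 (λ r → ((((r :+ r :* (con 1 :+ r)) :* r :+ ((con 1 :+ r) :+ r)) :+ ((con 1 :+ r) :+ (con 1 :+ r))) :+ ((con 2 :+ r) :+ ((con 1 :+ r) :+ (((r :+ r :* (con 1 :+ r)) :* r :+ ((con 1 :+ r) :+ r)) :+ ((con 1 :+ r) :+ (con 1 :+ r))) :* r)))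
      := con 1 :+ (r :* (con 1 :+ r) :^ 3 :+ con 3 :* (con 1 :+ r) :^ 2 :+ con 2 :* (con 1 :+ r))) refl

 opaque
  -- The summands are the lines at distance one, three and five from a point of a hexagon, and one
  -- line to spare.
  tree≡ : ∀ q → (suc q ℕ.+ (suc q ℕ.* q) ℕ.* q) ℕ.+ ((((suc q ℕ.* q) ℕ.* q) ℕ.* q) ℕ.* q ℕ.+ 1) ≡ suc (q ℕ.^ 5 ℕ.+ q ℕ.^ 4 ℕ.+ q ℕ.^ 3 ℕ.+ q ℕ.^ 2 ℕ.+ q ℕ.+ 1)
  tree≡ = solve 1 (λ q → (con 1 :+ q :+ ((con 1 :+ q) :* q) :* q) :+ (((((con 1 :+ q) :* q) :* q) :* q) :* q :+ con 1) := con 1 :+ (q :^ 5 :+ q :^ 4 :+ q :^ 3 :+ q :^ 2 :+ q :+ con 1)) refl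

module _ (F : FiniteField) where

 -- Field arithmetic and a reflective solver for scalar and vector identities

 module Field where
  open FiniteField F public
   using (0F; 1F; 0≢1; elements)
   renaming (Carrier to K; _+F_ to infixl 6 _+_; _*F_ to infixl 7 _*_; -F_ to infix 8 -_; _≟F_ to infix 4 _≟_)
  open FiniteField F using (isCommutativeRing; inverse; complete; unique; order)

  q : ℕ
  q = order

  ring : CommutativeRing 0ℓ 0ℓ
  ring = record { isCommutativeRing = isCommutativeRing }

  open CommutativeRing ring public
   using (+-assoc; +-comm; *-assoc; *-comm; +-identityˡ; +-identityʳ; *-identityˡ; *-identityʳ; distribˡ; distribʳ; zeroˡ; zeroʳ; -‿inverseˡ; -‿inverseʳ)
  open RingP (CommutativeRing.ring ring) public
   using (-‿distribˡ-*; -‿distribʳ-*; -0#≈0#; -‿involutive; -‿+-comm)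

  infixl 6 _-_
  _-_ : K → K → K
  a - b = a + (- b)

  -1F : K
  -1F = - 1F

  data Expr : Set where
   at : ℕ → Expr
   _+e_ _*e_ : Expr → Expr → Expr
   ⊖_ : Expr → Expr
   0k 1k : Expr
  infixl 6 _+e_ _-e_
  infixl 7 _*e_
  infix 8 ⊖_

  -1k : Expr
  -1k = ⊖ 1k

  `0 `1 `2 `3 `4 `5 `6 `7 `8 `9 `10 `11 `12 `13 `14 `15 `16 `17 `18 `19 `20 `21 `22 `23 `24 `25 : Expr
  `0 = at 0
  `1 = at 1
  `2 = at 2
  `3 = at 3
  `4 = at 4
  `5 = at 5
  `6 = at 6
  `7 = at 7
  `8 = at 8
  `9 = at 9
  `10 = at 10
  `11 = at 11
  `12 = at 12
  `13 = at 13
  `14 = at 14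
  `15 = at 15
  `16 = at 16
  `17 = at 17
  `18 = at 18
  `19 = at 19
  `20 = at 20
  `21 = at 21
  `22 = at 22
  `23 = at 23
  `24 = at 24
  `25 = at 25

  _-e_ : Expr → Expr → Expr
  a -e b = a +e (⊖ b)

  ⟦_⟧ : Expr → (ℕ → K) → K
  ⟦ at i ⟧ ρ = ρ i
  ⟦ a +e b ⟧ ρ = ⟦ a ⟧ ρ + ⟦ b ⟧ ρ
  ⟦ a *e b ⟧ ρ = ⟦ a ⟧ ρ * ⟦ b ⟧ ρ
  ⟦ ⊖ a ⟧ ρ = - ⟦ a ⟧ ρ
  ⟦ 0k ⟧ ρ = 0F
  ⟦ 1k ⟧ ρ = 1F

  private
   Mono : Set
   Mono = List ℕ
   -- a signed monomial; integer coefficients are represented by repetition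
   Term : Set
   Term = Bool × Mono
   Poly : Set
   Poly = List Term

   insM : ℕ → Mono → Mono
   insM x [] = x ∷ []
   insM x (y ∷ m) = if x ℕ.≤ᵇ y then x ∷ y ∷ m else y ∷ insM x m

   mulM : Mono → Mono → Mono
   mulM m m' = foldr insM m' m

   data Cmp (m m' : Mono) : Set where
    lt gt : Cmp m m'
    eq : m ≡ m' → Cmp m m'

   cmp : ∀ m m' → Cmp m m'
   cmp [] [] = eq refl
   cmp [] (_ ∷ _) = lt
   cmp (_ ∷ _) [] = gt
   cmp (x ∷ m) (y ∷ m') with x ℕ.≟ y
   ... | no _ = if x ℕ.<ᵇ y then lt else gt
   ... | yes refl with cmp m m'
   ...   | lt = lt
   ...   | gt = gt
   ...   | eq e = eq (cong (x ∷_) e)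

   insT : Term → Poly → Poly
   insT t [] = t ∷ []
   insT (s , m) ((s' , m') ∷ p) with cmp m m'
   ... | lt = (s , m) ∷ (s' , m') ∷ p
   ... | gt = (s' , m') ∷ insT (s , m) p
   ... | eq _ = if s xor s' then p else (s , m) ∷ (s' , m') ∷ p

   addP : Poly → Poly → Poly
   addP p r = foldr insT r p

   mulT : Term → Term → Term
   mulT (s , m) (s' , m') = not (s xor s') , mulM m m'

   negT : Term → Term
   negT (s , m) = not s , m

   mulP : Poly → Poly → Poly
   mulP p r = foldr (λ t acc → addP (List.map (mulT t) r) acc) [] p

  nf : Expr → Poly
  nf (at i) = (true , i ∷ []) ∷ []
  nf (a +e b) = addP (nf a) (nf b)
  nf (a *e b) = mulP (nf a) (nf b)
  nf (⊖ a) = List.map negT (nf a)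
  nf 0k = []
  nf 1k = (true , []) ∷ []

  private
   module Sound (ρ : ℕ → K) where
    open ≡-Reasoning

    evM : Mono → K
    evM = foldr (λ x a → ρ x * a) 1F

    sg : Bool → K → K
    sg true a = a
    sg false a = - a

    evT : Term → K
    evT (s , m) = sg s (evM m)

    evP : Poly → K
    evP = foldr (λ t a → evT t + a) 0F

    swap* : ∀ a b c → a * (b * c) ≡ b * (a * c)
    swap* a b c = sym (*-assoc a b c) >> cong (_* c) (*-comm a b) >> *-assoc b a c

    swap+ : ∀ a b c → a + (b + c) ≡ b + (a + c)
    swap+ a b c = sym (+-assoc a b c) >> cong (_+ c) (+-comm a b) >> +-assoc b a c

    insM-ok : ∀ x m → evM (insM x m) ≡ ρ x * evM m
    insM-ok x [] = refl
    insM-ok x (y ∷ m) with x ℕ.≤ᵇ y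
    ... | true = refl
    ... | false = cong (ρ y *_) (insM-ok x m) >> swap* _ _ _

    mulM-ok : ∀ m m' → evM (mulM m m') ≡ evM m * evM m'
    mulM-ok [] m' = sym (*-identityˡ _)
    mulM-ok (x ∷ m) m' = insM-ok x (mulM m m') >> cong (ρ x *_) (mulM-ok m m') >> sym (*-assoc _ _ _)

    cancel : ∀ s s' a → s xor s' ≡ true → sg s a + sg s' a ≡ 0F
    cancel true false a _ = -‿inverseʳ a
    cancel false true a _ = -‿inverseˡ a

    insT-ok : ∀ t p → evP (insT t p) ≡ evT t + evP p
    insT-ok t [] = refl
    insT-ok (s , m) ((s' , m') ∷ p) with cmp m m'
    ... | lt = refl
    ... | gt = cong (evT (s' , m') +_) (insT-ok (s , m) p) >> swap+ _ _ _
    ... | eq refl with s xor s' in e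
    ...   | false = refl
    ...   | true = sym (sym (+-assoc _ _ _) >> cong (_+ evP p) (cancel s s' (evM m) e) >> +-identityˡ _)

    addP-ok : ∀ p r → evP (addP p r) ≡ evP p + evP r
    addP-ok [] r = sym (+-identityˡ _)
    addP-ok (t ∷ p) r = insT-ok t (addP p r) >> cong (evT t +_) (addP-ok p r) >> sym (+-assoc _ _ _)

    sg-mul : ∀ s s' a b → sg (not (s xor s')) (a * b) ≡ sg s a * sg s' b
    sg-mul true true a b = refl
    sg-mul true false a b = -‿distribʳ-* a b
    sg-mul false true a b = -‿distribˡ-* a b
    sg-mul false false a b = sym (sym (-‿distribˡ-* a (- b)) >> (cong -_ (sym (-‿distribʳ-* a b))) >> -‿involutive _)

    mulT-ok : ∀ t t' → evT (mulT t t') ≡ evT t * evT t'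
    mulT-ok (s , m) (s' , m') = cong (sg (not (s xor s'))) (mulM-ok m m') >> sg-mul s s' (evM m) (evM m')

    mapT-ok : ∀ t r → evP (List.map (mulT t) r) ≡ evT t * evP r
    mapT-ok t [] = sym (zeroʳ _)
    mapT-ok t (t' ∷ r) = (cong₂ _+_ (mulT-ok t t') (mapT-ok t r)) >> sym (distribˡ _ _ _)

    mulP-ok : ∀ p r → evP (mulP p r) ≡ evP p * evP r
    mulP-ok [] r = sym (zeroˡ _)
    mulP-ok (t ∷ p) r = addP-ok (List.map (mulT t) r) (mulP p r) >>
     (cong₂ _+_ (mapT-ok t r) (mulP-ok p r)) >> sym (distribʳ _ _ _)

    negT-ok : ∀ t → evT (negT t) ≡ - evT t
    negT-ok (true , m) = refl
    negT-ok (false , m) = sym (-‿involutive _)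

    negP-ok : ∀ p → evP (List.map negT p) ≡ - evP p
    negP-ok [] = sym -0#≈0#
    negP-ok (t ∷ p) = (cong₂ _+_ (negT-ok t) (negP-ok p)) >> -‿+-comm _ _

    nf-ok : ∀ e → evP (nf e) ≡ ⟦ e ⟧ ρ
    nf-ok (at i) = +-identityʳ _ >> *-identityʳ _
    nf-ok (a +e b) = addP-ok (nf a) (nf b) >> (cong₂ _+_ (nf-ok a) (nf-ok b))
    nf-ok (a *e b) = mulP-ok (nf a) (nf b) >> (cong₂ _*_ (nf-ok a) (nf-ok b))
    nf-ok (⊖ a) = negP-ok (nf a) >> (cong -_ (nf-ok a))
    nf-ok 0k = refl
    nf-ok 1k = +-identityʳ _

  env : {A : Set} → A → List A → ℕ → A
  env d [] _ = d
  env d (x ∷ xs) zero = x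
  env d (x ∷ xs) (suc n) = env d xs n

  opaque
   solve′ : (ρ : ℕ → K) (e e' : Expr) → nf e ≡ nf e' → ⟦ e ⟧ ρ ≡ ⟦ e' ⟧ ρ
   solve′ ρ e e' p = sym (Sound.nf-ok ρ e) >> cong (Sound.evP ρ) p >> Sound.nf-ok ρ e'

  opaque
   solve : (xs : List K) (e e' : Expr) → nf e ≡ nf e' → ⟦ e ⟧ (env 0F xs) ≡ ⟦ e' ⟧ (env 0F xs)
   solve xs = solve′ (env 0F xs)

  -- Linear combinations of hypotheses: to get a ≡ b from l ≡ r, exhibit a ≡ b + k (l − r).
  infix 2 _⇐_
  opaque
   _⇐_ : ∀ {a b d} → a ≡ b + d → d ≡ 0F → a ≡ b
   p ⇐ z = p >> cong (_ +_) z >> +-identityʳ _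

  infixl 6 _&_
  opaque
   _&_ : ∀ {a b} → a ≡ 0F → b ≡ 0F → a + b ≡ 0F
   p & r = (cong₂ _+_ p r) >> +-identityʳ _

  infix 7 _*:_
  opaque
   _*:_ : ∀ k {l r} → l ≡ r → k * (l - r) ≡ 0F
   k *: refl = cong (k *_) (-‿inverseʳ _) >> zeroʳ k

  opaque
   -‿injective-0 : ∀ {a b} → a - b ≡ 0F → a ≡ b
   -‿injective-0 {a} {b} e = solve (a :: b) (`0) (`1 +e (`0 -e `1)) refl ⇐ e

  1≢0 : 1F ≢ 0F
  1≢0 e = 0≢1 (sym e)

  opaque
   inv : ∀ x → x ≢ 0F → K
   inv x nz = fst (inverse x nz)

   inv-r : ∀ x nz → x * inv x nz ≡ 1F
   inv-r x nz = snd (inverse x nz)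

  opaque
   *-cancel-0 : ∀ x {y} → x ≢ 0F → x * y ≡ 0F → y ≡ 0F
   *-cancel-0 x {y} nz e = solve (x ∷ y :: inv x nz) (`1) (0k +e ((⊖ `1) *e (`0 *e `2 -e 1k) +e `2 *e (`0 *e `1 -e 0k))) refl
    ⇐ (- y) *: inv-r x nz & inv x nz *: e

  opaque
   inv≢0 : ∀ x nz → inv x nz ≢ 0F
   inv≢0 x nz e = 1≢0 (sym (inv-r x nz) >> cong (x *_) e >> zeroʳ x)

  opaque
   *≢0 : ∀ {x y} → x ≢ 0F → y ≢ 0F → x * y ≢ 0F
   *≢0 nx ny e = ny (*-cancel-0 _ nx e)

  opaque
   -≢0 : ∀ {x} → x ≢ 0F → - x ≢ 0F
   -≢0 nx e = nx (sym (-‿involutive _) >> (cong -_ e) >> -0#≈0#)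

  module _ {N : ℕ} where
   V : Set
   V = Vect F N

   infixl 6 _<+>_
   infixr 7 _*>_
   _<+>_ : V → V → V
   _<+>_ = _⊕_ F
   _*>_ : K → V → V
   _*>_ = _·_ F
   0v : V
   0v = zeroV F N

  data VExpr : Set where
   v : ℕ → VExpr
   _+v_ : VExpr → VExpr → VExpr
   _*v_ : Expr → VExpr → VExpr
   0w : VExpr
  infixl 6 _+v_
  infixr 7 _*v_

  ^0 ^1 ^2 ^3 ^4 ^5 ^6 ^7 : VExpr
  ^0 = v 0
  ^1 = v 1
  ^2 = v 2
  ^3 = v 3
  ^4 = v 4
  ^5 = v 5
  ^6 = v 6
  ^7 = v 7

  infixl 6 _-v_
  _-v_ : VExpr → VExpr → VExpr
  a -v b = a +v -1k *v b

  module _ {N : ℕ} where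
   ⟦_⟧v : VExpr → (ℕ → K) → (ℕ → V {N}) → V {N}
   ⟦ v i ⟧v σ τ = τ i
   ⟦ a +v b ⟧v σ τ = ⟦ a ⟧v σ τ <+> ⟦ b ⟧v σ τ
   ⟦ s *v a ⟧v σ τ = ⟦ s ⟧ σ *> ⟦ a ⟧v σ τ
   ⟦ 0w ⟧v σ τ = 0v

  private
   dbl : ℕ → ℕ
   dbl zero = zero
   dbl (suc n) = suc (suc (dbl n))

   -- Scalars sit at even and vector coordinates at odd variable indices, so that a vector identity
   -- becomes a single polynomial identity for a generic coordinate.
   look : (ℕ → K) → (ℕ → K) → ℕ → K
   look σ τ zero = σ 0
   look σ τ (suc zero) = τ 0
   look σ τ (suc (suc n)) = look (σ ∘ suc) (τ ∘ suc) n

   look-s : ∀ n σ τ → look σ τ (dbl n) ≡ σ n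
   look-s zero σ τ = refl
   look-s (suc n) σ τ = look-s n (σ ∘ suc) (τ ∘ suc)

   look-t : ∀ n σ τ → look σ τ (suc (dbl n)) ≡ τ n
   look-t zero σ τ = refl
   look-t (suc n) σ τ = look-t n (σ ∘ suc) (τ ∘ suc)

   emb : Expr → Expr
   emb (at i) = at (dbl i)
   emb (a +e b) = emb a +e emb b
   emb (a *e b) = emb a *e emb b
   emb (⊖ a) = ⊖ emb a
   emb 0k = 0k
   emb 1k = 1k

   emb-ok : ∀ e σ τ → ⟦ emb e ⟧ (look σ τ) ≡ ⟦ e ⟧ σ
   emb-ok (at i) σ τ = look-s i σ τ
   emb-ok (a +e b) σ τ = cong₂ _+_ (emb-ok a σ τ) (emb-ok b σ τ)
   emb-ok (a *e b) σ τ = cong₂ _*_ (emb-ok a σ τ) (emb-ok b σ τ)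
   emb-ok (⊖ a) σ τ = cong -_ (emb-ok a σ τ)
   emb-ok 0k σ τ = refl
   emb-ok 1k σ τ = refl

   toE : VExpr → Expr
   toE (v i) = at (suc (dbl i))
   toE (a +v b) = toE a +e toE b
   toE (s *v a) = emb s *e toE a
   toE 0w = 0k

   toE-ok : ∀ {N} e σ (τ : ℕ → V {N}) i → lookup (⟦ e ⟧v σ τ) i ≡ ⟦ toE e ⟧ (look σ (λ n → lookup (τ n) i))
   toE-ok (v j) σ τ i = sym (look-t j σ _)
   toE-ok (a +v b) σ τ i = (Vecₚ.lookup-zipWith _+_ i (⟦ a ⟧v σ τ) (⟦ b ⟧v σ τ)) >> (cong₂ _+_ (toE-ok a σ τ i) (toE-ok b σ τ i))
   toE-ok (s *v a) σ τ i = Vecₚ.lookup-map i (⟦ s ⟧ σ *_) (⟦ a ⟧v σ τ) >> (cong₂ _*_ (sym (emb-ok s σ _)) (toE-ok a σ τ i))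
   toE-ok 0w σ τ i = Vecₚ.lookup-replicate i 0F

  opaque
   vec-ext : ∀ {A : Set} {n} (x y : Vec A n) → (∀ i → lookup x i ≡ lookup y i) → x ≡ y
   vec-ext [] [] _ = refl
   vec-ext (a ∷ x) (b ∷ y) h = cong₂ _∷_ (h zero) (vec-ext x y (h ∘ suc))

  vnf : VExpr → Poly
  vnf e = nf (toE e)

  opaque
   vsolve : ∀ {N} (as : List K) (xs : List (V {N})) (e e' : VExpr) → vnf e ≡ vnf e' →
        ⟦ e ⟧v (env 0F as) (env 0v xs) ≡ ⟦ e' ⟧v (env 0F as) (env 0v xs)
   vsolve {N} as xs e e' p = vec-ext (⟦ e ⟧v (env 0F as) (env 0v xs)) (⟦ e' ⟧v (env 0F as) (env 0v xs)) (λ i → trans (toE-ok e _ _ i)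
    (solve′ _ (toE e) (toE e') p >> sym (toE-ok e' _ _ i)))

  module _ {N : ℕ} where
   infix 2 _⇐v_
   opaque
    _⇐v_ : ∀ {a b d : V {N}} → a ≡ b <+> d → d ≡ 0v → a ≡ b
    _⇐v_ {b = b} p refl = p >> (vsolve [] [ b ] (^0 +v 0w) (^0) refl)

   infixl 6 _&v_
   opaque
    _&v_ : ∀ {a b : V {N}} → a ≡ 0v → b ≡ 0v → a <+> b ≡ 0v
    refl &v refl = vsolve [] [] (0w +v 0w) 0w refl

   infix 7 _∙:_
   opaque
    _∙:_ : ∀ k {l r : V {N}} → l ≡ r → k *> (l <+> -1F *> r) ≡ 0v
    _∙:_ k {l} refl = vsolve [ k ] [ l ] (`0 *v (^0 -v ^0)) 0w refl

   infix 7 _s:_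
   opaque
    _s:_ : ∀ {l r : K} → l ≡ r → (x : V {N}) → (l - r) *> x ≡ 0v
    _s:_ {l} refl x = vsolve [ l ] [ x ] ((`0 -e `0) *v ^0) 0w refl

 -- Linear algebra over a finite field

 module LinAlg where
  open Field public
  open FiniteField F using (complete; unique)

  private
   idx : K → Fin q
   idx x = Any.index (complete x)

   elt : Fin q → K
   elt = List.lookup elements

   elt-idx : ∀ x → elt (idx x) ≡ x
   elt-idx x = sym (Anyₚ.lookup-index (complete x))

   lookup-inj : ∀ {xs : List K} → AllPairs _≢_ xs → ∀ i j → List.lookup xs i ≡ List.lookup xs j → i ≡ j
   lookup-inj (_ ∷ _) zero zero _ = refl
   lookup-inj (a ∷ _) zero (suc j) e = ⊥-elim (All.lookup a (∈ₚ.∈-lookup j) e)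
   lookup-inj (a ∷ _) (suc i) zero e = ⊥-elim (All.lookup a (∈ₚ.∈-lookup i) (sym e))
   lookup-inj (_ ∷ u) (suc i) (suc j) e = cong suc (lookup-inj u i j e)

   elt-inj : ∀ i j → elt i ≡ elt j → i ≡ j
   elt-inj = lookup-inj unique

   idx-inj : ∀ x y → idx x ≡ idx y → x ≡ y
   idx-inj x y e = sym (elt-idx x) >> cong elt e >> elt-idx y

   enc : ∀ {m} → Vec K m → Fin (q ℕ.^ m)
   enc [] = zero
   enc (x ∷ xs) = Fin.combine (idx x) (enc xs)

   enc-inj : ∀ {m} (x y : Vec K m) → enc x ≡ enc y → x ≡ y
   enc-inj [] [] _ = refl
   enc-inj (a ∷ x) (b ∷ y) e with Finₚ.combine-injective (idx a) (enc x) (idx b) (enc y) e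
   ... | p , r = cong₂ _∷_ (idx-inj a b p) (enc-inj x y r)

   dcd : ∀ {m} → Fin (q ℕ.^ m) → Vec K m
   dcd {zero} _ = []
   dcd {suc m} i = elt (fst (Fin.remQuot {q} (q ℕ.^ m) i)) ∷ dcd (snd (Fin.remQuot {q} (q ℕ.^ m) i))

   dcd-inj : ∀ {m} i j → dcd {m} i ≡ dcd j → i ≡ j
   dcd-inj {zero} zero zero _ = refl
   dcd-inj {suc m} i j e = sym (Finₚ.combine-remQuot {q} (q ℕ.^ m) i) >>
    cong₂ Fin.combine (elt-inj _ _ (Vecₚ.∷-injectiveˡ e)) (dcd-inj _ _ (Vecₚ.∷-injectiveʳ e)) >> Finₚ.combine-remQuot {q} (q ℕ.^ m) j

  opaque
   q≥2 : 2 ℕ.≤ q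
   q≥2 = go (idx 0F) (idx 1F) (λ e → 0≢1 (idx-inj 0F 1F e))
    where
     go : ∀ {n} (i j : Fin n) → i ≢ j → 2 ℕ.≤ n
     go {suc zero} zero zero ne = ⊥-elim (ne refl)
     go {suc (suc n)} _ _ _ = s≤s (s≤s z≤n)

  opaque
   searchK : {P : K → Set} → (∀ x → Dec (P x)) → Dec (∃ P)
   searchK P? with Any.any? P? elements
   ... | yes a = yes (Any.satisfied a)
   ... | no na = no λ (x , p) → na (Any.map (λ { refl → p }) (complete x))

  opaque
   -- Vectors over a finite field can be enumerated; all existence questions about points and lines
   -- are decided through this.
   search : ∀ {m} {P : Vec K m → Set} → (∀ x → Dec (P x)) → Dec (∃ P)
   search {zero} P? = map′ ([] ,_) (λ { ([] , p) → p }) (P? [])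
   search {suc m} P? = map′ (λ (x , y , p) → x ∷ y , p) (λ { (x ∷ y , p) → x , y , p })
    (searchK λ x → search λ y → P? (x ∷ y))

  infix 4 _≟v_
  opaque
   _≟v_ : ∀ {m} (x y : Vec K m) → Dec (x ≡ y)
   _≟v_ = Vecₚ.≡-dec _≟_

  infix 4 _∈<_>
  _∈<_> : ∀ {N k} → V {N} → Vec (V {N}) k → Set
  x ∈< B > = InSpan F B x

  Ind : ∀ {N k} → Vec (V {N}) k → Set
  Ind = Independent F

  lin : ∀ {N k} → Vec K k → Vec (V {N}) k → V {N}
  lin = lincomb F

  0c : ∀ {k} → Vec K k
  0c = replicate _ 0F

  opaque
   lin-+ : ∀ {N k} (cs ds : Vec K k) (B : Vec (V {N}) k) → lin (cs <+> ds) B ≡ lin cs B <+> lin ds B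
   lin-+ [] [] [] = vsolve [] [] 0w (0w +v 0w) refl
   lin-+ (c ∷ cs) (d ∷ ds) (b ∷ B) = cong ((c + d) *> b <+>_) (lin-+ cs ds B) >>
    vsolve (c :: d) (b ∷ lin cs B :: lin ds B) ((`0 +e `1) *v ^0 +v (^1 +v ^2)) ((`0 *v ^0 +v ^1) +v (`1 *v ^0 +v ^2)) refl

  opaque
   lin-∙ : ∀ {N k} r (cs : Vec K k) (B : Vec (V {N}) k) → lin (r *> cs) B ≡ r *> lin cs B
   lin-∙ r [] [] = vsolve [ r ] [] 0w (`0 *v 0w) refl
   lin-∙ r (c ∷ cs) (b ∷ B) = cong ((r * c) *> b <+>_) (lin-∙ r cs B) >>
    vsolve (c :: r) (b :: lin cs B) ((`1 *e `0) *v ^0 +v `1 *v ^1) (`1 *v (`0 *v ^0 +v ^1)) refl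

  opaque
   lin-0 : ∀ {N k} (B : Vec (V {N}) k) → lin 0c B ≡ 0v
   lin-0 [] = refl
   lin-0 (b ∷ B) = cong (0F *> b <+>_) (lin-0 B) >> (vsolve [] [ b ] (0k *v ^0 +v 0w) 0w refl)

  opaque
   lin-++ : ∀ {N k l} (cs : Vec K k) (ds : Vec K l) (A : Vec (V {N}) k) B → lin (cs ++ ds) (A ++ B) ≡ lin cs A <+> lin ds B
   lin-++ [] ds [] B = vsolve [] [ lin ds B ] (^0) (0w +v ^0) refl
   lin-++ (c ∷ cs) ds (a ∷ A) B = cong (c *> a <+>_) (lin-++ cs ds A B) >>
    vsolve [ c ] (a ∷ lin cs A :: lin ds B) (`0 *v ^0 +v (^1 +v ^2)) (`0 *v ^0 +v ^1 +v ^2) refl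

  opaque
   0∈ : ∀ {N k} {B : Vec (V {N}) k} → 0v ∈< B >
   0∈ {B = B} = 0c , lin-0 B

  opaque
   +∈ : ∀ {N k} {B : Vec (V {N}) k} {x y} → x ∈< B > → y ∈< B > → x <+> y ∈< B >
   +∈ {B = B} (cs , refl) (ds , refl) = cs <+> ds , lin-+ cs ds B

  opaque
   ∙∈ : ∀ {N k} {B : Vec (V {N}) k} r {x} → x ∈< B > → r *> x ∈< B >
   ∙∈ {B = B} r (cs , refl) = r *> cs , lin-∙ r cs B

  opaque
   wk∈ : ∀ {N k} {B : Vec (V {N}) k} {b x} → x ∈< B > → x ∈< b ∷ B >
   wk∈ {B = B} {b} (cs , refl) = 0F ∷ cs , vsolve [] (b :: lin cs B) (0k *v ^0 +v ^1) (^1) refl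

  opaque
   hd∈ : ∀ {N k} {B : Vec (V {N}) k} {b} → b ∈< b ∷ B >
   hd∈ {B = B} {b} = 1F ∷ 0c , trans (cong (1F *> b <+>_) (lin-0 B)) (vsolve [] [ b ] (1k *v ^0 +v 0w) (^0) refl)

  opaque
   gens∈ : ∀ {N k} (B : Vec (V {N}) k) → VAll (_∈< B >) B
   gens∈ [] = []
   gens∈ (b ∷ B) = hd∈ ∷ VAll.map wk∈ (gens∈ B)

  opaque
   span⊆ : ∀ {N k l} {A : Vec (V {N}) k} {B : Vec (V {N}) l} → VAll (_∈< B >) A → ∀ {x} → x ∈< A > → x ∈< B >
   span⊆ [] ([] , refl) = 0∈
   span⊆ (a ∷ h) (c ∷ cs , refl) = +∈ (∙∈ c a) (span⊆ h (cs , refl))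

  opaque
   ∈? : ∀ {N k} (x : V {N}) (B : Vec (V {N}) k) → Dec (x ∈< B >)
   ∈? x B = search λ cs → lin cs B ≟v x

  Dep : ∀ {N k} → Vec (V {N}) k → Set
  Dep B = ∃ λ cs → cs ≢ 0c × lin cs B ≡ 0v

  opaque
   ind? : ∀ {N k} (B : Vec (V {N}) k) → Dep B ⊎ Ind B
   ind? B with search (λ cs → ¬? (cs ≟v 0c) ×-dec (lin cs B ≟v 0v))
   ... | yes d = inj₁ d
   ... | no n = inj₂ λ cs e → decidable-stable (cs ≟v 0c) λ ne → n (cs , ne , e)

  ind-dep : ∀ {N k} {B : Vec (V {N}) k} → Ind B → ¬ Dep B
  ind-dep i (cs , ne , e) = ne (i cs e)

  -- Pigeonhole on coefficient vectors: q ^ m combinations, only q ^ k values.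
  opaque
   dependent : ∀ {N k m} → k ℕ.< m → (A : Vec (V {N}) m) (B : Vec (V {N}) k) → VAll (_∈< B >) A → Dep A
   dependent {k = k} {m} k<m A B h with Finₚ.pigeonhole (ℕₚ.^-monoʳ-< q q≥2 k<m) (λ i → enc (fst (f i)))
    where
     f : ∀ i → lin (dcd {m} i) A ∈< B >
     f i = span⊆ h (dcd i , refl)
   ... | i , j , i<j , e = c , c≢0 , trans (lin-+ (dcd i) (-1F *> dcd j) A)
      (cong (_<+> lin (-1F *> dcd j) A) same >> cong (lin (dcd j) A <+>_) (lin-∙ -1F (dcd j) A) >> (vsolve [] [ lin (dcd j) A ] (^0 -v ^0) 0w refl))
    where
     c : Vec K m
     c = dcd i <+> -1F *> dcd j
     c≢0 : c ≢ 0c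
     c≢0 z = ℕₚ.<⇒≢ i<j (cong Fin.toℕ (dcd-inj i j (vsolve [] (dcd i :: dcd j) (^0) (^1 +v (^0 -v ^1)) refl ⇐v z)))
     same : lin (dcd i) A ≡ lin (dcd j) A
     same = sym (snd (span⊆ h (dcd i , refl))) >>
      cong (λ z → lin z B) (enc-inj (fst (span⊆ h (dcd i , refl))) (fst (span⊆ h (dcd j , refl))) e) >> snd (span⊆ h (dcd j , refl))

  opaque
   head∈ : ∀ {N k} {x : V {N}} {B : Vec (V {N}) k} → Ind B → Dep (x ∷ B) → x ∈< B >
   head∈ {x = x} {B} i (c ∷ cs , ne , e) with c ≟ 0F
   ... | yes refl = ⊥-elim (ne (cong (0F ∷_) (i cs ((vsolve [] (x :: lin cs B) (^1) (0k *v ^0 +v ^1) refl) >> e))))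
   ... | no nz = (- inv c nz) *> cs , trans (lin-∙ (- inv c nz) cs B)
     (vsolve (c :: inv c nz) (x :: lin cs B) ((⊖ `1) *v ^1) (^0 +v ((`0 *e `1 -e 1k) *v ^0 +v (⊖ `1) *v ((`0 *v ^0 +v ^1) -v 0w))) refl
      ⇐v (inv-r c nz s: x) &v ((- inv c nz) ∙: e))

  opaque
   ext : ∀ {N k} {x : V {N}} {B : Vec (V {N}) k} → Ind B → ¬ x ∈< B > → Ind (x ∷ B)
   ext {x = x} {B} i nx with ind? (x ∷ B)
   ... | inj₂ j = j
   ... | inj₁ d = ⊥-elim (nx (head∈ i d))

  opaque
   ∉-head : ∀ {N k} {x : V {N}} {B : Vec (V {N}) k} → Ind (x ∷ B) → ¬ x ∈< B >
   ∉-head {x = x} {B} i (cs , refl) = 1≢0 (cong Vec.head (i (1F ∷ -1F *> cs)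
    (cong (1F *> lin cs B <+>_) (lin-∙ -1F cs B) >> (vsolve [] [ lin cs B ] (1k *v ^0 +v -1k *v ^0) 0w refl))))

  opaque
   ind-tail : ∀ {N k} {x : V {N}} {B : Vec (V {N}) k} → Ind (x ∷ B) → Ind B
   ind-tail {x = x} {B} i cs e = cong Vec.tail (i (0F ∷ cs) (cong (0F *> x <+>_) e >> (vsolve [] [ x ] (0k *v ^0 +v 0w) 0w refl)))

  opaque
   ind-nonzero : ∀ {N k} {x : V {N}} {B : Vec (V {N}) k} → Ind (x ∷ B) → x ≢ 0v
   ind-nonzero i refl = ∉-head i 0∈

  opaque
   -- `k + 1` vectors in the span of `k` are dependent, and the relation must involve `y` because
   -- `A` is independent.
   dimEq : ∀ {N k} {A B : Vec (V {N}) k} → Ind A → VAll (_∈< B >) A → ∀ {y} → y ∈< B > → y ∈< A >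
   dimEq {A = A} {B} i h {y} y∈ = head∈ i (dependent ℕₚ.≤-refl (y ∷ A) B (y∈ ∷ h))

  opaque
   ind-no : ∀ {N k m} → k ℕ.< m → {A : Vec (V {N}) m} (B : Vec (V {N}) k) → Ind A → VAll (_∈< B >) A → ⊥
   ind-no lt {A} B i h = ind-dep i (dependent lt A B h)

  opaque
   ++-0 : ∀ {k l} (cs : Vec K k) {ds : Vec K l} → cs ≡ 0c → ds ≡ 0c → cs ++ ds ≡ 0c
   ++-0 [] _ e = e
   ++-0 (c ∷ cs) e f = cong₂ _∷_ (Vecₚ.∷-injectiveˡ e) (++-0 cs (Vecₚ.∷-injectiveʳ e) f)

  opaque
   -- The part of the relation over `A` is the common vector; if it vanished, independence of both
   -- lists would make all coefficients zero.
   common : ∀ {N k l} {A : Vec (V {N}) k} {C : Vec (V {N}) l} → Ind A → Ind C → Dep (A ++ C) → ∃ λ z → z ≢ 0v × z ∈< A > × z ∈< C >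
   common {k = k} {A = A} {C} i j (es , ne , e) with Vec.splitAt k es
   ... | cs , ds , refl = lin cs A , nz , (cs , refl) , (-1F *> ds , trans (lin-∙ -1F ds C)
       (vsolve [] (lin cs A :: lin ds C) (-1k *v ^1) (^0 +v -1k *v ((^0 +v ^1) -v 0w)) refl ⇐v (-1F ∙: e')))
    where
     e' : lin cs A <+> lin ds C ≡ 0v
     e' = sym (lin-++ cs ds A C) >> e
     nz : lin cs A ≢ 0v
     nz z = ne (++-0 cs (i cs z) (j ds (vsolve [] (lin cs A :: lin ds C) (^1) (0w +v (1k *v ((^0 +v ^1) -v 0w) +v -1k *v (^0 -v 0w))) refl
       ⇐v (1F ∙: e') &v (-1F ∙: z))))

  opaque
   meet : ∀ {N k l m} {A : Vec (V {N}) k} {C : Vec (V {N}) l} (B : Vec (V {N}) m) → Ind A → Ind C →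
       VAll (_∈< B >) A → VAll (_∈< B >) C → m ℕ.< k ℕ.+ l → ∃ λ z → z ≢ 0v × z ∈< A > × z ∈< C >
   meet {A = A} {C} B i j hA hC lt = common i j (dependent lt (A ++ C) B (VAllₚ.++⁺ hA hC))

  opaque
   coef : ∀ {N k} {B : Vec (V {N}) k} → Ind B → ∀ cs → lin cs B ≡ 0v → ∀ i → lookup cs i ≡ 0F
   coef i cs e j = cong (λ z → lookup z j) (i cs e) >> Vecₚ.lookup-replicate j 0F

  unit : ∀ k → Vec (V {k}) k
  unit zero = []
  unit (suc k) = (1F ∷ 0v) ∷ Vec.map (0F ∷_) (unit k)

  opaque
   unit-lin : ∀ {k} (z : V {k}) → lin z (unit k) ≡ z
   unit-lin [] = refl
   unit-lin {suc k} (c ∷ z) = cong ((c * 1F ∷ c *> 0v) <+>_) (pad z (unit k)) >> (cong₂ _∷_ (solve [ c ] (`0 *e 1k +e 0k) (`0) refl) (cong (c *> 0v <+>_) (unit-lin z) >> vsolve [ c ] [ z ] (`0 *v 0w +v ^0) (^0) refl))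
    where
     pad : ∀ {j} (cs : Vec K j) (A : Vec (V {k}) j) → lin cs (Vec.map (0F ∷_) A) ≡ 0F ∷ lin cs A
     pad [] [] = refl
     pad (c ∷ cs) (a ∷ A) = cong ((c * 0F ∷ c *> a) <+>_) (pad cs A) >> cong (_∷ (c *> a <+> lin cs A)) (solve [ c ] (`0 *e 0k +e 0k) 0k refl)

  unit∈ : ∀ {k} (z : V {k}) → z ∈< unit k >
  unit∈ z = z , unit-lin z

  opaque
   basis∈ : ∀ {k} {A : Vec (V {k}) k} → Ind A → ∀ z → z ∈< A >
   basis∈ {A = A} i z = dimEq i (VAll.universal unit∈ A) (unit∈ z)

 -- Lines up to equality of spans, and counts of lines

 module Lines where
  open LinAlg public
  open FiniteField F using (complete; unique)

  famK : Fam _≡_ (λ (_ : K) → ⊤) q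
  famK = fam elements ℕₚ.≤-refl (All.universal (λ _ → tt) elements) unique

  opaque
   dep⇒fewer : ∀ {N j} {A : Vec (V {N}) (suc j)} → Dep A → ∃ λ (A' : Vec (V {N}) j) → VAll (_∈< A' >) A
   dep⇒fewer {j = j} {a ∷ A} (c ∷ cs , ne , e) with c ≟ 0F
   ... | no nz = A , ((- inv c nz) *> cs , trans (lin-∙ (- inv c nz) cs A)
     (vsolve (c :: inv c nz) (a :: lin cs A) ((⊖ `1) *v ^1) (^0 +v ((`0 *e `1 -e 1k) *v ^0 +v (⊖ `1) *v ((`0 *v ^0 +v ^1) -v 0w))) refl
      ⇐v (inv-r c nz s: a) &v ((- inv c nz) ∙: e))) ∷ gens∈ A
   dep⇒fewer {j = zero} {a ∷ []} (c ∷ [] , ne , e) | yes refl = ⊥-elim (ne refl)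
   dep⇒fewer {j = suc j} {a ∷ A} (c ∷ cs , ne , e) | yes refl with dep⇒fewer {A = A} (cs , (λ z → ne (cong (0F ∷_) z)) ,
      trans (vsolve [] (a :: lin cs A) (^1) (0k *v ^0 +v ^1) refl) e)
   ... | A' , h = a ∷ A' , hd∈ ∷ VAll.map wk∈ h

  opaque
   -- A dependent `A` would be contained in the span of fewer vectors, too few for the independent
   -- `B`. This is the tool for every reordering or change of basis.
   ind-gen : ∀ {N k} {A B : Vec (V {N}) k} → Ind B → VAll (_∈< A >) B → Ind A
   ind-gen {k = zero} {[]} i h [] e = refl
   ind-gen {k = suc k} {A} {B} i h with ind? A
   ... | inj₂ j = j
   ... | inj₁ d with dep⇒fewer d
   ... | A' , g = ⊥-elim (ind-no ℕₚ.≤-refl A' i (VAll.map (span⊆ g) h))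

  module _ {N : ℕ} where
   Ln : Set
   Ln = Line F N

   infix 4 _≈ℓ_
   -- A record around `SameSub`, so that the two lines can be read off from the type.
   record _≈ℓ_ (ℓ m : Ln) : Set where
    constructor same
    field sub : SameSub F ℓ m
   open _≈ℓ_ public

   ln : (x y : V {N}) → Ind (x :: y) → Ln
   ln x y i = subspace (x :: y) i

   bas : ∀ {d} → Subspace F N d → Vec (V {N}) (suc d)
   bas = basis {F}

   ≈-sym : ∀ {ℓ m} → ℓ ≈ℓ m → m ≈ℓ ℓ
   ≈-sym (same (a , b)) = same (b , a)

   ≈-trans : ∀ {ℓ m k} → ℓ ≈ℓ m → m ≈ℓ k → ℓ ≈ℓ k
   ≈-trans (same (a , b)) (same (c , d)) = same ((λ x → c x ∘ a x) , (λ x → b x ∘ d x))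

   opaque
    ⊆? : ∀ {d e} (X : Subspace F N d) (Y : Subspace F N e) → Dec (_⊆S_ F X Y)
    ⊆? X Y = map′ (λ h x → span⊆ h) (λ h → VAll.map (h _) (gens∈ (bas X))) (VAll.all? (λ x → ∈? x (bas Y)) (bas X))

   opaque
    ≈? : ∀ (ℓ m : Ln) → Dec (ℓ ≈ℓ m)
    ≈? ℓ m = map′ same sub (⊆? ℓ m ×-dec ⊆? m ℓ)

   opaque
    sub-eq : ∀ {d} (X Y : Subspace F N d) → VAll (_∈< bas Y >) (bas X) → SameSub F X Y
    sub-eq X Y h = (λ x → span⊆ h) , (λ x → dimEq (Subspace.indep X) h)

   LCount : (Ln → Set) → ℕ → Set
   LCount = LineCount F

   LFam : (Ln → Set) → ℕ → Set
   LFam = Fam _≈ℓ_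

   opaque
    card-fam : ∀ {S m} → LCount S m → LFam S m
    card-fam {S} (xs , a , d , _) = fam (Vec.toList xs) (ℕₚ.≤-reflexive (sym (Vecₚ.length-toList xs))) (VAllₚ.toList⁺ a) (go xs (λ i j ne e → d i j ne (sub e)))
     where
      all-tab : ∀ {m} {P : Ln → Set} (xs : Vec Ln m) → (∀ i → P (lookup xs i)) → All P (Vec.toList xs)
      all-tab [] _ = []
      all-tab (x ∷ xs) h = h zero ∷ all-tab xs (h ∘ suc)
      go : ∀ {m} (xs : Vec Ln m) → (∀ i j → i ≢ j → ¬ lookup xs i ≈ℓ lookup xs j) → AllPairs (λ a b → ¬ a ≈ℓ b) (Vec.toList xs)
      go [] _ = []
      go (x ∷ xs) h = all-tab xs (λ i → h zero (suc i) (λ ())) ∷ go xs (λ i j ne → h (suc i) (suc j) (ne ∘ Finₚ.suc-injective))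

   opaque
    card-bound : ∀ {S m c} → LCount S m → LFam S c → c ℕ.≤ m
    card-bound {S} {m} (xs , _ , _ , cov) f = ℕₚ.≤-trans (fam-bound (λ p r → ≈-trans p (≈-sym r)) f (Vec.toList xs) (λ s → conv (cov _ s)))
      (ℕₚ.≤-reflexive (Vecₚ.length-toList xs))
     where
      at-tab : ∀ {m} {P : Ln → Set} (xs : Vec Ln m) i → P (lookup xs i) → Any P (Vec.toList xs)
      at-tab (x ∷ xs) zero p = here p
      at-tab (x ∷ xs) (suc i) p = there (at-tab xs i p)
      conv : ∀ {a} → (∃ λ i → SameSub F a (lookup xs i)) → Any (a ≈ℓ_) (Vec.toList xs)
      conv (i , p) = at-tab xs i (same p)

   opaque
    rm : ∀ {S c} → LFam S (suc c) → ∀ b → LFam (λ a → S a × ¬ a ≈ℓ b) c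
    rm = fam-rem ≈? ≈-sym ≈-trans

 -- The dot product in dimension three

 module Vectors3 where
  open Lines

  K3 : Set
  K3 = V {3}

  dot : K3 → K3 → K
  dot (x ∷ y :: z) (x' ∷ y' :: z') = x * x' + y * y' + z * z'

  opaque
   dot-comm : ∀ u w → dot u w ≡ dot w u
   dot-comm (x ∷ y :: z) (x' ∷ y' :: z') = solve (x ∷ y ∷ z ∷ x' ∷ y' :: z')
    (`0 *e `3 +e `1 *e `4 +e `2 *e `5) (`3 *e `0 +e `4 *e `1 +e `5 *e `2) refl

  opaque
   dot-lin : ∀ u c w d w' → dot u (c *> w <+> d *> w') ≡ c * dot u w + d * dot u w'
   dot-lin (x ∷ y :: z) c (x' ∷ y' :: z') d (x″ ∷ y″ :: z″) = solve (x ∷ y ∷ z ∷ x' ∷ y' ∷ z' ∷ x″ ∷ y″ ∷ z″ ∷ c :: d)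
    (`0 *e (`9 *e `3 +e `10 *e `6) +e `1 *e (`9 *e `4 +e `10 *e `7) +e `2 *e (`9 *e `5 +e `10 *e `8))
    (`9 *e (`0 *e `3 +e `1 *e `4 +e `2 *e `5) +e `10 *e (`0 *e `6 +e `1 *e `7 +e `2 *e `8)) refl

  opaque
   dot-linˡ : ∀ u c w d w' → dot (c *> w <+> d *> w') u ≡ c * dot w u + d * dot w' u
   dot-linˡ u c w d w' = dot-comm (c *> w <+> d *> w') u >> dot-lin u c w d w' >> cong₂ (λ x y → c * x + d * y) (dot-comm u w) (dot-comm u w')

  opaque
   dot-0 : ∀ u → dot u 0c ≡ 0F
   dot-0 (x ∷ y :: z) = solve (x ∷ y :: z) (`0 *e 0k +e `1 *e 0k +e `2 *e 0k) 0k refl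

  opaque
   -- The three columns of the matrix with rows `u` and `u'` are dependent; the coefficients of the
   -- relation are the solution.
   perp : ∀ u u' → ∃ λ w → w ≢ 0c × dot u w ≡ 0F × dot u' w ≡ 0F
   perp (x ∷ y :: z) (x' ∷ y' :: z') with dependent (s≤s (s≤s (s≤s z≤n))) ((x :: x') ∷ (y :: y') :: (z :: z')) (unit 2) (unit∈ _ ∷ unit∈ _ :: unit∈ _)
   ... | a ∷ b :: c , ne , e = a ∷ b :: c , ne , trans (sol x y z) (cong Vec.head e) , trans (sol x' y' z') (cong (Vec.head ∘ Vec.tail) e)
    where
     sol : ∀ x y z → x * a + y * b + z * c ≡ a * x + (b * y + (c * z + 0F))
     sol x y z = solve (x ∷ y ∷ z ∷ a ∷ b :: c) (`0 *e `3 +e `1 *e `4 +e `2 *e `5) (`3 *e `0 +e (`4 *e `1 +e (`5 *e `2 +e 0k))) refl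

  opaque
   perp-basis : ∀ u → u ≢ 0c → ∃₂ λ w w' → Ind (w :: w') × dot u w ≡ 0F × dot u w' ≡ 0F
   perp-basis (x ∷ y :: z) nz with x ≟ 0F | y ≟ 0F | z ≟ 0F
   ... | yes refl | yes refl | yes refl = ⊥-elim (nz refl)
   ... | no xnz | _ | _ = - y ∷ x :: 0F , - z ∷ 0F :: x ,
     (λ { (a :: b) e → cong₂ (λ a b → a :: b) (*-cancel-0 x xnz (solve (x ∷ a :: b) (`0 *e `1) (`1 *e `0 +e (`2 *e 0k +e 0k)) refl >> cong (Vec.head ∘ Vec.tail) e))
        (*-cancel-0 x xnz (solve (x ∷ a :: b) (`0 *e `2) (`1 *e 0k +e (`2 *e `0 +e 0k)) refl >> cong (Vec.head ∘ Vec.tail ∘ Vec.tail) e)) }) ,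
     solve (x ∷ y :: z) (`0 *e (⊖ `1) +e `1 *e `0 +e `2 *e 0k) 0k refl , solve (x ∷ y :: z) (`0 *e (⊖ `2) +e `1 *e 0k +e `2 *e `0) 0k refl
   ... | yes _ | no ynz | _ = y ∷ - x :: 0F , 0F ∷ - z :: y ,
     (λ { (a :: b) e → cong₂ (λ a b → a :: b) (*-cancel-0 y ynz (solve (y ∷ a :: b) (`0 *e `1) (`1 *e `0 +e (`2 *e 0k +e 0k)) refl >> cong Vec.head e))
        (*-cancel-0 y ynz (solve (y ∷ a :: b) (`0 *e `2) (`1 *e 0k +e (`2 *e `0 +e 0k)) refl >> cong (Vec.head ∘ Vec.tail ∘ Vec.tail) e)) }) ,
     solve (x ∷ y :: z) (`0 *e `1 +e `1 *e (⊖ `0) +e `2 *e 0k) 0k refl , solve (x ∷ y :: z) (`0 *e 0k +e `1 *e (⊖ `2) +e `2 *e `1) 0k refl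
   ... | yes _ | yes _ | no znz = z ∷ 0F :: - x , 0F ∷ z :: - y ,
     (λ { (a :: b) e → cong₂ (λ a b → a :: b) (*-cancel-0 z znz (solve (z ∷ a :: b) (`0 *e `1) (`1 *e `0 +e (`2 *e 0k +e 0k)) refl >> cong Vec.head e))
        (*-cancel-0 z znz (solve (z ∷ a :: b) (`0 *e `2) (`1 *e 0k +e (`2 *e `0 +e 0k)) refl >> cong (Vec.head ∘ Vec.tail) e)) }) ,
     solve (x ∷ y :: z) (`0 *e `2 +e `1 *e 0k +e `2 *e (⊖ `0)) 0k refl , solve (x ∷ y :: z) (`0 *e 0k +e `1 *e `2 +e `2 *e (⊖ `1)) 0k refl

  opaque
   lin-inj : ∀ {N k} {B : Vec (V {N}) k} → Ind B → ∀ cs ds → lin cs B ≡ lin ds B → cs ≡ ds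
   lin-inj {B = B} i cs ds e = vsolve [] (cs :: ds) (^0) (^1 +v (^0 -v ^1)) refl ⇐v i (cs <+> -1F *> ds)
    (lin-+ cs (-1F *> ds) B >> (cong₂ _<+>_ e (lin-∙ -1F ds B)) >> (vsolve [] [ lin ds B ] (^0 -v ^0) 0w refl))

  opaque
   lin-lin : ∀ {N k} (B : Vec (V {N}) k) c u d u' → lin (c *> u <+> d *> u') B ≡ c *> lin u B <+> d *> lin u' B
   lin-lin B c u d u' = lin-+ (c *> u) (d *> u') B >> (cong₂ _<+>_ (lin-∙ c u B) (lin-∙ d u' B))

  opaque
   ind-lin : ∀ {N k} {B : Vec (V {N}) k} {w w'} → Ind B → Ind (w :: w') → Ind (lin w B :: lin w' B)
   ind-lin {B = B} {w} {w'} i j (c :: d) e = j (c :: d) (vsolve (c :: d) (w :: w') (`0 *v ^0 +v (`1 *v ^1 +v 0w)) (`0 *v ^0 +v `1 *v ^1) refl >>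
    i (c *> w <+> d *> w') (lin-lin B c w d w' >> vsolve (c :: d) (lin w B :: lin w' B) (`0 *v ^0 +v `1 *v ^1) (`0 *v ^0 +v (`1 *v ^1 +v 0w)) refl >> e))

 -- The cross product

 module Cross where
  open Lines
  open Vectors3

  cross : K3 → K3 → K3
  cross (x ∷ y :: z) (x' ∷ y' :: z') = y * z' - z * y' ∷ z * x' - x * z' :: x * y' - y * x'

  opaque
   vec3 : ∀ {x y z x' y' z' : K} → x ≡ x' → y ≡ y' → z ≡ z' → _≡_ {A = K3} (x ∷ y :: z) (x' ∷ y' :: z')
   vec3 refl refl refl = refl

  opaque
   cross-lin : ∀ c a d a' u → cross (c *> a <+> d *> a') u ≡ c *> cross a u <+> d *> cross a' u
   cross-lin c (x ∷ y :: z) d (x' ∷ y' :: z') (p ∷ r :: s) = vec3 (go y z y' z' s r) (go z x z' x' p s) (go x y x' y' r p)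
    where
     go : ∀ y z y' z' s r → (c * y + d * y') * s - (c * z + d * z') * r ≡ c * (y * s - z * r) + d * (y' * s - z' * r)
     go y z y' z' s r = solve (c ∷ d ∷ y ∷ z ∷ y' ∷ z' ∷ s :: r) ((`0 *e `2 +e `1 *e `4) *e `6 -e (`0 *e `3 +e `1 *e `5) *e `7)
       (`0 *e (`2 *e `6 -e `3 *e `7) +e `1 *e (`4 *e `6 -e `5 *e `7)) refl

  opaque
   anti : ∀ a b → cross a b ≡ -1F *> cross b a
   anti (x ∷ y :: z) (p ∷ r :: s) = vec3 (go y z r s) (go z x s p) (go x y p r)
    where
     go : ∀ y z r s → y * s - z * r ≡ -1F * (r * z - s * y)
     go y z r s = solve (y ∷ z ∷ r :: s) (`0 *e `3 -e `1 *e `2) (-1k *e (`2 *e `1 -e `3 *e `0)) refl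

  opaque
   cross-linʳ : ∀ u c a d a' → cross u (c *> a <+> d *> a') ≡ c *> cross u a <+> d *> cross u a'
   cross-linʳ u c a d a' = anti u (c *> a <+> d *> a') >> cong (-1F *>_) (cross-lin c a d a' u) >> trans
    (vsolve (c :: d) (cross a u :: cross a' u) (-1k *v (`0 *v ^0 +v `1 *v ^1)) (`0 *v -1k *v ^0 +v `1 *v -1k *v ^1) refl) (cong₂ (λ x y → c *> x <+> d *> y) (sym (anti u a)) (sym (anti u a')))

  opaque
   dot-crossˡ : ∀ a u → dot a (cross a u) ≡ 0F
   dot-crossˡ (x ∷ y :: z) (p ∷ r :: s) = solve (x ∷ y ∷ z ∷ p ∷ r :: s) (`0 *e (`1 *e `5 -e `2 *e `4) +e `1 *e (`2 *e `3 -e `0 *e `5) +e `2 *e (`0 *e `4 -e `1 *e `3)) 0k refl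

  opaque
   dot-crossʳ : ∀ a u → dot u (cross a u) ≡ 0F
   dot-crossʳ (x ∷ y :: z) (p ∷ r :: s) = solve (x ∷ y ∷ z ∷ p ∷ r :: s) (`3 *e (`1 *e `5 -e `2 *e `4) +e `4 *e (`2 *e `3 -e `0 *e `5) +e `5 *e (`0 *e `4 -e `1 *e `3)) 0k refl

  opaque
   bac : ∀ a b c → cross (cross a b) c ≡ dot a c *> b <+> (- dot b c) *> a
   bac (x ∷ y :: z) (x' ∷ y' :: z') (p ∷ r :: s) = vec3
     (solve (x ∷ y ∷ z ∷ x' ∷ y' ∷ z' ∷ p ∷ r :: s) ((`2 *e `3 -e `0 *e `5) *e `8 -e (`0 *e `4 -e `1 *e `3) *e `7) (D1 *e `3 +e (⊖ D2) *e `0) refl)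
     (solve (x ∷ y ∷ z ∷ x' ∷ y' ∷ z' ∷ p ∷ r :: s) ((`0 *e `4 -e `1 *e `3) *e `6 -e (`1 *e `5 -e `2 *e `4) *e `8) (D1 *e `4 +e (⊖ D2) *e `1) refl)
     (solve (x ∷ y ∷ z ∷ x' ∷ y' ∷ z' ∷ p ∷ r :: s) ((`1 *e `5 -e `2 *e `4) *e `7 -e (`2 *e `3 -e `0 *e `5) *e `6) (D1 *e `5 +e (⊖ D2) *e `2) refl)
    where
     D1 D2 : Expr
     D1 = `0 *e `6 +e `1 *e `7 +e `2 *e `8
     D2 = `3 *e `6 +e `4 *e `7 +e `5 *e `8

  opaque
   bac′ : ∀ a b c → cross a (cross b c) ≡ dot a c *> b <+> (- dot a b) *> c
   bac′ a b c = anti a (cross b c) >> cong (-1F *>_) (bac b c a) >> trans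
    (vsolve (dot b a :: dot c a) (b :: c) (-1k *v (`0 *v ^1 +v (⊖ `1) *v ^0)) (`1 *v ^0 +v (⊖ `0) *v ^1) refl) (cong₂ (λ x y → x *> b <+> (- y) *> c) (dot-comm c a) (dot-comm b a))

  opaque
   binet : ∀ a b c d → dot (cross a b) (cross c d) ≡ dot a c * dot b d - dot a d * dot b c
   binet a b c d = trip a b (cross c d) >> cong (dot a) (bac′ b c d) >> dot-lin a (dot b d) c (- dot b c) d >>
     solve (dot a c ∷ dot b d ∷ dot a d :: dot b c) (`1 *e `0 +e (⊖ `3) *e `2) (`0 *e `1 -e `2 *e `3) refl
    where
     trip : ∀ a b c → dot (cross a b) c ≡ dot a (cross b c)
     trip (x ∷ y :: z) (x' ∷ y' :: z') (p ∷ r :: s) = solve (x ∷ y ∷ z ∷ x' ∷ y' ∷ z' ∷ p ∷ r :: s)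
       ((`1 *e `5 -e `2 *e `4) *e `6 +e (`2 *e `3 -e `0 *e `5) *e `7 +e (`0 *e `4 -e `1 *e `3) *e `8)
       (`0 *e (`4 *e `8 -e `5 *e `7) +e `1 *e (`5 *e `6 -e `3 *e `8) +e `2 *e (`3 *e `7 -e `4 *e `6)) refl

  opaque
   co-vector : ∀ a → a ≢ 0c → ∃ λ y → dot y a ≢ 0F
   co-vector (x ∷ y :: z) nz with x ≟ 0F | y ≟ 0F | z ≟ 0F
   ... | no n | _ | _ = 1F ∷ 0F :: 0F , λ e → n (solve (x ∷ y :: z) (`0) (1k *e `0 +e 0k *e `1 +e 0k *e `2) refl >> e)
   ... | yes _ | no n | _ = 0F ∷ 1F :: 0F , λ e → n (solve (x ∷ y :: z) (`1) (0k *e `0 +e 1k *e `1 +e 0k *e `2) refl >> e)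
   ... | yes _ | yes _ | no n = 0F ∷ 0F :: 1F , λ e → n (solve (x ∷ y :: z) (`2) (0k *e `0 +e 0k *e `1 +e 1k *e `2) refl >> e)
   ... | yes refl | yes refl | yes refl = ⊥-elim (nz refl)

  opaque
   -- For a `y` with `dot y a` nonzero, the triple product formula for `cross y (cross a x)` can be
   -- solved for `x`.
   cross-∥ : ∀ a x → a ≢ 0c → cross a x ≡ 0c → ∃ λ r → x ≡ r *> a
   cross-∥ a x nz e with co-vector a nz
   ... | y , d = inv (dot y a) d * dot y x , (vsolve (dot y a ∷ dot y x :: inv (dot y a) d) (a :: x) (^1)
      ((`2 *e `1) *v ^0 +v ((`0 *e `2 -e 1k) *v (-1k *v ^1) +v (⊖ `2) *v ((`1 *v ^0 +v (⊖ `0) *v ^1) -v 0w))) refl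
     ⇐v (inv-r (dot y a) d s: (-1F *> x)) &v ((- inv (dot y a) d) ∙: z))
    where
     cr0 : ∀ y → cross y 0c ≡ 0c
     cr0 (p ∷ r :: s) = vec3 (go r s) (go s p) (go p r)
      where
       go : ∀ p r → p * 0F - r * 0F ≡ 0F
       go p r = solve (p :: r) (`0 *e 0k -e `1 *e 0k) 0k refl
     z : dot y x *> a <+> (- dot y a) *> x ≡ 0c
     z = sym (bac′ y a x) >> cong (cross y) e >> cr0 y

 -- Split octonions and collinearity in H(q)

 module Octonions where
  open Lines

  opaque
   solveV : ∀ (xs : List K) {m} (es es' : Vec Expr m) → Vec.map nf es ≡ Vec.map nf es' →
        Vec.map (λ e → ⟦ e ⟧ (env 0F xs)) es ≡ Vec.map (λ e → ⟦ e ⟧ (env 0F xs)) es'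
   solveV xs [] [] _ = refl
   solveV xs (e ∷ es) (e' ∷ es') p = cong₂ _∷_ (solve xs e e' (cong Vec.head p)) (solveV xs es es' (cong Vec.tail p))

  Q7 O : Set
  Q7 = V {7}
  O = V {8}

  -- Zorn matrices [ p a ; b s ], with the sign of the lower left corner reversed; (u , e , w) stands for [ −e u ; w e ].
  module Zorn {A : Set} (add times : A → A → A) (-′_ : A → A) where
   infixl 6 _−_ _+′_
   infixl 7 _×′_
   _+′_ _−_ _×′_ : A → A → A
   x +′ y = add x y
   x − y = add x (-′ y)
   x ×′ y = times x y

   incl : Vec A 7 → Vec A 8
   incl (u0 ∷ u1 ∷ u2 ∷ e ∷ w0 ∷ w1 :: w2) = -′ e ∷ u0 ∷ u1 ∷ u2 ∷ w0 ∷ w1 ∷ w2 :: e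

   -- Only left factors of trace zero occur, hence the seven coordinates of the first argument.
   mul : Vec A 7 → Vec A 8 → Vec A 8
   mul (u0 ∷ u1 ∷ u2 ∷ e ∷ w0 ∷ w1 :: w2) (p ∷ a₀ ∷ a₁ ∷ a₂ ∷ b₀ ∷ b₁ ∷ b₂ :: s) =
    -′ (e ×′ p) − ((u0 ×′ b₀ +′ u1 ×′ b₁) +′ u2 ×′ b₂) ∷
    (s ×′ u0 − e ×′ a₀) − (w1 ×′ b₂ − w2 ×′ b₁) ∷ (s ×′ u1 − e ×′ a₁) − (w2 ×′ b₀ − w0 ×′ b₂) ∷ (s ×′ u2 − e ×′ a₂) − (w0 ×′ b₁ − w1 ×′ b₀) ∷
    (p ×′ w0 +′ e ×′ b₀) − (u1 ×′ a₂ − u2 ×′ a₁) ∷ (p ×′ w1 +′ e ×′ b₁) − (u2 ×′ a₀ − u0 ×′ a₂) ∷ (p ×′ w2 +′ e ×′ b₂) − (u0 ×′ a₁ − u1 ×′ a₀) ∷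
    e ×′ s − ((w0 ×′ a₀ +′ w1 ×′ a₁) +′ w2 ×′ a₂) ∷ []

   norm : Vec A 7 → A
   norm (u0 ∷ u1 ∷ u2 ∷ e ∷ w0 ∷ w1 :: w2) = ((u0 ×′ w0 +′ u1 ×′ w1) +′ u2 ×′ w2) − e ×′ e

   polar : Vec A 7 → Vec A 7 → A
   polar (u0 ∷ u1 ∷ u2 ∷ e ∷ w0 ∷ w1 :: w2) (a₀ ∷ a₁ ∷ a₂ ∷ g ∷ b₀ ∷ b₁ :: b₂) =
    (((u0 ×′ b₀ +′ u1 ×′ b₁) +′ u2 ×′ b₂) +′ ((w0 ×′ a₀ +′ w1 ×′ a₁) +′ w2 ×′ a₂)) − (e ×′ g +′ e ×′ g)

   conj : Vec A 8 → Vec A 8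
   conj (p ∷ a₀ ∷ a₁ ∷ a₂ ∷ b₀ ∷ b₁ ∷ b₂ :: s) = s ∷ -′ a₀ ∷ -′ a₁ ∷ -′ a₂ ∷ -′ b₀ ∷ -′ b₁ ∷ -′ b₂ :: p

  open Zorn _+_ _*_ -_ public using () renaming (incl to ι; mul to om; norm to N; polar to B; conj to cj)
  -- The same formulas over solver terms; octonion identities are decided by comparing normal forms
  -- coordinate by coordinate.
  module Terms where
   module Z = Zorn _+e_ _*e_ ⊖_

   X7 Y7 : Vec Expr 7
   X7 = `0 ∷ `1 ∷ `2 ∷ `3 ∷ `4 ∷ `5 :: `6
   Y7 = `7 ∷ `8 ∷ `9 ∷ `10 ∷ `11 ∷ `12 :: `13
   Z8 : Vec Expr 8
   Z8 = `14 ∷ `15 ∷ `16 ∷ `17 ∷ `18 ∷ `19 ∷ `20 :: `21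
   Z7 : Vec Expr 7
   Z7 = `14 ∷ `15 ∷ `16 ∷ `17 ∷ `18 ∷ `19 :: `20

   _⊞′_ : ∀ {m} → Vec Expr m → Vec Expr m → Vec Expr m
   _⊞′_ = zipWith _+e_
   _⊡′_ : ∀ {m} → Expr → Vec Expr m → Vec Expr m
   e ⊡′ x = Vec.map (e *e_) x
   infixl 6 _⊞′_
   infixr 7 _⊡′_

   ev : ∀ {m} → List K → Vec Expr m → Vec K m
   ev ks = Vec.map (λ e → ⟦ e ⟧ (env 0F ks))

   1E : Vec Expr 8
   1E = 1k ∷ 0k ∷ 0k ∷ 0k ∷ 0k ∷ 0k ∷ 0k :: 1k
   0E : ∀ {m} → Vec Expr m
   0E = replicate _ 0k

   lst : ∀ {m} → Vec K m → List K → List K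
   lst [] l = l
   lst (x ∷ xs) l = x ∷ lst xs l
  open Terms

  one : O
  one = 1F ∷ 0F ∷ 0F ∷ 0F ∷ 0F ∷ 0F ∷ 0F :: 1F

  opaque
   alt : ∀ x y z → om x (om y z) <+> om y (om x z) ≡ (- B x y) *> z
   alt x@(_ ∷ _ ∷ _ ∷ _ ∷ _ ∷ _ :: _) y@(_ ∷ _ ∷ _ ∷ _ ∷ _ ∷ _ :: _) z@(_ ∷ _ ∷ _ ∷ _ ∷ _ ∷ _ ∷ _ :: _) =
    solveV (lst x (lst y (lst z []))) (Z.mul X7 (Z.mul Y7 Z8) ⊞′ Z.mul Y7 (Z.mul X7 Z8)) ((⊖ Z.polar X7 Y7) ⊡′ Z8) refl

  opaque
   -- Checked separately, since `alt` with equal arguments gives it only in odd characteristic.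
   sq : ∀ x z → om x (om x z) ≡ (- N x) *> z
   sq x@(_ ∷ _ ∷ _ ∷ _ ∷ _ ∷ _ :: _) z@(_ ∷ _ ∷ _ ∷ _ ∷ _ ∷ _ ∷ _ :: _) =
    solveV (lst x (lst x (lst z []))) (Z.mul X7 (Z.mul X7 Z8)) ((⊖ Z.norm X7) ⊡′ Z8) refl

  opaque
   om-conj : ∀ x y → om y (ι x) ≡ cj (om x (ι y))
   om-conj x@(_ ∷ _ ∷ _ ∷ _ ∷ _ ∷ _ :: _) y@(_ ∷ _ ∷ _ ∷ _ ∷ _ ∷ _ :: _) =
    solveV (lst x (lst y [])) (Z.mul Y7 (Z.incl X7)) (Z.conj (Z.mul X7 (Z.incl Y7))) refl

  opaque
   om-comm : ∀ x y → om x (ι y) <+> om y (ι x) ≡ (- B x y) *> one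
   om-comm x@(_ ∷ _ ∷ _ ∷ _ ∷ _ ∷ _ :: _) y@(_ ∷ _ ∷ _ ∷ _ ∷ _ ∷ _ :: _) =
    solveV (lst x (lst y [])) (Z.mul X7 (Z.incl Y7) ⊞′ Z.mul Y7 (Z.incl X7)) ((⊖ Z.polar X7 Y7) ⊡′ 1E) refl

  opaque
   om-self : ∀ x → om x (ι x) ≡ (- N x) *> one
   om-self x@(_ ∷ _ ∷ _ ∷ _ ∷ _ ∷ _ :: _) = solveV (lst x []) (Z.mul X7 (Z.incl X7)) ((⊖ Z.norm X7) ⊡′ 1E) refl

  opaque
   om-linʳ : ∀ x c y d z → om x (c *> y <+> d *> z) ≡ c *> om x y <+> d *> om x z
   om-linʳ x@(_ ∷ _ ∷ _ ∷ _ ∷ _ ∷ _ :: _) c y@(_ ∷ _ ∷ _ ∷ _ ∷ _ ∷ _ ∷ _ :: _) d z@(_ ∷ _ ∷ _ ∷ _ ∷ _ ∷ _ ∷ _ :: _) =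
    solveV (lst x (lst y (lst z (c :: d)))) (Z.mul X7 (`23 ⊡′ Y ⊞′ `24 ⊡′ Z)) (`23 ⊡′ Z.mul X7 Y ⊞′ `24 ⊡′ Z.mul X7 Z) refl
    where
     Y Z : Vec Expr 8
     Y = `7 ∷ `8 ∷ `9 ∷ `10 ∷ `11 ∷ `12 ∷ `13 :: `14
     Z = `15 ∷ `16 ∷ `17 ∷ `18 ∷ `19 ∷ `20 ∷ `21 :: `22

  opaque
   ι-lin : ∀ c x d y → ι (c *> x <+> d *> y) ≡ c *> ι x <+> d *> ι y
   ι-lin c x@(_ ∷ _ ∷ _ ∷ _ ∷ _ ∷ _ :: _) d y@(_ ∷ _ ∷ _ ∷ _ ∷ _ ∷ _ :: _) =
    solveV (lst x (lst y (c :: d))) (Z.incl (`14 ⊡′ X7 ⊞′ `15 ⊡′ Y7)) (`14 ⊡′ Z.incl X7 ⊞′ `15 ⊡′ Z.incl Y7) refl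

  τ : O → Q7
  τ (p ∷ a₀ ∷ a₁ ∷ a₂ ∷ b₀ ∷ b₁ ∷ b₂ :: s) = a₀ ∷ a₁ ∷ a₂ ∷ s ∷ b₀ ∷ b₁ :: b₂

  tr : O → K
  tr (p ∷ a₀ ∷ a₁ ∷ a₂ ∷ b₀ ∷ b₁ ∷ b₂ :: s) = p + s

  opaque
   τι : ∀ x → τ (ι x) ≡ x
   τι (_ ∷ _ ∷ _ ∷ _ ∷ _ ∷ _ :: _) = refl

  opaque
   ιτ : ∀ z → tr z ≡ 0F → ι (τ z) ≡ z
   ιτ (p ∷ a₀ ∷ a₁ ∷ a₂ ∷ b₀ ∷ b₁ ∷ b₂ :: s) e = cong (λ p → p ∷ a₀ ∷ a₁ ∷ a₂ ∷ b₀ ∷ b₁ ∷ b₂ :: s)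
    (solve (p :: s) (⊖ `1) (`0 +e -1k *e (`0 +e `1 -e 0k)) refl ⇐ -1F *: e)

  opaque
   tr-om : ∀ x y → tr (om x (ι y)) ≡ - B x y
   tr-om x@(_ ∷ _ ∷ _ ∷ _ ∷ _ ∷ _ :: _) y@(_ ∷ _ ∷ _ ∷ _ ∷ _ ∷ _ :: _) =
    solve (lst x (lst y [])) (Vec.head (Z.mul X7 (Z.incl Y7)) +e Vec.last (Z.mul X7 (Z.incl Y7))) (⊖ Z.polar X7 Y7) refl

  opaque
   tr-lin : ∀ c x d y → tr (c *> x <+> d *> y) ≡ c * tr x + d * tr y
   tr-lin c (p ∷ _ ∷ _ ∷ _ ∷ _ ∷ _ ∷ _ :: s) d (p' ∷ _ ∷ _ ∷ _ ∷ _ ∷ _ ∷ _ :: s') =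
    solve (c ∷ p ∷ s ∷ d ∷ p' :: s') (`0 *e `1 +e `3 *e `4 +e (`0 *e `2 +e `3 *e `5)) (`0 *e (`1 +e `2) +e `3 *e (`4 +e `5)) refl

  opaque
   B-lin : ∀ x c y d z → B x (c *> y <+> d *> z) ≡ c * B x y + d * B x z
   B-lin x@(_ ∷ _ ∷ _ ∷ _ ∷ _ ∷ _ :: _) c y@(_ ∷ _ ∷ _ ∷ _ ∷ _ ∷ _ :: _) d z@(_ ∷ _ ∷ _ ∷ _ ∷ _ ∷ _ :: _) =
    solve (lst x (lst y (lst z (c :: d)))) (Z.polar X7 (`21 ⊡′ Y7 ⊞′ `22 ⊡′ Z7)) (`21 *e Z.polar X7 Y7 +e `22 *e Z.polar X7 Z7) refl

  opaque
   B-sym : ∀ x y → B x y ≡ B y x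
   B-sym x@(_ ∷ _ ∷ _ ∷ _ ∷ _ ∷ _ :: _) y@(_ ∷ _ ∷ _ ∷ _ ∷ _ ∷ _ :: _) = solve (lst x (lst y [])) (Z.polar X7 Y7) (Z.polar Y7 X7) refl

  opaque
   N-lin : ∀ c x d y → N (c *> x <+> d *> y) ≡ c * c * N x + d * d * N y + c * d * B x y
   N-lin c x@(_ ∷ _ ∷ _ ∷ _ ∷ _ ∷ _ :: _) d y@(_ ∷ _ ∷ _ ∷ _ ∷ _ ∷ _ :: _) =
    solve (lst x (lst y (c :: d))) (Z.norm (`14 ⊡′ X7 ⊞′ `15 ⊡′ Y7)) (`14 *e `14 *e Z.norm X7 +e `15 *e `15 *e Z.norm Y7 +e `14 *e `15 *e Z.polar X7 Y7) refl

  opaque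
   om-0 : ∀ x → om x 0v ≡ 0v
   om-0 x@(_ ∷ _ ∷ _ ∷ _ ∷ _ ∷ _ :: _) = solveV (lst x []) (Z.mul X7 0E) 0E refl

  opaque
   ι-0 : ι 0v ≡ 0v
   ι-0 = solveV [] (Z.incl 0E) 0E refl

  opaque
   ∙-0 : ∀ {m k} {z : V {m}} → z ≢ 0v → k *> z ≡ 0v → k ≡ 0F
   ∙-0 {k = k} {z} nz e with k ≟ 0F
   ... | yes p = p
   ... | no n = ⊥-elim (nz (vsolve (k :: inv k n) [ z ] (^0) (0w +v ((⊖ (`0 *e `1 -e 1k)) *v ^0 +v `1 *v (`0 *v ^0 -v 0w))) refl
     ⇐v trans (vsolve [ k * inv k n - 1F ] [ z ] ((⊖ `0) *v ^0) (-1k *v `0 *v ^0) refl) (cong (-1F *>_) (inv-r k n s: z) >> (vsolve [] [] (-1k *v 0w) 0w refl)) &v (inv k n ∙: e)))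

  opaque
   ι≢0 : ∀ {x} → x ≢ 0v → ι x ≢ 0v
   ι≢0 {x} nz e = nz (sym (τι x) >> cong τ e)

  infix 4 _⟂_
  record _⟂_ (x y : Q7) : Set where
   constructor perp
   field om≡0 : om x (ι y) ≡ 0v
  open _⟂_ public

  opaque
   ⟂? : ∀ x y → Dec (x ⟂ y)
   ⟂? x y = map′ perp om≡0 (om x (ι y) ≟v 0v)

  opaque
   ⟂-sym : ∀ {x y} → x ⟂ y → y ⟂ x
   ⟂-sym {x} {y} (perp e) = perp (om-conj x y >> cong cj e >> (solveV [] (Z.conj 0E) 0E refl))

  opaque
   ⟂-lin : ∀ {x y z} → x ⟂ y → x ⟂ z → ∀ c d → x ⟂ c *> y <+> d *> z
   ⟂-lin {x} {y} {z} (perp e) (perp f) c d = perp (cong (om x) (ι-lin c y d z) >> om-linʳ x c (ι y) d (ι z) >> cong₂ (λ p r → c *> p <+> d *> r) e f >>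
    (vsolve (c :: d) [] (`0 *v 0w +v `1 *v 0w) 0w refl))

  opaque
   ⟂-0 : ∀ x → x ⟂ 0v
   ⟂-0 x = perp (cong (om x) ι-0 >> om-0 x)

  opaque
   ⟂-span : ∀ {k x} {A : Vec Q7 k} → VAll (x ⟂_) A → ∀ {y} → y ∈< A > → x ⟂ y
   ⟂-span {x = x} [] ([] , refl) = ⟂-0 x
   ⟂-span {x = x} {a ∷ A} (h ∷ hs) (c ∷ cs , refl) = subst (x ⟂_) (vsolve [ c ] (a :: lin cs A) (`0 *v ^0 +v 1k *v ^1) (`0 *v ^0 +v ^1) refl) (⟂-lin h (⟂-span hs (cs , refl)) c 1F)

  opaque
   -- `x (x y)` is zero, and by `sq` it is `- N x` times the nonzero `y`.
   ⟂⇒N : ∀ {x y} → x ⟂ y → y ≢ 0v → N x ≡ 0F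
   ⟂⇒N {x} {y} (perp e) nz = sym (-‿involutive (N x)) >> (cong -_ (∙-0 (ι≢0 nz) (sym (sq x (ι y)) >> cong (om x) e >> om-0 x))) >> -0#≈0#

  opaque
   N⇒⟂ : ∀ {x} → N x ≡ 0F → x ⟂ x
   N⇒⟂ {x} e = perp (om-self x >> cong (λ k → (- k) *> one) e >> (solveV [] ((⊖ 0k) ⊡′ 1E) 0E refl))

  opaque
   ⟂-self : ∀ {x y} → x ⟂ y → y ≢ 0v → x ⟂ x
   ⟂-self h nz = N⇒⟂ (⟂⇒N h nz)

  opaque
   ⟂⇒B : ∀ {x y} → x ⟂ y → B x y ≡ 0F
   ⟂⇒B {x} {y} h = sym (-‿involutive (B x y)) >> (cong -_ (∙-0 {z = one} (λ e → 1≢0 (cong Vec.head e)) (sym (om-comm x y) >>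
    (cong₂ _<+>_ (om≡0 h) (om≡0 (⟂-sym h))) >> (solveV [] (0E ⊞′ 0E) 0E refl)))) >> -0#≈0#

  opaque
   -- The form in which the alternative law is used: if `y` annihilates `z`, then multiplying `x z`
   -- by `y` returns a multiple of `z`, which vanishes when `x` and `y` are orthogonal.
   om-swap : ∀ {x y z} → om y z ≡ 0v → om y (om x z) ≡ (- B x y) *> z
   om-swap {x} {y} {z} e = (vsolve [] [ om y (om x z) ] (^0) (0w +v ^0) refl) >> cong (_<+> om y (om x z)) (sym (cong (om x) e >> om-0 x)) >> alt x y z

  opaque
   om-swap0 : ∀ {x y z} → B x y ≡ 0F → om y z ≡ 0v → om y (om x z) ≡ 0v
   om-swap0 {x} {y} {z} b e = om-swap e >> cong (λ k → (- k) *> z) b >> (vsolve [] [ z ] ((⊖ 0k) *v ^0) 0w refl)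

  opaque
   om-neg : ∀ {x y} z → B x y ≡ 0F → om x (om y z) ≡ -1F *> om y (om x z)
   om-neg {x} {y} z b = vsolve [ B x y ] (om x (om y z) ∷ om y (om x z) :: z) (^0) (-1k *v ^1 +v (1k *v ((^0 +v ^1) -v (⊖ `0) *v ^2) +v (`0 -e 0k) *v (-1k *v ^2))) refl
    ⇐v (1F ∙: alt x y z) &v (b s: (-1F *> z))

  opaque
   om-anti : ∀ {x y} → B x y ≡ 0F → om x (ι y) ≡ -1F *> om y (ι x)
   om-anti {x} {y} b = vsolve [ B x y ] (om x (ι y) ∷ om y (ι x) :: one) (^0) (-1k *v ^1 +v (1k *v ((^0 +v ^1) -v (⊖ `0) *v ^2) +v (`0 -e 0k) *v (-1k *v ^2))) refl
    ⇐v (1F ∙: om-comm x y) &v (b s: (-1F *> one))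

  opaque
   om-∙ : ∀ x k z → om x (k *> z) ≡ k *> om x z
   om-∙ x k z = cong (om x) (vsolve [ k ] [ z ] (`0 *v ^0) (`0 *v ^0 +v 0k *v ^0) refl) >> om-linʳ x k z 0F z >> vsolve [ k ] [ om x z ] (`0 *v ^0 +v 0k *v ^0) (`0 *v ^0) refl

  -- Linear bijections preserving collinearity in both directions; they bring points and hyperplanes
  -- into general position.
  record Aut : Set where
   field
    to from : Q7 → Q7
    to-lin : ∀ c x d y → to (c *> x <+> d *> y) ≡ c *> to x <+> d *> to y
    from-lin : ∀ c x d y → from (c *> x <+> d *> y) ≡ c *> from x <+> d *> from y
    to-from : ∀ x → to (from x) ≡ x
    from-to : ∀ x → from (to x) ≡ x
    to-⟂ : ∀ {x y} → x ⟂ y → to x ⟂ to y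
    from-⟂ : ∀ {x y} → x ⟂ y → from x ⟂ from y

  module MapLin {N M : ℕ} (g : V {N} → V {M}) (g-lin : ∀ c x d y → g (c *> x <+> d *> y) ≡ c *> g x <+> d *> g y) where
   opaque
    map-0 : g 0v ≡ 0v
    map-0 = cong g (vsolve [] [] 0w (0k *v 0w +v 0k *v 0w) refl) >> g-lin 0F 0v 0F 0v >> (vsolve [] [ g 0v ] (0k *v ^0 +v 0k *v ^0) 0w refl)

    map-lin : ∀ {k} cs (A : Vec (V {N}) k) → g (lin cs A) ≡ lin cs (Vec.map g A)
    map-lin [] [] = map-0
    map-lin (c ∷ cs) (a ∷ A) = cong g (vsolve [ c ] (a :: lin cs A) (`0 *v ^0 +v ^1) (`0 *v ^0 +v 1k *v ^1) refl) >> g-lin c a 1F (lin cs A) >>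
     cong (λ z → c *> g a <+> 1F *> z) (map-lin cs A) >> vsolve [ c ] (g a :: lin cs (Vec.map g A)) (`0 *v ^0 +v 1k *v ^1) (`0 *v ^0 +v ^1) refl

    map-∈ : ∀ {k} {A : Vec (V {N}) k} {x} → x ∈< A > → g x ∈< Vec.map g A >
    map-∈ {A = A} (cs , refl) = cs , sym (map-lin cs A)

  module AutLemmas (G : Aut) where
   open Aut G
   private
    module T = MapLin to to-lin
    module Fm = MapLin from from-lin

   opaque
    from-ind : ∀ {k} {A : Vec Q7 k} → Ind A → Ind (Vec.map from A)
    from-ind {A = A} i cs e = i cs (sym (to-from (lin cs A)) >> cong to (Fm.map-lin cs A >> e) >> T.map-0)

    to-ind : ∀ {k} {A : Vec Q7 k} → Ind A → Ind (Vec.map to A)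
    to-ind {A = A} i cs e = i cs (sym (from-to (lin cs A)) >> cong from (T.map-lin cs A >> e) >> Fm.map-0)

    from-∈ : ∀ {k} {A : Vec Q7 k} {x} → x ∈< A > → from x ∈< Vec.map from A >
    from-∈ = Fm.map-∈

    to-∈ : ∀ {k} {A : Vec Q7 k} {x} → x ∈< A > → to x ∈< Vec.map to A >
    to-∈ = T.map-∈

  -- An automorphism of the octonions fixing 1 is determined by its restriction to trace zero.
  private
   pres : (g : Q7 → Q7) (h : O → O) → (∀ x y → om (g x) (ι (g y)) ≡ h (om x (ι y))) → h 0v ≡ 0v → ∀ {x y} → x ⟂ y → g x ⟂ g y
   pres g h e z {x} {y} (perp p) = perp (e x y >> cong h p >> z)

   rotE : ∀ {A : Set} → Vec A 7 → Vec A 7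
   rotE (u0 ∷ u1 ∷ u2 ∷ e ∷ w0 ∷ w1 :: w2) = u1 ∷ u2 ∷ u0 ∷ e ∷ w1 ∷ w2 :: w0
   rot8 : ∀ {A : Set} → Vec A 8 → Vec A 8
   rot8 (p ∷ u0 ∷ u1 ∷ u2 ∷ w0 ∷ w1 ∷ w2 :: s) = p ∷ u1 ∷ u2 ∷ u0 ∷ w1 ∷ w2 ∷ w0 :: s

   rot-lin : ∀ c x d y → rotE (c *> x <+> d *> y) ≡ c *> rotE x <+> d *> rotE y
   rot-lin c (_ ∷ _ ∷ _ ∷ _ ∷ _ ∷ _ :: _) d (_ ∷ _ ∷ _ ∷ _ ∷ _ ∷ _ :: _) = refl

   rot³ : ∀ (x : Q7) → rotE (rotE (rotE x)) ≡ x
   rot³ (_ ∷ _ ∷ _ ∷ _ ∷ _ ∷ _ :: _) = refl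

   rot-⟂ : ∀ {x y} → x ⟂ y → rotE x ⟂ rotE y
   rot-⟂ = pres rotE rot8 (λ { x@(_ ∷ _ ∷ _ ∷ _ ∷ _ ∷ _ :: _) y@(_ ∷ _ ∷ _ ∷ _ ∷ _ ∷ _ :: _) →
    solveV (lst x (lst y [])) (Z.mul (rotE X7) (Z.incl (rotE Y7))) (rot8 (Z.mul X7 (Z.incl Y7))) refl }) refl

   dualF : {A : Set} (-′_ : A → A) → Vec A 7 → Vec A 7
   dualF -′_ (u0 ∷ u1 ∷ u2 ∷ e ∷ w0 ∷ w1 :: w2) = w0 ∷ w1 ∷ w2 ∷ -′ e ∷ u0 ∷ u1 :: u2
   dual8 : {A : Set} → Vec A 8 → Vec A 8
   dual8 (p ∷ u0 ∷ u1 ∷ u2 ∷ w0 ∷ w1 ∷ w2 :: s) = s ∷ w0 ∷ w1 ∷ w2 ∷ u0 ∷ u1 ∷ u2 :: p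

   dualK : Q7 → Q7
   dualK = dualF (λ e → - e)

   -- A unipotent map. Unlike the rotation and the duality it mixes the coordinates `w0`, `e` and
   -- `u0`, which creates new nonzero coefficients in the equation of a hyperplane.
   module El {A : Set} (_+′_ _*′_ : A → A → A) (-′_ : A → A) (t : A) where
    el : Vec A 7 → Vec A 7
    el (u0 ∷ u1 ∷ u2 ∷ e ∷ w0 ∷ w1 :: w2) = (u0 +′ (t *′ (e +′ e))) +′ (t *′ (t *′ w0)) ∷ u1 ∷ u2 ∷ e +′ (t *′ w0) ∷ w0 ∷ w1 +′ (-′ (t *′ u2)) :: w2 +′ (t *′ u1)
    el8 : Vec A 8 → Vec A 8
    el8 (p ∷ a₀ ∷ a₁ ∷ a₂ ∷ b₀ ∷ b₁ ∷ b₂ :: s) = p +′ (-′ (t *′ b₀)) ∷ (a₀ +′ (t *′ (s +′ (-′ p)))) +′ (t *′ (t *′ b₀)) ∷ a₁ ∷ a₂ ∷ b₀ ∷ b₁ +′ (-′ (t *′ a₂)) ∷ b₂ +′ (t *′ a₁) :: s +′ (t *′ b₀)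

   module EE = El _+e_ _*e_ ⊖_

   dual-⟂ : ∀ {x y} → x ⟂ y → dualK x ⟂ dualK y
   dual-⟂ = pres (dualK) dual8 (λ { x@(_ ∷ _ ∷ _ ∷ _ ∷ _ ∷ _ :: _) y@(_ ∷ _ ∷ _ ∷ _ ∷ _ ∷ _ :: _) →
    solveV (lst x (lst y [])) (Z.mul (dualF ⊖_ X7) (Z.incl (dualF ⊖_ Y7))) (dual8 (Z.mul X7 (Z.incl Y7))) refl }) refl

   dual-lin : ∀ c x d y → dualK (c *> x <+> d *> y) ≡ c *> dualK x <+> d *> dualK y
   dual-lin c x@(_ ∷ _ ∷ _ ∷ _ ∷ _ ∷ _ :: _) d y@(_ ∷ _ ∷ _ ∷ _ ∷ _ ∷ _ :: _) =
    solveV (lst x (lst y (c :: d))) (dualF ⊖_ (`14 ⊡′ X7 ⊞′ `15 ⊡′ Y7)) (`14 ⊡′ dualF ⊖_ X7 ⊞′ `15 ⊡′ dualF ⊖_ Y7) refl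

   dual² : ∀ x → dualK (dualK x) ≡ x
   dual² x@(_ ∷ _ ∷ _ ∷ _ ∷ _ ∷ _ :: _) = solveV (lst x []) (dualF ⊖_ (dualF ⊖_ X7)) X7 refl

   elK : K → Q7 → Q7
   elK t = El.el _+_ _*_ (λ e → - e) t

   el-lin : ∀ t c x d y → elK t (c *> x <+> d *> y) ≡ c *> elK t x <+> d *> elK t y
   el-lin t c x@(_ ∷ _ ∷ _ ∷ _ ∷ _ ∷ _ :: _) d y@(_ ∷ _ ∷ _ ∷ _ ∷ _ ∷ _ :: _) =
    solveV (lst x (lst y (c ∷ d :: t))) (EE.el (`16) (`14 ⊡′ X7 ⊞′ `15 ⊡′ Y7)) (`14 ⊡′ EE.el (`16) X7 ⊞′ `15 ⊡′ EE.el (`16) Y7) refl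

   el-⟂ : ∀ t {x y} → x ⟂ y → elK t x ⟂ elK t y
   el-⟂ t = pres (elK t) (El.el8 _+_ _*_ (λ e → - e) t) (λ { x@(_ ∷ _ ∷ _ ∷ _ ∷ _ ∷ _ :: _) y@(_ ∷ _ ∷ _ ∷ _ ∷ _ ∷ _ :: _) →
    solveV (lst x (lst y [ t ])) (Z.mul (EE.el (`14) X7) (Z.incl (EE.el (`14) Y7))) (EE.el8 (`14) (Z.mul X7 (Z.incl Y7))) refl }) (solveV [ t ] (EE.el8 (`0) 0E) 0E refl)

  rot dual : Aut
  rot = record { to = rotE ; from = rotE ∘ rotE ; to-lin = rot-lin ; from-lin = λ c x d y → trans (cong rotE (rot-lin c x d y)) (rot-lin c (rotE x) d (rotE y))
         ; to-from = rot³ ; from-to = rot³ ; to-⟂ = rot-⟂ ; from-⟂ = rot-⟂ ∘ rot-⟂ }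
  dual = record { to = dualK ; from = dualK ; to-lin = dual-lin ; from-lin = dual-lin ; to-from = dual² ; from-to = dual² ; to-⟂ = dual-⟂ ; from-⟂ = dual-⟂ }

  elation : Aut
  elation = record { to = elK 1F ; from = elK -1F ; to-lin = el-lin 1F ; from-lin = el-lin -1F
   ; to-from = λ { x@(_ ∷ _ ∷ _ ∷ _ ∷ _ ∷ _ :: _) → solveV (lst x []) (EE.el 1k (EE.el -1k X7)) X7 refl }
   ; from-to = λ { x@(_ ∷ _ ∷ _ ∷ _ ∷ _ ∷ _ :: _) → solveV (lst x []) (EE.el -1k (EE.el 1k X7)) X7 refl }
   ; to-⟂ = el-⟂ 1F ; from-⟂ = el-⟂ -1F }

  opaque
   om-linˡ : ∀ c x d y z → om (c *> x <+> d *> y) z ≡ c *> om x z <+> d *> om y z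
   om-linˡ c x@(_ ∷ _ ∷ _ ∷ _ ∷ _ ∷ _ :: _) d y@(_ ∷ _ ∷ _ ∷ _ ∷ _ ∷ _ :: _) z@(_ ∷ _ ∷ _ ∷ _ ∷ _ ∷ _ ∷ _ :: _) =
    solveV (lst x (lst y (lst z (c :: d)))) (Z.mul (`22 ⊡′ X7 ⊞′ `23 ⊡′ Y7) Z8) (`22 ⊡′ Z.mul X7 Z8 ⊞′ `23 ⊡′ Z.mul Y7 Z8) refl

 -- The plane of neighbours of a point, and products along paths

 module HexPlanes where
  open Lines
  open Octonions
  open Terms

  -- `thin` says that the plane is not totally collinear; this is what excludes triangles.
  record Plane (x : Q7) : Set where
   field
    y₁ y₂ : Q7
    ind : Ind (x ∷ y₁ :: y₂)
    p₁ : x ⟂ y₁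
    p₂ : x ⟂ y₂
    span : ∀ {z} → x ⟂ z → z ∈< x ∷ y₁ :: y₂ >
    thin : ¬ y₁ ⟂ y₂

  private
   planeAut : (G : Aut) → ∀ {x} → Plane (Aut.to G x) → Plane x
   planeAut G {x} P = record { y₁ = from y₁ ; y₂ = from y₂ ; ind = subst (λ z → Ind (z ∷ from y₁ :: from y₂)) (from-to x) (from-ind ind)
     ; p₁ = subst (_⟂ from y₁) (from-to x) (from-⟂ p₁) ; p₂ = subst (_⟂ from y₂) (from-to x) (from-⟂ p₂)
     ; span = λ {z} h → subst₂ (λ z y → z ∈< y ∷ from y₁ :: from y₂ >) (from-to z) (from-to x) (from-∈ (span (to-⟂ h)))
     ; thin = λ h → thin (subst₂ _⟂_ (to-from y₁) (to-from y₂) (to-⟂ h)) }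
    where
     open Aut G
     open AutLemmas G
     open Plane P

   planeScale : ∀ {x} k → k ≢ 0F → Plane (k *> x) → Plane x
   planeScale {x} k nz P = record { y₁ = y₁ ; y₂ = y₂
     ; ind = ind-gen ind ((k ∷ 0F :: 0F , vsolve [ k ] (x ∷ y₁ :: y₂) (`0 *v ^0 +v (0k *v ^1 +v (0k *v ^2 +v 0w))) (`0 *v ^0) refl) ∷ wk∈ hd∈ :: wk∈ (wk∈ hd∈))
     ; p₁ = down p₁ ; p₂ = down p₂ ; span = λ {z} h → span⊆ (∙∈ k hd∈ ∷ wk∈ hd∈ :: wk∈ (wk∈ hd∈)) (span (up h)) ; thin = thin }
    where
     open Plane P
     up : ∀ {z} → x ⟂ z → k *> x ⟂ z
     up h = ⟂-sym (⟂-span [ ⟂-sym h ] (∙∈ k hd∈))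
     down : ∀ {z} → k *> x ⟂ z → x ⟂ z
     down h = ⟂-sym (⟂-span [ ⟂-sym h ] (inv k nz ∷ [] , (vsolve (k :: inv k nz) [ x ] (`1 *v `0 *v ^0 +v 0w) (^0 +v (`0 *e `1 -e 1k) *v ^0) refl ⇐v (inv-r k nz s: x))))

   -- variables: u1 u2 e w1 w2; then u0 = 1 and w0 is determined by N x = 0
   XE Y1E Y2E : Vec Expr 7
   XE = 1k ∷ `0 ∷ `1 ∷ `2 ∷ `2 *e `2 -e (`0 *e `3 +e `1 *e `4) ∷ `3 :: `4
   Y1E = 0k ∷ `4 *e `4 ∷ ⊖ `2 -e `3 *e `4 ∷ ⊖ `4 ∷ ⊖ (`2 *e `4) -e `0 ∷ 1k :: 0k
   Y2E = 0k ∷ `2 -e `3 *e `4 ∷ `3 *e `3 ∷ `3 ∷ `2 *e `3 -e `1 ∷ 0k :: 1k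

   chart : ∀ u1 u2 e w1 w2 → Plane (ev (u1 ∷ u2 ∷ e ∷ w1 :: w2) XE)
   chart u1 u2 e w1 w2 = record { y₁ = ev ks Y1E ; y₂ = ev ks Y2E ; ind = ind
     ; p₁ = perp (solveV ks (Z.mul XE (Z.incl Y1E)) 0E refl) ; p₂ = perp (solveV ks (Z.mul XE (Z.incl Y2E)) 0E refl)
     ; span = span ; thin = λ h → 1≢0 (solve ks 1k (⊖ lookup (Z.mul Y1E (Z.incl Y2E)) (suc zero)) refl >> cong (λ z → - lookup z (suc zero)) (om≡0 h) >> -0#≈0#) }
    where
     ks : List K
     ks = u1 ∷ u2 ∷ e ∷ w1 :: w2
     ind : Ind (ev ks XE ∷ ev ks Y1E :: ev ks Y2E)
     ind (a ∷ b :: c) h = go (solve (a ∷ b :: c) (`0) (`0 *e 1k +e (`1 *e 0k +e (`2 *e 0k +e 0k))) refl >> cong Vec.head h) h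
      where
       go : a ≡ 0F → lin (a ∷ b :: c) (ev ks XE ∷ ev ks Y1E :: ev ks Y2E) ≡ 0v → a ∷ b :: c ≡ 0c
       go refl h = cong₂ (λ b c → 0F ∷ b :: c)
        (solve (b ∷ c :: w1) (`0) (0k *e `2 +e (`0 *e 1k +e (`1 *e 0k +e 0k))) refl >> cong (λ z → lookup z (suc (suc (suc (suc (suc zero)))))) h)
        (solve (b ∷ c :: w2) (`1) (0k *e `2 +e (`0 *e 0k +e (`1 *e 1k +e 0k))) refl >> cong (λ z → lookup z (suc (suc (suc (suc (suc (suc zero))))))) h)
     span : ∀ {z} → ev ks XE ⟂ z → z ∈< ev ks XE ∷ ev ks Y1E :: ev ks Y2E >
     -- The coordinates 0, 5 and 6 of `z` fix the three coefficients; the remaining four coordinates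
     -- are forced by the components 0, 1, 5 and 6 of the product.
     span {z@(a₀ ∷ a₁ ∷ a₂ ∷ g ∷ b₀ ∷ b₁ :: b₂)} (perp h) = a₀ ∷ b₁ - a₀ * w1 :: b₂ - a₀ * w2 ,
       v7 (solve zs (S zero) (`5) refl)
         (solve zs (S (# 1)) (`6 +e (1k *e (C (# 6) -e 0k) +e `4 *e (C (# 1) -e 0k))) refl ⇐ 1F *: eq (# 6) & w2 *: eq (# 1))
         (solve zs (S (# 2)) (`7 +e (-1k *e (C (# 5) -e 0k) +e (⊖ `3) *e (C (# 1) -e 0k))) refl ⇐ -1F *: eq (# 5) & (- w1) *: eq (# 1))
         (solve zs (S (# 3)) (`8 +e -1k *e (C (# 1) -e 0k)) refl ⇐ -1F *: eq (# 1))
         (solve zs (S (# 4)) (`9 +e (1k *e (C zero -e 0k) +e (⊖ `2) *e (C (# 1) -e 0k))) refl ⇐ 1F *: eq zero & (- e) *: eq (# 1))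
         (solve zs (S (# 5)) (`10) refl) (solve zs (S (# 6)) (`11) refl)
      where
       zs : List K
       zs = u1 ∷ u2 ∷ e ∷ w1 ∷ w2 ∷ lst z []
       ZE : Vec Expr 7
       ZE = `5 ∷ `6 ∷ `7 ∷ `8 ∷ `9 ∷ `10 :: `11
       C : Fin 8 → Expr
       C i = lookup (Z.mul XE (Z.incl ZE)) i
       S : Fin 7 → Expr
       S i = lookup (`5 ⊡′ XE ⊞′ ((`10 -e `5 *e `3) ⊡′ Y1E ⊞′ ((`11 -e `5 *e `4) ⊡′ Y2E ⊞′ 0E))) i
       eq : ∀ i → lookup (om (ev ks XE) (ι z)) i ≡ 0F
       eq i = cong (λ z → lookup z i) h >> Vecₚ.lookup-replicate i 0F
       v7 : ∀ {a b c d e f g a' b' c' d' e' f' g' : K} → a ≡ a' → b ≡ b' → c ≡ c' → d ≡ d' → e ≡ e' → f ≡ f' → g ≡ g' →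
          _≡_ {A = Q7} (a ∷ b ∷ c ∷ d ∷ e ∷ f :: g) (a' ∷ b' ∷ c' ∷ d' ∷ e' ∷ f' :: g')
       v7 refl refl refl refl refl refl refl = refl

   plane-head : ∀ {x} → x ⟂ x → x ≢ 0v → Vec.head x ≢ 0F → Plane x
   plane-head {x@(u0 ∷ u1 ∷ u2 ∷ e ∷ w0 ∷ w1 :: w2)} h nz n = planeScale k (inv≢0 u0 n)
     (subst Plane (cong₂ (λ a b → a ∷ k * u1 ∷ k * u2 ∷ k * e ∷ b ∷ k * w1 :: k * w2) (sym i) (sym w)) (chart (k * u1) (k * u2) (k * e) (k * w1) (k * w2)))
    where
     k : K
     k = inv u0 n
     i : k * u0 ≡ 1F
     i = *-comm k u0 >> inv-r u0 n
     w : k * w0 ≡ (k * e) * (k * e) - ((k * u1) * (k * w1) + (k * u2) * (k * w2))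
     w = solve (k ∷ lst x []) (`0 *e `5) ((`0 *e `4) *e (`0 *e `4) -e ((`0 *e `2) *e (`0 *e `6) +e (`0 *e `3) *e (`0 *e `7))
         +e ((`0 *e `0) *e (Z.norm (`1 ∷ `2 ∷ `3 ∷ `4 ∷ `5 ∷ `6 :: `7) -e 0k) +e (⊖ (`0 *e `5)) *e (`0 *e `1 -e 1k))) refl
       ⇐ (k * k) *: ⟂⇒N h nz & (- (k * w0)) *: i

  opaque
   -- Rotations and the duality bring any nonzero coordinate except `e` to the front, where `chart`
   -- applies. If only `e` can be nonzero, the norm is `- e * e`, so `x` vanishes.
   plane : ∀ {x} → x ≢ 0v → x ⟂ x → Plane x
   plane {x@(u0 ∷ u1 ∷ u2 ∷ e ∷ w0 ∷ w1 :: w2)} nz h with u0 ≟ 0F | u1 ≟ 0F | u2 ≟ 0F | w0 ≟ 0F | w1 ≟ 0F | w2 ≟ 0F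
   ... | no n | _ | _ | _ | _ | _ = plane-head h nz n
   ... | _ | no n | _ | _ | _ | _ = planeAut rot (plane-head (R h) (λ { refl → nz refl }) n)
    where
     R : x ⟂ x → Aut.to rot x ⟂ Aut.to rot x
     R = Aut.to-⟂ rot
   ... | _ | _ | no n | _ | _ | _ = planeAut rot (planeAut rot (plane-head (Aut.to-⟂ rot (Aut.to-⟂ rot h)) (λ { refl → nz refl }) n))
   ... | _ | _ | _ | no n | _ | _ = planeAut dual (plane-head (Aut.to-⟂ dual h) (λ p → n (cong Vec.head p)) n)
   ... | _ | _ | _ | _ | no n | _ = planeAut dual (planeAut rot (plane-head (Aut.to-⟂ rot (Aut.to-⟂ dual h)) (λ p → n (cong Vec.head p)) n))
   ... | _ | _ | _ | _ | _ | no n = planeAut dual (planeAut rot (planeAut rot (plane-head (Aut.to-⟂ rot (Aut.to-⟂ rot (Aut.to-⟂ dual h))) (λ p → n (cong Vec.head p)) n)))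
   ... | yes refl | yes refl | yes refl | yes refl | yes refl | yes refl = ⊥-elim (nz (cong (λ e → 0F ∷ 0F ∷ 0F ∷ e ∷ 0F ∷ 0F :: 0F) e0))
    where
     ee : e * e ≡ 0F
     ee = solve [ e ] (`0 *e `0) (⊖ Z.norm (0k ∷ 0k ∷ 0k ∷ `0 ∷ 0k ∷ 0k :: 0k)) refl >> (cong -_ (⟂⇒N h nz)) >> -0#≈0#
     e0 : e ≡ 0F
     e0 with e ≟ 0F
     ... | yes p = p
     ... | no n = ⊥-elim (*≢0 n n ee)

  opaque
   -- The three points would span the plane of `x`, so its generators would be collinear, against
   -- `thin`.
   notri : ∀ {x y z} → x ⟂ y → x ⟂ z → y ⟂ z → ¬ Ind (x ∷ y :: z)
   notri {x} {y} {z} xy xz yz i = thin (⟂-sym (⟂-span (go xx xy xz ∷ go (⟂-sym xy) yy yz :: go (⟂-sym xz) (⟂-sym yz) zz) (in′ (wk∈ hd∈))))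
    where
     znz : z ≢ 0v
     znz = ind-nonzero (ind-tail (ind-tail i))
     xx : x ⟂ x
     xx = ⟂-self xy (ind-nonzero (ind-tail i))
     yy : y ⟂ y
     yy = ⟂-self yz znz
     zz : z ⟂ z
     zz = ⟂-self (⟂-sym yz) (ind-nonzero (ind-tail i))
     open Plane (plane (ind-nonzero i) xx)
     in′ : ∀ {t} → t ∈< x ∷ y₁ :: y₂ > → t ∈< x ∷ y :: z >
     in′ = dimEq i (hd∈ ∷ span xy :: span xz)
     go : ∀ {t} → t ⟂ x → t ⟂ y → t ⟂ z → y₂ ⟂ t
     go a b c = ⟂-sym (⟂-span (a ∷ b :: c) (in′ (wk∈ (wk∈ hd∈))))

  opaque
   tri∈ : ∀ {x y s} → x ⟂ y → x ⟂ s → y ⟂ s → Ind (x :: y) → s ∈< x :: y >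
   tri∈ {x} {y} {s} xy xs ys i with ind? (s ∷ x :: y)
   ... | inj₁ d = head∈ i d
   ... | inj₂ j = ⊥-elim (notri (⟂-sym xs) (⟂-sym ys) xy j)

  private
   trace0 : ∀ {x y} → B x y ≡ 0F → ι (τ (om x (ι y))) ≡ om x (ι y)
   trace0 {x} {y} b = ιτ (om x (ι y)) (tr-om x y >> (cong -_ b) >> -0#≈0#)

   via : ∀ {x s z} → ι s ≡ z → om x z ≡ 0v → x ⟂ s
   via {x} e h = perp (cong (om x) e >> h)

   N0 : ∀ {x z} → N x ≡ 0F → om x (om x z) ≡ 0v
   N0 {x} {z} n = sq x z >> cong (λ k → (- k) *> z) n >> (vsolve [] [ z ] ((⊖ 0k) *v ^0) 0w refl)

  opaque
   -- The product of `x` and `b` has trace zero and is collinear with `x`, `y` and `b`; without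
   -- triangles it lies on both lines `x y` and `y b`, hence is a multiple of `y`. It is nonzero,
   -- again by `notri`.
   mid : ∀ {x y b} → x ⟂ y → b ⟂ y → Ind (x ∷ y :: b) → ∃ λ ρ → ρ ≢ 0F × om x (ι b) ≡ ρ *> ι y
   mid {x} {y} {b} xy by i = go (tri∈ xy xs (via s≡ (om-swap0 (⟂⇒B xy) (om≡0 (⟂-sym by)))) ixy) (tri∈ (⟂-sym by) (via s≡ (om-swap0 (⟂⇒B xy) (om≡0 (⟂-sym by)))) bs (ind-tail i))
    where
     ynz : y ≢ 0v
     ynz = ind-nonzero (ind-tail i)
     bxb : B x b ≡ 0F
     bxb = sym (-‿involutive (B x b)) >> (cong -_ (∙-0 (ι≢0 ynz) (sym (alt x b (ι y)) >> cong₂ (λ p r → om x p <+> om b r) (om≡0 by) (om≡0 xy) >> (cong₂ _<+>_ (om-0 x) (om-0 b)) >> (vsolve [] [] (0w +v 0w) 0w refl)))) >> -0#≈0#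
     s : Q7
     s = τ (om x (ι b))
     s≡ : ι s ≡ om x (ι b)
     s≡ = trace0 bxb
     xs : x ⟂ s
     xs = via s≡ (N0 (⟂⇒N xy ynz))
     bs : b ⟂ s
     bs = via s≡ (om-swap0 bxb (om≡0 (⟂-self by ynz)))
     ixy : Ind (x :: y)
     ixy = ind-tail (ind-gen i (wk∈ hd∈ ∷ wk∈ (wk∈ hd∈) :: hd∈))
     go : s ∈< x :: y > → s ∈< y :: b > → ∃ λ ρ → ρ ≢ 0F × om x (ι b) ≡ ρ *> ι y
     go (c :: ρ , e) (d :: d' , e') = ρ , (λ z → notri xy (perp (om≡ >> cong (_*> ι y) z >> (vsolve [] [ ι y ] (0k *v ^0) 0w refl))) (⟂-sym by) i) , om≡
      where
       c0 : c ≡ 0F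
       c0 = coef i (c ∷ ρ - d :: - d') (vsolve (c ∷ ρ ∷ d :: d') (x ∷ y ∷ b :: s) (`0 *v ^0 +v ((`1 -e `2) *v ^1 +v ((⊖ `3) *v ^2 +v 0w)))
         (0w +v (1k *v ((`0 *v ^0 +v (`1 *v ^1 +v 0w)) -v ^3) +v -1k *v ((`2 *v ^1 +v (`3 *v ^2 +v 0w)) -v ^3))) refl ⇐v (1F ∙: e) &v (-1F ∙: e')) zero
       om≡ : om x (ι b) ≡ ρ *> ι y
       om≡ = sym s≡ >> cong ι (sym e >> cong (λ c → lin (c :: ρ) (x :: y)) c0 >> vsolve [ ρ ] (x :: y) (0k *v ^0 +v (`0 *v ^1 +v 0w)) (0k *v ^0 +v `0 *v ^1) refl) >>
         ι-lin 0F x ρ y >> vsolve [ ρ ] (ι x :: ι y) (0k *v ^0 +v `0 *v ^1) (`0 *v ^1) refl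

  opaque
   -- Expanding the product by `mid` leaves a combination of `x` and `y` whose coefficients are
   -- nonzero multiples of `γ` and `δ`. So, within the solid, a third point of the line `x y` has
   -- neighbours only on that line.
   full3 : ∀ {x y a b} → Ind (x ∷ y ∷ a :: b) → x ⟂ y → x ⟂ a → y ⟂ b → ∀ {α β} γ δ → α ≢ 0F → β ≢ 0F → α *> x <+> β *> y ⟂ γ *> a <+> δ *> b → γ ≡ 0F × δ ≡ 0F
   full3 {x} {y} {a} {b} i xy xa yb {α} {β} γ δ αn βn (perp e) = go (mid xy (⟂-sym yb) ixyb) (mid (⟂-sym xy) (⟂-sym xa) iyxa)
    where
     ixyb : Ind (x ∷ y :: b)
     ixyb = ind-tail (ind-gen i (wk∈ hd∈ ∷ wk∈ (wk∈ hd∈) ∷ hd∈ :: wk∈ (wk∈ (wk∈ hd∈))))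
     iyxa : Ind (y ∷ x :: a)
     iyxa = ind-tail (ind-gen i (wk∈ (wk∈ hd∈) ∷ wk∈ hd∈ ∷ wk∈ (wk∈ (wk∈ hd∈)) :: hd∈))
     ixy : Ind (x :: y)
     ixy = ind-tail (ind-tail (ind-gen i (wk∈ (wk∈ hd∈) ∷ wk∈ (wk∈ (wk∈ hd∈)) ∷ hd∈ :: wk∈ hd∈)))
     go : (∃ λ ρ → ρ ≢ 0F × om x (ι b) ≡ ρ *> ι y) → (∃ λ σ → σ ≢ 0F × om y (ι a) ≡ σ *> ι x) → γ ≡ 0F × δ ≡ 0F
     go (ρ , ρn , er) (σ , σn , es) = pr (coef ixy (β * σ * γ :: α * ρ * δ) eq)
      where
       z : Q7
       z = α *> x <+> β *> y
       ze : (β * σ * γ) *> ι x <+> (α * ρ * δ) *> ι y ≡ 0v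
       ze = vsolve (α ∷ β ∷ γ ∷ δ ∷ ρ :: σ) (ι x :: ι y) ((`1 *e `5 *e `2) *v ^0 +v (`0 *e `4 *e `3) *v ^1)
           (`2 *v (`0 *v 0w +v `1 *v `5 *v ^0) +v `3 *v (`0 *v `4 *v ^1 +v `1 *v 0w)) refl >>
          cong₂ (λ p r → γ *> p <+> δ *> r) (cong₂ (λ p r → α *> p <+> β *> r) (sym (om≡0 xa)) (sym es) >> sym (om-linˡ α x β y (ι a)))
               (cong₂ (λ p r → α *> p <+> β *> r) (sym er) (sym (om≡0 yb)) >> sym (om-linˡ α x β y (ι b))) >>
           sym (om-linʳ z γ (ι a) δ (ι b)) >> cong (om z) (sym (ι-lin γ a δ b)) >> e
       eq : lin (β * σ * γ :: α * ρ * δ) (x :: y) ≡ 0v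
       eq = vsolve (β * σ * γ :: α * ρ * δ) (x :: y) (`0 *v ^0 +v (`1 *v ^1 +v 0w)) (`0 *v ^0 +v `1 *v ^1) refl >>
          sym (τι _) >> cong τ (ι-lin (β * σ * γ) x (α * ρ * δ) y >> ze)
       pr : (∀ j → lookup (β * σ * γ :: α * ρ * δ) j ≡ 0F) → γ ≡ 0F × δ ≡ 0F
       pr h = *-cancel-0 (β * σ) (*≢0 βn σn) (h zero) , *-cancel-0 (α * ρ) (*≢0 αn ρn) (h (suc zero))

  opaque
   -- If the product of `x` and `y₂` is not zero, it is collinear with `x` and with the whole line
   -- `y₁ y₂`, so it is a point of that line.
   transversal : ∀ {x y₁ y₂} → y₁ ⟂ y₂ → Ind (y₁ :: y₂) → N x ≡ 0F → B x y₁ ≡ 0F → B x y₂ ≡ 0F → ∃ λ y → y ≢ 0v × y ∈< y₁ :: y₂ > × x ⟂ y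
   transversal {x} {y₁} {y₂} yy i n b₁ b₂ with τ (om x (ι y₂)) ≟v 0v
   ... | yes z = y₂ , ind-nonzero (ind-tail i) , wk∈ hd∈ , perp (sym (trace0 b₂) >> cong ι z >> ι-0)
   ... | no nz = _ , nz , tri∈ yy (via (trace0 b₂) (om-swap0 b₁ (om≡0 yy))) (via (trace0 b₂) (om-swap0 b₂ (om≡0 (⟂-self (⟂-sym yy) (ind-nonzero i))))) i , via (trace0 b₂) (N0 n)

  record Dual (x₁ x₂ y₁ y₂ : Q7) : Set where
   field
    x⟂ : x₁ ⟂ x₂
    y⟂ : y₁ ⟂ y₂
    b11 : B x₁ y₁ ≡ 1F
    b22 : B x₂ y₂ ≡ 1F
    b12 : B x₁ y₂ ≡ 0F
    b21 : B x₂ y₁ ≡ 0F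
    ind : Ind (x₁ ∷ x₂ ∷ y₁ :: y₂)

  -- Otherwise the difference of the two products would be collinear with four independent points.
  opaque
   regulus : ∀ {x₁ x₂ y₁ y₂} → Dual x₁ x₂ y₁ y₂ → om x₁ (ι y₁) ≡ om y₂ (ι x₂)
   regulus {x₁} {x₂} {y₁} {y₂} D = go (s ≟v 0v)
    where
     open Dual D
     nz2 : x₂ ≢ 0v
     nz2 = ind-nonzero (ind-tail ind)
     nw1 : y₁ ≢ 0v
     nw1 = ind-nonzero (ind-tail (ind-tail ind))
     nx1 : N x₁ ≡ 0F
     nx1 = ⟂⇒N x⟂ nz2
     d : O
     d = 1F *> om x₁ (ι y₁) <+> -1F *> om y₂ (ι x₂)
     s : Q7
     s = τ d
     s≡ : ι s ≡ d
     s≡ = ιτ d (tr-lin 1F (om x₁ (ι y₁)) -1F (om y₂ (ι x₂)) >> cong₂ (λ p r → 1F * p + -1F * r) (tr-om x₁ y₁ >> (cong -_ b11)) (tr-om y₂ x₂ >> (cong -_ (B-sym y₂ x₂ >> b22))) >>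
      (solve [] (1k *e -1k +e -1k *e -1k) 0k refl))
     both : ∀ {x k z} → om x (om x₁ (ι y₁)) ≡ (- k) *> z → om x (om y₂ (ι x₂)) ≡ (- k) *> z → x ⟂ s
     both {x} {k} {z} p r = via s≡ (om-linʳ x 1F (om x₁ (ι y₁)) -1F (om y₂ (ι x₂)) >> cong₂ (λ p r → 1F *> p <+> -1F *> r) p r >> vsolve [ k ] [ z ] (1k *v (⊖ `0) *v ^0 +v -1k *v (⊖ `0) *v ^0) 0w refl)
     b12′ : B y₂ x₁ ≡ 0F
     b12′ = B-sym y₂ x₁ >> b12
     sw : ∀ {x y z} → B x y ≡ 1F → om y z ≡ 0v → om y (om x z) ≡ -1F *> z
     sw {z = z} b e = om-swap e >> cong (λ k → (- k) *> z) b
     -- a (b c) = b (c a) when B a b = B a c = 0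
     turn : ∀ {a b c} → B a b ≡ 0F → B a c ≡ 0F → om a (om b (ι c)) ≡ om b (om c (ι a))
     turn {a} {b} {c} h h' = om-neg (ι c) h >> cong (λ z → -1F *> om b z) (om-anti h') >> cong (-1F *>_) (om-∙ b -1F (om c (ι a))) >> (vsolve [] [ om b (om c (ι a)) ] (-1k *v -1k *v ^0) (^0) refl)
     p₁ : x₁ ⟂ s
     p₁ = both {k = N x₁} (sq x₁ (ι y₁)) ((om-swap0 b12′ (om≡0 x⟂) >> (vsolve [] [ ι y₁ ] 0w ((⊖ 0k) *v ^0) refl)) >> cong (λ k → (- k) *> ι y₁) (sym nx1))
     q2 : y₂ ⟂ s
     q2 = both {k = N y₂} ((om-swap0 b12 (om≡0 (⟂-sym y⟂)) >> (vsolve [] [ ι x₂ ] 0w ((⊖ 0k) *v ^0) refl)) >> cong (λ k → (- k) *> ι x₂) (sym (⟂⇒N (⟂-sym y⟂) nw1))) (sq y₂ (ι x₂))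
     p₂ : x₂ ⟂ s
     p₂ = both {k = 1F} (turn (⟂⇒B (⟂-sym x⟂)) b21 >> sw (B-sym y₁ x₁ >> b11) (om≡0 x⟂)) (sw (B-sym y₂ x₂ >> b22) (om≡0 (⟂-self (⟂-sym x⟂) (ind-nonzero ind))))
     q1 : y₁ ⟂ s
     q1 = both {k = 1F} (sw b11 (om≡0 (⟂-self y⟂ (ind-nonzero (ind-tail (ind-tail (ind-tail ind))))))) (turn (⟂⇒B y⟂) (B-sym y₁ x₂ >> b21) >> sw b22 (om≡0 (⟂-sym y⟂)))
     go : Dec (s ≡ 0v) → om x₁ (ι y₁) ≡ om y₂ (ι x₂)
     go (yes z) = vsolve [] (om x₁ (ι y₁) :: om y₂ (ι x₂)) (^0) (^1 +v (1k *v ^0 +v -1k *v ^1)) refl ⇐v trans (sym s≡) (cong ι z >> ι-0)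
     go (no nz) = ⊥-elim (ind-no ℕₚ.≤-refl _ ind (f p₁ ∷ f p₂ ∷ f q1 :: f q2))
      where
       module P = Plane (plane nz (⟂-self (⟂-sym p₁) (ind-nonzero ind)))
       f : ∀ {x} → x ⟂ s → x ∈< s ∷ P.y₁ :: P.y₂ >
       f h = P.span (⟂-sym h)

 -- Upper bounds and exact counts of lines

 module Counting where
  open Lines
  open FiniteField F using (complete)

  module _ {N : ℕ} where
   opaque
    count-list : ∀ {S : Ln {N} → Set} (l : List (Ln {N})) → All S l → AllPairs (λ a b → ¬ a ≈ℓ b) l → (∀ a → S a → Any (a ≈ℓ_) l) → LCount S (length l)
    count-list l a d c = Vec.fromList l , VAllₚ.fromList⁺ a , (λ i j ne e → dist d i j ne (same e)) , λ x s → ix (c x s)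
     where
      all-at : ∀ {P : Ln {N} → Set} {l} → All P l → ∀ i → P (lookup (Vec.fromList l) i)
      all-at (p ∷ _) zero = p
      all-at (_ ∷ a) (suc i) = all-at a i
      dist : ∀ {l : List (Ln {N})} → AllPairs (λ a b → ¬ a ≈ℓ b) l → ∀ i j → i ≢ j → ¬ lookup (Vec.fromList l) i ≈ℓ lookup (Vec.fromList l) j
      dist (h ∷ d) zero zero ne _ = ne refl
      dist (h ∷ d) zero (suc j) ne e = all-at h j e
      dist (h ∷ d) (suc i) zero ne e = all-at h i (≈-sym e)
      dist (h ∷ d) (suc i) (suc j) ne e = dist d i j (ne ∘ cong suc) e
      ix : ∀ {x : Ln {N}} {l} → Any (x ≈ℓ_) l → ∃ λ i → SameSub F x (lookup (Vec.fromList l) i)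
      ix (here e) = zero , sub e
      ix (there h) = let i , e = ix h in suc i , e

   -- A line is covered by a list of pairs when one of the pairs spans it.
   Covers : (Ln {N} → Set) → List (V {N} × V {N}) → Set
   Covers S l = ∀ ℓ → S ℓ → Any (λ p → Ind (fst p :: snd p) × fst p ∈< bas ℓ > × snd p ∈< bas ℓ >) l

   -- The list may contain dependent pairs, repetitions and lines outside `S`; this keeps upper
   -- bounds easy to assemble.
   AtMost : (Ln {N} → Set) → ℕ → Set
   AtMost S k = ∃ λ l → length l ℕ.≤ k × Covers S l

   opaque
    spans : ∀ {x y} (i : Ind (x :: y)) {ℓ : Ln {N}} → x ∈< bas ℓ > → y ∈< bas ℓ > → ℓ ≈ℓ ln x y i
    spans i {ℓ} x∈ y∈ = ≈-sym (same (sub-eq (ln _ _ i) ℓ (x∈ :: y∈)))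

   opaque
    -- Dropping dependent pairs, lines outside `S` and repetitions from the covering list leaves an
    -- exact enumeration.
    count : ∀ {S : Ln {N} → Set} {k} → (∀ ℓ → Dec (S ℓ)) → (∀ {ℓ m} → ℓ ≈ℓ m → S ℓ → S m) → AtMost S k → ∃ λ m → LCount S m × m ℕ.≤ k
    count {S} {k} S? resp (l , le , cov) = let l' , a , d , le' , c = go l in length l' , count-list l' a d (λ ℓ s → c s (cov ℓ s)) , ℕₚ.≤-trans le' le
     where
      Hit : Ln {N} → V {N} × V {N} → Set
      Hit ℓ p = Ind (fst p :: snd p) × fst p ∈< bas ℓ > × snd p ∈< bas ℓ >
      go : ∀ l → ∃ λ l' → All S l' × AllPairs (λ a b → ¬ a ≈ℓ b) l' × length l' ℕ.≤ length l × (∀ {ℓ} → S ℓ → Any (Hit ℓ) l → Any (ℓ ≈ℓ_) l')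
      go [] = [] , [] , [] , z≤n , λ _ ()
      go ((x , y) ∷ l) with go l | ind? (x :: y)
      ... | l' , a , d , le , c | inj₁ dep = l' , a , d , ℕₚ.m≤n⇒m≤1+n le , λ { s (here (i , _)) → ⊥-elim (ind-dep i dep) ; s (there h) → c s h }
      ... | l' , a , d , le , c | inj₂ i with S? (ln x y i) | Any.any? (≈? (ln x y i)) l'
      ... | no n | _ = l' , a , d , ℕₚ.m≤n⇒m≤1+n le , λ { s (here (_ , x∈ , y∈)) → ⊥-elim (n (resp (spans i x∈ y∈) s)) ; s (there h) → c s h }
      ... | yes _ | yes p = l' , a , d , ℕₚ.m≤n⇒m≤1+n le , λ { s (here (_ , x∈ , y∈)) → Any.map (≈-trans (spans i x∈ y∈)) p ; s (there h) → c s h }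
      ... | yes s | no n = ln x y i ∷ l' , s ∷ a , Allₚ.¬Any⇒All¬ l' n ∷ d , s≤s le , λ { s (here (_ , x∈ , y∈)) → here (spans i x∈ y∈) ; s (there h) → there (c s h) }

   opaque
    am-⊆ : ∀ {S T : Ln {N} → Set} {k k'} → (∀ ℓ → T ℓ → S ℓ) → k ℕ.≤ k' → AtMost S k → AtMost T k'
    am-⊆ f le (l , le' , c) = l , ℕₚ.≤-trans le' le , λ ℓ t → c ℓ (f ℓ t)

    am-∪ : ∀ {S T : Ln {N} → Set} {k k'} → AtMost S k → AtMost T k' → AtMost (λ ℓ → S ℓ ⊎ T ℓ) (k ℕ.+ k')
    am-∪ (l , le , c) (l' , le' , c') = l List.++ l' , ℕₚ.≤-trans (ℕₚ.≤-reflexive (Listₚ.length-++ l)) (ℕₚ.+-mono-≤ le le') ,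
     λ { ℓ (inj₁ s) → Anyₚ.++⁺ˡ (c ℓ s) ; ℓ (inj₂ s) → Anyₚ.++⁺ʳ l (c' ℓ s) }

    am-Σ : ∀ {I : Set} (S : I → Ln {N} → Set) {k} (is : List I) → (∀ {i} → i ∈ is → AtMost (S i) k) → AtMost (λ ℓ → ∃ λ i → i ∈ is × S i ℓ) (length is ℕ.* k)
    am-Σ S [] f = [] , z≤n , λ { ℓ (_ , () , _) }
    am-Σ S (i ∷ is) f = am-⊆ (λ { ℓ (_ , here refl , s) → inj₁ s ; ℓ (j , there m , s) → inj₂ (j , m , s) }) ℕₚ.≤-refl (am-∪ (f (here refl)) (am-Σ S is (f ∘ there)))

    am-0 : ∀ {S : Ln {N} → Set} → (∀ ℓ → ¬ S ℓ) → AtMost S 0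
    am-0 n = [] , z≤n , λ ℓ s → ⊥-elim (n ℓ s)

    am-1 : ∀ {S : Ln {N} → Set} x y → (∀ ℓ → S ℓ → Ind (x :: y) × x ∈< bas ℓ > × y ∈< bas ℓ >) → AtMost S 1
    am-1 x y h = (x , y) ∷ [] , s≤s z≤n , λ ℓ s → here (h ℓ s)

 -- Points and planes of H(q): pencils of lines

 module HexLines where
  open Lines
  open Octonions
  open HexPlanes
  open Counting
  open FiniteField F using (complete; unique)

  HL : Ln {7} → Set
  HL (subspace (x :: y) _) = x ⟂ y

  opaque
   HL? : ∀ ℓ → Dec (HL ℓ)
   HL? (subspace (x :: y) _) = ⟂? x y

  opaque
   on : ∀ {ℓ} → HL ℓ → ∀ {u w} → u ∈< bas ℓ > → w ∈< bas ℓ > → u ⟂ w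
   on {subspace (x :: y) i} h {u} {w} u∈ w∈ = ⟂-sym (⟂-span (a (⟂-self h (ind-nonzero (ind-tail i))) h :: a (⟂-sym h) (⟂-self (⟂-sym h) (ind-nonzero i))) u∈)
    where
     a : ∀ {z} → z ⟂ x → z ⟂ y → w ⟂ z
     a p r = ⟂-sym (⟂-span (p :: r) w∈)

  opaque
   ind1 : ∀ {N} {x : V {N}} → x ≢ 0v → Ind [ x ]
   ind1 {x = x} nz [ c ] e = cong (_∷ []) (∙-0 nz (vsolve [ c ] [ x ] (`0 *v ^0) (`0 *v ^0 +v 0w) refl >> e))

  opaque
   swap2 : ∀ {N} {x y : V {N}} → Ind (x :: y) → Ind (y :: x)
   swap2 i = ind-gen i (wk∈ hd∈ :: hd∈)

  opaque
   partner : ∀ {N} (ℓ : Ln {N}) {x} → x ≢ 0v → ∃ λ y → Ind (x :: y) × y ∈< bas ℓ >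
   partner (subspace (a :: b) i) {x} nz with ∈? a [ x ] | ∈? b [ x ]
   ... | no n | _ = a , swap2 (ext (ind1 nz) n) , hd∈
   ... | yes _ | no n = b , swap2 (ext (ind1 nz) n) , wk∈ hd∈
   ... | yes p | yes r = ⊥-elim (ind-no ℕₚ.≤-refl [ x ] i (p :: r))

  -- The lines through `x` in the plane of `x`, `a` and `b` other than `x b`, with the slope as
  -- parameter.
  module Fan {N : ℕ} {x a b : V {N}} (i : Ind (x ∷ a :: b)) where
   opaque
    fan-ind : ∀ t → Ind (x :: a <+> t *> b)
    fan-ind t = swap2 (ext (ind1 (ind-nonzero i)) λ { (k ∷ [] , e) → 1≢0 (sym (-‿involutive 1F) >> (cong -_ (coef i (k ∷ - 1F :: - t)
     (vsolve (k :: t) (x ∷ a :: b) (`0 *v ^0 +v (-1k *v ^1 +v ((⊖ `1) *v ^2 +v 0w))) (0w +v 1k *v ((`0 *v ^0 +v 0w) -v (^1 +v `1 *v ^2))) refl ⇐v 1F ∙: e) (suc zero))) >> -0#≈0#) })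

   fan : K → Ln
   fan t = ln x (a <+> t *> b) (fan-ind t)

   opaque
    fan-eq : ∀ t {s r} → s *> a <+> r *> b ∈< bas (fan t) > → r ≡ s * t
    fan-eq t {s} {r} (k :: l , e) = solve (s ∷ r ∷ t :: l) (`1) (`0 *e `2 +e (`2 *e ((`3 -e `0) -e 0k) +e -1k *e ((`3 *e `2 -e `1) -e 0k))) refl
      ⇐ t *: h (suc zero) & -1F *: h (suc (suc zero))
     where
      h : ∀ j → lookup (k ∷ l - s :: l * t - r) j ≡ 0F
      h = coef i (k ∷ l - s :: l * t - r) (vsolve (k ∷ l ∷ s ∷ t :: r) (x ∷ a :: b) (`0 *v ^0 +v ((`1 -e `2) *v ^1 +v ((`1 *e `3 -e `4) *v ^2 +v 0w)))
       (0w +v 1k *v ((`0 *v ^0 +v (`1 *v (^1 +v `3 *v ^2) +v 0w)) -v (`2 *v ^1 +v `4 *v ^2))) refl ⇐v 1F ∙: e)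

    fan-dist : ∀ {t t'} → t ≢ t' → ¬ fan t ≈ℓ fan t'
    fan-dist {t} {t'} ne (same (p , _)) = ne (fan-eq t' (subst (_∈< bas (fan t') >) (vsolve [ t ] (a :: b) (^0 +v `0 *v ^1) (1k *v ^0 +v `0 *v ^1) refl) (p _ (wk∈ hd∈))) >> *-identityˡ t')

    fan-off : ∀ t → ¬ b ∈< bas (fan t) >
    fan-off t h = 1≢0 (fan-eq t {0F} {1F} (subst (_∈< bas (fan t) >) (vsolve [] (a :: b) (^1) (0k *v ^0 +v 1k *v ^1) refl) h) >> zeroˡ t)

    fan-cov : ∀ {z} → z ∈< x ∷ a :: b > → z ∈< x :: b > ⊎ ∃ λ t → a <+> t *> b ∈< x :: z >
    fan-cov {z} (α ∷ β :: γ , e) with β ≟ 0F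
    ... | yes refl = inj₁ (α :: γ , trans (vsolve (α :: γ) (x ∷ a :: b) (`0 *v ^0 +v (`1 *v ^2 +v 0w)) (`0 *v ^0 +v (0k *v ^1 +v (`1 *v ^2 +v 0w))) refl) e)
    ... | no n = inj₂ (inv β n * γ , - (inv β n * α) :: inv β n , (vsolve (α ∷ β ∷ γ :: inv β n) (x ∷ a ∷ b :: z) ((⊖ (`3 *e `0)) *v ^0 +v (`3 *v ^3 +v 0w))
      ((^1 +v (`3 *e `2) *v ^2) +v ((⊖ `3) *v ((`0 *v ^0 +v (`1 *v ^1 +v (`2 *v ^2 +v 0w))) -v ^3) +v (`1 *e `3 -e 1k) *v ^1)) refl ⇐v ((- inv β n) ∙: e) &v (inv-r β n s: a)))

   fans : List Ln
   fans = List.map fan elements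

   opaque
    fans-dist : AllPairs (λ l m → ¬ l ≈ℓ m) fans
    fans-dist = APₚ.map⁺ (AP.map fan-dist unique)

    fans-all : ∀ {S : Ln {N} → Set} → (∀ t → S (fan t)) → All S fans
    fans-all h = Allₚ.map⁺ (All.universal h elements)

    fans-any : ∀ {ℓ} → x ∈< bas ℓ > → ∀ {z} → z ∈< bas ℓ > → (∃ λ t → a <+> t *> b ∈< x :: z >) → Any (ℓ ≈ℓ_) fans
    fans-any {ℓ} x∈ z∈ (t , h) = Anyₚ.map⁺ (Any.map (λ { refl → spans (fan-ind t) x∈ (span⊆ (x∈ :: z∈) h) }) (complete t))

  Th : Q7 → Ln → Set
  Th x ℓ = HL ℓ × x ∈< bas ℓ >

  opaque
   -- Every line of H(q) through `x` lies in the plane of its neighbours, whose lines through `x`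
   -- are the fan and the line `x y₂`.
   pencil : ∀ {x} → x ≢ 0v → x ⟂ x → LCount (Th x) (suc q)
   pencil {x} nz xx = subst (LCount (Th x)) (cong suc (Listₚ.length-map fan elements)) (count-list (ln x y₂ ib ∷ fans)
     ((p₂ , hd∈) ∷ fans-all (λ t → ⟂-span (p₁ :: p₂) (a+tb t) , hd∈)) (fans-all (λ { t (same (h , _)) → fan-off t (h _ (wk∈ hd∈)) }) ∷ fans-dist) cov)
    where
     open Plane (plane nz xx)
     open Fan ind
     ib : Ind (x :: y₂)
     ib = ind-tail (ind-gen ind (wk∈ hd∈ ∷ hd∈ :: wk∈ (wk∈ hd∈)))
     a+tb : ∀ t → y₁ <+> t *> y₂ ∈< y₁ :: y₂ >
     a+tb t = +∈ hd∈ (∙∈ t (wk∈ hd∈))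
     cov : ∀ ℓ → Th x ℓ → Any (ℓ ≈ℓ_) (ln x y₂ ib ∷ fans)
     cov ℓ (h , x∈) with partner ℓ nz
     ... | z , i , z∈ with fan-cov (span (on {ℓ} h x∈ z∈))
     ... | inj₁ m = here (spans ib x∈ (span⊆ (x∈ :: z∈) (dimEq i (hd∈ :: m) (wk∈ hd∈))))
     ... | inj₂ p = there (fans-any x∈ z∈ p)

  opaque
   Pt7 : ∀ x → x ≢ 0v → LCount (Th x) 0 ⊎ LCount (Th x) (suc q)
   Pt7 x nz with ⟂? x x
   ... | yes h = inj₂ (pencil nz h)
   ... | no n = inj₁ ([] , [] , (λ ()) , λ ℓ (h , x∈) → ⊥-elim (n (on {ℓ} h x∈ x∈)))

  -- A predicate with a bound on the dimension replaces a basis, because the preimage of a subspace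
  -- under the embedding may have smaller dimension than the subspace.
  record Sub (k : ℕ) : Set1 where
   field
    P : Q7 → Set
    P? : ∀ x → Dec (P x)
    P0 : P 0v
    P+ : ∀ {x y} → P x → P y → ∀ c d → P (c *> x <+> d *> y)
    Pdep : (A : Vec Q7 (suc k)) → VAll P A → Dep A

   opaque
    Pspan : ∀ {j} {A : Vec Q7 j} → VAll P A → ∀ {y} → y ∈< A > → P y
    Pspan [] ([] , refl) = P0
    Pspan {A = a ∷ A} (h ∷ hs) (c ∷ cs , refl) = subst P (vsolve [ c ] (a :: lin cs A) (`0 *v ^0 +v 1k *v ^1) (`0 *v ^0 +v ^1) refl) (P+ h (Pspan hs (cs , refl)) c 1F)

    P∈ : ∀ {A : Vec Q7 k} → Ind A → VAll P A → ∀ {y} → P y → y ∈< A >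
    P∈ {A} i h {y} p = head∈ i (Pdep (y ∷ A) (p ∷ h))

  Inside : (Q7 → Set) → Ln → Set
  Inside P ℓ = HL ℓ × VAll P (bas ℓ)

  opaque
   find : ∀ {S : Ln {7} → Set} {m} {Q : Ln → Set} → LCount S m → (∀ ℓ → Dec (Q ℓ)) → (∀ {ℓ m} → ℓ ≈ℓ m → Q m → Q ℓ) → (∃ λ ℓ → S ℓ × ¬ Q ℓ) ⊎ (∀ ℓ → S ℓ → Q ℓ)
   find (xs , a , _ , c) Q? resp with Finₚ.any? (λ i → ¬? (Q? (lookup xs i)))
   ... | yes (i , n) = inj₁ (lookup xs i , VAllₚ.lookup⁺ a i , n)
   ... | no n = inj₂ (λ ℓ s → let i , e = c ℓ s in resp (same e) (decidable-stable (Q? (lookup xs i)) (λ m → n (i , m))))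

  opaque
   card-≐ : ∀ {S T : Ln {7} → Set} {m} → (∀ ℓ → S ℓ → T ℓ) → (∀ ℓ → T ℓ → S ℓ) → LCount S m → LCount T m
   card-≐ f g (xs , a , d , c) = xs , VAll.map (f _) a , d , λ ℓ t → c ℓ (g ℓ t)

  -- Generators of the plane of `x` adapted to two lines through `x`: a subspace containing both
  -- lines contains this plane.
  record Star (x : Q7) (ℓ m : Ln {7}) : Set where
   field
    p r : Q7
    ind : Ind (x ∷ p :: r)
    p∈ : p ∈< bas ℓ >
    r∈ : r ∈< bas m >
    x⟂p : x ⟂ p
    x⟂r : x ⟂ r
    span : ∀ {z} → x ⟂ z → z ∈< x ∷ p :: r >
    span⁻ : ∀ {z} → z ∈< x ∷ p :: r > → x ⟂ z

  opaque
   star : ∀ {x ℓ m} → HL ℓ → HL m → ¬ ℓ ≈ℓ m → x ≢ 0v → x ∈< bas ℓ > → x ∈< bas m > → Star x ℓ m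
   star {x} {ℓ} {m} hℓ hm ne nz xℓ xm = go (partner ℓ nz) (partner m nz)
    where
     go : (∃ λ y → Ind (x :: y) × y ∈< bas ℓ >) → (∃ λ y → Ind (x :: y) × y ∈< bas m >) → Star x ℓ m
     go (p , ip , p∈) (r , ir , r∈) = record { p = p ; r = r ; ind = i ; p∈ = p∈ ; r∈ = r∈ ; x⟂p = xp ; x⟂r = xr
       ; span = λ h → dimEq i (hd∈ ∷ Pl.span xp :: Pl.span xr) (Pl.span h) ; span⁻ = ⟂-span (on {ℓ} hℓ xℓ xℓ ∷ xp :: xr) }
      where
       xp : x ⟂ p
       xp = on {ℓ} hℓ xℓ p∈
       xr : x ⟂ r
       xr = on {m} hm xm r∈
       module Pl = Plane (plane nz (on {ℓ} hℓ xℓ xℓ))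
       i : Ind (x ∷ p :: r)
       i = ind-gen (ext ip (λ h → ne (≈-trans (spans ir xℓ (span⊆ (xℓ :: p∈) h)) (≈-sym (spans ir xm r∈))))) (wk∈ (wk∈ hd∈) ∷ hd∈ :: wk∈ hd∈)

  module Solids {k : ℕ} (total : AtMost HL k) where
   opaque
    -- A cover of all lines also covers those inside a decidable subspace, so `count` makes their
    -- number exact.
    inside-count : ∀ {j} (U : Sub j) → ∃ λ m → LCount (Inside (Sub.P U)) m
    inside-count U = let m , c , _ = count (λ ℓ → HL? ℓ ×-dec VAll.all? (Sub.P? U) (bas ℓ)) transfer (am-⊆ (λ _ → fst) ℕₚ.≤-refl total) in m , c
     where
      transfer : ∀ {ℓ m} → ℓ ≈ℓ m → Inside (Sub.P U) ℓ → Inside (Sub.P U) m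
      transfer {subspace (a :: b) i} {subspace (c :: d) j} (same (_ , g)) (h , p) = on {ln a b i} h (g _ hd∈) (g _ (wk∈ hd∈)) , Sub.Pspan U p (g _ hd∈) :: Sub.Pspan U p (g _ (wk∈ hd∈))

    -- Two lines in a plane share a point `x`, and the plane is then that of the neighbours of `x`.
    -- Any line in it passes through `x`, since otherwise there would be a triangle.
    Pl7 : (U : Sub 3) → let S = Inside (Sub.P U) in LCount S 0 ⊎ LCount S 1 ⊎ LCount S (suc q)
    Pl7 U with inside-count U
    ... | 0 , c = inj₁ c
    ... | 1 , c = inj₂ (inj₁ c)
    ... | suc (suc _) , (ℓ@(subspace (a :: b) i) ∷ m@(subspace (c :: d) j) ∷ _ , (hℓ , pa :: pb) ∷ (hm , pc :: pd) ∷ _ , dis , _)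
       with common i j (Sub.Pdep U (a ∷ b ∷ c :: d) (pa ∷ pb ∷ pc :: pd))
    ... | x , nz , xℓ , xm = inj₂ (inj₂ (card-≐ f g (pencil nz (on {ℓ} hℓ xℓ xℓ))))
     where
      open Sub U
      open Star (star {x} {ℓ} {m} hℓ hm (λ e → dis zero (suc zero) (λ ()) (sub e)) nz xℓ xm)
      P3 : VAll P (x ∷ p :: r)
      P3 = Pspan (pa :: pb) xℓ ∷ Pspan (pa :: pb) p∈ :: Pspan (pc :: pd) r∈
      f : ∀ ℓ → Th x ℓ → Inside P ℓ
      f ℓ (h , x∈) = h , VAll.map (λ m → Pspan P3 (span (on {ℓ} h x∈ m))) (gens∈ (bas ℓ))
      g : ∀ ℓ → Inside P ℓ → Th x ℓ
      g (subspace (a :: b) i) (h , pa :: pb) = h , tri∈ h (⟂-sym (span⁻ (P∈ ind P3 pa))) (⟂-sym (span⁻ (P∈ ind P3 pb))) i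

 -- Two disjoint lines: a transversal or a regulus

 module HexSolids where
  open Lines
  open Octonions
  open HexPlanes
  open Counting
  open HexLines
  open FiniteField F using (complete; unique)

  opaque
   -- The matrix of `B` between the lines decides. A kernel vector is a point of the second line
   -- orthogonal to the whole first line, hence collinear with one of its points by `transversal`;
   -- an invertible matrix provides dual bases.
   pairing : ∀ {x₁ x₂ y₁ y₂} → x₁ ⟂ x₂ → y₁ ⟂ y₂ → Ind (x₁ ∷ x₂ ∷ y₁ :: y₂) →
        (∃₂ λ x y → x ≢ 0v × y ≢ 0v × x ∈< x₁ :: x₂ > × y ∈< y₁ :: y₂ > × x ⟂ y)
        ⊎ ∃₂ λ z1 z2 → z1 ∈< y₁ :: y₂ > × z2 ∈< y₁ :: y₂ > × Dual x₁ x₂ z1 z2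
   pairing {x₁} {x₂} {y₁} {y₂} xx yy i = go (ind? cols)
    where
     ix : Ind (x₁ :: x₂)
     ix = ind-tail (ind-tail (ind-gen i (wk∈ (wk∈ hd∈) ∷ wk∈ (wk∈ (wk∈ hd∈)) ∷ hd∈ :: wk∈ hd∈)))
     iy : Ind (y₁ :: y₂)
     iy = ind-tail (ind-tail i)
     cols : Vec (V {2}) 2
     cols = (B x₁ y₁ :: B x₂ y₁) :: (B x₁ y₂ :: B x₂ y₂)
     comb : V {2} → Q7
     comb (c :: d) = c *> y₁ <+> d *> y₂
     comb∈ : ∀ c → comb c ∈< y₁ :: y₂ >
     comb∈ (c :: d) = +∈ (∙∈ c hd∈) (∙∈ d (wk∈ hd∈))
     val : ∀ c {a b} → lin c cols ≡ a :: b → B x₁ (comb c) ≡ a × B x₂ (comb c) ≡ b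
     val (c :: d) refl = t x₁ , t x₂
      where
       t : ∀ x → B x (c *> y₁ <+> d *> y₂) ≡ c * B x y₁ + (d * B x y₂ + 0F)
       t x = B-lin x c y₁ d y₂ >> solve (c * B x y₁ :: d * B x y₂) (`0 +e `1) (`0 +e (`1 +e 0k)) refl
     c⟂ : ∀ c c' → comb c ⟂ comb c'
     c⟂ c c' = on {ln y₁ y₂ iy} yy (comb∈ c) (comb∈ c')
     Res : Set
     Res = (∃₂ λ x y → x ≢ 0v × y ≢ 0v × x ∈< x₁ :: x₂ > × y ∈< y₁ :: y₂ > × x ⟂ y) ⊎ ∃₂ λ z1 z2 → z1 ∈< y₁ :: y₂ > × z2 ∈< y₁ :: y₂ > × Dual x₁ x₂ z1 z2
     go : Dep cols ⊎ Ind cols → Res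
     go (inj₁ (c , ne , e)) with val c e
     ... | e1 , e2 = let x , nz , x∈ , h = transversal {comb c} {x₁} {x₂} xx ix (⟂⇒N (c⟂ c c) cnz) (B-sym (comb c) x₁ >> e1) (B-sym (comb c) x₂ >> e2)
             in inj₁ (x , comb c , nz , cnz , x∈ , comb∈ c , ⟂-sym h)
      where
       cnz : comb c ≢ 0v
       cnz z = ne (z0 c z)
        where
         z0 : ∀ c → comb c ≡ 0v → c ≡ 0c
         z0 (c :: d) z = iy (c :: d) (vsolve (c :: d) (y₁ :: y₂) (`0 *v ^0 +v (`1 *v ^1 +v 0w)) (`0 *v ^0 +v `1 *v ^1) refl >> z)
     go (inj₂ j) = inj₂ (comb (fst s1) , comb (fst s2) , comb∈ (fst s1) , comb∈ (fst s2) , D)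
      where
       s1 : (1F :: 0F) ∈< cols >
       s1 = basis∈ j _
       s2 : (0F :: 1F) ∈< cols >
       s2 = basis∈ j _
       z1 z2 : Q7
       z1 = comb (fst s1)
       z2 = comb (fst s2)
       v1 : B x₁ z1 ≡ 1F × B x₂ z1 ≡ 0F
       v1 = val (fst s1) (snd s1)
       v2 : B x₁ z2 ≡ 0F × B x₂ z2 ≡ 1F
       v2 = val (fst s2) (snd s2)
       D : Dual x₁ x₂ z1 z2
       D = record { x⟂ = xx ; y⟂ = c⟂ (fst s1) (fst s2) ; b11 = fst v1 ; b22 = snd v2 ; b12 = fst v2 ; b21 = snd v1 ; ind = λ { (a ∷ b ∷ c :: d) e → four a b c d e } }
        where
         ex : ∀ x → x ⟂ x₁ → x ⟂ x₂ → ∀ a b c d → lin (a ∷ b ∷ c :: d) (x₁ ∷ x₂ ∷ z1 :: z2) ≡ 0v → c * B x z1 + d * B x z2 ≡ 0F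
         ex x h1 h2 a b c d e = sym (B-lin x c z1 d z2) >> cong (B x) (vsolve (a ∷ b ∷ c :: d) (x₁ ∷ x₂ ∷ z1 :: z2) (`2 *v ^2 +v `3 *v ^3)
           ((⊖ `0) *v ^0 +v (⊖ `1) *v ^1 +v 1k *v ((`0 *v ^0 +v (`1 *v ^1 +v (`2 *v ^2 +v (`3 *v ^3 +v 0w)))) -v 0w)) refl ⇐v 1F ∙: e) >>
          ⟂⇒B (⟂-lin h1 h2 (- a) (- b))
         four : ∀ a b c d → lin (a ∷ b ∷ c :: d) (x₁ ∷ x₂ ∷ z1 :: z2) ≡ 0v → a ∷ b ∷ c :: d ≡ 0c
         four a b c d e = fin c0 d0 e
          where
           c0 : c ≡ 0F
           c0 = solve (c :: d) (`0) (`0 *e 1k +e `1 *e 0k) refl >> cong₂ (λ p r → c * p + d * r) (sym (fst v1)) (sym (fst v2)) >> ex x₁ (⟂-self xx (ind-nonzero (ind-tail ix))) xx a b c d e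
           d0 : d ≡ 0F
           d0 = solve (c :: d) (`1) (`0 *e 0k +e `1 *e 1k) refl >> cong₂ (λ p r → c * p + d * r) (sym (snd v1)) (sym (snd v2)) >> ex x₂ (⟂-sym xx) (⟂-self (⟂-sym xx) (ind-nonzero ix)) a b c d e
           fin : c ≡ 0F → d ≡ 0F → lin (a ∷ b ∷ c :: d) (x₁ ∷ x₂ ∷ z1 :: z2) ≡ 0v → a ∷ b ∷ c :: d ≡ 0c
           fin refl refl e = cong (λ z → Vec.head z ∷ Vec.head (Vec.tail z) ∷ 0F :: 0F) (ix (a :: b) (vsolve (a :: b) (x₁ ∷ x₂ ∷ z1 :: z2) (`0 *v ^0 +v (`1 *v ^1 +v 0w)) (`0 *v ^0 +v (`1 *v ^1 +v (0k *v ^2 +v (0k *v ^3 +v 0w)))) refl >> e))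

  module Regulus {x₁ x₂ y₁ y₂ : Q7} (D : Dual x₁ x₂ y₁ y₂) where
   open Dual D
   opaque
    ix : Ind (x₁ :: x₂)
    ix = ind-tail (ind-tail (ind-gen ind (wk∈ (wk∈ hd∈) ∷ wk∈ (wk∈ (wk∈ hd∈)) ∷ hd∈ :: wk∈ hd∈)))

    on-y : ∀ s {a b c d} → a *> x₁ <+> (b *> x₂ <+> (c *> y₁ <+> d *> y₂)) ∈< y₂ <+> s *> x₁ :: y₁ <+> (- s) *> x₂ > → a ≡ d * s × b ≡ - (c * s)
    on-y s {a} {b} {c} {d} (k :: l , e) = (solve (a ∷ d ∷ s :: k) (`0) (`1 *e `2 +e (-1k *e ((`3 *e `2 -e `0) -e 0k) +e `2 *e ((`3 -e `1) -e 0k))) refl ⇐ -1F *: h zero & s *: h (suc (suc (suc zero)))) ,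
      (solve (b ∷ c ∷ s :: l) (`0) (⊖ (`1 *e `2) +e (-1k *e ((⊖ (`3 *e `2) -e `0) -e 0k) +e (⊖ `2) *e ((`3 -e `1) -e 0k))) refl ⇐ -1F *: h (suc zero) & (- s) *: h (suc (suc zero)))
     where
      h : ∀ j → lookup (k * s - a ∷ - (l * s) - b ∷ l - c :: k - d) j ≡ 0F
      h = coef ind (k * s - a ∷ - (l * s) - b ∷ l - c :: k - d) (vsolve (a ∷ b ∷ c ∷ d ∷ k ∷ l :: s) (x₁ ∷ x₂ ∷ y₁ :: y₂)
       ((`4 *e `6 -e `0) *v ^0 +v ((⊖ (`5 *e `6) -e `1) *v ^1 +v ((`5 -e `2) *v ^2 +v ((`4 -e `3) *v ^3 +v 0w))))
       (0w +v 1k *v ((`4 *v (^3 +v `6 *v ^0) +v (`5 *v (^2 +v (⊖ `6) *v ^1) +v 0w)) -v (`0 *v ^0 +v (`1 *v ^1 +v (`2 *v ^2 +v `3 *v ^3))))) refl ⇐v 1F ∙: e)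

    ri : ∀ s → Ind (y₂ <+> s *> x₁ :: y₁ <+> (- s) *> x₂)
    ri s (k :: l) e = cong₂ (λ k l → k :: l) (h (suc (suc (suc zero)))) (h (suc (suc zero)))
     where
      h : ∀ j → lookup (k * s ∷ - (l * s) ∷ l :: k) j ≡ 0F
      h = coef ind (k * s ∷ - (l * s) ∷ l :: k) (vsolve (k ∷ l :: s) (x₁ ∷ x₂ ∷ y₁ :: y₂)
       ((`0 *e `2) *v ^0 +v ((⊖ (`1 *e `2)) *v ^1 +v (`1 *v ^2 +v (`0 *v ^3 +v 0w))))
       (0w +v 1k *v ((`0 *v (^3 +v `2 *v ^0) +v (`1 *v (^2 +v (⊖ `2) *v ^1) +v 0w)) -v 0w)) refl ⇐v 1F ∙: e)

   rl : K → Ln {7}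
   rl s = ln (y₂ <+> s *> x₁) (y₁ <+> (- s) *> x₂) (ri s)

   opaque
    -- The product expands to `s` times the difference of the two products that `regulus`
    -- identifies.
    rl-HL : ∀ s → HL (rl s)
    rl-HL s = perp (cong₂ (λ p r → om p (ι r)) (vsolve [ s ] (x₁ :: y₂) (^1 +v `0 *v ^0) (1k *v ^1 +v `0 *v ^0) refl) (vsolve [ s ] (x₂ :: y₁) (^1 +v (⊖ `0) *v ^0) (1k *v ^1 +v (⊖ `0) *v ^0) refl) >>
      om-linˡ 1F y₂ s x₁ (ι r) >> cong₂ (λ p r → 1F *> p <+> s *> r) (e y₂) (e x₁) >> cong₂ (λ p r → 1F *> (1F *> p <+> (- s) *> om y₂ (ι x₂)) <+> s *> (1F *> om x₁ (ι y₁) <+> (- s) *> r)) (om≡0 (⟂-sym y⟂)) (om≡0 x⟂) >>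
       (vsolve [ s ] (om y₂ (ι x₂) :: om x₁ (ι y₁)) (1k *v (1k *v 0w +v (⊖ `0) *v ^0) +v `0 *v (1k *v ^1 +v (⊖ `0) *v 0w)) (0w +v `0 *v (^1 -v ^0)) refl ⇐v s ∙: regulus D))
     where
      r : Q7
      r = 1F *> y₁ <+> (- s) *> x₂
      e : ∀ z → om z (ι r) ≡ 1F *> om z (ι y₁) <+> (- s) *> om z (ι x₂)
      e z = cong (om z) (ι-lin 1F y₁ (- s) x₂) >> om-linʳ z 1F (ι y₁) (- s) (ι x₂)

   lines : List (Ln {7})
   -- The line `y₁ y₂` is `rl 0F`, so only `x₁ x₂` has to be added to the parametrised lines.
   lines = ln x₁ x₂ ix ∷ List.map rl elements

   opaque
    dist : AllPairs (λ l m → ¬ l ≈ℓ m) lines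
    dist = Allₚ.map⁺ (All.universal (λ { s (same (h , _)) → off s (h _ hd∈) }) elements) ∷ APₚ.map⁺ (AP.map (λ { ne (same (h , _)) → ne (eq (h _ hd∈)) }) unique)
     where
      off : ∀ s → ¬ x₁ ∈< bas (rl s) >
      off s m = 1≢0 (fst (on-y s {1F} {0F} {0F} {0F} (subst (_∈< bas (rl s) >) (vsolve [] (x₁ ∷ x₂ ∷ y₁ :: y₂) (^0) (1k *v ^0 +v (0k *v ^1 +v (0k *v ^2 +v 0k *v ^3))) refl) m)) >> zeroˡ s)
      eq : ∀ {s t} → y₂ <+> s *> x₁ ∈< bas (rl t) > → s ≡ t
      eq {s} {t} m = fst (on-y t {s} {0F} {0F} {1F} (subst (_∈< bas (rl t) >) (vsolve [ s ] (x₁ ∷ x₂ ∷ y₁ :: y₂) (^3 +v `0 *v ^0) (`0 *v ^0 +v (0k *v ^1 +v (0k *v ^2 +v 1k *v ^3))) refl) m)) >> *-identityˡ t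

    -- the norm of a x₁ + b x₂ + c y₁ + d y₂ is a c + b d
    covers : ∀ {z} → N z ≡ 0F → z ∈< x₁ ∷ x₂ ∷ y₁ :: y₂ > → ∃ λ m → m ∈ lines × HL m × z ∈< bas m >
    covers {z} nz (a ∷ b ∷ c :: d , e) = go (c ≟ 0F) (d ≟ 0F)
     where
      p r : Q7
      p = a *> x₁ <+> b *> x₂
      r = c *> y₁ <+> d *> y₂
      Np : N p ≡ 0F
      Np = N-lin a x₁ b x₂ >> cong₂ (λ f g → a * a * f + b * b * g + a * b * B x₁ x₂) (⟂⇒N x⟂ (ind-nonzero (ind-tail ix))) (⟂⇒N (⟂-sym x⟂) (ind-nonzero ix)) >> cong (λ f → a * a * 0F + b * b * 0F + a * b * f) (⟂⇒B x⟂) >> solve (a :: b) (`0 *e `0 *e 0k +e `1 *e `1 *e 0k +e `0 *e `1 *e 0k) 0k refl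
      Nr : N r ≡ 0F
      Nr = N-lin c y₁ d y₂ >> cong₂ (λ f g → c * c * f + d * d * g + c * d * B y₁ y₂) (⟂⇒N y⟂ (ind-nonzero (ind-tail (ind-tail (ind-tail ind))))) (⟂⇒N (⟂-sym y⟂) (ind-nonzero (ind-tail (ind-tail ind)))) >> cong (λ f → c * c * 0F + d * d * 0F + c * d * f) (⟂⇒B y⟂) >> solve (c :: d) (`0 *e `0 *e 0k +e `1 *e `1 *e 0k +e `0 *e `1 *e 0k) 0k refl
      Bpr : B p r ≡ a * c + b * d
      Bpr = B-sym p r >> B-lin r a x₁ b x₂ >> cong₂ (λ f g → a * f + b * g) (t x₁ b11 b12) (B-sym r x₂ >> B-lin x₂ c y₁ d y₂ >> cong₂ (λ f g → c * f + d * g) b21 b22 >> solve (c :: d) (`0 *e 0k +e `1 *e 1k) (`1) refl)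
       where
        t : ∀ x → B x y₁ ≡ 1F → B x y₂ ≡ 0F → B r x ≡ c
        t x h h' = B-sym r x >> B-lin x c y₁ d y₂ >> cong₂ (λ f g → c * f + d * g) h h' >> solve (c :: d) (`0 *e 1k +e `1 *e 0k) (`0) refl
      z≡ : z ≡ a *> x₁ <+> (b *> x₂ <+> (c *> y₁ <+> d *> y₂))
      z≡ = sym e >> vsolve (a ∷ b ∷ c :: d) (x₁ ∷ x₂ ∷ y₁ :: y₂) (`0 *v ^0 +v (`1 *v ^1 +v (`2 *v ^2 +v (`3 *v ^3 +v 0w)))) (`0 *v ^0 +v (`1 *v ^1 +v (`2 *v ^2 +v `3 *v ^3))) refl
      acbd : a * c + b * d ≡ 0F
      acbd = solve (a ∷ b ∷ c :: d) (`0 *e `2 +e `1 *e `3) (1k *e 1k *e 0k +e 1k *e 1k *e 0k +e 1k *e 1k *e (`0 *e `2 +e `1 *e `3)) refl >>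
       sym (N-lin 1F p 1F r >> cong₂ (λ f g → 1F * 1F * f + 1F * 1F * g + 1F * 1F * B p r) Np Nr >> cong (λ f → 1F * 1F * 0F + 1F * 1F * 0F + 1F * 1F * f) Bpr) >>
        cong N (vsolve (a ∷ b ∷ c :: d) (x₁ ∷ x₂ ∷ y₁ :: y₂) (1k *v (`0 *v ^0 +v `1 *v ^1) +v 1k *v (`2 *v ^2 +v `3 *v ^3)) (`0 *v ^0 +v (`1 *v ^1 +v (`2 *v ^2 +v `3 *v ^3))) refl >> sym z≡) >> nz
      hit : ∀ s → a ≡ d * s → b ≡ - (c * s) → ∃ λ m → m ∈ lines × HL m × z ∈< bas m >
      hit s ea eb = rl s , there (∈ₚ.∈-map⁺ rl (complete s)) , rl-HL s , d :: c , trans (vsolve (a ∷ b ∷ c ∷ d :: s) (x₁ ∷ x₂ ∷ y₁ :: y₂) (`3 *v (^3 +v `4 *v ^0) +v (`2 *v (^2 +v (⊖ `4) *v ^1) +v 0w))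
        ((`0 *v ^0 +v (`1 *v ^1 +v (`2 *v ^2 +v `3 *v ^3))) +v ((`0 -e `3 *e `4) *v (-1k *v ^0) +v (`1 -e (⊖ (`2 *e `4))) *v (-1k *v ^1))) refl ⇐v (ea s: (-1F *> x₁)) &v (eb s: (-1F *> x₂))) (sym z≡)
      go : Dec (c ≡ 0F) → Dec (d ≡ 0F) → ∃ λ m → m ∈ lines × HL m × z ∈< bas m >
      go (no n) _ = hit (- (inv c n * b)) (solve (a ∷ b ∷ c ∷ d :: inv c n) (`0) (`3 *e (⊖ (`4 *e `1)) +e ((⊖ `0) *e (`2 *e `4 -e 1k) +e `4 *e ((`0 *e `2 +e `1 *e `3) -e 0k))) refl ⇐ (- a) *: inv-r c n & inv c n *: acbd)
        (solve (b ∷ c :: inv c n) (`0) (⊖ (`1 *e (⊖ (`2 *e `0))) +e (⊖ `0) *e (`1 *e `2 -e 1k)) refl ⇐ (- b) *: inv-r c n)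
      go (yes c0) (no n) = hit (inv d n * a) (solve (a ∷ d :: inv d n) (`0) (`1 *e (`2 *e `0) +e (⊖ `0) *e (`1 *e `2 -e 1k)) refl ⇐ (- a) *: inv-r d n)
        (solve (a ∷ b ∷ c ∷ d :: inv d n) (`1) (⊖ (`2 *e (`4 *e `0)) +e ((⊖ `1) *e (`3 *e `4 -e 1k) +e `4 *e ((`0 *e `2 +e `1 *e `3) -e 0k))) refl ⇐ (- b) *: inv-r d n & inv d n *: acbd)
      go (yes c0) (yes d0) = ln x₁ x₂ ix , here refl , x⟂ , a :: b , trans (vsolve (a ∷ b ∷ c :: d) (x₁ ∷ x₂ ∷ y₁ :: y₂) (`0 *v ^0 +v (`1 *v ^1 +v 0w))
        ((`0 *v ^0 +v (`1 *v ^1 +v (`2 *v ^2 +v `3 *v ^3))) +v ((`2 -e 0k) *v (-1k *v ^2) +v (`3 -e 0k) *v (-1k *v ^3))) refl ⇐v (c0 s: (-1F *> y₁)) &v (d0 s: (-1F *> y₂))) (sym z≡)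

 -- Solids of H(q)

 module HexSolidCounts where
  open Lines
  open Octonions
  open HexPlanes
  open Counting
  open HexLines
  open HexSolids

  module Solid {k : ℕ} (total : AtMost HL k) (U : Sub 4) where
   open Sub U
   open Solids total

   -- Two lines of the solid that meet in `x` put the whole plane of neighbours of `x` inside the
   -- solid.
   module Meet {x : Q7} {ℓ m : Ln {7}} (iℓ : Inside P ℓ) (im : Inside P m) (ne : ¬ ℓ ≈ℓ m) (nz : x ≢ 0v) (xℓ : x ∈< bas ℓ >) (xm : x ∈< bas m >) where
    open Star (star {x} {ℓ} {m} (fst iℓ) (fst im) ne nz xℓ xm)
    private
     xx : x ⟂ x
     xx = on {ℓ} (fst iℓ) xℓ xℓ
     P3 : VAll P (x ∷ p :: r)
     P3 = Pspan (snd iℓ) xℓ ∷ Pspan (snd iℓ) p∈ :: Pspan (snd im) r∈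

    -- `k` misses `x` and meets the plane of `x` in `y`. The planes of `x` and `y` then both lie in
    -- the solid and share the line `x y`, so their pencils contribute `2q + 1` lines.
    module Second {k : Ln {7}} (ik : Inside P k) (n : ¬ x ∈< bas k >) {y : Q7} (ynz : y ≢ 0v) (y∈ : y ∈< x ∷ p :: r >) (yk : y ∈< bas k >)
           {b : Q7} (iyb : Ind (y :: b)) (bk : b ∈< bas k >) {a : Q7} (xa : x ⟂ a) (Pa : P a) (na : ¬ a ∈< x :: y >) where
     opaque
      xy : x ⟂ y
      xy = span⁻ y∈
      yb : y ⟂ b
      yb = on {k} (fst ik) yk bk
      yy : y ⟂ y
      yy = on {k} (fst ik) yk yk
      ixy : Ind (x :: y)
      ixy = ext (ind1 ynz) (λ h → n (span⊆ [ yk ] h))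
      nxb : ¬ x ⟂ b
      nxb h = n (span⊆ (yk :: bk) (tri∈ yb (⟂-sym xy) (⟂-sym h) iyb))
      i4 : Ind (b ∷ a ∷ x :: y)
      i4 = ext (ext ixy na) (λ h → nxb (⟂-span (xa ∷ xx :: xy) h))
      Ia : Ind (x ∷ a :: y)
      Ia = ind-gen (ind-tail i4) (wk∈ hd∈ ∷ hd∈ :: wk∈ (wk∈ hd∈))
      Ib : Ind (y ∷ b :: x)
      Ib = ind-tail (ind-gen i4 (wk∈ (wk∈ hd∈) ∷ hd∈ ∷ wk∈ (wk∈ (wk∈ hd∈)) :: wk∈ hd∈))
      I4 : Ind (x ∷ y ∷ a :: b)
      I4 = ind-gen i4 (wk∈ (wk∈ (wk∈ hd∈)) ∷ wk∈ (wk∈ hd∈) ∷ hd∈ :: wk∈ hd∈)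
     private
      module Fx = Fan Ia
      module Fy = Fan Ib
      module Y = Plane (plane ynz yy)
     opaque
      Px : P x
      Px = VAll.head P3
      Py : P y
      Py = Pspan (snd ik) yk
      Pb : P b
      Pb = Pspan (snd ik) bk
      spanx : ∀ {z} → x ⟂ z → z ∈< x ∷ a :: y >
      spanx h = dimEq Ia (hd∈ ∷ span xa :: y∈) (span h)
      spany : ∀ {z} → y ⟂ z → z ∈< y ∷ b :: x >
      spany h = dimEq Ib (hd∈ ∷ Y.span yb :: Y.span (⟂-sym xy)) (Y.span h)

     private
      module Off {l : Ln {7}} (il : Inside P l) (nx : ¬ x ∈< bas l >) (ny : ¬ y ∈< bas l >) where
       -- By `full3` a point of `x y` other than `x` and `y` has, within the solid, neighbours only
       -- on `x y`, so `l` would be that line and contain `x`.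
       onxy : ∀ {t} → t ≢ 0v → t ∈< x :: y > → t ∈< bas l > → ⊥
       onxy {t} tnz (α :: β , e) tl with α ≟ 0F | β ≟ 0F | partner l tnz
       ... | yes refl | yes refl | _ = tnz (sym e >> (vsolve [] (x :: y) (0k *v ^0 +v (0k *v ^1 +v 0w)) 0w refl))
       ... | yes refl | no βn | _ = ny (span⊆ [ tl ] (inv β βn ∷ [] , (vsolve (β :: inv β βn) (x ∷ y :: t) (`1 *v ^2 +v 0w) (^1 +v ((⊖ `1) *v ((0k *v ^0 +v (`0 *v ^1 +v 0w)) -v ^2) +v (`0 *e `1 -e 1k) *v ^1)) refl ⇐v ((- inv β βn) ∙: e) &v (inv-r β βn s: y))))
       ... | no αn | yes refl | _ = nx (span⊆ [ tl ] (inv α αn ∷ [] , (vsolve (α :: inv α αn) (x ∷ y :: t) (`1 *v ^2 +v 0w) (^0 +v ((⊖ `1) *v ((`0 *v ^0 +v (0k *v ^1 +v 0w)) -v ^2) +v (`0 *e `1 -e 1k) *v ^0)) refl ⇐v ((- inv α αn) ∙: e) &v (inv-r α αn s: x))))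
       ... | no αn | no βn | c , itc , cl with P∈ I4 (Px ∷ Py ∷ Pa :: Pb) (Pspan (snd il) cl)
       ... | c1 ∷ c2 ∷ γ :: δ , ec = fin (full3 I4 xy xa yb γ δ αn βn (subst₂ _⟂_ (sym e >> vsolve (α :: β) (x :: y) (`0 *v ^0 +v (`1 *v ^1 +v 0w)) (`0 *v ^0 +v `1 *v ^1) refl)
         (vsolve (c1 ∷ c2 ∷ γ :: δ) (x ∷ y ∷ a ∷ b :: c) (1k *v ^4 +v -1k *v (`0 *v ^0 +v `1 *v ^1)) ((`2 *v ^2 +v `3 *v ^3) +v -1k *v ((`0 *v ^0 +v (`1 *v ^1 +v (`2 *v ^2 +v (`3 *v ^3 +v 0w)))) -v ^4)) refl ⇐v -1F ∙: ec)
         (⟂-lin (on {l} (fst il) tl cl) (⟂-lin tx ty c1 c2) 1F -1F)))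
        where
         t∈ : t ∈< x :: y >
         t∈ = α :: β , e
         tx : t ⟂ x
         tx = ⟂-sym (⟂-span (xx :: xy) t∈)
         ty : t ⟂ y
         ty = ⟂-sym (⟂-span (⟂-sym xy :: yy) t∈)
         fin : γ ≡ 0F × δ ≡ 0F → ⊥
         fin (γ0 , δ0) = nx (span⊆ (tl :: cl) (dimEq itc (t∈ :: (c1 :: c2 , (vsolve (c1 ∷ c2 ∷ γ :: δ) (x ∷ y ∷ a ∷ b :: c) (`0 *v ^0 +v (`1 *v ^1 +v 0w))
          (^4 +v (1k *v ((`0 *v ^0 +v (`1 *v ^1 +v (`2 *v ^2 +v (`3 *v ^3 +v 0w)))) -v ^4) +v (`2 -e 0k) *v (-1k *v ^2) +v (`3 -e 0k) *v (-1k *v ^3))) refl ⇐v (1F ∙: ec) &v (γ0 s: (-1F *> a)) &v (δ0 s: (-1F *> b))))) hd∈))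

       -- a quadrangle x, y, z', z: the product x z' would be a multiple of both y and z
       none : ⊥
       none with common Ia (Subspace.indep l) (Pdep (x ∷ a ∷ y ∷ bas l) (Px ∷ Pa ∷ Py ∷ snd il)) | common Ib (Subspace.indep l) (Pdep (y ∷ b ∷ x ∷ bas l) (Py ∷ Pb ∷ Px ∷ snd il))
       ... | z , znz , z∈ , zl | z' , znz' , z'∈ , zl' with ∈? z (x :: y) | ∈? z' (x :: y)
       ... | yes h | _ = onxy znz h zl
       ... | no _ | yes h = onxy znz' h zl'
       ... | no f | no f' = cmp (mid xy (⟂-sym yz') (ind-gen (ext ixy f') (wk∈ (wk∈ hd∈) ∷ hd∈ :: wk∈ hd∈))) (mid xz (on {l} (fst il) zl' zl) (ind-gen (ext ixz g) (wk∈ (wk∈ hd∈) ∷ hd∈ :: wk∈ hd∈)))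
        where
         xz : x ⟂ z
         xz = ⟂-span (xx ∷ xa :: xy) z∈
         yz' : y ⟂ z'
         yz' = ⟂-span (yy ∷ yb :: ⟂-sym xy) z'∈
         ixz : Ind (x :: z)
         ixz = swap2 (ext (ind1 nz) (λ h → f (span⊆ [ hd∈ ] h)))
         g : ¬ z' ∈< x :: z >
         g h = f' (tri∈ xy (⟂-span (xx :: xz) h) yz' ixy)
         cmp : (∃ λ ρ → ρ ≢ 0F × om x (ι z') ≡ ρ *> ι y) → (∃ λ ρ → ρ ≢ 0F × om x (ι z') ≡ ρ *> ι z) → ⊥
         cmp (ρ , _ , e) (σ , σn , e') = f (0F :: inv σ σn * ρ , trans (sym (τι _)) (cong τ (cong ι (vsolve [ inv σ σn * ρ ] (x :: y) (0k *v ^0 +v (`0 *v ^1 +v 0w)) (0k *v ^0 +v `0 *v ^1) refl) >> ι-lin 0F x (inv σ σn * ρ) y >>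
          (vsolve (ρ ∷ σ :: inv σ σn) (ι x ∷ ι y ∷ ι z :: om x (ι z')) (0k *v ^0 +v (`2 *e `0) *v ^1) (^2 +v ((⊖ `2) *v (^3 -v `0 *v ^1) +v `2 *v (^3 -v `1 *v ^2) +v (`1 *e `2 -e 1k) *v ^2)) refl
           ⇐v (((- inv σ σn) ∙: e) &v (inv σ σn ∙: e')) &v (inv-r σ σn s: ι z))) >> τι z))

      list : List (Ln {7})
      list = ln x y ixy ∷ (Fx.fans List.++ Fy.fans)

      in-here : ∀ {l} → x ∈< bas l > → y ∈< bas l > → Any (l ≈ℓ_) list
      in-here x∈ y∈ = here (spans ixy x∈ y∈)

      cov : ∀ l → Inside P l → Any (l ≈ℓ_) list
      cov l il with ∈? x (bas l) | ∈? y (bas l)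
      ... | yes xl | yes yl = in-here {l} xl yl
      ... | no nx | no ny = ⊥-elim (Off.none {l} il nx ny)
      ... | yes xl | no ny = go (partner l nz)
       where
        go : (∃ λ z → Ind (x :: z) × z ∈< bas l >) → Any (l ≈ℓ_) list
        go (z , iz , zl) with Fx.fan-cov (spanx (on {l} (fst il) xl zl))
        ... | inj₁ h = ⊥-elim (ny (span⊆ (xl :: zl) (dimEq iz (hd∈ :: h) (wk∈ hd∈))))
        ... | inj₂ h = there (Anyₚ.++⁺ˡ (Fx.fans-any {l} xl zl h))
      ... | no nx | yes yl = go (partner l ynz)
       where
        go : (∃ λ z → Ind (y :: z) × z ∈< bas l >) → Any (l ≈ℓ_) list
        go (z , iz , zl) with Fy.fan-cov (spany (on {l} (fst il) yl zl))
        ... | inj₁ h = ⊥-elim (nx (span⊆ (yl :: zl) (dimEq iz (hd∈ :: h) (wk∈ hd∈))))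
        ... | inj₂ h = there (Anyₚ.++⁺ʳ Fx.fans (Fy.fans-any {l} yl zl h))

     opaque
      two-pencils : LCount (Inside P) (suc (2 ℕ.* q))
      two-pencils = subst (LCount (Inside P)) (cong suc (Listₚ.length-++ Fx.fans >> (cong₂ ℕ._+_ (Listₚ.length-map Fx.fan elements) (Listₚ.length-map Fy.fan elements >> sym (ℕₚ.+-identityʳ q)))))
       (count-list list ((xy , Px :: Py) ∷ Allₚ.++⁺ (Fx.fans-all (λ t → ⟂-span (xa :: xy) (+∈ hd∈ (∙∈ t (wk∈ hd∈))) , Px :: Pspan (Pa :: Py) (+∈ hd∈ (∙∈ t (wk∈ hd∈)))))
                               (Fy.fans-all (λ t → ⟂-span (yb :: ⟂-sym xy) (+∈ hd∈ (∙∈ t (wk∈ hd∈))) , Py :: Pspan (Pb :: Px) (+∈ hd∈ (∙∈ t (wk∈ hd∈))))))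
        (Allₚ.++⁺ (Fx.fans-all (λ { t (same (h , _)) → Fx.fan-off t (h _ (wk∈ hd∈)) })) (Fy.fans-all (λ { t (same (h , _)) → Fy.fan-off t (h _ hd∈) }))
         ∷ APₚ.++⁺ Fx.fans-dist Fy.fans-dist (Fx.fans-all (λ t → Fy.fans-all (λ { t' (same (h , _)) → Fy.fan-off t' (h _ hd∈) }))))
        cov)

    opaque
     counts : LCount (Inside P) (suc q) ⊎ LCount (Inside P) (suc (2 ℕ.* q))
     counts with find (snd (inside-count U)) (λ l → ∈? x (bas l)) (λ { (same (_ , g)) h → g _ h })
     ... | inj₂ all = inj₁ (card-≐ (λ l (h , x∈) → h , VAll.map (λ m → Pspan P3 (span (on {l} h x∈ m))) (gens∈ (bas l))) (λ l s → fst s , all l s) (pencil nz xx))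
     ... | inj₁ (k , ik , n) with common ind (Subspace.indep k) (Pdep (x ∷ p ∷ r ∷ bas k) (VAllₚ.++⁺ P3 (snd ik)))
     ... | y , ynz , y∈ , yk with partner k ynz | ∈? p (x :: y) | ∈? r (x :: y)
     ... | b , iyb , bk | no np | _ = inj₂ (Second.two-pencils {k} ik n ynz y∈ yk iyb bk x⟂p (VAll.head (VAll.tail P3)) np)
     ... | b , iyb , bk | yes _ | no nr = inj₂ (Second.two-pencils {k} ik n ynz y∈ yk iyb bk x⟂r (VAll.head (VAll.tail (VAll.tail P3))) nr)
     ... | b , iyb , bk | yes hp | yes hr = ⊥-elim (ind-no ℕₚ.≤-refl (x :: y) ind (hd∈ ∷ hp :: hr))

   opaque
    Sd7 : let S = Inside P in LCount S 0 ⊎ LCount S 1 ⊎ LCount S (suc q) ⊎ LCount S (suc (2 ℕ.* q))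
    Sd7 = go (inside-count U)
     where
      Goal : Set
      Goal = let S = Inside P in LCount S 0 ⊎ LCount S 1 ⊎ LCount S (suc q) ⊎ LCount S (suc (2 ℕ.* q))
      meets : ∀ {x ℓ m} → Inside P ℓ → Inside P m → ¬ ℓ ≈ℓ m → x ≢ 0v → x ∈< bas ℓ > → x ∈< bas m > → Goal
      meets {x} {ℓ} {m} iℓ im ne nz xℓ xm = inj₂ (inj₂ (Meet.counts {x} {ℓ} {m} iℓ im ne nz xℓ xm))
      go : (∃ λ m → LCount (Inside P) m) → Goal
      go (0 , c) = inj₁ c
      go (1 , c) = inj₂ (inj₁ c)
      go (suc (suc _) , C@(ℓ@(subspace (a :: b) i) ∷ m@(subspace (c :: d) j) ∷ _ , iℓ@(hℓ , pa :: pb) ∷ im@(hm , pc :: pd) ∷ _ , dis , _)) with ind? (a ∷ b ∷ c :: d)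
      ... | inj₁ dep = let x , nz , xℓ , xm = common i j dep in meets {x} {ℓ} {m} iℓ im (λ e → dis zero (suc zero) (λ ()) (sub e)) nz xℓ xm
      ... | inj₂ i4 with pairing hℓ hm i4
      ... | inj₁ (x , y , xnz , ynz , x∈ , y∈ , xy) = meets {x} {ℓ} {ln x y ixy} iℓ (xy , Pspan (pa :: pb) x∈ :: Pspan (pc :: pd) y∈) (λ { (same (_ , g)) → y∉ (g _ (wk∈ hd∈)) }) xnz x∈ hd∈
       where
        y∉ : ¬ y ∈< a :: b >
        y∉ (α :: β , e) = go' y∈
         where
          go' : y ∈< c :: d > → ⊥
          go' (γ :: δ , e') = ynz (sym e >> cong₂ (λ α β → lin (α :: β) (a :: b)) (z zero) (z (suc zero)) >> (vsolve [] (a :: b) (0k *v ^0 +v (0k *v ^1 +v 0w)) 0w refl))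
           where
            z : ∀ t → lookup (α ∷ β ∷ - γ :: - δ) t ≡ 0F
            z = coef i4 (α ∷ β ∷ - γ :: - δ) (vsolve (α ∷ β ∷ γ :: δ) (a ∷ b ∷ c ∷ d :: y) (`0 *v ^0 +v (`1 *v ^1 +v ((⊖ `2) *v ^2 +v ((⊖ `3) *v ^3 +v 0w))))
             (0w +v (1k *v ((`0 *v ^0 +v (`1 *v ^1 +v 0w)) -v ^4) +v -1k *v ((`2 *v ^2 +v (`3 *v ^3 +v 0w)) -v ^4))) refl ⇐v (1F ∙: e) &v (-1F ∙: e'))
        ixy : Ind (x :: y)
        ixy = swap2 (ext (ind1 xnz) (λ h → y∉ (span⊆ [ x∈ ] h)))
      ... | inj₂ (z1 , z2 , z1∈ , z2∈ , D) = fin (find C (λ l → Any.any? (≈? l) lines) (λ e → Any.map (≈-trans e)))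
       where
        open Regulus D
        P4 : VAll P (a ∷ b ∷ z1 :: z2)
        P4 = pa ∷ pb ∷ Pspan (pc :: pd) z1∈ :: Pspan (pc :: pd) z2∈
        rl-in : ∀ s → Inside P (rl s)
        rl-in s = rl-HL s , Pspan P4 (+∈ (wk∈ (wk∈ (wk∈ hd∈))) (∙∈ s hd∈)) :: Pspan P4 (+∈ (wk∈ (wk∈ hd∈)) (∙∈ (- s) (wk∈ hd∈)))
        all-in : All (Inside P) lines
        all-in = (hℓ , pa :: pb) ∷ Allₚ.map⁺ (All.universal rl-in elements)
        fin : (∃ λ l → Inside P l × ¬ Any (l ≈ℓ_) lines) ⊎ (∀ l → Inside P l → Any (l ≈ℓ_) lines) → Goal
        fin (inj₂ cov) = inj₂ (inj₂ (inj₁ (subst (LCount (Inside P)) (cong suc (Listₚ.length-map rl elements)) (count-list lines all-in dist cov))))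
        -- A line of the solid outside the regulus still meets a line of the regulus, because every
        -- singular point of the solid is covered; this returns to the case of two intersecting
        -- lines.
        fin (inj₁ (l@(subspace (e :: f) il) , hl@(h , pe :: pf) , off)) with covers (⟂⇒N h (ind-nonzero (ind-tail il))) (P∈ (Dual.ind D) P4 pe)
        ... | r , r∈ , hr , e∈ = meets {e} {l} {r} hl (All.lookup all-in r∈) (λ eq → off (Any.map (λ { refl → eq }) r∈)) (ind-nonzero il) hd∈ e∈

 -- Every line of H(q) belongs to a flag

 module HexFlags where
  open Lines
  open Vectors3 hiding (perp)
  open Cross
  open Octonions
  open Terms
  open Counting
  open HexLines
  open FiniteField F using (complete)

  mk : K3 → K → K3 → Q7
  mk a e b = a ++ e ∷ b

  opaque
   mk-lin : ∀ c a e b d a' e' b' → c *> mk a e b <+> d *> mk a' e' b' ≡ mk (c *> a <+> d *> a') (c * e + d * e') (c *> b <+> d *> b')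
   mk-lin c (_ ∷ _ :: _) e (_ ∷ _ :: _) d (_ ∷ _ :: _) e' (_ ∷ _ :: _) = refl

  opaque
   mk-∙ : ∀ c a e b → c *> mk a e b ≡ mk (c *> a) (c * e) (c *> b)
   mk-∙ c (_ ∷ _ :: _) e (_ ∷ _ :: _) = refl

  opaque
   split : ∀ x → ∃ λ a → ∃₂ λ e b → x ≡ mk a e b
   split (a₀ ∷ a₁ ∷ a₂ ∷ e ∷ b) = a₀ ∷ a₁ :: a₂ , e , b , refl

  opaque
   mk-inj : ∀ {a e b a' e' b'} → mk a e b ≡ mk a' e' b' → a ≡ a' × e ≡ e' × b ≡ b'
   mk-inj {_ ∷ _ :: _} {_} {_} {_ ∷ _ :: _} refl = refl , refl , refl

  opaque
   mk3 : ∀ {a a' : K3} {e e' : K} {b b' : K3} → a ≡ a' → e ≡ e' → b ≡ b' → mk a e b ≡ mk a' e' b'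
   mk3 refl refl refl = refl

  -- The vanishing of the product of `(u , e , w)` and `(a , g , b)`, written with dot and cross
  -- products of the two halves.
  record Eqs (u : K3) (e : K) (w a : K3) (g : K) (b : K3) : Set where
   field
    ub : dot u b ≡ e * g
    wa : dot w a ≡ e * g
    ua : cross u a ≡ e *> b <+> (- g) *> w
    wb : cross w b ≡ g *> u <+> (- e) *> a

  opaque
   eqs : ∀ {u e w a g b} → mk u e w ⟂ mk a g b → Eqs u e w a g b
   eqs {u@(u0 ∷ u1 :: u2)} {e} {w@(w0 ∷ w1 :: w2)} {a@(a₀ ∷ a₁ :: a₂)} {g} {b@(b₀ ∷ b₁ :: b₂)} (perp h) = record
     { ub = solve (e ∷ g :: dot u b) (`2) (`0 *e `1 +e -1k *e (((⊖ (`0 *e (⊖ `1))) -e `2) -e 0k)) refl ⇐ -1F *: c (# 0)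
     ; wa = solve (e ∷ g :: dot w a) (`2) (`0 *e `1 +e -1k *e ((`0 *e `1 -e `2) -e 0k)) refl ⇐ -1F *: c (# 7)
     ; ua = vec3 (s e b₀ g w0 (c (# 4))) (s e b₁ g w1 (c (# 5))) (s e b₂ g w2 (c (# 6)))
     ; wb = vec3 (t g u0 e a₀ (c (# 1))) (t g u1 e a₁ (c (# 2))) (t g u2 e a₂ (c (# 3))) }
    where
     c : ∀ i → lookup (om (mk u e w) (ι (mk a g b))) i ≡ 0F
     c i = cong (λ z → lookup z i) h >> Vecₚ.lookup-replicate i 0F
     s : ∀ e b g w {x} → ((- g) * w + e * b) - x ≡ 0F → x ≡ e * b + (- g) * w
     s e b g w {x} p = solve (e ∷ b ∷ g ∷ w :: x) (`4) (`0 *e `1 +e (⊖ `2) *e `3 +e -1k *e ((((⊖ `2) *e `3 +e `0 *e `1) -e `4) -e 0k)) refl ⇐ -1F *: p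
     t : ∀ g u e a {x} → (g * u - e * a) - x ≡ 0F → x ≡ g * u + (- e) * a
     t g u e a {x} p = solve (g ∷ u ∷ e ∷ a :: x) (`4) (`0 *e `1 +e (⊖ `2) *e `3 +e -1k *e (((`0 *e `1 -e `2 *e `3) -e `4) -e 0k)) refl ⇐ -1F *: p

  opaque
   eqs⁻ : ∀ {u e w a g b} → Eqs u e w a g b → mk u e w ⟂ mk a g b
   eqs⁻ {u@(u0 ∷ u1 :: u2)} {e} {w@(w0 ∷ w1 :: w2)} {a@(a₀ ∷ a₁ :: a₂)} {g} {b@(b₀ ∷ b₁ :: b₂)} E = perp (cong₂ _∷_ (solve (e ∷ g :: dot u b) ((⊖ (`0 *e (⊖ `1))) -e `2) (0k +e -1k *e (`2 -e `0 *e `1)) refl ⇐ -1F *: ub)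
     (cong₂ _∷_ (t g u0 e a₀ (cong (λ z → lookup z (# 0)) wb)) (cong₂ _∷_ (t g u1 e a₁ (cong (λ z → lookup z (# 1)) wb)) (cong₂ _∷_ (t g u2 e a₂ (cong (λ z → lookup z (# 2)) wb))
     (cong₂ _∷_ (s e b₀ g w0 (cong (λ z → lookup z (# 0)) ua)) (cong₂ _∷_ (s e b₁ g w1 (cong (λ z → lookup z (# 1)) ua)) (cong₂ _∷_ (s e b₂ g w2 (cong (λ z → lookup z (# 2)) ua))
     (cong (_∷ []) (solve (e ∷ g :: dot w a) (`0 *e `1 -e `2) (0k +e -1k *e (`2 -e `0 *e `1)) refl ⇐ -1F *: wa)))))))))
    where
     open Eqs E
     s : ∀ e b g w {x} → x ≡ e * b + (- g) * w → ((- g) * w + e * b) - x ≡ 0F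
     s e b g w refl = solve (e ∷ b ∷ g :: w) (((⊖ `2) *e `3 +e `0 *e `1) -e (`0 *e `1 +e (⊖ `2) *e `3)) 0k refl
     t : ∀ g u e a {x} → x ≡ g * u + (- e) * a → (g * u - e * a) - x ≡ 0F
     t g u e a refl = solve (g ∷ u ∷ e :: a) ((`0 *e `1 -e `2 *e `3) -e (`0 *e `1 +e (⊖ `2) *e `3)) 0k refl

  -- the line belongs to the flag (a , b): it is spanned by a and b, or meets ⟨a , b> in a point other than these two
  At : K3 → K3 → Ln → Set
  At a b ℓ = (mk a 0F 0c ∈< bas ℓ > × mk 0c 0F b ∈< bas ℓ >)
       ⊎ ∃ λ l → l ≢ 0F × mk a 0F (l *> b) ∈< bas ℓ > × ∃₂ λ a₀ b₀ → mk a₀ 1F b₀ ∈< bas ℓ >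

  opaque
   At-scaleˡ : ∀ {k a b ℓ} → k ≢ 0F → At a b ℓ → At (k *> a) b ℓ
   At-scaleˡ {k} {a} {b} {ℓ} nz (inj₁ (p , r)) = inj₁ (subst (_∈< bas ℓ >) (mk-∙ k a 0F 0c >> mk3 refl (zeroʳ k) (vsolve [ k ] [] (`0 *v 0w) 0w refl)) (∙∈ k p) , r)
   At-scaleˡ {k} {a} {b} {ℓ} nz (inj₂ (l , lnz , p , z)) = inj₂ (k * l , *≢0 nz lnz , subst (_∈< bas ℓ >) (mk-∙ k a 0F (l *> b) >> mk3 refl (zeroʳ k) (vsolve (k :: l) [ b ] (`0 *v `1 *v ^0) ((`0 *e `1) *v ^0) refl)) (∙∈ k p) , z)

  opaque
   At-scaleʳ : ∀ {k a b ℓ} → k ≢ 0F → At a b ℓ → At a (k *> b) ℓ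
   At-scaleʳ {k} {a} {b} {ℓ} nz (inj₁ (p , r)) = inj₁ (p , subst (_∈< bas ℓ >) (mk-∙ k 0c 0F b >> mk3 (vsolve [ k ] [] (`0 *v 0w) 0w refl) (zeroʳ k) refl) (∙∈ k r))
   At-scaleʳ {k} {a} {b} {ℓ} nz (inj₂ (l , lnz , p , z)) = inj₂ (l * inv k nz , *≢0 lnz (inv≢0 k nz) , subst (_∈< bas ℓ >) (mk3 refl refl (vsolve (k ∷ l :: inv k nz) [ b ] (`1 *v ^0) ((`1 *e `2) *v `0 *v ^0 +v (`0 *e `2 -e 1k) *v (⊖ `1) *v ^0) refl ⇐v (inv-r k nz s: ((- l) *> b)))) p , z)

  private
   cr0 : ∀ (y : K3) → cross 0c y ≡ 0c
   cr0 y = cong (λ z → cross z y) (vsolve [] [] 0w (0k *v 0w +v 0k *v 0w) refl) >> cross-lin 0F 0c 0F 0c y >> (vsolve [] [ cross 0c y ] (0k *v ^0 +v 0k *v ^0) 0w refl)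

   Flag : Ln → Set
   Flag ℓ = ∃₂ λ a b → a ≢ 0c × b ≢ 0c × dot a b ≡ 0F × At a b ℓ

   0-eq : ∀ (b w : K3) → 0F *> b <+> (- 0F) *> w ≡ 0c
   0-eq b w = vsolve [] (b :: w) (0k *v ^0 +v (⊖ 0k) *v ^1) 0w refl

   -- On a line with `e = 0` the cross products `u × a` and `w × b` vanish. So each half varies only
   -- by a scalar, and the line is spanned by one point from each of the two planes.
   flat : ∀ {ℓ u w a b} → HL ℓ → u ≢ 0c → Ind (mk u 0F w :: mk a 0F b) → mk u 0F w ∈< bas ℓ > → mk a 0F b ∈< bas ℓ > → Flag ℓ
   flat {ℓ} {u} {w} {a} {b} h nz i x∈ y∈ = go (cross-∥ u a nz (Eqs.ua E >> 0-eq b w))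
    where
     E : Eqs u 0F w a 0F b
     E = eqs (on {ℓ} h x∈ y∈)
     X : Eqs u 0F w u 0F w
     X = eqs (on {ℓ} h x∈ x∈)
     go : (∃ λ k → a ≡ k *> u) → Flag ℓ
     go (k , refl) = fin (cross-∥ d w dnz (cong (λ z → cross z w) (vsolve [ k ] (w :: b) (^1 +v (⊖ `0) *v ^0) (1k *v ^1 +v (⊖ `0) *v ^0) refl) >> cross-lin 1F b (- k) w w >>
        cong₂ (λ p r → 1F *> p <+> (- k) *> r) (anti b w >> cong (-1F *>_) (Eqs.wb E >> 0-eq u (k *> u))) (Eqs.wb X >> 0-eq u u) >> (vsolve [ k ] [] (1k *v -1k *v 0w +v (⊖ `0) *v 0w) 0w refl)))
      where
       d : K3
       d = b <+> (- k) *> w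
       D : mk 0c 0F d ≡ (- k) *> mk u 0F w <+> 1F *> mk (k *> u) 0F b
       D = sym (mk-lin (- k) u 0F w 1F (k *> u) 0F b >> mk3 (vsolve [ k ] [ u ] ((⊖ `0) *v ^0 +v 1k *v `0 *v ^0) 0w refl) (solve [ k ] ((⊖ `0) *e 0k +e 1k *e 0k) 0k refl) (vsolve [ k ] (w :: b) ((⊖ `0) *v ^0 +v 1k *v ^1) (^1 +v (⊖ `0) *v ^0) refl))
       dnz : d ≢ 0c
       dnz z = 1≢0 (coef i (- k :: 1F) (vsolve [ k ] (mk u 0F w :: mk (k *> u) 0F b) ((⊖ `0) *v ^0 +v (1k *v ^1 +v 0w)) ((⊖ `0) *v ^0 +v 1k *v ^1) refl >> sym D >> cong (mk 0c 0F) z) (suc zero))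
       d∈ : mk 0c 0F d ∈< bas ℓ >
       d∈ = subst (_∈< bas ℓ >) (sym D) (+∈ (∙∈ (- k) x∈) (∙∈ 1F y∈))
       fin : (∃ λ l → w ≡ l *> d) → Flag ℓ
       fin (l , e) = u , d , nz , dnz , trans (Eqs.ub (eqs {u} {0F} {w} {0c} {0F} {d} (on {ℓ} h x∈ d∈))) (zeroˡ 0F) , inj₁ (subst (_∈< bas ℓ >) (mk-lin 1F u 0F w (- l) 0c 0F d >> mk3 (vsolve [ l ] [ u ] (1k *v ^0 +v (⊖ `0) *v 0w) (^0) refl) (solve [ l ] (1k *e 0k +e (⊖ `0) *e 0k) 0k refl)
          (vsolve [ l ] (w :: d) (1k *v ^0 +v (⊖ `0) *v ^1) (0w +v 1k *v (^0 -v `0 *v ^1)) refl ⇐v 1F ∙: e)) (+∈ (∙∈ 1F x∈) (∙∈ (- l) d∈)) , d∈)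

   -- Elimination gives one point `(p , 0 , r)` and one with middle coordinate one. The cross
   -- product equations express `p` and `r` through each other, so that neither half can vanish
   -- alone.
   steep : ∀ {ℓ u e w a g b} → HL ℓ → g ≢ 0F → Ind (mk u e w :: mk a g b) → mk u e w ∈< bas ℓ > → mk a g b ∈< bas ℓ > → Flag ℓ
   steep {ℓ} {u} {e} {w} {a} {g} {b} h nz i x∈ y∈ = p , r , pnz , rnz , trans (Eqs.ub (eqs (on {ℓ} h x'∈ x'∈))) (zeroˡ 0F) ,
     inj₂ (1F , 1≢0 , subst (λ z → mk p 0F z ∈< bas ℓ >) (vsolve [] [ r ] (^0) (1k *v ^0) refl) x'∈ , a' , b' , y'∈)
    where
     k : K
     k = inv g nz
     kg : k * g ≡ 1F
     kg = *-comm k g >> inv-r g nz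
     p r a' b' : K3
     p = 1F *> u <+> (- (e * k)) *> a
     r = 1F *> w <+> (- (e * k)) *> b
     a' = k *> a
     b' = k *> b
     X : mk p 0F r ≡ 1F *> mk u e w <+> (- (e * k)) *> mk a g b
     X = sym (mk-lin 1F u e w (- (e * k)) a g b >> mk3 refl (solve (e ∷ k :: g) (1k *e `0 +e (⊖ (`0 *e `1)) *e `2) (0k +e (⊖ `0) *e (`1 *e `2 -e 1k)) refl ⇐ (- e) *: kg) refl)
     x'∈ : mk p 0F r ∈< bas ℓ >
     x'∈ = subst (_∈< bas ℓ >) (sym X) (+∈ (∙∈ 1F x∈) (∙∈ (- (e * k)) y∈))
     y'∈ : mk a' 1F b' ∈< bas ℓ >
     y'∈ = subst (_∈< bas ℓ >) (mk-∙ k a g b >> mk3 refl kg refl) (∙∈ k y∈)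
     xnz : ¬ mk p 0F r ≡ 0v
     xnz z = 1≢0 (coef i (1F :: - (e * k)) (vsolve [ e * k ] (mk u e w :: mk a g b) (1k *v ^0 +v ((⊖ `0) *v ^1 +v 0w)) (1k *v ^0 +v (⊖ `0) *v ^1) refl >> sym X >> z) zero)
     E : Eqs p 0F r a' 1F b'
     E = eqs (on {ℓ} h x'∈ y'∈)
     p0 : cross r b' ≡ 0c → p ≡ 0c
     p0 z = vsolve [] (p ∷ a' :: cross r b') (^0) (0w +v (-1k *v (^2 -v (1k *v ^0 +v (⊖ 0k) *v ^1)) +v 1k *v (^2 -v 0w))) refl ⇐v (-1F ∙: Eqs.wb E) &v (1F ∙: z)
     r0 : cross p a' ≡ 0c → r ≡ 0c
     r0 z = vsolve [] (r ∷ b' :: cross p a') (^0) (0w +v (1k *v (^2 -v (0k *v ^1 +v -1k *v ^0)) +v -1k *v (^2 -v 0w))) refl ⇐v (1F ∙: Eqs.ua E) &v (-1F ∙: z)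
     pnz : p ≢ 0c
     pnz z = xnz (cong₂ (λ p r → mk p 0F r) z (r0 (cong (λ z → cross z a') z >> cr0 a')))
     rnz : r ≢ 0c
     rnz z = xnz (cong₂ (λ p r → mk p 0F r) (p0 (cong (λ z → cross z b') z >> cr0 b')) z)

  opaque
   flag : ∀ {ℓ} → HL ℓ → ∃₂ λ a b → a ≢ 0c × b ≢ 0c × dot a b ≡ 0F × At a b ℓ
   flag {ℓ@(subspace (x :: y) i)} h with split x | split y
   ... | u , e , w , refl | a , g , b , refl with g ≟ 0F | e ≟ 0F | u ≟v 0c | a ≟v 0c
   ... | no n | _ | _ | _ = steep {ℓ} h n i hd∈ (wk∈ hd∈)
   ... | yes _ | no n | _ | _ = steep {ℓ} h n (swap2 i) (wk∈ hd∈) hd∈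
   ... | yes refl | yes refl | no n | _ = flat {ℓ} h n i hd∈ (wk∈ hd∈)
   ... | yes refl | yes refl | yes _ | no n = flat {ℓ} h n (swap2 i) (wk∈ hd∈) hd∈
   ... | yes refl | yes refl | yes refl | yes refl = ⊥-elim (bad (cross-∥ w b wnz (Eqs.wb (eqs {0c} {0F} {w} {0c} {0F} {b} h) >> 0-eq 0c 0c)))
    where
     wnz : w ≢ 0c
     wnz refl = ind-nonzero i refl
     bad : ¬ ∃ λ k → b ≡ k *> w
     bad (k , refl) = ∉-head (swap2 i) (k ∷ [] , trans (vsolve [ k ] [ mk 0c 0F w ] (`0 *v ^0 +v 0w) (`0 *v ^0) refl) (mk-∙ k 0c 0F w >> mk3 (vsolve [ k ] [] (`0 *v 0w) 0w refl) (zeroʳ k) refl))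

  -- The lines of the second kind through a + l b all meet z + ⟨a>, for any single such z.
  opaque
   canon : ∀ a b l → a ≢ 0c → b ≢ 0c → l ≢ 0F → let x = mk a 0F (l *> b) ; S = λ ℓ → HL ℓ × x ∈< bas ℓ > × ∃₂ λ a₀ b₀ → mk a₀ 1F b₀ ∈< bas ℓ > in
       (∀ ℓ → ¬ S ℓ) ⊎ ∃ λ z → ∀ ℓ → S ℓ → ∃ λ r → z <+> r *> mk a 0F 0c ∈< bas ℓ > × Ind (x :: z <+> r *> mk a 0F 0c)
   canon a b l anz bnz lnz with search (λ z → (lookup z (# 3) ≟ 1F) ×-dec ⟂? (mk a 0F (l *> b)) z)
   ... | no n = inj₁ (λ { ℓ (h , x∈ , (a₀@(_ ∷ _ :: _) , b₀ , z∈)) → n (mk a₀ 1F b₀ , refl , on {ℓ} h x∈ z∈) })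
   ... | yes (z , e , xz) = inj₂ (z , found z e xz)
    where
     x : Q7
     x = mk a 0F (l *> b)
     lb : l *> b ≢ 0c
     lb h = lnz (∙-0 bnz h)
     found : ∀ z → lookup z (# 3) ≡ 1F → x ⟂ z → ∀ ℓ → HL ℓ × x ∈< bas ℓ > × (∃₂ λ a₀ b₀ → mk a₀ 1F b₀ ∈< bas ℓ >) → ∃ λ r → z <+> r *> mk a 0F 0c ∈< bas ℓ > × Ind (x :: z <+> r *> mk a 0F 0c)
     found (p ∷ r ∷ s ∷ _ ∷ b₁) refl xz ℓ (h , x∈ , (a₀ , b₀ , z∈)) = go (cross-∥ a a″ anz (Eqs.ua E >> 0-eq b″ (l *> b))) (cross-∥ (l *> b) b″ lb (Eqs.wb E >> 0-eq a a″))
      where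
       a₁ : K3
       a₁ = p ∷ r :: s
       a″ b″ : K3
       a″ = 1F *> a₀ <+> -1F *> a₁
       b″ = 1F *> b₀ <+> -1F *> b₁
       D : 1F *> mk a₀ 1F b₀ <+> -1F *> mk a₁ 1F b₁ ≡ mk a″ 0F b″
       D = mk-lin 1F a₀ 1F b₀ -1F a₁ 1F b₁ >> mk3 refl (solve [] (1k *e 1k +e -1k *e 1k) 0k refl) refl
       E : Eqs a 0F (l *> b) a″ 0F b″
       E = eqs (subst (x ⟂_) D (⟂-lin (on {ℓ} h x∈ z∈) xz 1F -1F))
       go : (∃ λ k → a″ ≡ k *> a) → (∃ λ m → b″ ≡ m *> l *> b) → ∃ λ r → mk a₁ 1F b₁ <+> r *> mk a 0F 0c ∈< bas ℓ > × Ind (x :: mk a₁ 1F b₁ <+> r *> mk a 0F 0c)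
       go (k , ek) (m , em) = k - m , subst (_∈< bas ℓ >) eq (+∈ z∈ (∙∈ (- m) x∈)) , λ { (c :: d) w → ind c d w }
        where
         eq : mk a₀ 1F b₀ <+> (- m) *> x ≡ mk a₁ 1F b₁ <+> (k - m) *> mk a 0F 0c
         eq = vsolve [ m ] (mk a₀ 1F b₀ ∷ mk a₁ 1F b₁ :: x) (^0 +v (⊖ `0) *v ^2) (^1 +v (1k *v (1k *v ^0 +v -1k *v ^1) +v (⊖ `0) *v ^2)) refl >>
          cong (mk a₁ 1F b₁ <+>_) (cong (λ t → 1F *> t <+> (- m) *> x) (D >> cong₂ (λ p r → mk p 0F r) ek em) >> mk-lin 1F (k *> a) 0F (m *> l *> b) (- m) a 0F (l *> b) >> trans
           (mk3 (vsolve (k :: m) [ a ] (1k *v `0 *v ^0 +v (⊖ `1) *v ^0) ((`0 -e `1) *v ^0) refl) (solve (k :: m) (1k *e 0k +e (⊖ `1) *e 0k) ((`0 -e `1) *e 0k) refl) (vsolve (k :: m) [ l *> b ] (1k *v `1 *v ^0 +v (⊖ `1) *v ^0) ((`0 -e `1) *v 0w) refl)) (sym (mk-∙ (k - m) a 0F 0c)))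
         ind : ∀ c d → lin (c :: d) (x :: mk a₁ 1F b₁ <+> (k - m) *> mk a 0F 0c) ≡ 0v → c :: d ≡ 0c
         ind c d w = fin d0 w
          where
           d0 : d ≡ 0F
           d0 = pr (mk-inj {a' = 0c} {0F} {0c} (sym (cong (λ t → c *> x <+> d *> t) (vsolve [ k - m ] (mk a₁ 1F b₁ :: mk a 0F 0c) (^0 +v `0 *v ^1) (1k *v ^0 +v `0 *v ^1) refl >> mk-lin 1F a₁ 1F b₁ (k - m) a 0F 0c) >> mk-lin c a 0F (l *> b) d _ _ _) >>
               vsolve (c :: d) (x :: mk a₁ 1F b₁ <+> (k - m) *> mk a 0F 0c) (`0 *v ^0 +v `1 *v ^1) (`0 *v ^0 +v (`1 *v ^1 +v 0w)) refl >> w >> refl))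
            where
             pr : ∀ {A B : Set} → A × (c * 0F + d * (1F * 1F + (k - m) * 0F) ≡ 0F) × B → d ≡ 0F
             pr (_ , h , _) = solve (c ∷ d :: k - m) (`1) (0k +e 1k *e ((`0 *e 0k +e `1 *e (1k *e 1k +e `2 *e 0k)) -e 0k)) refl ⇐ 1F *: h
           xnz : x ≢ 0v
           xnz h = anz (fst (mk-inj {a} {0F} {l *> b} {0c} {0F} {0c} (h >> refl)))
           fin : d ≡ 0F → lin (c :: d) (x :: mk a₁ 1F b₁ <+> (k - m) *> mk a 0F 0c) ≡ 0v → c :: d ≡ 0c
           fin refl w = cong (λ c → c :: 0F) (∙-0 xnz (vsolve [ c ] (x :: mk a₁ 1F b₁ <+> (k - m) *> mk a 0F 0c) (`0 *v ^0) (`0 *v ^0 +v (0k *v ^1 +v 0w)) refl >> w))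

 -- Counting the lines of H(q) by flags

 module HexBounds where
  open Lines
  open Vectors3 hiding (perp)
  open Cross
  open Octonions
  open Terms
  open Counting
  open HexLines
  open HexFlags
  open FiniteField F using (complete)

  -- `κ` bounds the lines at one flag: the line joining its two points, and `q` lines through each
  -- of the `q ∸ 1` other points of that line.
  q0 κ : ℕ
  q0 = ℕ.pred q
  κ = suc (q0 ℕ.* q)

  opaque
   q≡ : q ≡ suc q0
   q≡ = go q≥2
    where
     go : ∀ {m} → 2 ℕ.≤ m → m ≡ suc (ℕ.pred m)
     go (s≤s _) = refl

  nz : List K
  nz = List.filter (λ x → ¬? (x ≟ 0F)) elements

  opaque
   nz-len : length nz ℕ.≤ q0
   nz-len = ℕₚ.≤-pred (ℕₚ.≤-trans (Listₚ.filter-notAll (λ x → ¬? (x ≟ 0F)) elements (Any.map (λ { refl n → n refl }) (complete 0F))) (ℕₚ.≤-reflexive q≡))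

  module DotLemmas where
   ind-nz : ∀ {p r : K3} → Ind (p :: r) → ∀ t → p <+> t *> r ≢ 0c
   ind-nz {p} {r} i t z = 1≢0 (coef i (1F :: t) (vsolve [ t ] (p :: r) (1k *v ^0 +v (`0 *v ^1 +v 0w)) (^0 +v `0 *v ^1) refl >> z) zero)

   dot-+∙ : ∀ u a t b → dot u (a <+> t *> b) ≡ dot u a + t * dot u b
   dot-+∙ u a t b = cong (dot u) (vsolve [ t ] (a :: b) (^0 +v `0 *v ^1) (1k *v ^0 +v `0 *v ^1) refl) >> dot-lin u 1F a t b >> cong (_+ t * dot u b) (*-identityˡ _)

   dot-∙ʳ : ∀ u t b → dot u (t *> b) ≡ t * dot u b
   dot-∙ʳ u t b = cong (dot u) (vsolve [ t ] [ b ] (`0 *v ^0) (0w +v `0 *v ^0) refl) >> dot-+∙ u 0c t b >> cong (_+ t * dot u b) (dot-0 u) >> +-identityˡ _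

   dot-+0 : ∀ u a t b → dot u b ≡ 0F → dot u (a <+> t *> b) ≡ dot u a
   dot-+0 u a t b e = dot-+∙ u a t b >> cong (λ z → dot u a + t * z) e >> solve (dot u a :: t) (`0 +e `1 *e 0k) (`0) refl

   dot-span : ∀ {k} {A : Vec K3 k} u → VAll (λ a → dot u a ≡ 0F) A → ∀ {z} → z ∈< A > → dot u z ≡ 0F
   dot-span u [] ([] , refl) = dot-0 u
   dot-span {A = a ∷ A} u (h ∷ hs) (c ∷ cs , refl) = cong (dot u) (vsolve [ c ] (a :: lin cs A) (`0 *v ^0 +v ^1) (`0 *v ^0 +v 1k *v ^1) refl) >> dot-lin u c a 1F (lin cs A) >>
     cong₂ (λ p r → c * p + 1F * r) h (dot-span u hs (cs , refl)) >> solve [ c ] (`0 *e 0k +e 1k *e 0k) 0k refl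

   perp∈ : ∀ {α p r z} → α ≢ 0c → Ind (p :: r) → dot α p ≡ 0F → dot α r ≡ 0F → dot α z ≡ 0F → z ∈< p :: r >
   perp∈ {α} {p} {r} {z} αn i ep er ez with ∈? z (p :: r) | co-vector α αn
   ... | yes m | _ = m
   ... | no n | y , d = ⊥-elim (d (dot-comm y α >> dot-span α (ez ∷ ep :: er) (basis∈ (ext i n) y)))

  open DotLemmas

  module Sums (S : K3 → Ln {7} → Set) (scale : ∀ {k z ℓ} → k ≢ 0F → S z ℓ → S (k *> z) ℓ) where
   opaque
    am-line : ∀ {p r k k'} → (∀ t → AtMost (S (p <+> t *> r)) k) → AtMost (S r) k' → AtMost (λ ℓ → ∃ λ z → z ≢ 0c × z ∈< p :: r > × S z ℓ) (q ℕ.* k ℕ.+ k')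
    am-line {p} {r} h h' = am-⊆ f ℕₚ.≤-refl (am-∪ (am-Σ (λ t → S (p <+> t *> r)) elements (λ _ → h _)) h')
     where
      f : ∀ ℓ → (∃ λ z → z ≢ 0c × z ∈< p :: r > × S z ℓ) → (∃ λ t → t ∈ elements × S (p <+> t *> r) ℓ) ⊎ S r ℓ
      f ℓ (z , nz , (c :: d , e) , s) with c ≟ 0F
      ... | no n = inj₁ (inv c n * d , complete _ , subst (λ z → S z ℓ) (vsolve (c ∷ d :: inv c n) (p ∷ r :: z) (`2 *v ^2) ((^0 +v (`2 *e `1) *v ^1) +v ((⊖ `2) *v ((`0 *v ^0 +v (`1 *v ^1 +v 0w)) -v ^2) +v (`0 *e `2 -e 1k) *v ^0)) refl
         ⇐v ((- inv c n) ∙: e) &v (inv-r c n s: p)) (scale (inv≢0 c n) s))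
      ... | yes refl with d ≟ 0F
      ... | yes refl = ⊥-elim (nz (sym e >> (vsolve [] (p :: r) (0k *v ^0 +v (0k *v ^1 +v 0w)) 0w refl)))
      ... | no n = inj₂ (subst (λ z → S z ℓ) (vsolve (d :: inv d n) (p ∷ r :: z) (`1 *v ^2) (^1 +v ((⊖ `1) *v ((0k *v ^0 +v (`0 *v ^1 +v 0w)) -v ^2) +v (`0 *e `1 -e 1k) *v ^1)) refl
         ⇐v ((- inv d n) ∙: e) &v (inv-r d n s: r)) (scale (inv≢0 d n) s))

    -- The points off a line form an affine plane; scaling normalises `dot α z` to the value
    -- `dot α y` of a fixed `y`, and `q * q` translates of `y` remain.
    am-off : ∀ α {k} → α ≢ 0c → (∀ z → dot α z ≢ 0F → AtMost (S z) k) → AtMost (λ ℓ → ∃ λ z → dot α z ≢ 0F × S z ℓ) (q ℕ.* (q ℕ.* k))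
    am-off α {k} αn h with perp-basis α αn | co-vector α αn
    ... | p , r , i , ep , er | y , dy = am-⊆ f ℕₚ.≤-refl (am-Σ T elements (λ {s} _ → am-Σ (λ t → S ((y <+> s *> p) <+> t *> r)) elements (λ {t} _ → h _ (λ e → dαy (sym (dot-+0 α (y <+> s *> p) t r er >> dot-+0 α y s p ep) >> e)))))
     where
      dαy : dot α y ≢ 0F
      dαy e = dy (dot-comm y α >> e)
      T : K → Ln {7} → Set
      T s ℓ = ∃ λ t → t ∈ elements × S ((y <+> s *> p) <+> t *> r) ℓ
      f : ∀ ℓ → (∃ λ z → dot α z ≢ 0F × S z ℓ) → ∃ λ s → s ∈ elements × T s ℓ
      f ℓ (z , dz , s) = go (perp∈ {z = k' *> z <+> -1F *> y} αn i ep er (dot-lin α k' z -1F y >> (solve (dot α z ∷ dot α y :: inv (dot α z) dz) (`2 *e `1 *e `0 +e -1k *e `1) (0k +e `1 *e (`0 *e `2 -e 1k)) refl ⇐ dot α y *: inv-r (dot α z) dz)))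
       where
        k' : K
        k' = inv (dot α z) dz * dot α y
        go : k' *> z <+> -1F *> y ∈< p :: r > → ∃ λ s → s ∈ elements × T s ℓ
        go (c :: d , e) = c , complete c , d , complete d , subst (λ z → S z ℓ) (vsolve (k' ∷ c :: d) (z ∷ y ∷ p :: r) (`0 *v ^0) ((^1 +v `1 *v ^2) +v `2 *v ^3 +v -1k *v ((`1 *v ^2 +v (`2 *v ^3 +v 0w)) -v (`0 *v ^0 +v -1k *v ^1))) refl ⇐v -1F ∙: e)
          (scale (*≢0 (inv≢0 _ dz) dαy) s)

  val : Q7 → Q7 → K
  val (f₀ ∷ f₁ ∷ f2 ∷ f3 ∷ f4 ∷ f5 :: f6) (x0 ∷ x₁ ∷ x₂ ∷ x3 ∷ x4 ∷ x5 :: x6) = f₀ * x0 + f₁ * x₁ + f2 * x₂ + f3 * x3 + (f4 * x4 + f5 * x5 + f6 * x6)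

  vE : Vec Expr 7 → Vec Expr 7 → Expr
  vE (f₀ ∷ f₁ ∷ f2 ∷ f3 ∷ f4 ∷ f5 :: f6) (x0 ∷ x₁ ∷ x₂ ∷ x3 ∷ x4 ∷ x5 :: x6) = f₀ *e x0 +e f₁ *e x₁ +e f2 *e x₂ +e f3 *e x3 +e (f4 *e x4 +e f5 *e x5 +e f6 *e x6)

  opaque
   val-mk : ∀ α ε β a e b → val (mk α ε β) (mk a e b) ≡ dot α a + ε * e + dot β b
   val-mk (_ ∷ _ :: _) ε (_ ∷ _ :: _) (_ ∷ _ :: _) e (_ ∷ _ :: _) = refl

  opaque
   val-lin : ∀ f c x d y → val f (c *> x <+> d *> y) ≡ c * val f x + d * val f y
   val-lin f@(_ ∷ _ ∷ _ ∷ _ ∷ _ ∷ _ :: _) c x@(_ ∷ _ ∷ _ ∷ _ ∷ _ ∷ _ :: _) d y@(_ ∷ _ ∷ _ ∷ _ ∷ _ ∷ _ :: _) =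
    solve (lst f (lst x (lst y (c :: d)))) (vE X7 (`21 ⊡′ Y7 ⊞′ `22 ⊡′ Z7)) (`21 *e vE X7 Y7 +e `22 *e vE X7 Z7) refl

  Zero : Q7 → Ln → Set
  Zero f ℓ = HL ℓ × VAll (λ x → val f x ≡ 0F) (bas ℓ)

  opaque
   val∈ : ∀ {k f} {A : Vec Q7 k} → VAll (λ x → val f x ≡ 0F) A → ∀ {x} → x ∈< A > → val f x ≡ 0F
   val∈ {f = f} [] ([] , refl) = cong (val f) (vsolve [] [] 0w (0k *v 0w +v 0k *v 0w) refl) >> val-lin f 0F 0v 0F 0v >> solve [ val f 0v ] (0k *e `0 +e 0k *e `0) 0k refl
   val∈ {f = f} {a ∷ A} (h ∷ hs) (c ∷ cs , refl) = cong (val f) (vsolve [ c ] (a :: lin cs A) (`0 *v ^0 +v ^1) (`0 *v ^0 +v 1k *v ^1) refl) >> val-lin f c a 1F (lin cs A) >>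
      cong₂ (λ p r → c * p + 1F * r) h (val∈ {f = f} hs (cs , refl)) >> solve [ c ] (`0 *e 0k +e 1k *e 0k) 0k refl

  module FlagCount (f : Q7) where
   Fl : K3 → K3 → Ln → Set
   Fl a b ℓ = Zero f ℓ × At a b ℓ

   opaque
    flag-all : ∀ {a b} → a ≢ 0c → b ≢ 0c → AtMost (Fl a b) κ
    flag-all {a} {b} an bn = am-⊆ g (s≤s (ℕₚ.*-monoˡ-≤ q nz-len)) (am-∪ (am-1 {S = λ ℓ → mk a 0F 0c ∈< bas ℓ > × mk 0c 0F b ∈< bas ℓ >} (mk a 0F 0c) (mk 0c 0F b) (λ ℓ s → i , s)) (am-Σ T nz (λ {l} l∈ → thick l (snd (∈ₚ.∈-filter⁻ (λ x → ¬? (x ≟ 0F)) {xs = elements} l∈)))))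
     where
      T : K → Ln {7} → Set
      T l ℓ = HL ℓ × mk a 0F (l *> b) ∈< bas ℓ > × ∃₂ λ a₀ b₀ → mk a₀ 1F b₀ ∈< bas ℓ >
      g : ∀ ℓ → Fl a b ℓ → (mk a 0F 0c ∈< bas ℓ > × mk 0c 0F b ∈< bas ℓ >) ⊎ ∃ λ l → l ∈ nz × T l ℓ
      g ℓ (_ , inj₁ s) = inj₁ s
      g ℓ ((h , _) , inj₂ (l , ln , x∈ , z)) = inj₂ (l , ∈ₚ.∈-filter⁺ (λ x → ¬? (x ≟ 0F)) (complete l) ln , h , x∈ , z)
      i : Ind (mk a 0F 0c :: mk 0c 0F b)
      i (c :: d) e = pr (mk-inj {a' = 0c} {0F} {0c} (sym (mk-lin c a 0F 0c d 0c 0F b) >> vsolve (c :: d) (mk a 0F 0c :: mk 0c 0F b) (`0 *v ^0 +v `1 *v ^1) (`0 *v ^0 +v (`1 *v ^1 +v 0w)) refl >> e))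
       where
        pr : ∀ {A : Set} → c *> a <+> d *> 0c ≡ 0c × A × c *> 0c <+> d *> b ≡ 0c → c :: d ≡ 0c
        pr (p , _ , r) = cong₂ (λ c d → c :: d) (∙-0 an (vsolve (c :: d) [ a ] (`0 *v ^0) (`0 *v ^0 +v `1 *v 0w) refl >> p)) (∙-0 bn (vsolve (c :: d) [ b ] (`1 *v ^0) (`0 *v 0w +v `1 *v ^0) refl >> r))
      thick : ∀ l → l ≢ 0F → AtMost (T l) q
      thick l ln with canon a b l an bn ln
      ... | inj₁ n = am-⊆ (λ _ s → s) z≤n (am-0 n)
      ... | inj₂ (z , h) = am-⊆ (λ ℓ s → let r , y∈ , i = h ℓ s in r , complete r , i , fst (snd s) , y∈) (ℕₚ.≤-reflexive (ℕₚ.*-identityʳ q))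
         (am-Σ (λ r ℓ → Ind (mk a 0F (l *> b) :: z <+> r *> mk a 0F 0c) × mk a 0F (l *> b) ∈< bas ℓ > × z <+> r *> mk a 0F 0c ∈< bas ℓ >) elements (λ {r} _ → am-1 (mk a 0F (l *> b)) (z <+> r *> mk a 0F 0c) (λ ℓ s → s)))

   PerA : K3 → Ln → Set
   PerA a ℓ = ∃ λ b → b ≢ 0c × dot a b ≡ 0F × Fl a b ℓ

   opaque
    scaleA : ∀ {k a ℓ} → k ≢ 0F → PerA a ℓ → PerA (k *> a) ℓ
    scaleA {k} {a} {ℓ} kn (b , bn , e , z , h) = b , bn , trans (dot-comm (k *> a) b) (dot-∙ʳ b k a >> cong (k *_) (dot-comm b a >> e) >> zeroʳ k) , z , At-scaleˡ {ℓ = ℓ} kn h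

    scaleB : ∀ {a k b ℓ} → k ≢ 0F → Fl a b ℓ → Fl a (k *> b) ℓ
    scaleB {ℓ = ℓ} kn (z , h) = z , At-scaleʳ {ℓ = ℓ} kn h

    perA-line : ∀ {a p r k k'} → a ≢ 0c → Ind (p :: r) → dot a p ≡ 0F → dot a r ≡ 0F → (∀ t → AtMost (Fl a (p <+> t *> r)) k) → AtMost (Fl a r) k' → AtMost (PerA a) (q ℕ.* k ℕ.+ k')
    perA-line {a} an i ep er h h' = am-⊆ (λ { ℓ (b , bn , e , s) → b , bn , perp∈ an i ep er e , s }) ℕₚ.≤-refl (Sums.am-line (Fl a) (λ {k} {b} {ℓ} → scaleB {a} {k} {b} {ℓ}) h h')

    perA-all : ∀ {a} → a ≢ 0c → AtMost (PerA a) (q ℕ.* κ ℕ.+ κ)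
    perA-all {a} an with perp-basis a an
    ... | p , r , i , ep , er = perA-line an i ep er (λ t → flag-all an (ind-nz i t)) (flag-all an (ind-nonzero (ind-tail i)))

   open Sums PerA (λ {k} {a} {ℓ} → scaleA {k} {a} {ℓ}) public

   opaque
    by-a : ∀ α {k k'} → α ≢ 0c → AtMost (λ ℓ → ∃ λ a → dot α a ≢ 0F × PerA a ℓ) k → AtMost (λ ℓ → ∃ λ a → a ≢ 0c × dot α a ≡ 0F × PerA a ℓ) k' → AtMost (Zero f) (k ℕ.+ k')
    by-a α αn h h' = am-⊆ g ℕₚ.≤-refl (am-∪ h h')
     where
      g : ∀ ℓ → Zero f ℓ → (∃ λ a → dot α a ≢ 0F × PerA a ℓ) ⊎ (∃ λ a → a ≢ 0c × dot α a ≡ 0F × PerA a ℓ)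
      g ℓ s with flag {ℓ} (fst s)
      ... | a , b , an , bn , e , h with dot α a ≟ 0F
      ... | yes z = inj₂ (a , an , z , b , bn , e , s , h)
      ... | no n = inj₁ (a , n , b , bn , e , s , h)

    perp-line : ∀ {α p r k k'} → α ≢ 0c → Ind (p :: r) → dot α p ≡ 0F → dot α r ≡ 0F → (∀ t → AtMost (PerA (p <+> t *> r)) k) → AtMost (PerA r) k' →
          AtMost (λ ℓ → ∃ λ a → a ≢ 0c × dot α a ≡ 0F × PerA a ℓ) (q ℕ.* k ℕ.+ k')
    perp-line αn i ep er h h' = am-⊆ (λ { ℓ (a , an , e , s) → a , an , perp∈ αn i ep er e , s }) ℕₚ.≤-refl (am-line h h')

  private
   dot≢⇒nz : ∀ {α a} → dot α a ≢ 0F → a ≢ 0c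
   dot≢⇒nz {α} n refl = n (dot-0 α)

   total≡ : ∀ p → let q = suc p ; k = suc (p ℕ.* q) ; K = q ℕ.* k ℕ.+ k in q ℕ.* (q ℕ.* K) ℕ.+ (q ℕ.* K ℕ.+ K) ≡ q ℕ.^ 5 ℕ.+ q ℕ.^ 4 ℕ.+ q ℕ.^ 3 ℕ.+ q ℕ.^ 2 ℕ.+ q ℕ.+ 1
   total≡ = S.solve 1 (λ p → let open S ; q = con 1 :+ p ; k = con 1 :+ p :* q ; K = q :* k :+ k in q :* (q :* K) :+ (q :* K :+ K) := q :^ 5 :+ q :^ 4 :+ q :^ 3 :+ q :^ 2 :+ q :+ con 1) refl
    where module S = Data.Nat.Solver.+-*-Solver

  opaque
   -- There are `q² + q + 1` points `a`, each with `q + 1` points `b`, and `κ` lines at each flag.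
   -- With the zero functional, `Zero` describes all lines.
   total : AtMost HL (q ℕ.^ 5 ℕ.+ q ℕ.^ 4 ℕ.+ q ℕ.^ 3 ℕ.+ q ℕ.^ 2 ℕ.+ q ℕ.+ 1)
   total = subst (AtMost HL) (subst (λ z → let k = suc (ℕ.pred z ℕ.* z) ; K = z ℕ.* k ℕ.+ k in z ℕ.* (z ℕ.* K) ℕ.+ (z ℕ.* K ℕ.+ K) ≡ z ℕ.^ 5 ℕ.+ z ℕ.^ 4 ℕ.+ z ℕ.^ 3 ℕ.+ z ℕ.^ 2 ℕ.+ z ℕ.+ 1) (sym q≡) (total≡ q0))
     (am-⊆ (λ ℓ h → h , VAll.universal v0 (bas ℓ)) ℕₚ.≤-refl (by-a α αn (am-off α αn (λ z n → perA-all (dot≢⇒nz {α} n))) on-α))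
    where
     α : K3
     α = 1F ∷ 0F :: 0F
     αn : α ≢ 0c
     αn e = 1≢0 (cong Vec.head e)
     v0 : ∀ x → val 0v x ≡ 0F
     v0 x@(_ ∷ _ ∷ _ ∷ _ ∷ _ ∷ _ :: _) = solve (lst x []) (0k *e `0 +e 0k *e `1 +e 0k *e `2 +e 0k *e `3 +e (0k *e `4 +e 0k *e `5 +e 0k *e `6)) 0k refl
     open FlagCount 0v
     on-α : AtMost (λ ℓ → ∃ λ a → a ≢ 0c × dot α a ≡ 0F × PerA a ℓ) (q ℕ.* (q ℕ.* κ ℕ.+ κ) ℕ.+ (q ℕ.* κ ℕ.+ κ))
     on-α with perp-basis α αn
     ... | p , r , i , ep , er = perp-line αn i ep er (λ t → perA-all (ind-nz i t)) (perA-all (ind-nonzero (ind-tail i)))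

 -- Counting the lines of H(q) in a hyperplane

 module HexHyperplanes where
  open Lines
  open Vectors3 hiding (perp)
  open Cross
  open Octonions
  open Terms
  open Counting
  open HexLines
  open HexFlags
  open HexBounds
  open DotLemmas

  -- The contributions are `q²` points `a` off the line `α` with `q` lines each, `q` points on it
  -- with one complete flag each, and one point with `q + 1` complete flags.
  hpBound : ℕ
  hpBound = q ℕ.* (q ℕ.* q) ℕ.+ (q ℕ.* κ ℕ.+ (q ℕ.* κ ℕ.+ κ))

  module Generic (α : K3) (ε : K) (β : K3) (αn : α ≢ 0c) (βn : β ≢ 0c) where
   open FlagCount (mk α ε β)
   private
    vab : ∀ {ℓ a b} → Zero (mk α ε β) ℓ → mk a 0F b ∈< bas ℓ > → dot α a + dot β b ≡ 0F
    vab {ℓ} {a} {b} (_ , z) m = solve (dot α a ∷ dot β b :: ε) (`0 +e `1) (`0 +e `2 *e 0k +e `1) refl >> sym (val-mk α ε β a 0F b) >> val∈ {f = mk α ε β} z m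

    +0 : ∀ {x y} → x + y ≡ 0F → y ≡ 0F → x ≡ 0F
    +0 {x} e refl = sym (+-identityʳ x) >> e

    0+ : ∀ {x y} → x + y ≡ 0F → x ≡ 0F → y ≡ 0F
    0+ {_} {y} e refl = sym (+-identityˡ y) >> e

    none1 : ∀ {a b} → dot α a ≢ 0F → dot β b ≡ 0F → AtMost (Fl a b) 0
    none1 {a} {b} n e = am-0 λ { ℓ (z , inj₁ (p , _)) → n (+0 (vab {ℓ} z p) (dot-0 β)) ; ℓ (z , inj₂ (l , _ , p , _)) → n (+0 (vab {ℓ} z p) (dot-∙ʳ β l b >> cong (l *_) e >> zeroʳ l)) }

    none2 : ∀ {a b ℓ} → dot α a ≡ 0F → dot β b ≢ 0F → ¬ Fl a b ℓ
    none2 {a} {b} {ℓ} e n (z , inj₁ (_ , p)) = n (0+ (vab {ℓ} z p) (dot-0 α))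
    none2 {a} {b} {ℓ} e n (z , inj₂ (l , ln , p , _)) = n (*-cancel-0 l ln (sym (dot-∙ʳ β l b) >> 0+ (vab {ℓ} z p) e))

    -- On such a flag the equation of the hyperplane fixes the point `a + l b` of the line, and then
    -- the parameter of the line through that point.
    single : ∀ {a b} → dot α a ≢ 0F → dot β b ≢ 0F → AtMost (Fl a b) 1
    single {a} {b} na nb = go (canon a b l (dot≢ {α} na) (dot≢ {β} nb) l≢0)
     where
      dot≢ : ∀ {u z} → dot u z ≢ 0F → z ≢ 0c
      dot≢ {u} n refl = n (dot-0 u)
      l : K
      l = (- dot α a) * inv (dot β b) nb
      l≢0 : l ≢ 0F
      l≢0 = *≢0 (-≢0 na) (inv≢0 _ nb)
      T : Ln {7} → Set
      T ℓ = HL ℓ × mk a 0F (l *> b) ∈< bas ℓ > × ∃₂ λ a₀ b₀ → mk a₀ 1F b₀ ∈< bas ℓ >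
      at-l : ∀ {ℓ} → Fl a b ℓ → T ℓ
      at-l {ℓ} (z , inj₁ (p , _)) = ⊥-elim (na (+0 (vab {ℓ} z p) (dot-0 β)))
      at-l {ℓ} (z , inj₂ (l' , _ , p , y)) = fst z , subst (λ l → mk a 0F (l *> b) ∈< bas ℓ >) eq p , y
       where
        eq : l' ≡ l
        eq = solve (dot α a ∷ dot β b ∷ inv (dot β b) nb :: l') (`3) ((⊖ `0) *e `2 +e ((⊖ `3) *e (`1 *e `2 -e 1k) +e `2 *e ((`0 +e `3 *e `1) -e 0k))) refl
         ⇐ (- l') *: inv-r (dot β b) nb & inv (dot β b) nb *: trans (cong (dot α a +_) (sym (dot-∙ʳ β l' b))) (vab {ℓ} z p)
      go : (∀ ℓ → ¬ T ℓ) ⊎ (∃ λ z → ∀ ℓ → T ℓ → ∃ λ r → z <+> r *> mk a 0F 0c ∈< bas ℓ > × Ind (mk a 0F (l *> b) :: z <+> r *> mk a 0F 0c)) → AtMost (Fl a b) 1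
      go (inj₁ n) = am-⊆ (λ _ s → s) z≤n (am-0 (λ ℓ s → n ℓ (at-l {ℓ} s)))
      go (inj₂ (z , h)) = am-1 (mk a 0F (l *> b)) (z <+> r₀ *> mk a 0F 0c) (λ ℓ s → fin ℓ s (h ℓ (at-l {ℓ} s)))
       where
        r₀ : K
        r₀ = (- val (mk α ε β) z) * inv (dot α a) na
        fin : ∀ ℓ → Fl a b ℓ → (∃ λ r → z <+> r *> mk a 0F 0c ∈< bas ℓ > × Ind (mk a 0F (l *> b) :: z <+> r *> mk a 0F 0c)) → Ind (mk a 0F (l *> b) :: z <+> r₀ *> mk a 0F 0c) × mk a 0F (l *> b) ∈< bas ℓ > × z <+> r₀ *> mk a 0F 0c ∈< bas ℓ >
        fin ℓ s (r , m , i) = subst (λ r → Ind (mk a 0F (l *> b) :: z <+> r *> mk a 0F 0c)) eq i , fst (snd (at-l {ℓ} s)) , subst (λ r → z <+> r *> mk a 0F 0c ∈< bas ℓ >) eq m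
         where
          h0 : val (mk α ε β) z + r * dot α a ≡ 0F
          h0 = (cong₂ _+_ (sym (*-identityˡ _)) (cong (r *_) (solve (dot α a :: ε) (`0) (`0 +e `1 *e 0k +e 0k) refl >> cong (λ t → dot α a + ε * 0F + t) (sym (dot-0 β)) >> sym (val-mk α ε β a 0F 0c)))) >>
           sym (val-lin (mk α ε β) 1F z r (mk a 0F 0c)) >> cong (val (mk α ε β)) (vsolve [ r ] (z :: mk a 0F 0c) (1k *v ^0 +v `0 *v ^1) (^0 +v `0 *v ^1) refl) >> val∈ {f = mk α ε β} (snd (fst s)) m
          eq : r ≡ r₀
          eq = solve (dot α a ∷ val (mk α ε β) z ∷ inv (dot α a) na :: r) (`3) ((⊖ `1) *e `2 +e ((⊖ `3) *e (`0 *e `2 -e 1k) +e `2 *e ((`1 +e `3 *e `0) -e 0k))) refl ⇐ (- r) *: inv-r (dot α a) na & inv (dot α a) na *: h0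

    perA-off′ : ∀ {a p r} → dot α a ≢ 0F → Ind (p :: r) → dot a p ≡ 0F → dot a r ≡ 0F → dot β r ≡ 0F → AtMost (PerA a) q
    perA-off′ {a} {p} {r} na i ep er e = am-⊆ (λ _ s → s) (ℕₚ.≤-reflexive (ℕₚ.+-identityʳ _ >> ℕₚ.*-identityʳ q)) (perA-line (λ { refl → na (dot-0 α) }) i ep er (λ t → try (p <+> t *> r)) (none1 na e))
     where
      try : ∀ b → AtMost (Fl a b) 1
      try b with dot β b ≟ 0F
      ... | no n = single na n
      ... | yes e = am-⊆ (λ _ s → s) z≤n (none1 na e)

    perA-off : ∀ a → dot α a ≢ 0F → AtMost (PerA a) q
    perA-off a na with perp-basis a (λ { refl → na (dot-0 α) })
    ... | p , r , i , ep , er with dot β r ≟ 0F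
    ... | yes e = perA-off′ na i ep er e
    ... | no n = perA-off′ na i' er (dot-+∙ a p c r >> cong₂ (λ x y → x + c * y) ep er >> solve [ c ] (0k +e `0 *e 0k) 0k refl) es
     where
      c : K
      c = - (inv (dot β r) n * dot β p)
      es : dot β (p <+> c *> r) ≡ 0F
      es = dot-+∙ β p c r >> (solve (dot β p ∷ dot β r :: inv (dot β r) n) (`0 +e (⊖ (`2 *e `0)) *e `1) (0k +e (⊖ `0) *e (`1 *e `2 -e 1k)) refl ⇐ (- dot β p) *: inv-r (dot β r) n)
      i' : Ind (r :: p <+> c *> r)
      i' = ind-gen i ((- c :: 1F , vsolve [ c ] (p :: r) ((⊖ `0) *v ^1 +v (1k *v (^0 +v `0 *v ^1) +v 0w)) (^0) refl) :: hd∈)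

    -- For `a` on `α` only flags with `dot β b` zero contribute, and `cross a β` is the only such
    -- `b` up to a scalar.
    perA-on : ∀ a → a ≢ 0c → dot α a ≡ 0F → cross a β ≢ 0c → AtMost (PerA a) κ
    perA-on a an e cn = am-⊆ g ℕₚ.≤-refl (flag-all an cn)
     where
      g : ∀ ℓ → PerA a ℓ → Fl a (cross a β) ℓ
      g ℓ (b , bn , eb , s) with dot β b ≟ 0F
      ... | no n = ⊥-elim (none2 {a} {b} {ℓ} e n s)
      ... | yes z with cross-∥ (cross a β) b cn (bac a β b >> cong₂ (λ x y → x *> β <+> (- y) *> a) eb z >> (vsolve [] (β :: a) (0k *v ^0 +v (⊖ 0k) *v ^1) 0w refl))
      ... | r , refl = subst (λ z → Fl a z ℓ) (vsolve (r :: inv r rn) [ cross a β ] (`1 *v `0 *v ^0) (^0 +v (`0 *e `1 -e 1k) *v ^0) refl ⇐v (inv-r r rn s: cross a β)) (scaleB {a} {inv r rn} {r *> cross a β} {ℓ} (inv≢0 r rn) s)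
       where
        rn : r ≢ 0F
        rn refl = bn (vsolve [] [ cross a β ] (0k *v ^0) 0w refl)

    ∥β : ∀ {a} → a ≢ 0c → (∀ r → β ≢ r *> a) → cross a β ≢ 0c
    ∥β {a} an h e = let r , p = cross-∥ a β an e in h r p

    -- When `β` itself is a point of `α`, it is the exceptional point: there `cross a β` vanishes
    -- and all `q + 1` flags may contribute.
    along : ∀ {p} → dot α β ≡ 0F → Ind (p :: β) → dot α p ≡ 0F → AtMost (λ ℓ → ∃ λ a → a ≢ 0c × dot α a ≡ 0F × PerA a ℓ) (q ℕ.* κ ℕ.+ (q ℕ.* κ ℕ.+ κ))
    along {p} e i ep = perp-line αn i ep e (λ t → perA-on (p <+> t *> β) (ind-nz i t) (dot-+0 α p t β e >> ep) (∥β (ind-nz i t) (λ s h → 1≢0 (t0 s t (coef i (s :: s * t - 1F) (rel s t h)))))) (perA-all βn)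
     where
      rel : ∀ s t → β ≡ s *> (p <+> t *> β) → lin (s :: s * t - 1F) (p :: β) ≡ 0c
      rel s t h = vsolve (s :: t) (p :: β) (`0 *v ^0 +v ((`0 *e `1 -e 1k) *v ^1 +v 0w)) (0w +v -1k *v (^1 -v `0 *v (^0 +v `1 *v ^1))) refl ⇐v -1F ∙: h
      t0 : ∀ s t → (∀ j → lookup (s :: s * t - 1F) j ≡ 0F) → 1F ≡ 0F
      t0 s t h = solve (s :: t) 1k (0k +e (`1 *e (`0 -e 0k) +e -1k *e ((`0 *e `1 -e 1k) -e 0k))) refl ⇐ t *: h zero & -1F *: h (suc zero)

    on-α : AtMost (λ ℓ → ∃ λ a → a ≢ 0c × dot α a ≡ 0F × PerA a ℓ) (q ℕ.* κ ℕ.+ (q ℕ.* κ ℕ.+ κ))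
    on-α with perp-basis α αn
    ... | p , r , i , ep , er with dot α β ≟ 0F
    ... | no n = am-⊆ (λ _ s → s) (ℕₚ.+-monoʳ-≤ (q ℕ.* κ) (ℕₚ.m≤n+m κ (q ℕ.* κ))) (perp-line αn i ep er (λ t → ok (p <+> t *> r) (ind-nz i t) (dot-+0 α p t r er >> ep)) (ok r (ind-nonzero (ind-tail i)) er))
     where
      ok : ∀ a → a ≢ 0c → dot α a ≡ 0F → AtMost (PerA a) κ
      ok a an e = perA-on a an e (∥β an (λ s h → n (cong (dot α) h >> dot-∙ʳ α s a >> cong (s *_) e >> zeroʳ s)))
    ... | yes e with ∈? p [ β ] | ∈? r [ β ]
    ... | yes h | yes h' = ⊥-elim (ind-no ℕₚ.≤-refl [ β ] i (h :: h'))
    ... | no h | _ = along e (ext (ind1 βn) h) ep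
    ... | yes _ | no h = along e (ext (ind1 βn) h) er

   opaque
    generic : AtMost (Zero (mk α ε β)) hpBound
    generic = by-a α αn (am-off α αn perA-off) on-α

  private
   pull : (G : Aut) → ∀ {f f' k} → (∀ x → val f (Aut.to G x) ≡ val f' x) → AtMost (Zero f') k → AtMost (Zero f) k
   pull G {f} {f'} e (l , le , c) = List.map (λ (x , y) → to x , to y) l , ℕₚ.≤-trans (ℕₚ.≤-reflexive (Listₚ.length-map _ l)) le , cov
    where
     open Aut G
     open AutLemmas G
     cov : Covers (Zero f) (List.map (λ (x , y) → to x , to y) l)
     cov ℓ@(subspace (x :: y) i) (h , zx :: zy) = Anyₚ.map⁺ (Any.map (λ (j , p , r) → to-ind j , back p , back r)
       (c (ln (from x) (from y) (from-ind i)) (from-⟂ h , trans (sym (e (from x))) (cong (val f) (to-from x) >> zx) :: trans (sym (e (from y))) (cong (val f) (to-from y) >> zy))))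
      where
       back : ∀ {z} → z ∈< from x :: from y > → to z ∈< x :: y >
       back {z} m = subst₂ (λ a b → to z ∈< a :: b >) (to-from x) (to-from y) (to-∈ m)

   nz3 : ∀ {a b c : K} → _≢_ {A = K3} (a ∷ b :: c) 0c → a ≢ 0F ⊎ b ≢ 0F ⊎ c ≢ 0F
   nz3 {a} {b} {c} n with a ≟ 0F | b ≟ 0F | c ≟ 0F
   ... | no h | _ | _ = inj₁ h
   ... | yes _ | no h | _ = inj₂ (inj₁ h)
   ... | yes _ | yes _ | no h = inj₂ (inj₂ h)
   ... | yes refl | yes refl | yes refl = ⊥-elim (n refl)

   -- The new coefficients are those of the functional composed with the elation.
   bound-el : ∀ f₀ f₁ f2 e g₀ g₁ g₂ → AtMost (Zero (f₀ ∷ f₁ + g₂ ∷ f2 - g₁ ∷ e + f₀ + f₀ ∷ g₀ + e + f₀ ∷ g₁ :: g₂)) hpBound → AtMost (Zero (f₀ ∷ f₁ ∷ f2 ∷ e ∷ g₀ ∷ g₁ :: g₂)) hpBound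
   bound-el f₀ f₁ f2 e g₀ g₁ g₂ = pull elation λ { x@(_ ∷ _ ∷ _ ∷ _ ∷ _ ∷ _ :: _) → solve (f₀ ∷ f₁ ∷ f2 ∷ e ∷ g₀ ∷ g₁ ∷ g₂ ∷ lst x [])
    (vE X7 ((`7 +e 1k *e (`10 +e `10)) +e 1k *e (1k *e `11) ∷ `8 ∷ `9 ∷ `10 +e 1k *e `11 ∷ `11 ∷ `12 +e ⊖ (1k *e `9) :: `13 +e 1k *e `8))
    (vE (`0 ∷ `1 +e `6 ∷ `2 -e `5 ∷ `3 +e `0 +e `0 ∷ `4 +e `3 +e `0 ∷ `5 :: `6) Y7) refl }

   -- f = (0 , e , g): an elation makes the first part nonzero, after a rotation if g₁ = g₂ = 0
   bound-β : ∀ e g₀ g₁ g₂ → _≢_ {A = K3} (g₀ ∷ g₁ :: g₂) 0c → AtMost (Zero (0F ∷ 0F ∷ 0F ∷ e ∷ g₀ ∷ g₁ :: g₂)) hpBound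
   bound-β e g₀ g₁ g₂ n = go (nz3 n)
    where
     base : ∀ g₀ g₁ g₂ → g₁ ≢ 0F ⊎ g₂ ≢ 0F → AtMost (Zero (0F ∷ 0F ∷ 0F ∷ e ∷ g₀ ∷ g₁ :: g₂)) hpBound
     base g₀ g₁ g₂ h = bound-el 0F 0F 0F e g₀ g₁ g₂ (Generic.generic (0F ∷ 0F + g₂ :: 0F - g₁) (e + 0F + 0F) (g₀ + e + 0F ∷ g₁ :: g₂) (λ z → a h (cong (λ z → lookup z (# 2)) z) (cong (λ z → lookup z (# 1)) z)) (λ z → b h (cong (λ z → lookup z (# 1)) z) (cong (λ z → lookup z (# 2)) z)))
      where
       a : g₁ ≢ 0F ⊎ g₂ ≢ 0F → 0F - g₁ ≡ 0F → 0F + g₂ ≡ 0F → ⊥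
       a (inj₁ n) p _ = n (sym (-‿injective-0 p))
       a (inj₂ n) _ r = n (sym (+-identityˡ _) >> r)
       b : g₁ ≢ 0F ⊎ g₂ ≢ 0F → g₁ ≡ 0F → g₂ ≡ 0F → ⊥
       b (inj₁ n) p _ = n p
       b (inj₂ n) _ r = n r
     go : g₀ ≢ 0F ⊎ g₁ ≢ 0F ⊎ g₂ ≢ 0F → AtMost (Zero (0F ∷ 0F ∷ 0F ∷ e ∷ g₀ ∷ g₁ :: g₂)) hpBound
     go (inj₂ h) = base g₀ g₁ g₂ h
     go (inj₁ h) = pull rot (λ { x@(_ ∷ _ ∷ _ ∷ _ ∷ _ ∷ _ :: _) → solve (e ∷ g₀ ∷ g₁ ∷ g₂ ∷ at′ x) (vE (0k ∷ 0k ∷ 0k ∷ `0 ∷ `1 ∷ `2 :: `3) (`5 ∷ `6 ∷ `4 ∷ `7 ∷ `9 ∷ `10 :: `8))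
       (vE (0k ∷ 0k ∷ 0k ∷ `0 ∷ `3 ∷ `1 :: `2) (`4 ∷ `5 ∷ `6 ∷ `7 ∷ `8 ∷ `9 :: `10)) refl }) (base g₂ g₀ g₁ (inj₁ h))
      where
       at′ : Q7 → List K
       at′ x = lst x []

  opaque
   -- `Generic` requires both halves of the functional to be nonzero; the duality, the rotation and
   -- the elation arrange this. A functional with only a middle coefficient takes the elation twice.
   hyperplane : ∀ f → f ≢ 0v → AtMost (Zero f) hpBound
   hyperplane (f₀ ∷ f₁ ∷ f2 ∷ e ∷ g₀ ∷ g₁ :: g₂) n with (f₀ ∷ f₁ :: f2) ≟v 0c | (g₀ ∷ g₁ :: g₂) ≟v 0c
   ... | no a | no b = Generic.generic (f₀ ∷ f₁ :: f2) e (g₀ ∷ g₁ :: g₂) a b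
   ... | yes refl | no b = bound-β e g₀ g₁ g₂ b
   ... | no a | yes refl = pull dual (λ { x@(_ ∷ _ ∷ _ ∷ _ ∷ _ ∷ _ :: _) → solve (f₀ ∷ f₁ ∷ f2 ∷ e ∷ lst x []) (vE (`0 ∷ `1 ∷ `2 ∷ `3 ∷ 0k ∷ 0k :: 0k) (`8 ∷ `9 ∷ `10 ∷ ⊖ `7 ∷ `4 ∷ `5 :: `6))
      (vE (0k ∷ 0k ∷ 0k ∷ ⊖ `3 ∷ `0 ∷ `1 :: `2) (`4 ∷ `5 ∷ `6 ∷ `7 ∷ `8 ∷ `9 :: `10)) refl }) (bound-β (- e) f₀ f₁ f2 a)
   ... | yes refl | yes refl = bound-el 0F 0F 0F e 0F 0F 0F (subst (λ f → AtMost (Zero f) hpBound) (solveV [ e ] (0k ∷ 0k ∷ 0k ∷ `0 ∷ `0 ∷ 0k :: 0k) (0k ∷ 0k +e 0k ∷ 0k -e 0k ∷ `0 +e 0k +e 0k ∷ 0k +e `0 +e 0k ∷ 0k :: 0k) refl)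
      (bound-β e e 0F 0F (λ z → n (cong (λ e → 0F ∷ 0F ∷ 0F ∷ e ∷ 0F ∷ 0F :: 0F) (cong Vec.head z)))))

  opaque
   -- A maximal independent list in `U` has at most six members, so the seven coordinate columns of
   -- that list are dependent; the relation is the functional.
   functional : (U : Sub 6) → ∃ λ f → f ≢ 0v × ∀ x → Sub.P U x → val f x ≡ 0F
   functional U = go (grow 6 [] (λ { [] _ → refl }) [] refl)
    where
     open Sub U
     go : (∃₂ λ k (B : Vec Q7 k) → k ℕ.≤ 6 × ∀ x → P x → x ∈< B >) → ∃ λ f → f ≢ 0v × ∀ x → P x → val f x ≡ 0F
     grow : ∀ j {k} (B : Vec Q7 k) → Ind B → VAll P B → k ℕ.+ j ≡ 6 → ∃₂ λ k' (B' : Vec Q7 k') → k' ℕ.≤ 6 × ∀ x → P x → x ∈< B' >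
     grow j {k} B i h e with search (λ x → P? x ×-dec ¬? (∈? x B))
     ... | no n = k , B , ℕₚ.m+n≤o⇒m≤o k (ℕₚ.≤-reflexive e) , λ x p → decidable-stable (∈? x B) (λ m → n (x , p , m))
     grow zero {k} B i h e | yes (x , p , m) with trans (sym (ℕₚ.+-identityʳ k)) e
     ... | refl = ⊥-elim (ind-dep (ext i m) (Pdep (x ∷ B) (p ∷ h)))
     grow (suc j) {k} B i h e | yes (x , p , m) = grow j (x ∷ B) (ext i m) (p ∷ h) (sym (ℕₚ.+-suc k j) >> e)

     col : ∀ {k} → Fin 7 → Vec Q7 k → V {k}
     col i = Vec.map (λ b → lookup b i)
     cols : ∀ {k} → Vec Q7 k → Vec (V {k}) 7
     cols B = col (# 0) B ∷ col (# 1) B ∷ col (# 2) B ∷ col (# 3) B ∷ col (# 4) B ∷ col (# 5) B :: col (# 6) B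
     vals : ∀ {k} f (B : Vec Q7 k) → lin f (cols B) ≡ 0v → VAll (λ b → val f b ≡ 0F) B
     vals f [] _ = []
     vals f@(_ ∷ _ ∷ _ ∷ _ ∷ _ ∷ _ :: _) (b@(_ ∷ _ ∷ _ ∷ _ ∷ _ ∷ _ :: _) ∷ B) e = trans (solve (lst f (lst b [])) (vE X7 Y7) (`0 *e `7 +e (`1 *e `8 +e (`2 *e `9 +e (`3 *e `10 +e (`4 *e `11 +e (`5 *e `12 +e (`6 *e `13 +e 0k))))))) refl) (cong Vec.head e) ∷ vals f B (cong Vec.tail e)
     orth : ∀ {k} (B : Vec Q7 k) → k ℕ.< 7 → ∃ λ f → f ≢ 0v × VAll (λ b → val f b ≡ 0F) B
     orth {k} B lt = let f , n , e = dependent lt (cols B) (unit k) (VAll.universal unit∈ (cols B)) in f , n , vals f B e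
     go (k , B , le , h) = let f , fn , e = orth B (s≤s le) in f , fn , λ x p → val∈ {f = f} e (h x p)

  opaque
   hp≤ : hpBound ℕ.≤ q ℕ.^ 4 ℕ.∸ q ℕ.^ 3 ℕ.+ 3 ℕ.* q ℕ.^ 2 ℕ.+ 2 ℕ.* q
   hp≤ = go q≥2
    where
     H : ℕ → ℕ
     H q = let k = suc (ℕ.pred q ℕ.* q) in q ℕ.* (q ℕ.* q) ℕ.+ (q ℕ.* k ℕ.+ (q ℕ.* k ℕ.+ k))
     -- With `t = q ∸ 2` and `p = q ∸ 1`, the slack between the count and the bound is
     -- `q * q * t * t + p`.
     lem : ∀ t → let p = suc t ; q = suc p in H q ℕ.+ (q ℕ.* q ℕ.* t ℕ.* t ℕ.+ p) ≡ p ℕ.* q ℕ.^ 3 ℕ.+ 3 ℕ.* q ℕ.^ 2 ℕ.+ 2 ℕ.* q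
     lem = S.solve 1 (λ t → let open S ; p = con 1 :+ t ; q = con 1 :+ p ; k = con 1 :+ p :* q in (q :* (q :* q) :+ (q :* k :+ (q :* k :+ k))) :+ (q :* q :* t :* t :+ p) := p :* q :^ 3 :+ con 3 :* q :^ 2 :+ con 2 :* q) refl
      where module S = Data.Nat.Solver.+-*-Solver
     go : ∀ {q} → 2 ℕ.≤ q → H q ℕ.≤ q ℕ.^ 4 ℕ.∸ q ℕ.^ 3 ℕ.+ 3 ℕ.* q ℕ.^ 2 ℕ.+ 2 ℕ.* q
     go (s≤s (s≤s {n = t} z≤n)) = let p = suc t ; q = suc p in ℕₚ.≤-trans (ℕₚ.m≤m+n (H q) _) (ℕₚ.≤-reflexive (lem t >> cong (λ z → z ℕ.+ 3 ℕ.* q ℕ.^ 2 ℕ.+ 2 ℕ.* q) (sym (ℕₚ.m+n∸m≡n (q ℕ.^ 3) (p ℕ.* q ℕ.^ 3)))))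

 -- Vanishing products and the Grassmann equations

 module StandardLines where
  open Lines
  open Vectors3 hiding (perp)
  open Cross
  open Octonions
  open Terms
  open HexLines
  open HexFlags

  opaque
   ⟂-N : ∀ {x} → x ⟂ x → N x ≡ 0F
   ⟂-N {x} h = sym (-‿involutive (N x)) >> (cong -_ (∙-0 {z = one} (λ e → 1≢0 (cong Vec.head e)) (sym (om-self x) >> om≡0 h))) >> -0#≈0#

  opaque
   N⇒Q6 : ∀ x → N x ≡ 0F → OnQ6 F x
   N⇒Q6 (_ ∷ _ ∷ _ ∷ _ ∷ _ ∷ _ :: _) = -‿injective-0

  opaque
   Q6⇒N : ∀ x → OnQ6 F x → N x ≡ 0F
   Q6⇒N (_ ∷ _ ∷ _ ∷ e ∷ _ ∷ _ :: _) h = cong (_- e * e) h >> -‿inverseʳ (e * e)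

  opaque
   HL⇒HLine : ∀ ℓ → HL ℓ → HLine F ℓ
   HL⇒HLine ℓ@(subspace (x@(u₀ ∷ u1 ∷ u2 ∷ e ∷ w0 ∷ w1 :: w2) :: y@(a₀ ∷ a₁ ∷ a₂ ∷ g ∷ b₀ ∷ b₁ :: b₂)) i) h =
     (λ z m → N⇒Q6 z (⟂-N (on {ℓ} h m m))) ,
     s zero b₀ w0 (cong Vec.head E.ua) , t a₂ u2 (w0 * b₁) (w1 * b₀) (cong (λ z → lookup z (# 2)) E.wb) ,
     s (# 1) b₁ w1 (cong (λ z → lookup z (# 1)) E.ua) , t a₀ u₀ (w1 * b₂) (w2 * b₁) (cong (λ z → lookup z (# 0)) E.wb) ,
     s (# 2) b₂ w2 (cong (λ z → lookup z (# 2)) E.ua) , t a₁ u1 (w2 * b₀) (w0 * b₂) (cong (λ z → lookup z (# 1)) E.wb)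
    where
     module E = Eqs (eqs {u₀ ∷ u1 :: u2} {e} {w0 ∷ w1 :: w2} {a₀ ∷ a₁ :: a₂} {g} {b₀ ∷ b₁ :: b₂} h)
     s : (i : Fin 3) → ∀ b w {p} → p ≡ e * b + (- g) * w → p ≡ e * b - w * g
     s _ b w refl = solve (e ∷ b ∷ g :: w) (`0 *e `1 +e (⊖ `2) *e `3) (`0 *e `1 -e `3 *e `2) refl
     t : ∀ a u p r → p - r ≡ g * u + (- e) * a → r - p ≡ e * a - u * g
     t a u p r h = solve (e ∷ a ∷ g ∷ u ∷ p :: r) (`5 -e `4) ((`0 *e `1 -e `3 *e `2) +e -1k *e ((`4 -e `5) -e (`2 *e `3 +e (⊖ `0) *e `1))) refl ⇐ -1F *: h

  opaque
   -- The Grassmann equations are the two cross product equations of `Eqs`. Of the two dot product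
   -- equations the quadric yields only the sum, so one of them has to be derived, by a case
   -- distinction on `e`, `g` and `u`.
   HLine⇒HL : ∀ ℓ → HLine F ℓ → HL ℓ
   HLine⇒HL (subspace (x@(u₀ ∷ u1 ∷ u2 ∷ e ∷ w0 ∷ w1 :: w2) :: y@(a₀ ∷ a₁ ∷ a₂ ∷ g ∷ b₀ ∷ b₁ :: b₂)) i) (Q , g₁ , g₂ , g₃ , g₄ , g₅ , g6) = go (e ≟ 0F) (g ≟ 0F) (u ≟v 0c)
    where
     u w a b : K3
     u = u₀ ∷ u1 :: u2
     w = w0 ∷ w1 :: w2
     a = a₀ ∷ a₁ :: a₂
     b = b₀ ∷ b₁ :: b₂
     s : ∀ b w {p} → p ≡ e * b - w * g → p ≡ e * b + (- g) * w
     s b w refl = solve (e ∷ b ∷ g :: w) (`0 *e `1 -e `3 *e `2) (`0 *e `1 +e (⊖ `2) *e `3) refl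
     t : ∀ a u p r → r - p ≡ e * a - u * g → p - r ≡ g * u + (- e) * a
     t a u p r h = solve (e ∷ a ∷ g ∷ u ∷ p :: r) (`4 -e `5) ((`2 *e `3 +e (⊖ `0) *e `1) +e -1k *e ((`5 -e `4) -e (`0 *e `1 -e `3 *e `2))) refl ⇐ -1F *: h
     ua : cross u a ≡ e *> b <+> (- g) *> w
     ua = vec3 (s b₀ w0 g₁) (s b₁ w1 g₃) (s b₂ w2 g₅)
     wb : cross w b ≡ g *> u <+> (- e) *> a
     wb = vec3 (t a₀ u₀ (w1 * b₂) (w2 * b₁) g₄) (t a₁ u1 (w2 * b₀) (w0 * b₂) g6) (t a₂ u2 (w0 * b₁) (w1 * b₀) g₂)
     uw : dot u w ≡ e * e
     uw = -‿injective-0 (Q6⇒N x (Q x hd∈))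
     ab : dot a b ≡ g * g
     ab = -‿injective-0 (Q6⇒N y (Q y (wk∈ hd∈)))
     bxy : dot u b + dot w a ≡ e * g + e * g
     bxy = -‿injective-0 ((solve (N x ∷ N y :: B x y) (`2) ((1k *e 1k *e `0 +e 1k *e 1k *e `1 +e 1k *e 1k *e `2) +e (-1k *e (`0 -e 0k) +e -1k *e (`1 -e 0k))) refl ⇐ -1F *: Q6⇒N x (Q x hd∈) & -1F *: Q6⇒N y (Q y (wk∈ hd∈))) >>
      sym (N-lin 1F x 1F y) >> Q6⇒N (1F *> x <+> 1F *> y) (Q _ (+∈ (∙∈ 1F hd∈) (∙∈ 1F (wk∈ hd∈)))))
     fin1 : dot u b ≡ e * g → x ⟂ y
     fin1 ub = eqs⁻ {u} {e} {w} {a} {g} {b} (record { ub = ub ; wa = solve (e * g ∷ dot u b :: dot w a) (`2) (`0 +e (1k *e ((`1 +e `2) -e (`0 +e `0)) +e -1k *e (`1 -e `0))) refl ⇐ 1F *: bxy & -1F *: ub ; ua = ua ; wb = wb })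
     fin2 : dot w a ≡ e * g → x ⟂ y
     fin2 wa = eqs⁻ {u} {e} {w} {a} {g} {b} (record { wa = wa ; ub = solve (e * g ∷ dot u b :: dot w a) (`1) (`0 +e (1k *e ((`1 +e `2) -e (`0 +e `0)) +e -1k *e (`2 -e `0))) refl ⇐ 1F *: bxy & -1F *: wa ; ua = ua ; wb = wb })
     cancel : ∀ {k z z'} → k ≢ 0F → k * (z - z') ≡ 0F → z ≡ z'
     cancel n h = -‿injective-0 (*-cancel-0 _ n h)
     go : Dec (e ≡ 0F) → Dec (g ≡ 0F) → Dec (u ≡ 0c) → x ⟂ y
     -- The dot product of `ua` with `u` kills the cross product and determines `dot u b`, because
     -- `e` can be cancelled.
     go (no n) _ _ = fin1 (cancel n ((solve (e ∷ g ∷ dot u b :: dot u w) (`0 *e (`2 -e `0 *e `1)) ((`0 *e `2 +e (⊖ `1) *e `3) +e `1 *e (`3 -e `0 *e `0)) refl ⇐ g *: uw) >>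
       sym (dot-lin u e b (- g) w) >> cong (dot u) (sym ua) >> dot-crossˡ u a))
     go (yes _) (no n) _ = fin2 (cancel n ((solve (e ∷ g ∷ dot a b :: dot w a) (`1 *e (`3 -e `0 *e `1)) (-1k *e (`0 *e `2 +e (⊖ `1) *e `3) +e `0 *e (`2 -e `1 *e `1)) refl ⇐ e *: ab) >>
       cong (-1F *_) (cong (λ z → e * dot a b + (- g) * z) (dot-comm w a) >> sym (dot-lin a e b (- g) w) >> cong (dot a) (sym ua) >> dot-crossʳ u a) >> zeroʳ _))
     go (yes e0) (yes g0) (yes u0) = fin1 (cong (λ z → dot z b) u0 >> dot-comm 0c b >> dot-0 b >> sym (zeroˡ g) >> cong (_* g) (sym e0))
     go (yes e0) (yes g0) (no n) with cross-∥ u a n (ua >> cong₂ (λ e g → e *> b <+> (- g) *> w) e0 g0 >> (vsolve [] (b :: w) (0k *v ^0 +v (⊖ 0k) *v ^1) 0w refl))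
     ... | k , ek = fin2 (cong (dot w) (ek >> vsolve [ k ] [ u ] (`0 *v ^0) (`0 *v ^0 +v 0k *v ^0) refl) >> dot-lin w k u 0F u >> cong₂ (λ p r → k * p + 0F * r) (dot-comm w u >> uw) (dot-comm w u >> uw) >>
        cong (λ e → k * (e * e) + 0F * (e * e)) e0 >> solve (k :: g) (`0 *e (0k *e 0k) +e 0k *e (0k *e 0k)) (0k *e `1) refl >> cong (_* g) (sym e0))

 -- From an embedded H(q) to the conditions

 module HexEmbedding (n : ℕ) (L : Line F (suc n) → Set) (isLS : IsLineSet F n L) (φ : Vec (Vect F (suc n)) 7) (iφ : Independent F φ) (into : ∀ m → L m → ∃ λ ℓ → HLine F ℓ × SpanEq F (basis m) (Vec.map (λ x → lincomb F x φ) (basis ℓ))) (onto : ∀ m → (∃ λ ℓ → HLine F ℓ × SpanEq F (basis m) (Vec.map (λ x → lincomb F x φ) (basis ℓ))) → L m) where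
  open Lines
  open Vectors3 using (lin-inj; lin-lin; ind-lin)
  open Octonions
  open Counting
  open HexLines
  open HexSolidCounts
  open HexBounds
  open HexHyperplanes
  open StandardLines
  open MapLin (λ x → lin x φ) (lin-lin φ)
  private
   im : Ln {7} → Ln {suc n}
   im (subspace (x :: y) i) = ln (lin x φ) (lin y φ) (ind-lin iφ i)

   im∈ : ∀ ℓ {x} → x ∈< bas ℓ > → lin x φ ∈< bas (im ℓ) >
   im∈ (subspace (_ :: _) _) = map-∈

   im∋ : ∀ ℓ {X} → X ∈< bas (im ℓ) > → ∃ λ x → x ∈< bas ℓ > × lin x φ ≡ X
   im∋ (subspace (x :: y) _) (cs , e) = lin cs (x :: y) , (cs , refl) , trans (map-lin cs (x :: y)) e

   im⁻ : ∀ ℓ {x} → lin x φ ∈< bas (im ℓ) > → x ∈< bas ℓ >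
   im⁻ ℓ {x} m = let y , y∈ , e = im∋ ℓ m in subst (_∈< bas ℓ >) (lin-inj iφ y x e) y∈

   L-im : ∀ ℓ → HL ℓ → L (im ℓ)
   L-im ℓ@(subspace (_ :: _) _) h = onto (im ℓ) (ℓ , HL⇒HLine ℓ h , λ _ → (λ m → m) , λ m → m)

   L-pre : ∀ m → L m → ∃ λ ℓ → HL ℓ × m ≈ℓ im ℓ
   L-pre m h with into m h
   ... | ℓ@(subspace (_ :: _) _) , hl , e = ℓ , HLine⇒HL ℓ hl , same ((λ z → fst (e z)) , λ z → snd (e z))

   -- Injectivity of `φ` keeps distinct lines distinct, so an enumeration of lines of H(q) maps to
   -- an enumeration in the ambient space.
   transfer : ∀ {S : Ln {7} → Set} {T : Ln {suc n} → Set} {k} → (∀ ℓ → S ℓ → T (im ℓ)) → (∀ ℓ m → HL ℓ → m ≈ℓ im ℓ → T m → S ℓ) → (∀ m → T m → L m) → LCount S k → LCount T k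
   transfer {S} {T} f g t (xs , a , d , c) = Vec.map im xs , VAllₚ.map⁺ (VAll.map (λ {ℓ} → f ℓ) a) , dist , λ m h → cov m h (L-pre m (t m h))
    where
     dist : ∀ i j → i ≢ j → ¬ SameSub F (lookup (Vec.map im xs) i) (lookup (Vec.map im xs) j)
     dist i j ne e with subst₂ (SameSub F) (Vecₚ.lookup-map i im xs) (Vecₚ.lookup-map j im xs) e
     ... | p , r = d i j ne ((λ z m → im⁻ (lookup xs j) (p _ (im∈ (lookup xs i) m))) , λ z m → im⁻ (lookup xs i) (r _ (im∈ (lookup xs j) m)))
     cov : ∀ m → T m → (∃ λ ℓ → HL ℓ × m ≈ℓ im ℓ) → ∃ λ i → SameSub F m (lookup (Vec.map im xs) i)
     cov m h (ℓ , hl , e) with c ℓ (g ℓ m hl e h)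
     ... | i , (p , r) = i , subst (SameSub F m) (sym (Vecₚ.lookup-map i im xs)) (sub e′)
      where
       up : ∀ ℓ ℓ' → (∀ z → z ∈< bas ℓ > → z ∈< bas ℓ' >) → ∀ {z} → z ∈< bas (im ℓ) > → z ∈< bas (im ℓ') >
       up ℓ ℓ' p q = let y , y∈ , e = im∋ ℓ q in subst (_∈< bas (im ℓ') >) e (im∈ ℓ' (p y y∈))
       e′ : m ≈ℓ im (lookup xs i)
       e′ = ≈-trans e (same ((λ z q → up ℓ (lookup xs i) p q) , λ z q → up (lookup xs i) ℓ r q))

   Pre : ∀ {d} → Subspace F (suc n) d → Q7 → Set
   Pre X x = lin x φ ∈< bas X >

   sub-of : ∀ {d} → Subspace F (suc n) d → Sub (suc d)
   sub-of {d} X = record { P = Pre X ; P? = λ x → ∈? (lin x φ) (bas X) ; P0 = subst (_∈< bas X >) (sym (lin-0 φ)) 0∈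
     ; P+ = λ {x} {y} p r c d → subst (_∈< bas X >) (sym (lin-lin φ c x d y)) (+∈ (∙∈ c p) (∙∈ d r)) ; Pdep = dep }
    where
     dep : (A : Vec Q7 (suc (suc d))) → VAll (Pre X) A → Dep A
     dep A h = let cs , ne , e = dependent ℕₚ.≤-refl (Vec.map (λ x → lin x φ) A) (bas X) (VAllₚ.map⁺ h) in cs , ne , iφ (lin cs A) (map-lin cs A >> e)

   inside : ∀ {d k} (X : Subspace F (suc n) d) → LCount (Inside (Pre X)) k → LCount (λ m → L m × _⊆S_ F m X) k
   inside X = transfer (λ { ℓ@(subspace (_ :: _) _) (h , p :: r) → L-im ℓ h , λ _ → span⊆ (p :: r) })
    (λ { ℓ m hl (same (_ , g)) (_ , s) → hl , VAll.map (λ q → s _ (g _ (im∈ ℓ q))) (gens∈ (bas ℓ)) }) (λ _ → fst)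

   open Solids total

   HL-resp : ∀ {ℓ m : Ln {7}} → ℓ ≈ℓ m → HL ℓ → HL m
   HL-resp {ℓ} {subspace (a :: b) _} (same (_ , g)) h = on {ℓ} h (g _ hd∈) (g _ (wk∈ hd∈))

   pt : Conds.Pt F n L
   pt p nz with ∈? p φ
   ... | no n = inj₁ ([] , [] , (λ ()) , λ m (h , p∈) → let ℓ , _ , same (e , _) = L-pre m h ; x , _ , q = im∋ ℓ (e _ p∈) in ⊥-elim (n (x , q)))
   ... | yes (x , refl) = Data.Sum.map tf tf (Pt7 x (λ z → nz (cong (λ x → lin x φ) z >> lin-0 φ)))
    where
     tf : ∀ {k} → LCount (Th x) k → LCount (λ m → L m × OnSub F (lin x φ) m) k
     tf = transfer (λ ℓ (h , x∈) → L-im ℓ h , im∈ ℓ x∈) (λ { ℓ m hl (same (g , _)) (_ , x∈) → hl , im⁻ ℓ (g _ x∈) }) (λ _ → fst)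

   hp : Conds.Hp' F n L
   hp X with functional (sub-of X)
   ... | f , fn , h with count (λ ℓ → HL? ℓ ×-dec VAll.all? (Sub.P? (sub-of X)) (bas ℓ)) (λ {ℓ} {m} → rsp {ℓ} {m}) (am-⊆ (λ ℓ (hl , p) → hl , VAll.map (h _) p) hp≤ (hyperplane f fn))
    where
     rsp : ∀ {ℓ m : Ln {7}} → ℓ ≈ℓ m → Inside (Pre X) ℓ → Inside (Pre X) m
     rsp {ℓ} {m} e@(same (_ , g)) (hl , p) = HL-resp {ℓ} {m} e hl , VAll.map (λ q → Sub.Pspan (sub-of X) p (g _ q)) (gens∈ (bas m))
   ... | m , c , le = m , inside X c , le

   to : Conds.To F n L
   to = let m , c , le = count HL? (λ {ℓ} {m} → HL-resp {ℓ} {m}) total in m , transfer L-im (λ ℓ m hl _ _ → hl) (λ _ h → h) c , le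

  opaque
   conditions : AllConditions F n L
   conditions = pt , (λ X → Data.Sum.map (inside X) (Data.Sum.map (inside X) (inside X)) (Pl7 (sub-of X))) ,
    (λ X → Data.Sum.map (inside X) (Data.Sum.map (inside X) (Data.Sum.map (inside X) (inside X))) (Solid.Sd7 total (sub-of X))) , hp , to

 -- From the conditions to geometry: collinearity and line counts

 record Hyp (n : ℕ) (L : Line F (suc n) → Set) : Set where
  field
   isLS : IsLineSet F n L
   pt : Conds.Pt F n L
   pl : Conds.Pl F n L
   sd : Conds.Sd F n L
   hp : Conds.Hp' F n L
   to : Conds.To F n L

 module _ (n : ℕ) (L : Line F (suc n) → Set) (H : Hyp n L) where

  module Geometry where
   open Lines public
   open Hyp H

   W : Set
   W = V {suc n}

   L? : ∀ ℓ → Dec (L ℓ)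
   L? = fst isLS

   L-resp : ∀ {ℓ m} → ℓ ≈ℓ m → L ℓ → L m
   L-resp {ℓ} {m} e = snd isLS ℓ m (sub e)

   infix 4 _~_
   record _~_ (x y : W) : Set where
    constructor adj
    field
     line : Ln
     onL : L line
     fst∈ : x ∈< bas line >
     snd∈ : y ∈< bas line >

   Pnt : W → Set
   Pnt x = x ≢ 0v × x ~ x

   g0 : ∀ {N k} {B : Vec (V {N}) k} {a} → a ∈< a ∷ B >
   g0 = hd∈
   g1 : ∀ {N k} {B : Vec (V {N}) k} {a b} → b ∈< a ∷ b ∷ B >
   g1 = wk∈ hd∈
   g2 : ∀ {N k} {B : Vec (V {N}) k} {a b c} → c ∈< a ∷ b ∷ c ∷ B >
   g2 = wk∈ g1
   g3 : ∀ {N k} {B : Vec (V {N}) k} {a b c d} → d ∈< a ∷ b ∷ c ∷ d ∷ B >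
   g3 = wk∈ g2
   g4 : ∀ {N k} {B : Vec (V {N}) k} {a b c d e} → e ∈< a ∷ b ∷ c ∷ d ∷ e ∷ B >
   g4 = wk∈ g3
   g5 : ∀ {N k} {B : Vec (V {N}) k} {a b c d e f} → f ∈< a ∷ b ∷ c ∷ d ∷ e ∷ f ∷ B >
   g5 = wk∈ g4

   swap : ∀ {N} {x y : V {N}} → Ind (x :: y) → Ind (y :: x)
   swap i = ind-gen i (g1 :: g0)

   opaque
    ind1 : ∀ {N} {x : V {N}} → x ≢ 0v → Ind [ x ]
    ind1 {x = x} nz = ext (λ { [] _ → refl }) (λ { ([] , e) → nz (sym e) })

   opaque
    par? : ∀ {N} {x : V {N}} y → x ≢ 0v → y ∈< x ∷ [] > ⊎ Ind (y :: x)
    par? {x = x} y nz with ∈? y [ x ]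
    ... | yes p = inj₁ p
    ... | no np = inj₂ (ext (ind1 nz) np)

   opaque
    par-sym : ∀ {N} {x y : V {N}} → y ≢ 0v → y ∈< x ∷ [] > → x ∈< y ∷ [] >
    par-sym {x = x} nz p = dimEq (ind1 nz) [ p ] g0

   ~sym : ∀ {x y} → x ~ y → y ~ x
   ~sym (adj l h a b) = adj l h b a

   ~selfˡ : ∀ {x y} → x ~ y → x ~ x
   ~selfˡ (adj l h a b) = adj l h a a

   ~∙ : ∀ r {x y} → x ~ y → x ~ r *> y
   ~∙ r (adj l h a b) = adj l h a (∙∈ r b)

   ~on : ∀ {x y z} → Ind (x :: y) → x ~ y → z ∈< x :: y > → x ~ z
   ~on i (adj l h a b) z = adj l h a (span⊆ (a :: b) z)

   ~L : ∀ {x y} (i : Ind (x :: y)) → x ~ y → L (ln x y i)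
   ~L {x} {y} i (adj l h a b) = L-resp (≈-sym (same (sub-eq (ln x y i) l (a :: b)))) h

   L~ : ∀ {ℓ x y} → L ℓ → x ∈< bas ℓ > → y ∈< bas ℓ > → x ~ y
   L~ {ℓ} = adj ℓ

   opaque
    ~? : ∀ x y → Dec (x ~ y)
    ~? x y = map′ (λ (a , b , i , h , p , r) → adj (ln a b i) h p r)
       (λ { (adj (subspace (a :: b) i) h p r) → a , b , i , h , p , r })
       (search λ a → search λ b → dec a b)
     where
      dec : ∀ a b → Dec (Σ (Ind (a :: b)) λ i → L (ln a b i) × x ∈< a :: b > × y ∈< a :: b >)
      dec a b with ind? (a :: b)
      ... | inj₁ d = no λ (i , _) → ind-dep i d
      ... | inj₂ i = map′ (i ,_) (λ (j , h , r) → L-resp {ln a b j} {ln a b i} (same ((λ _ z → z) , (λ _ z → z))) h , r) (L? (ln a b i) ×-dec (∈? x (a :: b) ×-dec ∈? y (a :: b)))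

   opaque
    other : ∀ (ℓ : Ln {suc n}) {x} → x ≢ 0v → x ∈< bas ℓ > → ∃ λ y → y ∈< bas ℓ > × Ind (x :: y)
    other (subspace (a :: b) i) {x} nz x∈ with par? a nz
    ... | inj₂ j = a , g0 , swap j
    ... | inj₁ p with par? b nz
    ...   | inj₂ j = b , g1 , swap j
    ...   | inj₁ r = ⊥-elim (ind-no ℕₚ.≤-refl [ x ] i (p :: r))

   opaque
    ≈ln : ∀ {ℓ : Ln {suc n}} {x y} (i : Ind (x :: y)) → x ∈< bas ℓ > → y ∈< bas ℓ > → ℓ ≈ℓ ln x y i
    ≈ln {ℓ} {x} {y} i a b = ≈-sym (same (sub-eq (ln x y i) ℓ (a :: b)))

   fam2 : ∀ {S : Ln {suc n} → Set} {ℓ m} → S ℓ → S m → ¬ ℓ ≈ℓ m → LFam S 2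
   fam2 {ℓ = ℓ} {m} s t ne = fam (ℓ :: m) ℕₚ.≤-refl (s :: t) ([ ne ] :: [])

   In : ∀ {d} → Vec W d → Ln {suc n} → Set
   In D ℓ = L ℓ × VAll (_∈< D >) (bas ℓ)

   private
    toIn : ∀ {d} {D : Vec W (suc d)} (i : Ind D) {ℓ} → L ℓ × _⊆S_ F ℓ (subspace {F} D i) → In D ℓ
    toIn i {ℓ} (h , s) = h , VAll.map (s _) (gens∈ (bas ℓ))
    frIn : ∀ {d} {D : Vec W (suc d)} (i : Ind D) {ℓ} → In D ℓ → L ℓ × _⊆S_ F ℓ (subspace {F} D i)
    frIn i (h , s) = h , λ x → span⊆ s

   opaque
    plane≤ : ∀ {D : Vec W 3} {c} → Ind D → LFam (In D) c → c ℕ.≤ suc q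
    plane≤ {D} i f with pl (subspace D i)
    ... | inj₁ z = ℕₚ.≤-trans (card-bound z (fam-map (frIn i) f)) z≤n
    ... | inj₂ (inj₁ z) = ℕₚ.≤-trans (card-bound z (fam-map (frIn i) f)) (s≤s z≤n)
    ... | inj₂ (inj₂ z) = card-bound z (fam-map (frIn i) f)

   opaque
    -- Two lines rule out the counts zero and one, so the full number is present.
    plane≥ : ∀ {D : Vec W 3} → Ind D → LFam (In D) 2 → LFam (In D) (suc q)
    plane≥ {D} i f with pl (subspace D i)
    ... | inj₁ z with () ← card-bound z (fam-map (frIn i) f)
    ... | inj₂ (inj₁ z) with s≤s () ← card-bound z (fam-map (frIn i) f)
    ... | inj₂ (inj₂ z) = fam-map (toIn i) (card-fam z)

   opaque
    solid≤ : ∀ {D : Vec W 4} {c} → Ind D → LFam (In D) c → c ℕ.≤ suc (q ℕ.+ q)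
    solid≤ {D} i f with sd (subspace D i)
    ... | inj₁ z = ℕₚ.≤-trans (card-bound z (fam-map (frIn i) f)) z≤n
    ... | inj₂ (inj₁ z) = ℕₚ.≤-trans (card-bound z (fam-map (frIn i) f)) (s≤s z≤n)
    ... | inj₂ (inj₂ (inj₁ z)) = ℕₚ.≤-trans (card-bound z (fam-map (frIn i) f)) (s≤s (ℕₚ.m≤m+n q q))
    ... | inj₂ (inj₂ (inj₂ z)) = ℕₚ.≤-trans (card-bound z (fam-map (frIn i) f)) (ℕₚ.≤-reflexive (cong (λ z → suc (q ℕ.+ z)) (ℕₚ.+-identityʳ q)))

   opaque
    solid≥ : ∀ {D : Vec W 4} → Ind D → LFam (In D) 2 → LFam (In D) (suc q)
    solid≥ {D} i f with sd (subspace D i)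
    ... | inj₁ z with () ← card-bound z (fam-map (frIn i) f)
    ... | inj₂ (inj₁ z) with s≤s () ← card-bound z (fam-map (frIn i) f)
    ... | inj₂ (inj₂ (inj₁ z)) = fam-map (toIn i) (card-fam z)
    ... | inj₂ (inj₂ (inj₂ z)) = fam-≤ (s≤s (ℕₚ.m≤m+n q (q ℕ.+ 0))) (fam-map (toIn i) (card-fam z))

   Thru : W → Ln → Set
   Thru x ℓ = L ℓ × x ∈< bas ℓ >

   opaque
    pencil : ∀ {x} → Pnt x → LFam (Thru x) (suc q)
    pencil {x} (nz , adj ℓ h a _) with pt x nz
    ... | inj₁ z with () ← card-bound z (fam-one {S = Thru x} {a = ℓ} (h , a))
    ... | inj₂ z = card-fam z

   opaque
    inter : ∀ {N k} {B : Vec (V {N}) k} {c d z} → Ind (c ∷ d ∷ B) → z ∈< c ∷ B > → z ∈< d ∷ B > → z ∈< B >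
    inter {B = B} {c} {d} i (r ∷ cs , refl) (s ∷ ds , e) = cs , trans (vsolve [] (c :: lin cs B) (^1) (0k *v ^0 +v ^1) refl)
      (cong (λ z → z *> c <+> lin cs B) (sym r0))
     where
      r0 : r ≡ 0F
      r0 = coef i (r ∷ - s ∷ cs <+> -1F *> ds)
       (cong (λ z → r *> c <+> ((- s) *> d <+> z)) (lin-+ cs (-1F *> ds) B >> cong (lin cs B <+>_) (lin-∙ -1F ds B)) >>
        (vsolve (r :: s) (c ∷ d ∷ lin cs B :: lin ds B) (`0 *v ^0 +v ((⊖ `1) *v ^1 +v (^2 -v ^3)))
          (0w +v -1k *v ((`1 *v ^1 +v ^3) -v (`0 *v ^0 +v ^2))) refl ⇐v -1F ∙: e)) zero

   opaque
    ≈ln-inter : ∀ {ℓ : Ln {suc n}} {x y c d} (i : Ind (x :: y)) → Ind (c ∷ d ∷ x :: y) →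
          VAll (_∈< c ∷ x :: y >) (bas ℓ) → VAll (_∈< d ∷ x :: y >) (bas ℓ) → ℓ ≈ℓ ln x y i
    ≈ln-inter {subspace (a :: b) k} {x} {y} i j (p :: p') (r :: r') =
     same (sub-eq (subspace (a :: b) k) (ln x y i) (inter j p r :: inter j p' r'))

   -- The three planes spanned by pairs of the lines would hold 3q > 2q + 1 lines of one solid.
   opaque
    coplanar : ∀ {x a b c} → x ~ a → x ~ b → x ~ c → ¬ Ind (c ∷ b ∷ a :: x)
    coplanar {x} {a} {b} {c} xa xb xc i = absurd (solid≤ i (fam-++ fa (fam-++ {U = UU} fb fc dbc inj₁ inj₂)
       (λ { s (inj₁ t) e → dab s t e ; s (inj₂ t) e → dac s t e }) sa sbc))
     where
      ia : Ind (a :: x)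
      ia = ind-tail (ind-tail i)
      ib : Ind (b :: x)
      ib = ind-tail (ind-gen (ind-tail i) (g1 ∷ g0 :: g2))
      ic : Ind (c :: x)
      ic = ind-tail {x = b} (ind-tail {x = a} (ind-gen i (g2 ∷ g1 ∷ g0 :: g3)))
      UU : Ln {suc n} → Set
      UU m = (In (c ∷ a :: x) m × ¬ m ≈ℓ ln a x ia) ⊎ ((In (c ∷ b :: x) m × ¬ m ≈ℓ ln b x ib) × ¬ m ≈ℓ ln c x ic)
      two : ∀ {y z} → x ~ y → x ~ z → Ind (y ∷ z :: x) → LFam (In (y ∷ z :: x)) (suc q)
      two {y} {z} xy xz j = plane≥ j (fam2 {ℓ = ln y x iy} {m = ln z x iz} (~L iy (~sym xy) , g0 :: g2) (~L iz (~sym xz) , g1 :: g2)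
         λ e → ∉-head j (fst (sub e) y g0))
       where
        iz : Ind (z :: x)
        iz = ind-tail j
        iy : Ind (y :: x)
        iy = ind-tail {x = z} (ind-gen j (g1 ∷ g0 :: g2))
      fa : LFam (In (b ∷ a :: x)) (suc q)
      fa = two xb xa (ind-tail i)
      fb : LFam (λ m → In (c ∷ a :: x) m × ¬ m ≈ℓ ln a x ia) q
      fb = rm (two xc xa (ind-tail {x = b} (ind-gen i (g1 ∷ g0 ∷ g2 :: g3)))) (ln a x ia)
      fc : LFam (λ m → (In (c ∷ b :: x) m × ¬ m ≈ℓ ln b x ib) × ¬ m ≈ℓ ln c x ic) (ℕ.pred q)
      fc = rm (fam-≤ (ℕₚ.≤-reflexive (ℕₚ.suc-pred q {{ℕ.>-nonZero (ℕₚ.≤-trans (s≤s z≤n) q≥2)}})) (rm (two xc xb (ind-tail {x = a} (ind-gen i (g1 ∷ g2 ∷ g0 :: g3)))) (ln b x ib))) (ln c x ic)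
      mv : ∀ {ℓ m d} {D : Vec W d} → ℓ ≈ℓ m → In D ℓ → VAll (_∈< D >) (bas m)
      mv {m = m} e (_ , s) = VAll.map (λ {z} h → span⊆ s (snd (sub e) z h)) (gens∈ (bas m))
      dab : ∀ {ℓ m} → In (b ∷ a :: x) ℓ → In (c ∷ a :: x) m × ¬ m ≈ℓ ln a x ia → ¬ ℓ ≈ℓ m
      dab s ((_ , t) , ne) e = ne (≈ln-inter ia i t (mv e s))
      dac : ∀ {ℓ m} → In (b ∷ a :: x) ℓ → (In (c ∷ b :: x) m × ¬ m ≈ℓ ln b x ib) × ¬ m ≈ℓ ln c x ic → ¬ ℓ ≈ℓ m
      dac s (((_ , t) , ne) , _) e = ne (≈ln-inter ib (ind-gen i (g0 ∷ g2 ∷ g1 :: g3)) t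
       (VAll.map (span⊆ (g1 ∷ g0 :: g2)) (mv e s)))
      dbc : ∀ {ℓ m} → In (c ∷ a :: x) ℓ × ¬ ℓ ≈ℓ ln a x ia → (In (c ∷ b :: x) m × ¬ m ≈ℓ ln b x ib) × ¬ m ≈ℓ ln c x ic → ¬ ℓ ≈ℓ m
      dbc (s , _) (((_ , t) , _) , ne) e = ne (≈ln-inter ic (ind-gen i (g2 ∷ g1 ∷ g0 :: g3))
        (VAll.map (span⊆ (g1 ∷ g0 :: g2)) (mv e s)) (VAll.map (span⊆ (g1 ∷ g0 :: g2)) t) )
      sa : ∀ {m} → In (b ∷ a :: x) m → In (c ∷ b ∷ a :: x) m
      sa (l , s) = l , VAll.map wk∈ s
      sbc : ∀ {m} → UU m → In (c ∷ b ∷ a :: x) m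
      sbc (inj₁ ((l , s) , _)) = l , VAll.map (span⊆ (g0 ∷ g2 :: g3)) s
      sbc (inj₂ (((l , s) , _) , _)) = l , VAll.map (span⊆ (g0 ∷ g1 :: g3)) s
      absurd : ¬ (suc q ℕ.+ (q ℕ.+ ℕ.pred q) ℕ.≤ suc (q ℕ.+ q))
      absurd = go q q≥2
       where
        go : ∀ k → 2 ℕ.≤ k → ¬ (suc k ℕ.+ (k ℕ.+ ℕ.pred k) ℕ.≤ suc (k ℕ.+ k))
        go (suc (suc k)) _ (s≤s h) = ℕₚ.m+1+n≰m (suc (suc k)) (ℕₚ.+-cancelˡ-≤ (suc (suc k)) _ _ h)
        go (suc zero) (s≤s ()) _

  -- The plane of a point; no triangles and no quadrangles

  module Pencils where
   open Geometry public
   open FiniteField F using (complete)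

   opaque
    q-pred : q ≡ suc (ℕ.pred q)
    q-pred = sym (ℕₚ.suc-pred q {{ℕ.>-nonZero (ℕₚ.≤-trans (s≤s z≤n) q≥2)}})

   opaque
    all~ : ∀ {ℓ x k} {D : Vec W k} → L ℓ → x ∈< bas ℓ > → (∀ {z} → x ~ z → z ∈< D >) → VAll (_∈< D >) (bas ℓ)
    all~ {ℓ} h x∈ f = VAll.map (λ z∈ → f (adj ℓ h x∈ z∈)) (gens∈ (bas ℓ))

   opaque
    in-plane : ∀ {x a b z} → x ~ a → x ~ b → Ind (a ∷ b :: x) → x ~ z → z ∈< a ∷ b :: x >
    in-plane {x} {a} {b} {z} xa xb i xz with ∈? z (a ∷ b :: x)
    ... | yes p = p
    ... | no np = ⊥-elim (coplanar xb xa xz (ext i np))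

   -- The q + 1 lines of L through x fill the pencil of the plane.
   opaque
    plane⊇ : ∀ {x a b y} → x ~ a → x ~ b → Ind (a ∷ b :: x) → y ∈< a ∷ b :: x > → x ~ y
    plane⊇ {x} {a} {b} {y} xa xb i y∈ with par? y (ind-nonzero (ind-tail (ind-tail i)))
    ... | inj₁ p = adj (_~_.line xa) (_~_.onL xa) (_~_.fst∈ xa) (span⊆ [ _~_.fst∈ xa ] p)
    ... | inj₂ iy with ~? x y
    ...   | yes xy = xy
    ...   | no ny = ⊥-elim (fin (choose (∈? a (y :: x)) (∈? b (y :: x))))
     where
      nz : x ≢ 0v
      nz = ind-nonzero (ind-tail (ind-tail i))
      choose : Dec (a ∈< y :: x >) → Dec (b ∈< y :: x >) → ∃ λ c → x ~ c × Ind (c ∷ y :: x) × c ∈< a ∷ b :: x >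
      choose (no na) _ = a , xa , ext iy na , g0
      choose (yes _) (no nb) = b , xb , ext iy nb , g1
      choose (yes pa) (yes pb) = ⊥-elim (ind-no ℕₚ.≤-refl (y :: x) i (pa ∷ pb :: g1))
      fin : (∃ λ c → x ~ c × Ind (c ∷ y :: x) × c ∈< a ∷ b :: x >) → ⊥
      fin (c , xc , j , c∈) = ℕₚ.<-irrefl refl (ℕₚ.≤-trans (fam-bound (λ p r → ≈-trans p (≈-sym r)) (pencil (nz , ~selfˡ xa)) (List.map g elements) cov)
         (ℕₚ.≤-reflexive (Listₚ.length-map g elements)))
       where
        g-ind : ∀ r → Ind (c <+> r *> y :: x)
        g-ind r = ind-tail {x = y} (ind-gen j ((- r ∷ 1F :: 0F ,
         vsolve [ r ] (c ∷ y :: x) ((⊖ `0) *v ^1 +v (1k *v (^0 +v `0 *v ^1) +v (0k *v ^2 +v 0w))) (^0) refl) ∷ g0 :: g2))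
        g : K → Ln {suc n}
        g r = ln (c <+> r *> y) x (g-ind r)
        cov : ∀ {ℓ} → Thru x ℓ → Any (ℓ ≈ℓ_) (List.map g elements)
        cov {ℓ} (h , x∈) with other ℓ nz x∈
        ... | z , z∈ , k with dimEq j (c∈ ∷ y∈ :: g2) (in-plane xa xb i (L~ {ℓ} h x∈ z∈))
        ... | r ∷ s :: t , e with r ≟ 0F
        ... | yes refl = ⊥-elim (ny (adj ℓ h x∈ (span⊆ (x∈ :: z∈) (dimEq {B = y :: x} k (g1 :: (s :: t ,
            trans (vsolve (s :: t) (c ∷ y :: x) (`0 *v ^1 +v (`1 *v ^2 +v 0w)) (0k *v ^0 +v (`0 *v ^1 +v (`1 *v ^2 +v 0w))) refl) e)) g0))))
        ... | no r≢0 = Anyₚ.map⁺ (Any.map (λ { refl → ≈ln (g-ind _) (span⊆ (z∈ :: x∈) (inv r r≢0 :: - (inv r r≢0 * t) ,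
            (vsolve (r ∷ s ∷ t :: inv r r≢0) (c ∷ y ∷ x :: z) (`3 *v ^3 +v ((⊖ (`3 *e `2)) *v ^2 +v 0w))
              ((^0 +v (`3 *e `1) *v ^1) +v ((`0 *e `3 -e 1k) *v ^0 +v (⊖ `3) *v ((`0 *v ^0 +v (`1 *v ^1 +v (`2 *v ^2 +v 0w))) -v ^3))) refl
             ⇐v (inv-r r r≢0 s: c) &v ((- inv r r≢0) ∙: e)))) x∈ }) (complete (inv r r≢0 * s)))

   record Plane (x : W) : Set where
    constructor plane
    field
     {p₁ p₂} : W
     a₁ : x ~ p₁
     a₂ : x ~ p₂
     ind : Ind (p₁ ∷ p₂ :: x)

   opaque
    planeOf : ∀ {x} → Pnt x → Plane x
    planeOf {x} p@(nz , _) with pick (pencil p)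
    ... | ℓ , h , x∈ with pick (rm (fam-≤ (s≤s (ℕₚ.≤-trans (s≤s z≤n) q≥2)) (pencil p)) ℓ)
    ... | m , (h' , x∈') , ne with other ℓ nz x∈ | other m nz x∈'
    ... | a , a∈ , i | b , b∈ , j = plane (L~ {ℓ} h x∈ a∈) (L~ {m} h' x∈' b∈) (ext (swap j) λ a∈' → ne (≈-sym (
       ≈-trans (≈ln i x∈ a∈) (≈-sym (≈ln i x∈' (span⊆ (b∈ :: x∈') a∈'))))))

   opaque
    ~+ : ∀ {x y z} → x ≢ 0v → x ~ y → x ~ z → x ~ y <+> z
    ~+ nz xy xz with planeOf (nz , ~selfˡ xy)
    ... | plane a b i = plane⊇ a b i (+∈ (in-plane a b i xy) (in-plane a b i xz))

   opaque
    ~span : ∀ {x k} {B : Vec W (suc k)} → x ≢ 0v → VAll (x ~_) B → ∀ {z} → z ∈< B > → x ~ z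
    ~span {B = b ∷ []} nz [ h ] (c ∷ [] , refl) = subst (_ ~_) (vsolve [ c ] [ b ] (`0 *v ^0) (`0 *v ^0 +v 0w) refl) (~∙ c h)
    ~span {B = b ∷ b' ∷ B} nz (h ∷ hs) (c ∷ cs , refl) = ~+ nz (~∙ c h) (~span nz hs (cs , refl))

   opaque
    ~0 : ∀ {x y} → x ~ y → x ~ 0v
    ~0 {y = y} h = subst (_ ~_) (vsolve [] [ y ] (0k *v ^0) 0w refl) (~∙ 0F h)

   opaque
    third : ∀ {x y} → x ~ y → Ind (y :: x) → ∃ λ z → x ~ z × Ind (z ∷ y :: x)
    third {x} {y} h i with planeOf (ind-nonzero (ind-tail i) , ~selfˡ h)
    ... | plane {a} {b} xa xb j with ∈? a (y :: x) | ∈? b (y :: x)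
    ... | no na | _ = a , xa , ext i na
    ... | yes _ | no nb = b , xb , ext i nb
    ... | yes pa | yes pb = ⊥-elim (ind-no ℕₚ.≤-refl (y :: x) j (pa ∷ pb :: g1))

   opaque
    -- The line `y z` lies in the plane of `x` and misses `x`, but that plane already holds the
    -- `q + 1` lines through `x`.
    tri : ∀ {x y z} → x ~ y → y ~ z → x ~ z → ¬ Ind (y ∷ z :: x)
    tri {x} {y} {z} xy yz xz i = ℕₚ.m+1+n≰m (suc q) (plane≤ i (fam-++ {U = In (y ∷ z :: x)} (pencil (nz , ~selfˡ xy))
       (fam-one {S = _≡ ln y z j} refl) (λ { {ℓ} (h , x∈) refl e → ∉-head (ind-gen i (g1 ∷ g2 :: g0)) (fst (sub e) x x∈) })
       (λ {ℓ} (h , x∈) → h , all~ {ℓ} h x∈ (in-plane xy xz i)) (λ { refl → ~L j yz , g0 :: g1 })))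
     where
      nz : x ≢ 0v
      nz = ind-nonzero (ind-tail (ind-tail i))
      j : Ind (y :: z)
      j = ind-tail {x = x} (ind-gen i (g1 ∷ g2 :: g0))

   opaque
    tri∈ : ∀ {x y z} → Ind (z :: x) → x ~ y → y ~ z → x ~ z → y ∈< z :: x >
    tri∈ {x} {y} {z} i xy yz xz with ∈? y (z :: x)
    ... | yes p = p
    ... | no np = ⊥-elim (tri xy yz xz (ext i np))

   -- All lines through `x` lie in the span of `D`, so `x` contributes `q + 1` lines to any count
   -- there.
   record Full {k} (D : Vec W k) (x : W) : Set where
    constructor full
    field
     isP : Pnt x
     sub⊆ : ∀ {z} → x ~ z → z ∈< D >

   opaque
    self∈ : ∀ {k} {D : Vec W k} {x} → Full D x → x ∈< D >
    self∈ (full (_ , h) f) = f h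

   opaque
    full2 : ∀ {k} {D : Vec W k} {x y z} → x ~ y → x ~ z → Ind (y ∷ z :: x) → y ∈< D > → z ∈< D > → x ∈< D > → Full D x
    full2 xy xz i y∈ z∈ x∈ = full (ind-nonzero (ind-tail (ind-tail i)) , ~selfˡ xy)
     λ xg → span⊆ (y∈ ∷ z∈ :: x∈) (in-plane xy xz i xg)

   opaque
    pencilIn : ∀ {k} {D : Vec W k} {x} → Full D x → LFam (λ ℓ → In D ℓ × x ∈< bas ℓ >) (suc q)
    pencilIn (full p f) = fam-map (λ {ℓ} (h , x∈) → (h , all~ {ℓ} h x∈ f) , x∈) (pencil p)

   opaque
    pencil∖ : ∀ {k} {D : Vec W k} {x y} → Ind (x :: y) → Full D x → LFam (λ ℓ → (In D ℓ × x ∈< bas ℓ >) × ¬ y ∈< bas ℓ >) q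
    pencil∖ {x = x} {y} i f = fam-map (λ {ℓ} ((s , x∈) , ne) → (s , x∈) , λ y∈ → ne (≈ln i x∈ y∈)) (rm (pencilIn f) (ln x y i))

   -- Two full points already account for 2q + 1 lines of a solid.
   opaque
    two-full : ∀ {D : Vec W 4} {x y ℓ} → Ind D → Ind (x :: y) → Full D x → Full D y → In D ℓ → x ∈< bas ℓ > ⊎ y ∈< bas ℓ >
    two-full {D} {x} {y} {ℓ} i j fx fy inℓ with ∈? x (bas ℓ) | ∈? y (bas ℓ)
    ... | yes p | _ = inj₁ p
    ... | no _ | yes p = inj₂ p
    ... | no nx | no ny = ⊥-elim (ℕₚ.m+1+n≰m (suc (q ℕ.+ q)) (solid≤ i (fam-++ {U = In D} both (fam-one {S = _≡ ℓ} refl) dis (λ (s , _) → s) (λ { refl → inℓ }))))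
     where
      both : LFam (λ m → In D m × (x ∈< bas m > ⊎ y ∈< bas m >)) (suc q ℕ.+ q)
      both = fam-++ (pencilIn fx) (pencil∖ (swap j) fy) (λ (_ , x∈) (_ , x∉) e → x∉ (fst (sub e) x x∈))
        (λ (s , x∈) → s , inj₁ x∈) (λ ((s , y∈) , _) → s , inj₂ y∈)
      dis : ∀ {m k} → In D m × (x ∈< bas m > ⊎ y ∈< bas m >) → k ≡ ℓ → ¬ m ≈ℓ k
      dis (_ , inj₁ p) refl e = nx (fst (sub e) x p)
      dis (_ , inj₂ p) refl e = ny (fst (sub e) y p)

   opaque
    -- Among the lines through `z` that miss `x` there is one that also misses `y`, against
    -- `two-full`.
    no3full : ∀ {D : Vec W 4} {x y z} → Ind D → Ind (x :: y) → Ind (z :: x) → Ind (z :: y) → Full D x → Full D y → Full D z → ⊥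
    no3full {D} {x} {y} {z} i j k l fx fy fz with pick (rm (fam-≤ (ℕₚ.≤-trans (s≤s (s≤s z≤n)) q≥2) (pencil∖ k fz)) (ln z y l))
    ... | ℓ , ((s , z∈) , x∉) , ne with two-full {ℓ = ℓ} i j fx fy s
    ... | inj₁ x∈ = x∉ x∈
    ... | inj₂ y∈ = ne (≈ln l z∈ y∈)

   opaque
    ¬~ind : ∀ {x y} → ¬ x ~ y → Pnt x → Ind (y :: x)
    ¬~ind {x} {y} nxy (nz , xx) with par? y nz
    ... | inj₂ i = i
    ... | inj₁ p = ⊥-elim (nxy (~span nz [ xx ] p))

   opaque
    -- A proper quadrangle would span a solid in which `b`, `x` and `a` are three full points.
    quad : ∀ {x a b d} → Pnt x → Pnt b → a ≢ 0v → d ≢ 0v → x ~ a → a ~ b → b ~ d → d ~ x → ¬ x ~ b → a ∈< d ∷ [] >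
    quad {x} {a} {b} {d} px@(xnz , xx) pb@(bnz , bb) anz dnz xa ab bd dx nxb with par? a dnz
    ... | inj₁ p = p
    ... | inj₂ ad = ⊥-elim (cases (∈? x (a :: d)))
     where
      bx : Ind (b :: x)
      bx = ¬~ind nxb px
      pa : Pnt a
      pa = anz , ~selfˡ ab
      cases : Dec (x ∈< a :: d >) → ⊥
      cases (yes p) = nxb (~sym (~span bnz (~sym ab :: bd) p))
      cases (no nx) = cases' (∈? a (b :: x))
       where
        xad : Ind (x ∷ a :: d)
        xad = ext ad nx
        cases' : Dec (a ∈< b :: x >) → ⊥
        cases' (yes p) = nxb (~on xai xa (dimEq xai (g1 :: p) g0))
         where
          xai : Ind (x :: a)
          xai = ind-tail {x = d} (ind-gen xad (g1 ∷ g2 :: g0))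
        cases' (no na) = cases'' (∈? d (a ∷ b :: x))
         where
          abx : Ind (a ∷ b :: x)
          abx = ext bx na
          cases'' : Dec (d ∈< a ∷ b :: x >) → ⊥
          cases'' (yes p) = tri xa (~span anz (~selfˡ ab ∷ ab :: ~sym xa) p) (~sym dx) (ind-gen xad (g2 ∷ g0 :: g1))
          cases'' (no nd) = no3full {d ∷ a ∷ b :: x} (ext abx nd) bx
             (ind-tail {x = x} (ind-gen abx (g1 ∷ g2 :: g0)))
             (ind-tail {x = b} (ind-gen abx (g1 ∷ g0 :: g2)))
             (full2 (~sym ab) bd abd g1 g0 g2) (full2 xa (~sym dx) (ind-gen xad (g2 ∷ g0 :: g1)) g1 g0 g3)
             (full2 (~sym xa) ab (ind-gen abx (g2 ∷ g1 :: g0)) g3 g2 g1)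
           where
            abd : Ind (a ∷ d :: b)
            abd = ind-tail {x = x} (ind-gen (ext abx nd) (g2 ∷ g1 ∷ g3 :: g0))

  -- Pentagons and the 4-space they span

  module PentagonDefs where
   open Pencils public

   opaque
    inter′ : ∀ {N k l} {B : Vec (V {N}) k} {E : Vec (V {N}) l} {c z} → ¬ c ∈< E > → VAll (_∈< E >) B → z ∈< c ∷ B > → z ∈< E > → z ∈< B >
    inter′ {B = B} {E} {c} nc h (r ∷ cs , refl) z∈ with r ≟ 0F
    ... | yes refl = cs , vsolve [] (c :: lin cs B) (^1) (0k *v ^0 +v ^1) refl
    ... | no nz = ⊥-elim (nc (subst (_∈< E >)
       (vsolve (r :: inv r nz) (c :: lin cs B) (`1 *v ((`0 *v ^0 +v ^1) -v ^1)) (^0 +v (`0 *e `1 -e 1k) *v ^0) refl ⇐v (inv-r r nz s: c))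
       (∙∈ (inv r nz) (+∈ z∈ (∙∈ -1F (span⊆ h (cs , refl)))))))

   opaque
    ind-join : ∀ {N k l} {A : Vec (V {N}) k} {C : Vec (V {N}) l} → Ind A → Ind C → (∀ {z} → z ∈< A > → z ∈< C > → z ≡ 0v) → Ind (A ++ C)
    ind-join {k = k} {A = A} {C} i j dis es e with Vec.splitAt k es
    ... | cs , ds , refl = ++-0 cs (i cs z0) (j ds (vsolve [] (lin cs A :: lin ds C) (^1) (0w +v (1k *v ((^0 +v ^1) -v 0w) +v -1k *v (^0 -v 0w))) refl
        ⇐v (1F ∙: e') &v (-1F ∙: z0)))
     where
      e' : lin cs A <+> lin ds C ≡ 0v
      e' = sym (lin-++ cs ds A C) >> e
      z0 : lin cs A ≡ 0v
      z0 = dis (cs , refl) (-1F *> ds , trans (lin-∙ -1F ds C)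
        (vsolve [] (lin cs A :: lin ds C) (-1k *v ^1) (^0 +v -1k *v ((^0 +v ^1) -v 0w)) refl ⇐v (-1F ∙: e')))

   opaque
    path3 : ∀ {a b c} → Pnt a → Pnt b → Pnt c → a ~ b → b ~ c → ¬ a ~ c → Ind (b ∷ c :: a)
    path3 {a} {b} {c} pa pb pc ab bc nac = ext (¬~ind nac pa) λ b∈ → nac (~sym (~span (fst pc) (~sym bc :: snd pc) (dimEq ibc (b∈ :: g0) g1)))
     where
      ibc : Ind (b :: c)
      ibc with par? b (fst pc)
      ... | inj₂ i = i
      ... | inj₁ p = ⊥-elim (nac (~span (fst pa) [ ab ] (par-sym (fst pb) p)))

   opaque
    path4 : ∀ {a b c d} → Pnt a → Pnt b → Pnt c → a ~ b → b ~ c → ¬ a ~ c → ¬ b ~ d → Ind (d ∷ b ∷ c :: a)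
    path4 pa pb pc ab bc nac nbd = ext (path3 pa pb pc ab bc nac) λ d∈ → nbd (~span (fst pb) (snd pb ∷ bc :: ~sym ab) d∈)

   record Pent : Set where
    field
     p0 p1 p2 p3 p4 : W
     P0 : Pnt p0
     P1 : Pnt p1
     P2 : Pnt p2
     P3 : Pnt p3
     P4 : Pnt p4
     a01 : p0 ~ p1
     a12 : p1 ~ p2
     a23 : p2 ~ p3
     a34 : p3 ~ p4
     a40 : p4 ~ p0
     n02 : ¬ p0 ~ p2
     n13 : ¬ p1 ~ p3
     n24 : ¬ p2 ~ p4
     n30 : ¬ p3 ~ p0
     n41 : ¬ p4 ~ p1

  module PentagonU (pent : PentagonDefs.Pent) where
   open PentagonDefs public
   open Pent pent public

   U : Vec W 5
   U = p0 ∷ p1 ∷ p2 ∷ p3 :: p4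

   opaque
    -- If `p4` lay in the solid of the other four vertices, then `p1`, `p2` and `p3` would be three
    -- full points of it.
    indU : Ind U
    indU = ind-gen (ext i4 p4∉) (g4 ∷ g3 ∷ g1 ∷ g2 :: g0)
     where
      i4 : Ind (p3 ∷ p1 ∷ p2 :: p0)
      i4 = path4 P0 P1 P2 a01 a12 n02 n13
      p4∉ : ¬ p4 ∈< p3 ∷ p1 ∷ p2 :: p0 >
      p4∉ p = no3full i4 (ind-tail (ind-tail (ind-gen i4 (g0 ∷ g2 ∷ g3 :: g1)))) (ind-tail (ind-tail (ind-gen i4 (g2 ∷ g3 ∷ g0 :: g1))))
         (ind-tail (ind-tail (ind-gen i4 (g2 ∷ g0 ∷ g3 :: g1))))
         (full2 (~sym a01) a12 (ind-gen (ind-tail i4) (g2 ∷ g1 :: g0)) g3 g2 g1)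
         (full2 (~sym a12) a23 (ind-tail {x = p0} (ind-gen i4 (g2 ∷ g1 ∷ g3 :: g0))) g1 g0 g2)
         (full2 (~sym a23) a34 (ind-gen (path3 P2 P3 P4 a23 a34 n24) (g2 ∷ g1 :: g0)) g2 p g0)

   σ0 : Vec W 4
   σ0 = p0 ∷ p2 ∷ p3 :: p4

   opaque
    indσ0 : Ind σ0
    indσ0 = ind-tail {x = p1} (ind-gen indU (g1 ∷ g0 ∷ g2 ∷ g3 :: g4))

   opaque
    -- If the plane of `r` lay in `U`, it would contain a line of `L` through `r` inside `σ0`, where
    -- `p3` and `p4` are full. By `two-full` that line passes through `p3` or `p4`, making `p3`
    -- collinear with `p0` or `p2` collinear with `p4`.
    not-full : ∀ {r0 r2} → r0 ≢ 0F → r2 ≢ 0F → ¬ Full U (r0 *> p0 <+> r2 *> p2)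
    not-full {r0} {r2} z0 z2 (full pr fr) with planeOf pr
    ... | plane {y1} {y2} a b i with meet U (ind-tail (ind-gen i (g1 ∷ g2 :: g0))) indσ0 (fr a :: fr b) (g0 ∷ g2 ∷ g3 :: g4) ℕₚ.≤-refl
    ... | z , znz , z∈y , z∈σ = fin (two-full {ℓ = ln r z irz} indσ0 i34 f3 f4 (~L irz rz , (r0 ∷ r2 ∷ 0F :: 0F ,
         vsolve (r0 :: r2) (p0 ∷ p2 ∷ p3 :: p4) (`0 *v ^0 +v (`1 *v ^1 +v (0k *v ^2 +v (0k *v ^3 +v 0w)))) (`0 *v ^0 +v `1 *v ^1) refl) :: z∈σ))
     where
      r : W
      r = r0 *> p0 <+> r2 *> p2
      rz : r ~ z
      rz = ~span (fst pr) (a :: b) z∈y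
      irz : Ind (r :: z)
      irz with par? r znz
      ... | inj₂ j = j
      ... | inj₁ p = ⊥-elim (∉-head (ind-gen i (g1 ∷ g2 :: g0)) (span⊆ [ z∈y ] p))
      i34 : Ind (p3 :: p4)
      i34 = ind-tail (ind-tail indσ0)
      f3 : Full σ0 p3
      f3 = full2 (~sym a23) a34 (ind-gen (path3 P2 P3 P4 a23 a34 n24) (g2 ∷ g1 :: g0)) g1 g3 g2
      f4 : Full σ0 p4
      f4 = full2 (~sym a34) a40 (ind-gen (path3 P3 P4 P0 a34 a40 n30) (g2 ∷ g1 :: g0)) g2 g0 g3
      fin : p3 ∈< r :: z > ⊎ p4 ∈< r :: z > → ⊥
      fin (inj₁ p) = n30 (~span (fst P3) (~sym (~on irz rz p) :: ~sym a23) (inv r0 z0 :: - (inv r0 z0 * r2) ,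
        (vsolve (r0 ∷ r2 :: inv r0 z0) (p0 :: p2) (`2 *v (`0 *v ^0 +v `1 *v ^1) +v ((⊖ (`2 *e `1)) *v ^1 +v 0w)) (^0 +v (`0 *e `2 -e 1k) *v ^0) refl
        ⇐v (inv-r r0 z0 s: p0))))
      fin (inj₂ p) = n24 (~sym (~span (fst P4) (~sym (~on irz rz p) :: a40) (inv r2 z2 :: - (inv r2 z2 * r0) ,
        (vsolve (r0 ∷ r2 :: inv r2 z2) (p0 :: p2) (`2 *v (`0 *v ^0 +v `1 *v ^1) +v ((⊖ (`2 *e `0)) *v ^0 +v 0w)) (^1 +v (`1 *e `2 -e 1k) *v ^1) refl
        ⇐v (inv-r r2 z2 s: p2)))))

   -- The `q²` solids of the 4-space `U` through `p0` and `p2` that avoid `p1`.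
   σ : K → K → Vec W 4
   σ s t = p0 ∷ p2 ∷ p4 <+> s *> p1 :: p3 <+> t *> p1

   opaque
    indσ′ : ∀ s t → Ind (p1 ∷ σ s t)
    indσ′ s t = ind-gen indU (g1 ∷ g0 ∷ g2 ∷
     (- t ∷ 0F ∷ 0F ∷ 0F :: 1F , vsolve (s :: t) (p0 ∷ p1 ∷ p2 ∷ p3 :: p4) ((⊖ `1) *v ^1 +v (0k *v ^0 +v (0k *v ^2 +v (0k *v (^4 +v `0 *v ^1) +v (1k *v (^3 +v `1 *v ^1) +v 0w))))) (^3) refl) ∷
     (- s ∷ 0F ∷ 0F ∷ 1F :: 0F , vsolve (s :: t) (p0 ∷ p1 ∷ p2 ∷ p3 :: p4) ((⊖ `0) *v ^1 +v (0k *v ^0 +v (0k *v ^2 +v (1k *v (^4 +v `0 *v ^1) +v (0k *v (^3 +v `1 *v ^1) +v 0w))))) (^4) refl) ∷ [])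

   opaque
    indσ : ∀ s t → Ind (σ s t)
    indσ s t = ind-tail (indσ′ s t)

   opaque
    p1∉σ : ∀ s t → ¬ p1 ∈< σ s t >
    p1∉σ s t = ∉-head (indσ′ s t)

   opaque
    σ⊆U : ∀ s t → VAll (_∈< U >) (σ s t)
    σ⊆U s t = g0 ∷ g2 ∷ +∈ g4 (∙∈ s g1) :: +∈ g3 (∙∈ t g1)

   opaque
    scal-p1 : ∀ {s t} r r' x → x <+> r *> p1 ∈< σ s t > → x <+> r' *> p1 ∈< σ s t > → r ≡ r'
    scal-p1 {s} {t} r r' x a b with r - r' ≟ 0F
    ... | yes e = -‿injective-0 e
    ... | no ne = ⊥-elim (p1∉σ s t (subst (_∈< σ s t >)
       (vsolve (r ∷ r' :: inv (r - r') ne) (x :: p1) (`2 *v ((^0 +v `0 *v ^1) -v (^0 +v `1 *v ^1))) (^1 +v ((`0 -e `1) *e `2 -e 1k) *v ^1) refl ⇐v (inv-r (r - r') ne s: p1))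
       (∙∈ (inv (r - r') ne) (+∈ a (∙∈ -1F b)))))

   opaque
    p0~ : ∀ s → p0 ~ p4 <+> s *> p1
    p0~ s = ~+ (fst P0) (~sym a40) (~∙ s a01)

   opaque
    p2~ : ∀ t → p2 ~ p3 <+> t *> p1
    p2~ t = ~+ (fst P2) a23 (~∙ t (~sym a12))

   opaque
    i₀ : ∀ s → Ind (p0 :: p4 <+> s *> p1)
    i₀ s = ind-tail (ind-tail (ind-gen (indσ s 0F) (g2 ∷ g0 ∷ g3 :: g1)))

   opaque
    i₂ : ∀ t → Ind (p2 :: p3 <+> t *> p1)
    i₂ t = ind-tail (ind-tail (ind-gen (indσ 0F t) (g1 ∷ g2 ∷ g0 :: g3)))

   ℓ0 : K → Ln
   ℓ0 s = ln p0 (p4 <+> s *> p1) (i₀ s)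

   ℓ2 : K → Ln
   ℓ2 t = ln p2 (p3 <+> t *> p1) (i₂ t)

   opaque
    ℓ0-in : ∀ s t → In (σ s t) (ℓ0 s)
    ℓ0-in s t = ~L (i₀ s) (p0~ s) , g0 :: g2

   opaque
    ℓ2-in : ∀ s t → In (σ s t) (ℓ2 t)
    ℓ2-in s t = ~L (i₂ t) (p2~ t) , g1 :: g3

   opaque
    -- The plane of `p0` contains `p1`, which is outside the solid, so it meets the solid in one
    -- line only.
    thru-p0 : ∀ {s t k} → In (σ s t) k → p0 ∈< bas k > → k ≈ℓ ℓ0 s
    thru-p0 {s} {t} {k} (h , s⊆) p∈ with other k (fst P0) p∈
    ... | y , y∈ , i = ≈-trans (≈ln i p∈ y∈) (≈-sym (≈ln {ℓ = ℓ0 s} i g0 (span⊆ (g1 :: g0)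
      (inter′ (p1∉σ s t) (g2 :: g0) (span⊆ (g0 ∷ (- s ∷ 1F :: 0F , vsolve [ s ] (p1 ∷ p4 :: p0) ((⊖ `0) *v ^0 +v (1k *v (^1 +v `0 *v ^0) +v (0k *v ^2 +v 0w))) (^1) refl) :: g2)
        (in-plane a01 (~sym a40) (ind-gen (path3 P4 P0 P1 a40 a01 n41) (g2 ∷ g0 :: g1)) (L~ {k} h p∈ y∈))) (span⊆ s⊆ y∈)))))

   opaque
    thru-p2 : ∀ {s t k} → In (σ s t) k → p2 ∈< bas k > → k ≈ℓ ℓ2 t
    thru-p2 {s} {t} {k} (h , s⊆) p∈ with other k (fst P2) p∈
    ... | y , y∈ , i = ≈-trans (≈ln i p∈ y∈) (≈-sym (≈ln {ℓ = ℓ2 t} i g0 (span⊆ (g1 :: g0)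
      (inter′ (p1∉σ s t) (g3 :: g1) (span⊆ (g0 ∷ (- t ∷ 1F :: 0F , vsolve [ t ] (p1 ∷ p3 :: p2) ((⊖ `0) *v ^0 +v (1k *v (^1 +v `0 *v ^0) +v (0k *v ^2 +v 0w))) (^1) refl) :: g2)
        (in-plane (~sym a12) a23 (ind-gen (path3 P1 P2 P3 a12 a23 n13) (g2 ∷ g1 :: g0)) (L~ {k} h p∈ y∈))) (span⊆ s⊆ y∈)))))

   Apart : ∀ {d} → Vec W d → Ln → Set
   Apart B k = ∀ {z} → z ∈< bas k > → z ∈< B > → z ≡ 0v

   opaque
    -- A line through a third point of `p0 p2`, together with the line from that point to `p1`,
    -- would make the point full in `U`, against `not-full`.
    meet02 : ∀ {s t k} → In (σ s t) k → ¬ k ≈ℓ ℓ0 s → ¬ k ≈ℓ ℓ2 t → Apart (p0 :: p2) k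
    meet02 {s} {t} {k} ik n0 n2 {z} z∈ z∈' with z ≟v 0v
    ... | yes e = e
    ... | no znz = ⊥-elim (go z∈')
     where
      go : z ∈< p0 :: p2 > → ⊥
      go (r0 :: r2 , e) with r0 ≟ 0F | r2 ≟ 0F
      ... | yes refl | _ = n2 (thru-p2 {k = k} ik (span⊆ [ z∈ ] (par-sym znz (r2 ∷ [] , trans (vsolve [ r2 ] (p0 :: p2) (`0 *v ^1 +v 0w) (0k *v ^0 +v (`0 *v ^1 +v 0w)) refl) e))))
      ... | no _ | yes refl = n0 (thru-p0 {k = k} ik (span⊆ [ z∈ ] (par-sym znz (r0 ∷ [] , trans (vsolve [ r0 ] (p0 :: p2) (`0 *v ^0 +v 0w) (`0 *v ^0 +v (0k *v ^1 +v 0w)) refl) e))))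
      ... | no z0 | no z2 with other k znz z∈
      ...   | y , y∈ , i = not-full z0 z2 (subst (Full U) (sym e >> vsolve (r0 :: r2) (p0 :: p2) (`0 *v ^0 +v (`1 *v ^1 +v 0w)) (`0 *v ^0 +v `1 *v ^1) refl)
          (full2 (~sym (~span (fst P1) (~sym a01 :: a12) z∈')) (L~ {k} (fst ik) z∈ y∈)
            (ext (swap i) λ p → p1∉σ s t (span⊆ (span⊆ (snd ik) y∈ :: span⊆ (snd ik) z∈) p)) g1 (span⊆ (σ⊆U s t) (span⊆ (snd ik) y∈)) (span⊆ (σ⊆U s t) (span⊆ (snd ik) z∈))))

  -- Lines in the 4-space of a pentagon

  module PentagonT (pent : PentagonDefs.Pent) where
   open PentagonU pent public

   -- A point of the line `p0 p2` other than the two vertices: collinear with `p1`, and not full in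
   -- `U`.
   w : W
   w = p0 <+> p2

   Sσ : K → K → Ln → Set
   Sσ s t k = In (σ s t) k × Apart (p0 :: p2) k

   opaque
    i02 : Ind (p0 :: p2)
    i02 = swap (¬~ind n02 P0)

   opaque
    ℓ0≉ℓ2 : ∀ s t → ¬ ℓ0 s ≈ℓ ℓ2 t
    ℓ0≉ℓ2 s t e = ∉-head (indσ s t) (span⊆ (g0 :: g2) (fst (sub e) p0 g0))

   opaque
    famσ : ∀ s t → LFam (Sσ s t) (ℕ.pred q)
    famσ s t = fam-map (λ {k} ((i , n0) , n2) → i , meet02 {k = k} i n0 n2)
     (rm (fam-≤ (ℕₚ.≤-reflexive (sym q-pred)) (rm (solid≥ (indσ s t) (fam2 {ℓ = ℓ0 s} {m = ℓ2 t} (ℓ0-in s t) (ℓ2-in s t) (ℓ0≉ℓ2 s t))) (ℓ0 s))) (ℓ2 t))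

   opaque
    -- For `s = t = 0` the solid contains `p3` and `p4` as full points, hence has `2q + 1` lines;
    -- two of them are removed as in `famσ`.
    famσ0 : LFam (Sσ 0F 0F) (q ℕ.+ ℕ.pred q)
    famσ0 = fam-map (λ {k} ((i , n0) , n2) → i , meet02 {k = k} i n0 n2) (rm (fam-≤ (ℕₚ.≤-reflexive e) (rm all (ℓ0 0F))) (ℓ2 0F))
     where
      e : suc (q ℕ.+ ℕ.pred q) ≡ q ℕ.+ q
      e = sym (ℕₚ.+-suc q (ℕ.pred q)) >> cong (q ℕ.+_) (sym q-pred)
      m4 : p4 ∈< σ 0F 0F >
      m4 = subst (_∈< σ 0F 0F >) (vsolve [] (p4 :: p1) (^0 +v 0k *v ^1) (^0) refl) g2
      m3 : p3 ∈< σ 0F 0F >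
      m3 = subst (_∈< σ 0F 0F >) (vsolve [] (p3 :: p1) (^0 +v 0k *v ^1) (^0) refl) g3
      f3 : Full (σ 0F 0F) p3
      f3 = full2 (~sym a23) a34 (ind-gen (path3 P2 P3 P4 a23 a34 n24) (g2 ∷ g1 :: g0)) g1 m4 m3
      f4 : Full (σ 0F 0F) p4
      f4 = full2 (~sym a34) a40 (ind-gen (path3 P3 P4 P0 a34 a40 n30) (g2 ∷ g1 :: g0)) m3 g0 m4
      all : LFam (In (σ 0F 0F)) (suc q ℕ.+ q)
      all = fam-++ (pencilIn f4) (pencil∖ (ind-tail (ind-tail indσ0)) f3) (λ (_ , x) (_ , y) e → y (fst (sub e) p4 x)) fst (fst ∘ fst)

   opaque
    -- A line of the solid disjoint from `p0 p2` spans the solid together with it, so it determines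
    -- `s` and `t`.
    σ-dis : ∀ {s t s' t' k k'} → Sσ s t k → Sσ s' t' k' → k ≈ℓ k' → s ≡ s' × t ≡ t'
    σ-dis {s} {t} {s'} {t'} {k@(subspace (y :: y') i)} {k'} ((_ , a :: b) , ap) ((_ , h') , _) e =
      scal-p1 s s' p4 g2 (mv g2) , scal-p1 t t' p3 g3 (mv g3)
     where
      J4 : Ind (y ∷ y' ∷ p0 :: p2)
      J4 = ind-join i i02 ap
      mv : ∀ {z} → z ∈< σ s' t' > → z ∈< σ s t >
      mv z∈ = span⊆ (a ∷ b ∷ g0 :: g1) (dimEq J4 (span⊆ h' (fst (sub e) y g0) ∷ span⊆ h' (fst (sub e) y' g1) ∷ g0 :: g1) z∈)

   -- Being disjoint from `p1 w`, such a line spans a plane with `w`, and a solid with `w` and the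
   -- point chosen outside `U`; it is also kept apart from the lines through `p1`.
   LamS : Ln {suc n} → Set
   LamS k = In U k × Apart (p1 :: w) k

   opaque
    w∈ : w ∈< p0 :: p2 >
    w∈ = +∈ g0 g1

   opaque
    Sσ⇒LamS : ∀ {s t k} → Sσ s t k → LamS k
    Sσ⇒LamS {s} {t} ((h , i) , ap) = (h , VAll.map (span⊆ (σ⊆U s t)) i) , λ z∈ z∈' →
     ap z∈ (span⊆ [ w∈ ] (inter′ (p1∉σ s t) [ span⊆ (g0 :: g1) w∈ ] z∈' (span⊆ i z∈)))

   private
    zero-mult : ∀ {r x} → r ≡ 0F → r *> x ≡ 0v {suc n}
    zero-mult {x = x} refl = vsolve [] [ x ] (0k *v ^0) 0w refl

   opaque
    ℓ0-Lam : ∀ s → LamS (ℓ0 s)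
    ℓ0-Lam s = (~L (i₀ s) (p0~ s) , VAll.map (span⊆ (σ⊆U s 0F)) (g0 :: g2)) , ap
     where
      ap : Apart (p1 :: w) (ℓ0 s)
      ap z∈ z∈' = go z∈ (inter′ (p1∉σ s 0F) [ span⊆ (g0 :: g1) w∈ ] z∈' (span⊆ (g0 :: g2) z∈))
       where
        go : ∀ {z} → z ∈< bas (ℓ0 s) > → z ∈< w ∷ [] > → z ≡ 0v
        go (a :: b , e) (r ∷ [] , refl) = vsolve [ r ] [ w ] (`0 *v ^0 +v 0w) (`0 *v ^0) refl >> zero-mult (coef (indσ s 0F) (r - a ∷ r ∷ - b :: 0F)
         (vsolve (r ∷ a ∷ b :: s) (p0 ∷ p2 ∷ p4 ∷ p1 :: p3) ((`0 -e `1) *v ^0 +v (`0 *v ^1 +v ((⊖ `2) *v (^2 +v `3 *v ^3) +v (0k *v (^4 +v 0k *v ^3) +v 0w))))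
          (0w +v -1k *v ((`1 *v ^0 +v (`2 *v (^2 +v `3 *v ^3) +v 0w)) -v (`0 *v (^0 +v ^1) +v 0w))) refl ⇐v -1F ∙: e) (suc zero))

   opaque
    ℓ2-Lam : ∀ t → LamS (ℓ2 t)
    ℓ2-Lam t = (~L (i₂ t) (p2~ t) , VAll.map (span⊆ (σ⊆U 0F t)) (g1 :: g3)) , ap
     where
      ap : Apart (p1 :: w) (ℓ2 t)
      ap z∈ z∈' = go z∈ (inter′ (p1∉σ 0F t) [ span⊆ (g0 :: g1) w∈ ] z∈' (span⊆ (g1 :: g3) z∈))
       where
        go : ∀ {z} → z ∈< bas (ℓ2 t) > → z ∈< w ∷ [] > → z ≡ 0v
        go (a :: b , e) (r ∷ [] , refl) = vsolve [ r ] [ w ] (`0 *v ^0 +v 0w) (`0 *v ^0) refl >> zero-mult (coef (indσ 0F t) (r ∷ r - a ∷ 0F :: - b)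
         (vsolve (r ∷ a ∷ b :: t) (p0 ∷ p2 ∷ p3 ∷ p1 :: p4) (`0 *v ^0 +v ((`0 -e `1) *v ^1 +v (0k *v (^4 +v 0k *v ^3) +v ((⊖ `2) *v (^2 +v `3 *v ^3) +v 0w))))
          (0w +v -1k *v ((`1 *v ^1 +v (`2 *v (^2 +v `3 *v ^3) +v 0w)) -v (`0 *v (^0 +v ^1) +v 0w))) refl ⇐v -1F ∙: e) zero)

   opaque
    famKK : Fam {K × K} _≡_ (λ _ → ⊤) (q ℕ.* q)
    famKK = fam-map (λ _ → tt) (fam-sum {S = λ _ → ⊤} (λ r i → fst i ≡ r) famK (λ r _ → fam-img (r ,_) famK (λ _ → refl) (λ _ _ ne e → ne (cong snd e)))
     (λ { _ _ ne refl refl e → ne (cong fst e) }))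

   lam : ℕ
   lam = (ℕ.pred (q ℕ.* q) ℕ.* ℕ.pred q ℕ.+ (q ℕ.+ ℕ.pred q)) ℕ.+ (q ℕ.+ q)

   opaque
    -- `q² ∸ 1` solids contribute `q ∸ 1` lines each, the special solid `2q ∸ 1`, and the lines `ℓ0`
    -- and `ℓ2` another `2q`.
    famΛ : LFam LamS lam
    famΛ = fam-++ {U = LamS} part1 part2 dis
       (λ { {k} (i , s) → Sσ⇒LamS {k = k} s }) (λ { (inj₁ (s , refl)) → ℓ0-Lam s ; (inj₂ (t , refl)) → ℓ2-Lam t })
     where
      S1 : Ln {suc n} → Set
      S1 k = ∃ λ (i : K × K) → Sσ (fst i) (snd i) k
      qq : q ℕ.* q ≡ suc (ℕ.pred (q ℕ.* q))
      qq = subst (λ z → z ℕ.* z ≡ suc (ℕ.pred (z ℕ.* z))) (sym q-pred) refl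
      part1 : LFam S1 (ℕ.pred (q ℕ.* q) ℕ.* ℕ.pred q ℕ.+ (q ℕ.+ ℕ.pred q))
      part1 = fam-++ (fam-sum (λ i k → Sσ (fst i) (snd i) k)
          (fam-rem (≡-dec _≟_ _≟_) sym trans (fam-≤ (ℕₚ.≤-reflexive (sym qq)) famKK) (0F , 0F)) (λ (s , t) _ → famσ s t)
          (λ { {x} {y} {k} {k'} _ _ ne a b e → let p , r = σ-dis {k = k} {k' = k'} a b e in ne (cong₂ _,_ p r) })) famσ0
         (λ { {k} {k'} (i , (_ , ne) , a) b e → let p , r = σ-dis {k = k} {k' = k'} a b e in ne (cong₂ _,_ p r) })
         (λ (i , _ , a) → i , a) (λ a → (0F , 0F) , a)
      S2 : Ln {suc n} → Set
      S2 k = (∃ λ s → k ≡ ℓ0 s) ⊎ (∃ λ t → k ≡ ℓ2 t)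
      part2 : LFam S2 (q ℕ.+ q)
      part2 = fam-++ {S = λ k → ∃ λ s → k ≡ ℓ0 s} {T = λ k → ∃ λ t → k ≡ ℓ2 t}
        (fam-img ℓ0 famK (λ {s} _ → s , refl) (λ {s} {s'} _ _ ne e → ne (scal-p1 {s} {0F} s s' p4 g2 (span⊆ (g0 :: g2) (snd (sub e) (p4 <+> s' *> p1) g1)))))
        (fam-img ℓ2 famK (λ {s} _ → s , refl) (λ {s} {s'} _ _ ne e → ne (scal-p1 {0F} {s} s s' p3 g3 (span⊆ (g1 :: g3) (snd (sub e) (p3 <+> s' *> p1) g1)))))
        (λ { (s , refl) (t , refl) → ℓ0≉ℓ2 s t }) inj₁ inj₂
      dis : ∀ {a b} → S1 a → S2 b → ¬ a ≈ℓ b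
      dis (_ , _ , ap) (inj₁ (s , refl)) e = fst P0 (ap (snd (sub e) p0 g0) g0)
      dis (_ , _ , ap) (inj₂ (s , refl)) e = fst P2 (ap (snd (sub e) p2 g0) g1)

   opaque
    p1~w : p1 ~ w
    p1~w = ~+ (fst P1) (~sym a01) a12

   opaque
    ip1w : Ind (p1 :: w)
    ip1w = ind-tail {x = p0} (ind-gen (path3 P0 P1 P2 a01 a12 n02) (g1 ∷ (- 1F ∷ 0F :: 1F , vsolve [] (p0 ∷ p1 :: p2) (-1k *v ^0 +v (0k *v ^1 +v (1k *v (^0 +v ^2) +v 0w))) (^2) refl) :: g0))

   opaque
    wnz : w ≢ 0v
    wnz = ind-nonzero (ind-tail ip1w)

   opaque
    w∈U : w ∈< U >
    w∈U = +∈ g0 g2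

   opaque
    wfull : ¬ Full U w
    wfull f = not-full 1≢0 1≢0 (subst (Full U) (vsolve [] (p0 :: p2) (^0 +v ^1) (1k *v ^0 +v 1k *v ^1) refl) f)

   opaque
    apex : ∃ λ z → w ~ z × ¬ z ∈< U >
    apex with planeOf (wnz , ~selfˡ (~sym p1~w))
    ... | plane {y} {y'} a b i with ∈? y U | ∈? y' U
    ... | no ny | _ = y , a , ny
    ... | yes _ | no ny = y' , b , ny
    ... | yes m | yes m' = ⊥-elim (wfull (full2 a b i m m' w∈U))

  -- Too many lines in a 5-space

  module PentagonZ (pent : PentagonDefs.Pent) where
   open PentagonT pent public

   z : W
   z = fst apex

   opaque
    w~z : w ~ z
    w~z = fst (snd apex)

   opaque
    z∉U : ¬ z ∈< U >
    z∉U = snd (snd apex)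

   T : Vec W 6
   T = z ∷ U

   opaque
    indT : Ind T
    indT = ext indU z∉U

   opaque
    izw : Ind (z :: w)
    izw = ext (ind1 wnz) λ p → z∉U (span⊆ [ w∈U ] p)

   nn : Ln {suc n}
   nn = ln z w izw

   D : Ln {suc n} → Vec W 4
   D k = z ∷ w ∷ bas k

   opaque
    w∉k : ∀ {k} → LamS k → ¬ w ∈< bas k >
    w∉k (_ , ap) w∈k = wnz (ap w∈k g1)

   opaque
    plane⊆U : ∀ {k} → LamS k → VAll (_∈< U >) (w ∷ bas k)
    plane⊆U ((_ , i) , _) = w∈U ∷ i

   opaque
    indD : ∀ {k} → LamS k → Ind (D k)
    indD {k} s = ext (ext (Subspace.indep k) (w∉k {k} s)) λ p → z∉U (span⊆ (plane⊆U {k} s) p)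

   opaque
    D∩U : ∀ {k x} → LamS k → x ∈< D k > → x ∈< U > → x ∈< w ∷ bas k >
    D∩U {k} s = inter′ z∉U (plane⊆U {k} s)

   -- A second line in the plane ⟨w, k> would give w two lines in U.
   opaque
    only-k : ∀ {k k'} → LamS k → L k' → VAll (_∈< w ∷ bas k >) (bas k') → k' ≈ℓ k
    only-k {k} {k'} s@((Lk , _) , ap) Lk' i' with ≈? k' k
    ... | yes e = e
    ... | no ne with meet (w ∷ bas k) (Subspace.indep k') (Subspace.indep k) i' (VAll.map wk∈ (gens∈ (bas k))) ℕₚ.≤-refl
    ... | x , xnz , x∈k' , x∈k with other k' xnz x∈k' | other k xnz x∈k
    ... | t , t∈ , j | t' , t∈' , j' = ⊥-elim (last (∈? x (p1 :: w)))
     where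
      i3 : Ind (t ∷ t' :: x)
      i3 = ext (swap j') λ p → ne (≈-trans (≈ln j x∈k' t∈) (≈-sym (≈ln j x∈k (span⊆ (t∈' :: x∈k) p))))
      xw : x ~ w
      xw = ~span xnz (L~ {k'} Lk' x∈k' t∈ ∷ L~ {k} Lk x∈k t∈' :: L~ {k} Lk x∈k x∈k)
       (dimEq i3 (span⊆ i' t∈ ∷ wk∈ t∈' :: wk∈ x∈k) g0)
      last : Dec (x ∈< p1 :: w >) → ⊥
      last (yes p) = xnz (ap x∈k p)
      last (no np) = wfull (full2 (~sym xw) (~sym p1~w) (ext ip1w np) (span⊆ (plane⊆U {k} s) (wk∈ x∈k)) g1 w∈U)

   HS : Ln {suc n} → Ln {suc n} → Set
   HS k h = In (D k) h × Apart (z :: w) h × ¬ h ≈ℓ k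

   opaque
    k∩n : ∀ {k x} → LamS k → x ∈< bas k > → x ∈< z :: w > → x ≡ 0v
    k∩n {k} s@((_ , i) , ap) x∈ x∈n = ap x∈ (span⊆ [ g1 ] (inter′ z∉U [ w∈U ] x∈n (span⊆ i x∈)))

   opaque
    nn-in : ∀ k → In (D k) nn
    nn-in k = ~L izw (~sym w~z) , g0 :: g1

   opaque
    k-in : ∀ {k} → LamS k → In (D k) k
    k-in {k} ((Lk , _) , _) = Lk , VAll.map (wk∈ ∘ wk∈) (gens∈ (bas k))

   opaque
    -- If no line of `L` in the solid other than `nn` meets `nn`, the `q + 1` lines of the solid
    -- without `nn` and `k` suffice. Otherwise the plane of a point `g` of `nn` lies in the solid
    -- and meets `k` in a point `x`, which is full there; the lines through `x` that avoid `g` and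
    -- differ from `k` are then taken, and a triangle would arise if one met `nn`.
    famH : ∀ {k} → LamS k → LFam (HS k) (ℕ.pred q)
    famH {k} s with search (λ g → search (λ g' → ¬? (g ≟v 0v) ×-dec (∈? g (z :: w) ×-dec (~? g g' ×-dec (∈? g' (D k) ×-dec ¬? (∈? g' (z :: w)))))))
    ... | no nQ = fam-map (λ { {h} ((i , nen) , nek) → i , (λ {x} → ap {h} i nen {x}) , nek })
      (rm (fam-≤ (ℕₚ.≤-reflexive (sym q-pred)) (rm (solid≥ (indD {k} s) (fam2 {ℓ = nn} {m = k} (nn-in k) (k-in {k} s) λ e → w∉k {k} s (fst (sub e) w g1))) nn)) k)
     where
      ap : ∀ {h} → In (D k) h → ¬ h ≈ℓ nn → Apart (z :: w) h
      ap {h} (Lh , i) ne {g} g∈ g∈n with g ≟v 0v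
      ... | yes e = e
      ... | no gnz with other h gnz g∈
      ...   | g' , g'∈ , j = ⊥-elim (nQ (g , g' , gnz , g∈n , L~ {h} Lh g∈ g'∈ , span⊆ i g'∈ ,
           λ p → ne (≈-trans (≈ln j g∈ g'∈) (≈-sym (≈ln {ℓ = nn} j g∈n p)))))
    ... | yes (g , g' , gnz , g∈n , gg' , g'∈ , g'∉n) with other nn gnz g∈n
    ...   | e , e∈n , j with meet (D k) (Subspace.indep k) i3 (VAll.map (wk∈ ∘ wk∈) (gens∈ (bas k))) (g'∈ ∷ span⊆ (g0 :: g1) e∈n :: span⊆ (g0 :: g1) g∈n) ℕₚ.≤-refl
     where
      i3 : Ind (g' ∷ e :: g)
      i3 = ext (swap j) λ p → g'∉n (span⊆ (e∈n :: g∈n) p)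
    ...   | x , xnz , x∈k , x∈π with other k xnz x∈k
    ...   | t , t∈ , jt = fam-map (λ { {h} (((i , x∈) , g∉) , nek) → i , (λ {y} → ap {h} i x∈ g∉ {y}) , nek }) (rm (fam-≤ (ℕₚ.≤-reflexive (sym q-pred)) (pencil∖ ixg fx)) k)
     where
      gx : g ~ x
      gx = ~span gnz (gg' ∷ L~ {nn} (fst (nn-in k)) g∈n e∈n :: L~ {nn} (fst (nn-in k)) g∈n g∈n) x∈π
      x∉n : ¬ x ∈< z :: w >
      x∉n p = xnz (k∩n {k} s x∈k p)
      ixg : Ind (x :: g)
      ixg = ext (ind1 gnz) λ p → x∉n (span⊆ [ g∈n ] p)
      fx : Full (D k) x
      fx = full2 (~sym gx) (L~ {k} (fst (fst s)) x∈k t∈) (ext (swap jt) λ p → gnz (k∩n {k} s (span⊆ (t∈ :: x∈k) p) g∈n))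
          (span⊆ (g0 :: g1) g∈n) (wk∈ (wk∈ t∈)) (wk∈ (wk∈ x∈k))
      ap : ∀ {h} → In (D k) h → x ∈< bas h > → ¬ g ∈< bas h > → Apart (z :: w) h
      ap {h} (Lh , i) x∈h g∉ {y} y∈ y∈n with y ≟v 0v
      ... | yes e = e
      ... | no ynz with par? g ynz
      ...   | inj₁ p = ⊥-elim (g∉ (span⊆ [ y∈ ] p))
      ...   | inj₂ igy = ⊥-elim (x∉n (span⊆ (g∈n :: y∈n) (tri∈ igy (L~ {h} Lh y∈ x∈h) (~sym gx) (L~ {nn} (fst (nn-in k)) y∈n g∈n))))

   opaque
    h∉U : ∀ {k h} → LamS k → HS k h → ¬ VAll (_∈< U >) (bas h)
    h∉U {k} {h@(subspace (a :: b) _)} s ((Lh , (a∈ :: b∈)) , _ , ne) (a∈U :: b∈U) = ne (only-k {k} {h} s Lh (D∩U {k} s a∈ a∈U :: D∩U {k} s b∈ b∈U))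

   opaque
    -- `h` and `nn` span the solid `D k`, whose intersection with `U` contains no line of `L` except
    -- `k`.
    HS-dis : ∀ {k k' h h'} → LamS k → LamS k' → HS k h → HS k' h' → h ≈ℓ h' → k ≈ℓ k'
    HS-dis {k} {k'@(subspace (c :: d) _)} {h@(subspace (a :: b) i)} {h'} s s'@((Lk' , c∈U :: d∈U) , _) ((_ , a∈ :: b∈) , ap , _) ((_ , i') , _) e =
      ≈-sym (only-k {k} {k'} s Lk' (D∩U {k} s (mv g2) c∈U :: D∩U {k} s (mv g3) d∈U))
     where
      J4 : Ind (a ∷ b ∷ z :: w)
      J4 = ind-join i izw ap
      mv : ∀ {x} → x ∈< D k' > → x ∈< D k >
      mv x∈ = span⊆ (a∈ ∷ b∈ ∷ g0 :: g1) (dimEq J4 (span⊆ i' (fst (sub e) a g0) ∷ span⊆ i' (fst (sub e) b g1) ∷ g0 :: g1) x∈)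

   opaque
    z∉+ : ∀ r {k} {B : Vec W k} → VAll (_∈< U >) B → ¬ z <+> r *> p1 ∈< B >
    z∉+ r h p = z∉U (subst (_∈< U >) (vsolve [ r ] (z :: p1) ((^0 +v `0 *v ^1) +v (⊖ `0) *v ^1) (^0) refl) (+∈ (span⊆ h p) (∙∈ (- r) g1)))

   opaque
    famC : LFam (λ k → In T k × w ∈< bas k > × ¬ VAll (_∈< U >) (bas k)) q
    famC = fam-img g famK (λ {r} _ → (~L (ig r) (~+ wnz w~z (~∙ r (~sym p1~w))) , wk∈ w∈U :: +∈ g0 (∙∈ r (wk∈ g1))) , g0 , λ { (_ :: p) → z∉+ r {B = U} (gens∈ U) p })
      (λ {r} {s} _ _ ne e → ne (inj r s (fst (sub e) (z <+> r *> p1) g1)))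
     where
      izpw : Ind (z ∷ p1 :: w)
      izpw = ext ip1w λ p → z∉U (span⊆ (g1 :: w∈U) p)
      ig : ∀ r → Ind (w :: z <+> r *> p1)
      ig r = swap (ext (ind1 wnz) (z∉+ r [ w∈U ]))
      g : K → Ln {suc n}
      g r = ln w (z <+> r *> p1) (ig r)
      inj : ∀ r s → z <+> r *> p1 ∈< w :: z <+> s *> p1 > → r ≡ s
      inj r s (a :: b , e) = solve (r ∷ s :: b) (`0) (`1 +e ((`0 -e `2 *e `1 -e 0k) +e (⊖ `1) *e (1k -e `2 -e 0k))) refl
        ⇐ trans (sym (solve (r ∷ s :: b) (1k *e (`0 -e `2 *e `1 -e 0k)) (`0 -e `2 *e `1 -e 0k) refl)) (1F *: c1) & (- s) *: c0
       where
        eq : lin (1F - b ∷ r - b * s :: - a) (z ∷ p1 :: w) ≡ 0v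
        eq = vsolve (r ∷ s ∷ a :: b) (z ∷ p1 :: w) ((1k -e `3) *v ^0 +v ((`0 -e `3 *e `1) *v ^1 +v ((⊖ `2) *v ^2 +v 0w)))
          (0w +v -1k *v ((`2 *v ^2 +v (`3 *v (^0 +v `1 *v ^1) +v 0w)) -v (^0 +v `0 *v ^1))) refl ⇐v -1F ∙: e
        c0 : 1F - b ≡ 0F
        c0 = coef izpw (1F - b ∷ r - b * s :: - a) eq zero
        c1 : r - b * s ≡ 0F
        c1 = coef izpw (1F - b ∷ r - b * s :: - a) eq (suc zero)

   opaque
    famT : LFam (In T) (lam ℕ.+ (suc q ℕ.+ (q ℕ.+ lam ℕ.* ℕ.pred q)))
    famT = fam-++ {U = In T} famΛ (fam-++ {U = TB} (pencilIn f1) (fam-++ {U = TC} famC famD disCD inj₁ inj₂) disB inj₁ inj₂) disA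
      (λ ((h , i) , _) → h , VAll.map wk∈ i) (λ { (inj₁ ((h , i) , _)) → h , VAll.map wk∈ i ; (inj₂ (inj₁ (i , _))) → i ; (inj₂ (inj₂ (k , s , (h , i) , _))) → h , VAll.map (span⊆ (g0 ∷ wk∈ w∈U ∷ VAll.map wk∈ (snd (fst s)))) i })
     where
      f1 : Full U p1
      f1 = full2 (~sym a01) a12 (ind-gen (path3 P0 P1 P2 a01 a12 n02) (g2 ∷ g1 :: g0)) g0 g2 g1
      famD : LFam (λ h → ∃ λ k → LamS k × HS k h) (lam ℕ.* ℕ.pred q)
      famD = fam-sum HS famΛ (λ k s → famH {k} s) (λ {k} {k'} {h} {h'} s s' ne a b e → ne (HS-dis {k} {k'} {h} {h'} s s' a b e))
      TC TB : Ln {suc n} → Set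
      TC k = (In T k × w ∈< bas k > × ¬ VAll (_∈< U >) (bas k)) ⊎ (∃ λ k' → LamS k' × HS k' k)
      TB k = (In U k × p1 ∈< bas k >) ⊎ TC k
      mvU : ∀ {a b} → a ≈ℓ b → VAll (_∈< U >) (bas a) → VAll (_∈< U >) (bas b)
      mvU {a} {b} e i = VAll.map (λ {y} y∈ → span⊆ i (snd (sub e) y y∈)) (gens∈ (bas b))
      disCD : ∀ {a b} → In T a × w ∈< bas a > × ¬ VAll (_∈< U >) (bas a) → (∃ λ k' → LamS k' × HS k' b) → ¬ a ≈ℓ b
      disCD (_ , w∈a , _) (k , s , _ , ap , _) e = wnz (ap (fst (sub e) w w∈a) g1)
      disB : ∀ {a b} → In U a × p1 ∈< bas a > → TC b → ¬ a ≈ℓ b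
      disB ((_ , i) , _) (inj₁ (_ , _ , nu)) e = nu (mvU e i)
      disB {b = b} ((_ , i) , _) (inj₂ (k , s , hs)) e = h∉U {k} {b} s hs (mvU e i)
      disA : ∀ {a b} → LamS a → TB b → ¬ a ≈ℓ b
      disA (_ , ap) (inj₁ (_ , p∈)) e = fst P1 (ap (snd (sub e) p1 p∈) g0)
      disA ((_ , i) , _) (inj₂ (inj₁ (_ , _ , nu))) e = nu (mvU e i)
      disA {b = b} ((_ , i) , _) (inj₂ (inj₂ (k , s , hs))) e = h∉U {k} {b} s hs (mvU e i)

  -- No pentagons, and the generalised hexagon

  module Hexagon where
   open PentagonDefs public
   open Hyp H
   open Arith

   opaque
    -- `famT` lists one line more than (Hp') permits.
    noPent : ¬ Pent
    noPent p with hp (subspace T indT)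
     where open PentagonZ p using (T; indT; famT)
    ... | m , cnt , le = ℕₚ.<-irrefl refl (ℕₚ.≤-trans (ℕₚ.≤-reflexive (sym e)) (ℕₚ.≤-trans (card-bound cnt (fam-map (λ (h , s) → h , λ x → span⊆ s) famT)) le))
     where
      open PentagonZ p using (T; indT; famT)
      e : tot q (ℕ.pred q) ≡ suc (bound q)
      e = subst (λ z → tot z (ℕ.pred z) ≡ suc (bound z)) (sym q-pred) (tot≡ (ℕ.pred q))

   opaque
    ~P : ∀ {x y} → x ≢ 0v → x ~ y → Pnt x
    ~P nz h = nz , ~selfˡ h

   opaque
    -- Any further collinearity among the five points would complete a quadrangle, so distinct `a`
    -- and `d` would give a proper pentagon.
    pentagon : ∀ {x a b c d} → Pnt x → Pnt a → Pnt b → Pnt c → Pnt d → x ~ a → a ~ b → b ~ c → c ~ d → d ~ x → ¬ x ~ b → ¬ x ~ c → a ∈< d ∷ [] >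
    pentagon {x} {a} {b} {c} {d} px pa pb pc pd xa ab bc cd dx nxb nxc with ∈? a [ d ]
    ... | yes p = p
    ... | no na = ⊥-elim (noPent record { p0 = a ; p1 = x ; p2 = d ; p3 = c ; p4 = b ; P0 = pa ; P1 = px ; P2 = pd ; P3 = pc ; P4 = pb
       ; a01 = ~sym xa ; a12 = ~sym dx ; a23 = ~sym cd ; a34 = ~sym bc ; a40 = ~sym ab
       ; n02 = nad ; n13 = nxc ; n24 = λ db → na (quad px pb (fst pa) (fst pd) xa ab (~sym db) dx nxb) ; n30 = λ ca → nac (~sym ca) ; n41 = λ bx → nxb (~sym bx) })
     where
      nac : ¬ a ~ c
      nac ac = na (quad px pc (fst pa) (fst pd) xa ac cd dx nxc)
      nad : ¬ a ~ d
      nad ad = nxb (~span (fst px) [ ~sym dx ] (par-sym (fst pd) (quad pa pc (fst pd) (fst pb) ad (~sym cd) (~sym bc) (~sym ab) nac)))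

   -- Distance at most four in the incidence graph when `x` and `y` are points; `s` may coincide
   -- with either of them.
   D4 : W → W → Set
   D4 x y = ∃ λ s → s ≢ 0v × x ~ s × s ~ y

   opaque
    D4? : ∀ x y → Dec (D4 x y)
    D4? x y = search λ s → ¬? (s ≟v 0v) ×-dec (~? x s ×-dec ~? s y)

   infix 4 _∥_
   _∥_ : W → W → Set
   a ∥ b = a ∈< b ∷ [] >

   opaque
    points : ∀ {ℓ : Ln {suc n}} {x} → x ≢ 0v → x ∈< bas ℓ > → Fam _∥_ (λ p → p ∈< bas ℓ > × Ind (p :: x)) q
    points {ℓ} {x} nz x∈ with other ℓ nz x∈
    ... | y , y∈ , i = fam-img (λ r → y <+> r *> x) famK (λ {r} _ → +∈ y∈ (∙∈ r x∈) , ind-gen (swap i) ((1F :: - r , vsolve [ r ] (x :: y) (1k *v (^1 +v `0 *v ^0) +v ((⊖ `0) *v ^0 +v 0w)) (^1) refl) :: g1))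
       (λ { {r} {s} _ _ ne (c ∷ [] , e) → ne (inj r s c e) })
     where
      inj : ∀ r s c → lin [ c ] [ y <+> s *> x ] ≡ y <+> r *> x → r ≡ s
      inj r s c e = solve (r ∷ s :: c) (`0) (`1 +e (1k *e (`0 -e `2 *e `1 -e 0k) +e (⊖ `1) *e (1k -e `2 -e 0k))) refl
        ⇐ 1F *: c1 & (- s) *: c0
       where
        eq : lin (1F - c :: r - c * s) (y :: x) ≡ 0v
        eq = vsolve (r ∷ s :: c) (y :: x) ((1k -e `2) *v ^0 +v ((`0 -e `2 *e `1) *v ^1 +v 0w))
          (0w +v -1k *v ((`2 *v (^0 +v `1 *v ^1) +v 0w) -v (^0 +v `0 *v ^1))) refl ⇐v -1F ∙: e
        c0 : 1F - c ≡ 0F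
        c0 = coef (swap i) (1F - c :: r - c * s) eq zero
        c1 : r - c * s ≡ 0F
        c1 = coef (swap i) (1F - c :: r - c * s) eq (suc zero)

   -- `S3` and `S2` are the lines at distance three and the points at distance four from `x`; `T5`
   -- gives the lines at distance five through a point `y`.
   S3 : W → Ln {suc n} → Set
   S3 x m = L m × ¬ x ∈< bas m > × ∃ λ p → p ≢ 0v × x ~ p × p ∈< bas m >

   S2 : W → W → Set
   S2 x y = Pnt y × ¬ x ~ y × ∃ λ p → p ≢ 0v × x ~ p × p ~ y

   T5 : W → W → Ln {suc n} → Set
   T5 x y m = Thru y m × (∀ {g} → g ≢ 0v → g ∈< bas m > → ¬ x ~ g)

   opaque
    pts1 : ∀ {x} → Pnt x → Fam _∥_ (λ p → Ind (p :: x) × x ~ p) (suc q ℕ.* q)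
    pts1 {x} px = fam-map (λ (ℓ , (h , x∈) , p∈ , i) → i , L~ {ℓ} h x∈ p∈)
     (fam-sum (λ ℓ p → p ∈< bas ℓ > × Ind (p :: x)) (pencil px) (λ ℓ (_ , x∈) → points {ℓ} (fst px) x∈)
      (λ {ℓ} {m} (_ , x∈) (_ , x∈') ne (p∈ , i) (p'∈ , i') e → ne (≈-trans (≈ln i p∈ x∈) (≈-sym (≈ln i (span⊆ [ p'∈ ] e) x∈')))))

   opaque
    lines3 : ∀ {x} → Pnt x → LFam (S3 x) ((suc q ℕ.* q) ℕ.* q)
    lines3 {x} px = fam-map (λ (p , (i , xp) , (h , p∈) , x∉) → h , x∉ , p , ind-nonzero i , xp , p∈)
     (fam-sum (λ p m → Thru p m × ¬ x ∈< bas m >) (pts1 px) (λ p (i , xp) → fam-map (λ {m} (t , ne) → t , λ x∈ → ne (≈ln i (snd t) x∈)) (rm (pencil (~P (ind-nonzero i) (~sym xp))) (ln p x i)))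
      (λ {p} {p'} {m} {m'} (i , xp) (i' , xp') np ((h , p∈) , x∉) ((h' , p'∈) , _) e → x∉ (cases p p' m i i' xp xp' np h p∈ (snd (sub e) p' p'∈))))
     where
      cases : ∀ p p' m → Ind (p :: x) → Ind (p' :: x) → x ~ p → x ~ p' → ¬ p ∥ p' → L m → p ∈< bas m > → p' ∈< bas m > → x ∈< bas m >
      cases p p' m i i' xp xp' np h p∈ p'∈ = span⊆ (p∈ :: p'∈) (tri∈ (ext (ind1 (ind-nonzero i')) np) (~sym xp') xp (L~ {m} h p'∈ p∈))

   opaque
    pts2 : ∀ {x} → Pnt x → Fam _∥_ (S2 x) (((suc q ℕ.* q) ℕ.* q) ℕ.* q)
    pts2 {x} px = fam-map (λ (m , (h , _ , p , pnz , xp , p∈) , y∈ , ynz , nxy) → ~P ynz (L~ {m} h y∈ p∈) , nxy , p , pnz , xp , L~ {m} h p∈ y∈)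
     (fam-sum (λ m y → y ∈< bas m > × y ≢ 0v × ¬ x ~ y) (lines3 px)
      (λ m (h , x∉ , p , pnz , xp , p∈) → fam-map (λ {y} (y∈ , i) → y∈ , ind-nonzero i , λ xy → x∉ (span⊆ (y∈ :: p∈) (tri∈ i (~sym xp) xy (L~ {m} h p∈ y∈)))) (points {m} pnz p∈))
      (λ {m} {m'} (h , _ , p , pnz , xp , p∈) (h' , _ , p' , p'nz , xp' , p'∈) ne (y∈ , ynz , nxy) (y'∈ , y'nz , nxy') e → ne (cases m m' h h' p p' pnz p'nz xp xp' p∈ p'∈ ynz nxy y∈ (span⊆ [ y'∈ ] e))))
     where
      cases : ∀ m m' {y} → L m → L m' → ∀ p p' → p ≢ 0v → p' ≢ 0v → x ~ p → x ~ p' → p ∈< bas m > → p' ∈< bas m' > → y ≢ 0v → ¬ x ~ y → y ∈< bas m > → y ∈< bas m' > → m ≈ℓ m'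
      cases m m' {y} h h' p p' pnz p'nz xp xp' p∈ p'∈ ynz nxy y∈ y∈' = ≈-trans (≈ln i p∈ y∈) (≈-sym (≈ln i (span⊆ [ p'∈ ] (quad px (~P ynz yp) pnz p'nz xp (~sym yp) (L~ {m'} h' y∈' p'∈) (~sym xp') nxy)) y∈'))
       where
        yp : y ~ p
        yp = L~ {m} h y∈ p∈
        i : Ind (p :: y)
        i with par? p ynz
        ... | inj₂ j = j
        ... | inj₁ e = ⊥-elim (nxy (~span (fst px) [ xp ] (par-sym pnz e)))

   opaque
    -- A line with two points at distance four from `x` and none collinear with `x` would close a
    -- pentagon, so no line is listed twice.
    lines5 : ∀ {x} → Pnt x → LFam (λ m → ∃ λ y → S2 x y × T5 x y m) ((((suc q ℕ.* q) ℕ.* q) ℕ.* q) ℕ.* q)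
    lines5 {x} px = fam-sum (T5 x) (pts2 px) one dis
     where
      one : ∀ y → S2 x y → LFam (T5 x y) q
      one y (py , nxy , p , pnz , xp , py') = fam-map (λ {m} ((h , y∈) , ne) → (h , y∈) , λ gnz g∈ xg → ne (≈ln i y∈
         (span⊆ [ g∈ ] (quad px py pnz gnz xp py' (L~ {m} h y∈ g∈) (~sym xg) nxy)))) (rm (pencil py) (ln y p i))
       where
        i : Ind (y :: p)
        i with par? y pnz
        ... | inj₂ j = j
        ... | inj₁ e = ⊥-elim (nxy (~span (fst px) [ xp ] e))
      dis : ∀ {y y' m m'} → S2 x y → S2 x y' → ¬ y ∥ y' → T5 x y m → T5 x y' m' → ¬ m ≈ℓ m'
      dis {y} {y'} {m} (py , nxy , p , pnz , xp , ppy) (py' , nxy' , p' , p'nz , xp' , ppy') np ((h , y∈) , no~) ((h' , y'∈) , _) e =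
        no~ pnz (span⊆ (y∈ :: y'∈m) (tri∈ (ext (ind1 (fst py')) np) (~sym p~y') ppy (~sym yy'))) xp
       where
        y'∈m : y' ∈< bas m >
        y'∈m = snd (sub e) y' y'∈
        yy' : y ~ y'
        yy' = L~ {m} h y∈ y'∈m
        p∥ : p ∥ p'
        p∥ = pentagon px (~P pnz ppy) py py' (~P p'nz ppy') xp ppy yy' (~sym ppy') (~sym xp') nxy nxy'
        p~y' : p ~ y'
        p~y' = ~sym (~span (fst py') [ ~sym ppy' ] p∥)

   opaque
    -- The lines at distance one, three and five already exhaust the bound in (To); a line without a
    -- point at distance at most four would be one too many.
    reach : ∀ {x m} → Pnt x → L m → ∃ λ r → r ≢ 0v × r ∈< bas m > × D4 x r
    reach {x} {m} px Lm with search (λ r → ¬? (r ≟v 0v) ×-dec (∈? r (bas m) ×-dec D4? x r))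
    ... | yes p = p
    ... | no none = ⊥-elim (ℕₚ.<-irrefl refl (ℕₚ.≤-trans (ℕₚ.≤-reflexive (sym (tree≡ q))) (ℕₚ.≤-trans (card-bound (fst (snd to)) all) (snd (snd to)))))
     where
      all : LFam L ((suc q ℕ.+ (suc q ℕ.* q) ℕ.* q) ℕ.+ ((((suc q ℕ.* q) ℕ.* q) ℕ.* q) ℕ.* q ℕ.+ 1))
      all = fam-++ {S = B3} {T = B5} {U = L} (fam-++ (pencil px) (lines3 px) (λ (_ , x∈) (_ , x∉ , _) e → x∉ (fst (sub e) x x∈)) inj₁ inj₂)
         (fam-++ (lines5 px) (fam-one {S = _≡ m} refl) (λ { (y , (py , _ , p , pnz , xp , ppy) , (_ , y∈) , _) refl e → none (y , fst py , fst (sub e) y y∈ , p , pnz , xp , ppy) }) inj₁ inj₂)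
         dis (λ { (inj₁ (h , _)) → h ; (inj₂ (h , _)) → h }) (λ { (inj₁ (_ , _ , (h , _) , _)) → h ; (inj₂ refl) → Lm })
       where
        B3 B5 : Ln {suc n} → Set
        B3 k = Thru x k ⊎ S3 x k
        B5 k = (∃ λ y → S2 x y × T5 x y k) ⊎ k ≡ m
        dis : ∀ {a b} → B3 a → B5 b → ¬ a ≈ℓ b
        dis (inj₁ (_ , x∈)) (inj₁ (_ , _ , _ , no~)) e = no~ (fst px) (fst (sub e) x x∈) (snd px)
        dis (inj₁ (_ , x∈)) (inj₂ refl) e = none (x , fst px , fst (sub e) x x∈ , x , fst px , snd px , snd px)
        dis (inj₂ (_ , _ , p , pnz , xp , p∈)) (inj₁ (_ , _ , _ , no~)) e = no~ pnz (fst (sub e) p p∈) xp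
        dis (inj₂ (_ , _ , p , pnz , xp , p∈)) (inj₂ refl) e = none (p , pnz , fst (sub e) p p∈ , p , pnz , xp , ~selfˡ (~sym xp))

  -- Regulus solids and regularity of points

  module Grids where
   open Hexagon public
   open FiniteField F using (complete)

   opaque
    ∥~ : ∀ {x y z} → Pnt x → y ∥ z → x ~ z → x ~ y
    ∥~ px p xz = ~span (fst px) [ xz ] p

   opaque
    D4-sym : ∀ {x y} → D4 x y → D4 y x
    D4-sym (s , nz , a , b) = s , nz , ~sym b , ~sym a

   opaque
    -- A common neighbour of `x` and `c` would close the path to a quadrangle or a pentagon.
    walk : ∀ {x a b c} → Pnt x → Pnt a → Pnt b → Pnt c → x ~ a → a ~ b → b ~ c → ¬ x ~ b → ¬ a ~ c → ¬ D4 x c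
    walk {x} {a} {b} {c} px pa pb pc xa ab bc nxb nac (s , snz , xs , sc) with ~? b s
    ... | yes bs = nac (~sym (∥~ pc (quad px pb (fst pa) snz xa ab bs (~sym xs) nxb) (~sym sc)))
    ... | no nbs = nac (~sym (∥~ pc (pentagon pb pa px (~P snz sc) pc (~sym ab) (~sym xa) xs sc (~sym bc) (nxb ∘ ~sym) nbs) (snd pc)))

   opaque
    -- The planes of two full points of a 4-space share a point, which is a common neighbour.
    opp-5 : ∀ {D : Vec W 5} {x y} → Full D x → Full D y → D4 x y
    opp-5 {D} {x} {y} (full px fx) (full py fy) with D4? x y
    ... | yes d = d
    ... | no nd with planeOf px | planeOf py
    ... | plane {y₁} {y₂} a b i | plane {z1} {z2} c d j = ⊥-elim (ind-no ℕₚ.≤-refl D (ind-join i j disj) (fx a ∷ fx b ∷ fx (snd px) ∷ fy c ∷ fy d :: fy (snd py)))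
     where
      disj : ∀ {z : W} → z ∈< y₁ ∷ y₂ :: x > → z ∈< z1 ∷ z2 :: y > → z ≡ 0v
      disj {z} z∈ z∈' with z ≟v 0v
      ... | yes e = e
      ... | no nz = ⊥-elim (nd (z , nz , plane⊇ a b i z∈ , ~sym (plane⊇ c d j z∈')))

   opaque
    -- If neither `r` nor `r'` is collinear with `x`, the two connecting points coincide because
    -- there are no pentagons, and the common one lies on the line `r r'` because there are no
    -- triangles.
    unique-near : ∀ {x r r'} → Pnt x → Ind (r :: r') → r ~ r' → D4 x r → D4 x r' → ∃ λ g → g ≢ 0v × g ∈< r :: r' > × x ~ g
    unique-near {x} {r} {r'} px i rr' (s , snz , xs , sr) (s' , snz' , xs' , sr') with ~? x r | ~? x r'
    ... | yes a | _ = r , ind-nonzero i , g0 , a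
    ... | no _ | yes a = r' , ind-nonzero (ind-tail i) , g1 , a
    ... | no nr | no nr' = s , snz , span⊆ (g1 :: g0) (tri∈ (swap i) (~sym sr) (∥~' ) rr') , xs
     where
      pr' : Pnt r'
      pr' = ~P (ind-nonzero (ind-tail i)) (~sym rr')
      ∥~' : s ~ r'
      ∥~' = ~sym (∥~ pr' (pentagon px (~P snz sr) (~P (ind-nonzero i) rr') pr' (~P snz' sr') xs sr rr' (~sym sr') (~sym xs') nr nr') (~sym sr'))

   -- A path `g a b a' g'`. The lines of `L` in the solid of its end edges `a g` and `a' g'` turn
   -- out to be pairwise disjoint and to cover the line `a a'`.
   record Grid : Set where
    field
     b a a' g g' : W
     pb : Pnt b
     pa : Pnt a
     pa' : Pnt a'
     pg : Pnt g
     pg' : Pnt g'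
     ba : b ~ a
     ba' : b ~ a'
     ag : a ~ g
     ag' : a' ~ g'
     naa' : ¬ a ~ a'
     nbg : ¬ b ~ g
     nbg' : ¬ b ~ g'

   module GridLemmas (G : Grid) where
    open Grid G

    σ : Vec W 4
    σ = a ∷ g ∷ a' :: g'

    E : Vec W 5
    E = b ∷ σ

    opaque
     indE : Ind E
     indE = ind-gen (ext i4 g'∉) (g4 ∷ g3 ∷ g1 ∷ g0 :: g2)
      where
       i4 : Ind (a' ∷ a ∷ b :: g)
       i4 = path4 pg pa pb (~sym ag) (~sym ba) (nbg ∘ ~sym) naa'
       g'∉ : ¬ g' ∈< a' ∷ a ∷ b :: g >
       g'∉ p = no3full i4 (ind-tail (ind-tail (ind-gen i4 (g0 ∷ g2 ∷ g3 :: g1)))) (ind-tail (ind-tail (ind-gen i4 (g2 ∷ g3 ∷ g0 :: g1))))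
         (ind-tail (ind-tail (ind-gen i4 (g2 ∷ g0 ∷ g3 :: g1))))
         (full2 ag (~sym ba) (ind-gen (ind-tail i4) (g2 ∷ g1 :: g0)) g3 g2 g1)
         (full2 ba ba' (ind-tail {x = g} (ind-gen i4 (g2 ∷ g1 ∷ g3 :: g0))) g1 g0 g2)
         (full2 (~sym ba') ag' (ind-gen (path3 pb pa' pg' ba' ag' nbg') (g2 ∷ g1 :: g0)) g2 p g0)

     b∉σ : ¬ b ∈< σ >
     b∉σ = ∉-head indE

     indσ : Ind σ
     indσ = ind-tail indE

     iag : Ind (a :: g)
     iag = ind-tail (ind-tail (ind-gen indσ (g2 ∷ g3 ∷ g0 :: g1)))

     iag' : Ind (a' :: g')
     iag' = ind-tail (ind-tail indσ)

     iaa' : Ind (a :: a')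
     iaa' = ind-tail (ind-tail (ind-gen indσ (g2 ∷ g0 ∷ g3 :: g1)))

     iba : Ind (b :: a)
     iba = ind-tail (ind-tail (ind-tail (ind-gen indE (g3 ∷ g4 ∷ g0 ∷ g1 :: g2))))

     iba' : Ind (b :: a')
     iba' = ind-tail (ind-tail (ind-tail (ind-gen indE (g3 ∷ g0 ∷ g1 ∷ g4 :: g2))))

    opaque
     -- A line from `r` to `r'` would close the path through `b` to a pentagon, or to a shorter
     -- cycle when `r` is `a` or `r'` is `a'`.
     opposite : ∀ {r r'} → r ≢ 0v → r' ≢ 0v → r ∈< a :: g > → r' ∈< a' :: g' > → ¬ r ~ r'
     opposite {r} {r'} rnz rnz' r∈ r∈' rr' = cases (~? b r) (~? b r')
      where
       pr : Pnt r
       pr = ~P rnz rr'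
       pr' : Pnt r'
       pr' = ~P rnz' (~sym rr')
       ar : a ~ r
       ar = ~on iag ag r∈
       ar' : a' ~ r'
       ar' = ~on iag' ag' r∈'
       no∥ : ¬ a ∥ a'
       no∥ p = naa' (~sym (∥~ pa' p (snd pa')))
       ra : b ~ r → r ∥ a
       ra br = inter (ind-tail (ind-tail (ind-gen indE (g2 ∷ g4 ∷ g3 ∷ g0 :: g1)))) (tri∈ iba ar (~sym br) (~sym ba)) (span⊆ (g1 :: g0) r∈)
       ra' : b ~ r' → r' ∥ a'
       ra' br = inter (ind-tail (ind-tail (ind-gen indE (g2 ∷ g0 ∷ g1 ∷ g4 :: g3)))) (tri∈ iba' ar' (~sym br) (~sym ba')) (span⊆ (g1 :: g0) r∈')
       cases : Dec (b ~ r) → Dec (b ~ r') → ⊥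
       cases (no nr) (no nr') = no∥ (pentagon pb pa pr pr' pa' ba ar rr' (~sym ar') (~sym ba') nr nr')
       cases (yes br) (no nr') = no∥ (quad pb pr' (fst pa) (fst pa') ba (~sym (∥~ pr' (par-sym rnz (ra br)) (~sym rr'))) (~sym ar') (~sym ba') nr')
       cases (no nr) (yes br') = no∥ (quad pb pr (fst pa) (fst pa') ba ar (∥~ pr (par-sym rnz' (ra' br')) rr') (~sym ba') nr)
       cases (yes br) (yes br') = naa' (~sym (∥~ pa' (par-sym rnz (ra br)) (~sym (∥~ pr (par-sym rnz' (ra' br')) rr'))))

    opaque
     -- The plane of a common point `p` would meet `a g` and `a' g'` in points `r` and `r'`; then
     -- `p`, `r` and `r'` would be three full points of the solid.
     disjoint : ∀ {k k' p} → In σ k → In σ k' → p ≢ 0v → p ∈< bas k > → p ∈< bas k' > → k ≈ℓ k'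
     disjoint {k} {k'} {p} (h , i) (h' , i') pnz p∈ p∈' with ≈? k k'
     ... | yes e = e
     ... | no ne with other k pnz p∈ | other k' pnz p∈'
     ... | y , y∈ , j | y' , y∈' , j' = ⊥-elim (go (meet σ iag i3 (g0 :: g1) in3 ℕₚ.≤-refl) (meet σ iag' i3 (g2 :: g3) in3 ℕₚ.≤-refl))
      where
       i3 : Ind (y ∷ y' :: p)
       i3 = ext (swap j') λ y∈2 → ne (≈-trans (≈ln j p∈ y∈) (≈-sym (≈ln j p∈' (span⊆ (y∈' :: p∈') y∈2))))
       in3 : VAll (_∈< σ >) (y ∷ y' :: p)
       in3 = span⊆ i y∈ ∷ span⊆ i' y∈' :: span⊆ i p∈
       py : p ~ y
       py = L~ {k} h p∈ y∈
       py' : p ~ y'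
       py' = L~ {k'} h' p∈' y∈'
       pp : Pnt p
       pp = pnz , ~selfˡ py
       fullr : ∀ {x y r} → Ind (x :: y) → x ~ y → x ∈< σ > → y ∈< σ > → r ≢ 0v → r ∈< x :: y > → p ~ r → ¬ p ∈< x :: y > → Full σ r
       fullr {x} {y} {r} ixy xy x∈ y∈ rnz r∈ pr p∉ with other (ln x y ixy) rnz r∈
       ... | t , t∈ , jt = full2 (~sym pr) (L~ {ln x y ixy} (~L ixy xy) r∈ t∈) (ext (swap jt) λ p∈ → p∉ (span⊆ (t∈ :: r∈) p∈)) (span⊆ i p∈) (span⊆ (x∈ :: y∈) t∈) (span⊆ (x∈ :: y∈) r∈)
       go : (∃ λ z → z ≢ 0v × z ∈< a :: g > × z ∈< y ∷ y' :: p >) → (∃ λ z → z ≢ 0v × z ∈< a' :: g' > × z ∈< y ∷ y' :: p >) → ⊥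
       go (r , rnz , r∈ , r∈π) (r' , rnz' , r∈' , r∈π') = no3full indσ
          (ext (ind1 rnz') λ e → opposite rnz rnz' r∈ r∈' (~sym (∥~ (~P rnz' (~sym pr')) e (~selfˡ (~sym pr')))))
          (ext (ind1 rnz) λ e → opposite rnz rnz' r∈ r∈' (~sym (∥~ (~P rnz' (~sym pr')) (par-sym pnz e) (~sym pr'))))
          (ext (ind1 rnz') λ e → opposite rnz rnz' r∈ r∈' (∥~ (~P rnz (~sym pr)) (par-sym pnz e) (~sym pr)))
          (fullr iag ag g0 g1 rnz r∈ pr λ p∈ → opposite pnz rnz' p∈ r∈' pr') (fullr iag' ag' g2 g3 rnz' r∈' pr' λ p∈ → opposite rnz pnz r∈ p∈ (~sym pr))
          (full2 py py' i3 (span⊆ i y∈) (span⊆ i' y∈') (span⊆ i p∈))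
        where
         pr : p ~ r
         pr = plane⊇ py py' i3 r∈π
         pr' : p ~ r'
         pr' = plane⊇ py py' i3 r∈π'

    opaque
     -- Let `b ~ s ~ r` with `r` on the line, by `reach`. If neither `r` nor `s` is the required
     -- point, then `r` is full in `E`, as are `a` and `a'`. By `opp-5` and `walk` the point `s`
     -- lies on both `b a` and `b a'`, hence is `b`, and `r` is collinear with `b` after all.
     meets : ∀ {t e} → Ind (t :: e) → t ~ e → t ∈< σ > → e ∈< σ > → ∃ λ f → f ≢ 0v × f ∈< t :: e > × f ∈< a :: a' >
     meets {t} {e} i te t∈ e∈ = fin (reach {m = ln t e i} pb (~L i te))
      where
       inσ : ∀ {x} → x ∈< t :: e > → x ∈< σ >
       inσ = span⊆ (t∈ :: e∈)
       iaab : Ind (a ∷ a' :: b)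
       iaab = ind-tail (ind-tail (ind-gen indE (g4 ∷ g2 ∷ g0 ∷ g3 :: g1)))
       on : ∀ {x} → b ~ x → x ∈< σ > → x ∈< a :: a' >
       on bx x∈ = inter′ b∉σ (g0 :: g2) (span⊆ (g1 ∷ g2 :: g0) (in-plane ba ba' iaab bx)) x∈
       fin : (∃ λ r → r ≢ 0v × r ∈< t :: e > × D4 b r) → ∃ λ f → f ≢ 0v × f ∈< t :: e > × f ∈< a :: a' >
       fin (r , rnz , r∈ , s , snz , bs , sr) with ~? b r | ∈? s (t :: e)
       ... | yes br | _ = r , rnz , r∈ , on br (inσ r∈)
       ... | no _ | yes s∈ = s , snz , s∈ , on bs (inσ s∈)
       ... | no nbr | no s∉ with other (ln t e i) rnz r∈
       ...   | t' , t∈' , j = ⊥-elim (nbr (~sym (∥~ pr (par-sym snz (inter (ind-gen iaab (g0 ∷ g1 :: g2)) (near iba ba fa) (near iba' ba' fa'))) (~sym sr))))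
        where
         pr : Pnt r
         pr = ~P rnz (~sym sr)
         ps : Pnt s
         ps = ~P snz sr
         s∈E : s ∈< E >
         s∈E = span⊆ (g1 ∷ g3 :: g0) (in-plane ba ba' iaab bs)
         fr : Full E r
         fr = full2 (~sym sr) (L~ {ln t e i} (~L i te) r∈ t∈') (ext (swap j) λ p → s∉ (span⊆ (t∈' :: r∈) p)) s∈E (wk∈ (inσ t∈')) (wk∈ (inσ r∈))
         fa : Full E a
         fa = full2 ag (~sym ba) (ind-gen (path3 pb pa pg ba ag nbg) (g2 ∷ g0 :: g1)) g2 g0 g1
         fa' : Full E a'
         fa' = full2 ag' (~sym ba') (ind-gen (path3 pb pa' pg' ba' ag' nbg') (g2 ∷ g0 :: g1)) g4 g0 g3
         near : ∀ {y} → Ind (b :: y) → b ~ y → Full E y → s ∈< y :: b >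
         near {y} iby by fy with ~? y s
         ... | yes ys = tri∈ (swap iby) bs (~sym ys) by
         ... | no nys = ⊥-elim (walk (Full.isP fy) pb ps pr (~sym by) bs sr nys nbr (opp-5 fy fr))

    opaque
     -- The solid holds at least `q + 1` pairwise disjoint lines, each meeting `a a'`; if `e` were
     -- missed, only `q` points would remain for them.
     cover : ∀ {e} → e ≢ 0v → e ∈< a :: a' > → ∃ λ t → e ~ t × t ∈< σ > × Ind (t :: e)
     cover {e} enz e∈ with search (λ t → ~? e t ×-dec (∈? t σ ×-dec ¬? (∈? t [ e ])))
     ... | yes (t , a , b , c) = t , a , b , ext (ind1 enz) c
     ... | no none with other (subspace (a :: a') iaa') enz e∈
     ... | y , y∈ , j = ⊥-elim (ℕₚ.<-irrefl refl (ℕₚ.≤-trans (ℕₚ.≤-reflexive (sym (ℕₚ.*-identityʳ (suc q)))) (ℕₚ.≤-trans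
         (fam-bound ∥-eq pts (List.map (λ r → y <+> r *> e) elements) cov) (ℕₚ.≤-reflexive (Listₚ.length-map _ elements)))))
      where
       ∥-eq : ∀ {a b c} → (a ∥ b × a ≢ 0v × b ≢ 0v) → (c ∥ b × c ≢ 0v × b ≢ 0v) → (a ∥ c × a ≢ 0v × c ≢ 0v)
       ∥-eq (p , n , m) (r , n' , _) = span⊆ [ par-sym n' r ] p , n , n'
       PT : W → Set
       PT p = p ≢ 0v × p ∈< a :: a' > × ¬ p ∥ e
       lines : LFam (In σ) (suc q)
       lines = solid≥ indσ (fam2 {ℓ = ln a g iag} {m = ln a' g' iag'} (~L iag ag , g0 :: g1) (~L iag' ag' , g2 :: g3)
         λ eq → ∉-head indσ (span⊆ (g1 :: g2) (fst (sub eq) a g0)))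
       pts : Fam (λ a b → a ∥ b × a ≢ 0v × b ≢ 0v) PT (suc q ℕ.* 1)
       pts = fam-map (λ (_ , _ , _ , p) → p) (fam-sum (λ k p → p ∈< bas k > × PT p) lines one
          λ {k} {k'} s s' ne (p∈ , pnz , _) (p'∈ , _) (par , _) → ne (disjoint {k} {k'} s s' pnz p∈ (span⊆ [ p'∈ ] par)))
        where
         one : ∀ k → In σ k → Fam (λ a b → a ∥ b × a ≢ 0v × b ≢ 0v) (λ p → p ∈< bas k > × PT p) 1
         one k@(subspace (c :: d) i) (h , c∈ :: d∈) with meets i (L~ {k} h g0 g1) c∈ d∈
         ... | f , fnz , f∈ , f∈a = fam-one {a = f} (f∈ , fnz , f∈a , λ p → contra (other k enz (span⊆ [ f∈ ] (par-sym fnz p))) (span⊆ [ f∈ ] (par-sym fnz p)))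
          where
           contra : (∃ λ y → y ∈< bas k > × Ind (e :: y)) → e ∈< bas k > → ⊥
           contra (t , t∈ , it) e∈k = none (t , L~ {k} h e∈k t∈ , span⊆ (c∈ :: d∈) t∈ , ∉-head (swap it))
       cov : ∀ {p} → PT p → Any (λ b → p ∥ b × p ≢ 0v × b ≢ 0v) (List.map (λ r → y <+> r *> e) elements)
       cov {p} (pnz , p∈ , np) with dimEq j (e∈ :: y∈) p∈
       ... | d :: c , refl with c ≟ 0F
       ... | yes refl = ⊥-elim (np (d ∷ [] , vsolve [ d ] (e :: y) (`0 *v ^0 +v 0w) (`0 *v ^0 +v (0k *v ^1 +v 0w)) refl))
       ... | no cnz = Anyₚ.map⁺ (Any.map (λ { refl → (c ∷ [] , (vsolve (d ∷ c :: inv c cnz) (e :: y) (`1 *v (^1 +v (`0 *e `2) *v ^0) +v 0w)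
            ((`0 *v ^0 +v (`1 *v ^1 +v 0w)) +v (`1 *e `2 -e 1k) *v (`0 *v ^0)) refl ⇐v (inv-r c cnz s: (d *> e)))) , pnz ,
            λ z → ∉-head (swap j) ((- (d * inv c cnz) ∷ [] , (vsolve (d :: inv c cnz) (e :: y) ((⊖ (`0 *e `1)) *v ^0 +v 0w) (^1 +v -1k *v ((^1 +v (`0 *e `1) *v ^0) -v 0w)) refl ⇐v -1F ∙: z))) }) (complete (d * inv c cnz)))

   -- regularity: the points of π_x that are not opposite y form a line
   opaque
    trace : ∀ {x y r1 r2} → Pnt x → Pnt y → ¬ D4 x y → x ~ r1 → x ~ r2 → Ind (r1 ∷ r2 :: x) → D4 r1 y → D4 r2 y →
        ∀ {e} → e ≢ 0v → e ∈< r1 :: r2 > → D4 e y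
    trace {x} {y} {r1} {r2} px py nxy xr1 xr2 i (s1 , s1nz , rs1 , sy1) (s2 , s2nz , rs2 , sy2) {e} enz e∈ = fin (X.cover enz e∈)
     where
      pr1 : Pnt r1
      pr1 = ~P (ind-nonzero i) rs1
      pr2 : Pnt r2
      pr2 = ~P (ind-nonzero (ind-tail i)) rs2
      ps1 : Pnt s1
      ps1 = ~P s1nz sy1
      ps2 : Pnt s2
      ps2 = ~P s2nz sy2
      GX : Grid
      GX = record { b = x ; a = r1 ; a' = r2 ; g = s1 ; g' = s2 ; pb = px ; pa = pr1 ; pa' = pr2 ; pg = ps1 ; pg' = ps2 ; ba = xr1 ; ba' = xr2 ; ag = rs1 ; ag' = rs2
            ; naa' = λ h → tri xr1 h xr2 i ; nbg = λ h → nxy (s1 , s1nz , h , sy1) ; nbg' = λ h → nxy (s2 , s2nz , h , sy2) }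
      module X = GridLemmas GX
      GY : Grid
      GY = record { b = y ; a = s1 ; a' = s2 ; g = r1 ; g' = r2 ; pb = py ; pa = ps1 ; pa' = ps2 ; pg = pr1 ; pg' = pr2 ; ba = ~sym sy1 ; ba' = ~sym sy2 ; ag = ~sym rs1 ; ag' = ~sym rs2
            ; naa' = X.opposite s1nz s2nz g1 g1 ; nbg = λ h → nxy (r1 , fst pr1 , xr1 , ~sym h) ; nbg' = λ h → nxy (r2 , fst pr2 , xr2 , ~sym h) }
      module Y = GridLemmas GY
      fin : (∃ λ t → e ~ t × t ∈< X.σ > × Ind (t :: e)) → D4 e y
      fin (t , et , t∈ , it) with Y.meets it (~sym et) (span⊆ (g1 ∷ g0 ∷ g3 :: g2) t∈) (span⊆ (g1 :: g3) e∈)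
      ... | f , fnz , f∈ , f∈s = f , fnz , ~on (swap it) et (span⊆ (g1 :: g0) f∈) , ~sym (~span (fst py) (~sym sy1 :: ~sym sy2) f∈s)

  -- Apartments and the correspondence between opposite edges

  module Apartments where
   open Grids public

   -- The vertices in cyclic order are `a0 b1 a2 b0 a1 b2`; `ai` and `bi` are opposite.
   record Apt : Set where
    field
     a0 a1 a2 b0 b1 b2 : W
     A0 : Pnt a0
     A1 : Pnt a1
     A2 : Pnt a2
     B0 : Pnt b0
     B1 : Pnt b1
     B2 : Pnt b2
     c01 : a0 ~ b1
     c02 : a0 ~ b2
     c10 : a1 ~ b0
     c12 : a1 ~ b2
     c20 : a2 ~ b0
     c21 : a2 ~ b1
     o0 : ¬ D4 a0 b0
     o1 : ¬ D4 a1 b1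
     o2 : ¬ D4 a2 b2

    na01 : ¬ a0 ~ a1
    na01 h = o0 (a1 , fst A1 , h , c10)
    na02 : ¬ a0 ~ a2
    na02 h = o0 (a2 , fst A2 , h , c20)
    na12 : ¬ a1 ~ a2
    na12 h = o1 (a2 , fst A2 , h , c21)
    nb01 : ¬ b0 ~ b1
    nb01 h = o0 (b1 , fst B1 , c01 , ~sym h)
    nb02 : ¬ b0 ~ b2
    nb02 h = o0 (b2 , fst B2 , c02 , ~sym h)
    nb12 : ¬ b1 ~ b2
    nb12 h = o1 (b2 , fst B2 , c12 , ~sym h)

   opaque
    apt : ∀ {x} → Pnt x → Apt
    apt {a0} A0 with planeOf A0
    ... | plane {b1'} {b2} cb1' c02 i with third (~sym c02) (swap (ind-tail i))
    ... | a1 , b2a1 , ia1 with third b2a1' ia1'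
     where
      b2a1' : a1 ~ b2
      b2a1' = ~sym b2a1
      ia1' : Ind (b2 :: a1)
      ia1' = ind-tail {x = a0} (ind-gen ia1 (g2 ∷ g0 :: g1))
    -- The path `b1' a0 b2 a1 b0` is closed by reaching from `b0` to the line `a0 b1'`; the point
    -- found there replaces `b1'`.
    ... | b0 , c10 , ib0 = fin (reach {m = ln a0 b1' ia0} B0 (~L ia0 cb1'))
     where
      B2 : Pnt b2
      B2 = ~P (ind-nonzero (ind-tail i)) (~sym c02)
      A1 : Pnt a1
      A1 = ~P (ind-nonzero ia1) (~sym b2a1)
      B0 : Pnt b0
      B0 = ~P (ind-nonzero ib0) (~sym c10)
      na01 : ¬ a0 ~ a1
      na01 h = tri b2a1 (~sym h) (~sym c02) ia1
      o0 : ¬ D4 a0 b0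
      o0 = walk A0 B2 A1 B0 c02 b2a1 c10 na01 (λ h → tri c10 (~sym h) (~sym b2a1) ib0)
      ia0 : Ind (a0 :: b1')
      ia0 = ind-tail {x = b2} (ind-gen i (g2 ∷ g0 :: g1))
      fin : (∃ λ r → r ≢ 0v × r ∈< a0 :: b1' > × D4 b0 r) → Apt
      fin (b1 , b1nz , b1∈ , a2 , a2nz , b0a2 , c21) = record { a0 = a0 ; a1 = a1 ; a2 = a2 ; b0 = b0 ; b1 = b1 ; b2 = b2 ; A0 = A0 ; A1 = A1 ; A2 = A2 ; B0 = B0 ; B1 = B1 ; B2 = B2
         ; c01 = c01 ; c02 = c02 ; c10 = c10 ; c12 = ~sym b2a1 ; c20 = ~sym b0a2 ; c21 = c21 ; o0 = o0
         ; o1 = walk A1 B2 A0 B1 (~sym b2a1) (~sym c02) c01 (na01 ∘ ~sym) (nb12 ∘ ~sym)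
         ; o2 = walk A2 B1 A0 B2 c21 (~sym c01) c02 (λ h → o0 (a2 , a2nz , ~sym h , ~sym b0a2)) nb12 }
       where
        c01 : a0 ~ b1
        c01 = ~on ia0 cb1' b1∈
        A2 : Pnt a2
        A2 = ~P a2nz c21
        B1 : Pnt b1
        B1 = ~P b1nz (~sym c01)
        ib1 : Ind (b1 :: a0)
        ib1 = ext (ind1 (fst A0)) λ p → o0 (a2 , a2nz , ~sym (∥~ A2 (par-sym b1nz p) c21) , ~sym b0a2)
        nb12 : ¬ b1 ~ b2
        nb12 h = tri c01 h c02 (ind-gen (ext ib1 λ p → ∉-head {x = b2} {B = b1' :: a0} (ind-gen i (g1 ∷ g0 :: g2)) (span⊆ (span⊆ (g1 :: g0) b1∈ :: g1) p)) (g1 ∷ g0 :: g2))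

   opaque
    ind-disj : ∀ {N k l} {A : Vec (V {N}) k} {C : Vec (V {N}) l} → Ind (A ++ C) → ∀ {z} → z ∈< A > → z ∈< C > → z ≡ 0v
    ind-disj {k = k} {l} {A} {C} i (cs , refl) (ds , e) = cong (λ z → lin z A) cs0 >> lin-0 A
     where
      eq : lin (cs ++ -1F *> ds) (A ++ C) ≡ 0v
      eq = lin-++ cs (-1F *> ds) A C >> cong (lin cs A <+>_) (lin-∙ -1F ds C) >>
         (vsolve [] (lin cs A :: lin ds C) (^0 -v ^1) (0w +v -1k *v (^1 -v ^0)) refl ⇐v -1F ∙: e)
      take0 : ∀ {k} (x : Vec K k) {y : Vec K l} → x ++ y ≡ 0c → x ≡ 0c
      take0 [] _ = refl
      take0 (c ∷ x) e = cong₂ _∷_ (Vecₚ.∷-injectiveˡ e) (take0 x (Vecₚ.∷-injectiveʳ e))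
      cs0 : cs ≡ 0c
      cs0 = take0 cs (i _ eq)

   -- The regulus through the opposite edges a1 b2 and a2 b1 of an apartment is cut by a third transversal, so the correspondence of its ends is linear.
   opaque
    edge : (T : Apt) → let open Apt T in ∃ λ κ → κ ≢ 0F × (∀ r → a1 <+> r *> a2 ~ b2 <+> (r * κ) *> b1)
    edge T = build (reach {m = ln a2 b1 iab} pt0 (~L iab c21))
     where
      open Apt T
      G1 : Grid
      G1 = record { b = b0 ; a = a1 ; a' = a2 ; g = b2 ; g' = b1 ; pb = B0 ; pa = A1 ; pa' = A2 ; pg = B2 ; pg' = B1 ; ba = ~sym c10 ; ba' = ~sym c20 ; ag = c12 ; ag' = c21 ; naa' = na12 ; nbg = nb02 ; nbg' = nb01 }
      G2 : Grid
      G2 = record { b = a0 ; a = b2 ; a' = b1 ; g = a1 ; g' = a2 ; pb = A0 ; pa = B2 ; pa' = B1 ; pg = A1 ; pg' = A2 ; ba = c02 ; ba' = c01 ; ag = ~sym c12 ; ag' = ~sym c21 ; naa' = nb12 ∘ ~sym ; nbg = na01 ; nbg' = na02 }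
      module X = GridLemmas G1
      module Y = GridLemmas G2
      iab : Ind (a2 :: b1)
      iab = X.iag'
      t : W
      t = a1 <+> b2
      it1 : Ind (t :: a1)
      it1 = ind-gen X.iag (g1 :: (1F :: - 1F , vsolve [] (a1 :: b2) (1k *v (^0 +v ^1) +v (-1k *v ^0 +v 0w)) (^1) refl))
      it2 : Ind (t :: b2)
      it2 = ind-gen X.iag ((1F :: - 1F , vsolve [] (a1 :: b2) (1k *v (^0 +v ^1) +v (-1k *v ^1 +v 0w)) (^0) refl) :: g1)
      t∈ : t ∈< a1 :: b2 >
      t∈ = +∈ g0 g1
      a1t : a1 ~ t
      a1t = ~on X.iag c12 t∈
      b2t : b2 ~ t
      b2t = ~on (swap X.iag) (~sym c12) (+∈ g1 g0)
      pt0 : Pnt t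
      pt0 = ~P (ind-nonzero it1) (~sym a1t)
      build : (∃ λ t' → t' ≢ 0v × t' ∈< a2 :: b1 > × D4 t t') → ∃ λ κ → κ ≢ 0F × (∀ r → a1 <+> r *> a2 ~ b2 <+> (r * κ) *> b1)
      -- The third transversal joins `t = a1 + b2` to `t' = p a2 + s b1`. Both coefficients are
      -- nonzero by `X.opposite`, and their quotient is the wanted constant.
      build (t' , tnz' , t∈'@(p :: s , e') , m , mnz , tm , mt') = s * inv p p≢0 , *≢0 s≢0 (inv≢0 p p≢0) , conc
       where
        near : ∀ {c x} → c ≢ 0v → c ∈< a2 :: b1 > → t' ∥ c → D4 x c → t ~ x → x ∈< a1 :: b2 > → Ind (t :: x) → ⊥
        near {c} {x} cnz c∈ par d tx x∈ i with unique-near pc i tx (m , mnz , ~sym (∥~' ) , ~sym tm) (D4-sym d)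
         where
          pc : Pnt c
          pc = ~P cnz (~sym (snd (snd (snd d))))
          ∥~' : m ~ c
          ∥~' = ∥~ (~P mnz mt') (par-sym tnz' par) mt'
        ... | g , gnz , g∈ , cg = X.opposite gnz cnz (span⊆ (t∈ :: x∈) g∈) c∈ (~sym cg)
        p≢0 : p ≢ 0F
        p≢0 refl = near (fst B1) g1 (s ∷ [] , trans (vsolve [ s ] (a2 :: b1) (`0 *v ^1 +v 0w) (0k *v ^0 +v (`0 *v ^1 +v 0w)) refl) e') (a0 , fst A0 , ~sym c02 , c01) (~sym b2t) g1 it2
        s≢0 : s ≢ 0F
        s≢0 refl = near (fst A2) g0 (p ∷ [] , trans (vsolve [ p ] (a2 :: b1) (`0 *v ^0 +v 0w) (`0 *v ^0 +v (0k *v ^1 +v 0w)) refl) e') (b0 , fst B0 , c10 , ~sym c20) (~sym a1t) g0 it1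
        pt' : Pnt t'
        pt' = ~P tnz' (~sym mt')
        pm : Pnt m
        pm = ~P mnz mt'
        oth : ∃ λ y → y ∈< a2 :: b1 > × Ind (t' :: y)
        oth = other (ln a2 b1 iab) tnz' t∈'
        g' : W
        g' = fst oth
        g'∈ : g' ∈< a2 :: b1 >
        g'∈ = fst (snd oth)
        ig' : Ind (t' :: g')
        ig' = snd (snd oth)
        t'g' : t' ~ g'
        t'g' = L~ {ln a2 b1 iab} (~L iab c21) t∈' g'∈
        G3 : Grid
        G3 = record { b = m ; a = t ; a' = t' ; g = a1 ; g' = g' ; pb = pm ; pa = pt0 ; pa' = pt' ; pg = A1 ; pg' = ~P (ind-nonzero (swap ig')) (~sym t'g') ; ba = ~sym tm ; ba' = mt' ; ag = ~sym a1t ; ag' = t'g'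
          ; naa' = X.opposite (fst pt0) tnz' t∈ t∈'
          ; nbg = λ h → X.opposite mnz tnz' (span⊆ (g0 :: t∈) (tri∈ (swap it1) tm h (~sym a1t))) t∈' mt'
          ; nbg' = λ h → X.opposite (fst pt0) mnz t∈ (span⊆ (g'∈ :: t∈') (tri∈ (swap ig') (~sym mt') h t'g')) tm }
        module Z = GridLemmas G3
        Zσ : ∀ {x} → x ∈< X.σ > → x ∈< Z.σ >
        Zσ = span⊆ (g1 ∷ (1F ∷ - 1F ∷ 0F :: 0F , vsolve [] (a1 ∷ b2 ∷ t' :: g') (1k *v (^0 +v ^1) +v (-1k *v ^0 +v (0k *v ^2 +v (0k *v ^3 +v 0w)))) (^1) refl) ∷ mv g0 :: mv g1)
         where
          mv : ∀ {x} → x ∈< a2 :: b1 > → x ∈< Z.σ >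
          mv x∈ = span⊆ (g2 :: g3) (dimEq ig' (t∈' :: g'∈) x∈)
        conc : ∀ r → a1 <+> r *> a2 ~ b2 <+> (r * (s * inv p p≢0)) *> b1
        conc r = go (X.cover enz e∈)
         where
          e : W
          e = a1 <+> r *> a2
          e∈ : e ∈< a1 :: a2 >
          e∈ = +∈ g0 (∙∈ r g1)
          enz : e ≢ 0v
          enz z = 1≢0 (coef X.iaa' (1F :: r) (vsolve [ r ] (a1 :: a2) (1k *v ^0 +v (`0 *v ^1 +v 0w)) (^0 +v `0 *v ^1) refl >> z) zero)
          e∈σ : e ∈< X.σ >
          e∈σ = span⊆ (g0 :: g2) e∈
          go : (∃ λ y → e ~ y × y ∈< X.σ > × Ind (y :: e)) → e ~ b2 <+> (r * (s * inv p p≢0)) *> b1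
          go (y , ey , y∈ , iy) with Y.meets iy (~sym ey) (span⊆ (g1 ∷ g0 ∷ g3 :: g2) y∈) (span⊆ (g1 ∷ g0 ∷ g3 :: g2) e∈σ) | Z.meets iy (~sym ey) (Zσ y∈) (Zσ e∈σ)
          ... | f , fnz , f∈ , f∈b@(f2 :: f1 , ef) | h , hnz , h∈ , (c :: d , eh) = last (dimEq ief (g1 :: f∈) h∈)
           where
            ief : Ind (e :: f)
            ief = ext (ind1 fnz) λ q → enz (ind-disj (ind-gen X.indσ (g0 ∷ g2 ∷ g1 :: g3)) e∈ (span⊆ [ f∈b ] q))
            last : h ∈< e :: f > → e ~ b2 <+> (r * (s * inv p p≢0)) *> b1
            last (x :: y' , e'') = subst (e ~_) final (~∙ (inv c c≢0 * y') (~on (swap iy) ey (span⊆ (g1 :: g0) f∈)))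
             where
              -- `h` lies on `t t'` and on `e f`; comparing its coordinates in the basis of the
              -- solid fixes the ratio of `f1` and `f2`.
              eq : lin (c - x ∷ c - y' * f2 ∷ d * p - x * r :: d * s - y' * f1) X.σ ≡ 0v
              eq = vsolve (c ∷ x ∷ y' ∷ f2 ∷ d ∷ p ∷ r ∷ s :: f1) (a1 ∷ b2 ∷ a2 ∷ b1 ∷ f ∷ h :: t')
                ((`0 -e `1) *v ^0 +v ((`0 -e `2 *e `3) *v ^1 +v ((`4 *e `5 -e `1 *e `6) *v ^2 +v ((`4 *e `7 -e `2 *e `8) *v ^3 +v 0w))))
                (0w +v (1k *v ((`0 *v (^0 +v ^1) +v (`4 *v ^6 +v 0w)) -v ^5) +v -1k *v ((`1 *v (^0 +v `6 *v ^2) +v (`2 *v ^4 +v 0w)) -v ^5)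
                  +v (⊖ `2) *v ((`3 *v ^1 +v (`8 *v ^3 +v 0w)) -v ^4) +v `4 *v ((`5 *v ^2 +v (`7 *v ^3 +v 0w)) -v ^6))) refl
               ⇐v (1F ∙: eh &v -1F ∙: e'' &v (- y') ∙: ef &v d ∙: e')
              E0 : c - x ≡ 0F
              E0 = coef X.indσ (c - x ∷ c - y' * f2 ∷ d * p - x * r :: d * s - y' * f1) eq zero
              E1 : c - y' * f2 ≡ 0F
              E1 = coef X.indσ (c - x ∷ c - y' * f2 ∷ d * p - x * r :: d * s - y' * f1) eq (suc zero)
              E2 : d * p - x * r ≡ 0F
              E2 = coef X.indσ (c - x ∷ c - y' * f2 ∷ d * p - x * r :: d * s - y' * f1) eq (suc (suc zero))
              E3 : d * s - y' * f1 ≡ 0F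
              E3 = coef X.indσ (c - x ∷ c - y' * f2 ∷ d * p - x * r :: d * s - y' * f1) eq (suc (suc (suc zero)))
              c≢0 : c ≢ 0F
              c≢0 refl = hnz (sym eh >> cong (λ z → 0F *> t <+> (z *> t' <+> 0v)) d0 >> (vsolve [] (t :: t') (0k *v ^0 +v (0k *v ^1 +v 0w)) 0w refl))
               where
                d0 : d ≡ 0F
                d0 = *-cancel-0 p p≢0 (solve (p ∷ d ∷ x :: r) (`0 *e `1) (0k +e (1k *e (`1 *e `0 -e `2 *e `3 -e 0k) +e (⊖ `3) *e (0k -e `2 -e 0k))) refl ⇐ 1F *: E2 & (- r) *: E0)
              final : (inv c c≢0 * y') *> f ≡ b2 <+> (r * (s * inv p p≢0)) *> b1
              final = vsolve (c ∷ inv c c≢0 ∷ p ∷ inv p p≢0 ∷ y' ∷ f2 ∷ f1 ∷ d ∷ s ∷ r :: x) (b2 ∷ b1 :: f)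
                ((`1 *e `4) *v ^2)
                ((^0 +v (`9 *e (`8 *e `3)) *v ^1) +v ((⊖ (`1 *e `4)) *v ((`5 *v ^0 +v (`6 *v ^1 +v 0w)) -v ^2)
                  +v (`0 -e `4 *e `5 -e 0k) *v ((⊖ `1) *v ^0) +v (`0 *e `1 -e 1k) *v (^0 +v (`9 *e (`8 *e `3)) *v ^1)
                  +v (`7 *e `8 -e `4 *e `6 -e 0k) *v ((⊖ `1) *v ^1)
                  +v (`7 *e `2 -e `10 *e `9 -e 0k) *v ((`1 *e `8 *e `3) *v ^1)
                  +v (`2 *e `3 -e 1k) *v ((⊖ (`1 *e `7 *e `8)) *v ^1)
                  +v (`0 -e `10 -e 0k) *v ((⊖ (`1 *e `9 *e `8 *e `3)) *v ^1))) refl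
               ⇐v (((- (inv c c≢0 * y')) ∙: ef) &v (E1 s: ((- inv c c≢0) *> b2)) &v (inv-r c c≢0 s: (b2 <+> (r * (s * inv p p≢0)) *> b1))
                 &v (E3 s: ((- inv c c≢0) *> b1)) &v (E2 s: ((inv c c≢0 * s * inv p p≢0) *> b1)) &v (inv-r p p≢0 s: ((- (inv c c≢0 * d * s)) *> b1)) &v (E0 s: ((- (inv c c≢0 * r * s * inv p p≢0)) *> b1)))

  -- Two dual planes from an apartment

  module Frames where
   open Apartments public
   open Vectors3 public

   record Frame : Set where
    constructor frame
    field
     es fs : Vec W 3
     ind : Ind (es ++ fs)
     orth : ∀ u w → u ≢ 0c → w ≢ 0c → dot u w ≡ 0F → lin u es ~ lin w fs
     orth⁻ : ∀ u w → u ≢ 0c → w ≢ 0c → lin u es ~ lin w fs → dot u w ≡ 0F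

   swapApt : Apt → Apt
   swapApt T = record { a0 = a1 ; a1 = a0 ; a2 = a2 ; b0 = b1 ; b1 = b0 ; b2 = b2 ; A0 = A1 ; A1 = A0 ; A2 = A2 ; B0 = B1 ; B1 = B0 ; B2 = B2
     ; c01 = c10 ; c02 = c12 ; c10 = c01 ; c12 = c02 ; c20 = c21 ; c21 = c20 ; o0 = o1 ; o1 = o0 ; o2 = o2 }
    where open Apt T

   private
    module Mk (T : Apt) (κ0 : K) (k0 : κ0 ≢ 0F) (ed0 : ∀ r → Apt.a1 T <+> r *> Apt.a2 T ~ Apt.b2 T <+> (r * κ0) *> Apt.b1 T)
         (κ1 : K) (k1 : κ1 ≢ 0F) (ed1 : ∀ r → Apt.a0 T <+> r *> Apt.a2 T ~ Apt.b2 T <+> (r * κ1) *> Apt.b0 T) where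
     open Apt T
     f0 f1 : W
     -- With these scalars the correspondences of the two edges become perpendicularity for `dot`.
     f0 = (- κ1) *> b0
     f1 = (- κ0) *> b1
     es fs : Vec W 3
     es = a0 ∷ a1 :: a2
     fs = f0 ∷ f1 :: b2

     nzs : ∀ {r} {x : W} → r ≢ 0F → x ≢ 0v → r *> x ≢ 0v
     nzs {r} {x} rnz xnz e = xnz (vsolve (r :: inv r rnz) [ x ] (^0) (0w +v (`1 *v (`0 *v ^0 -v 0w) +v (`0 *e `1 -e 1k) *v (-1k *v ^0))) refl
       ⇐v (inv r rnz ∙: e) &v (inv-r r rnz s: (-1F *> x)))
     F0 : f0 ≢ 0v
     F0 = nzs (-≢0 k1) (fst B0)
     F1 : f1 ≢ 0v
     F1 = nzs (-≢0 k0) (fst B1)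

     opaque
      indb : Ind (es ++ b0 ∷ b1 :: b2)
      indb = ind-gen {B = (b1 ∷ b2 :: a0) ++ (a1 ∷ a2 :: b0)} (ind-join i j disj) (g4 ∷ g5 ∷ g0 ∷ g1 ∷ g2 :: g3)
       where
        i : Ind (b1 ∷ b2 :: a0)
        i = ind-gen (path3 B1 A0 B2 (~sym c01) c02 nb12) (g2 ∷ g1 :: g0)
        j : Ind (a1 ∷ a2 :: b0)
        j = ind-gen (path3 A1 B0 A2 c10 (~sym c20) na12) (g2 ∷ g1 :: g0)
        disj : ∀ {z : W} → z ∈< b1 ∷ b2 :: a0 > → z ∈< a1 ∷ a2 :: b0 > → z ≡ 0v
        disj {z} z∈ z∈' with z ≟v 0v
        ... | yes e = e
        ... | no nz = ⊥-elim (o0 (z , nz , plane⊇ c01 c02 i z∈ , ~sym (plane⊇ (~sym c10) (~sym c20) j z∈')))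

      indS : Ind (es ++ fs)
      indS = ind-gen indb (g0 ∷ g1 ∷ g2 ∷ un κ1 k1 b0 g3 ∷ un κ0 k0 b1 g4 :: g5)
       where
        un : ∀ κ → κ ≢ 0F → ∀ x → (- κ) *> x ∈< es ++ fs > → x ∈< es ++ fs >
        un κ nz x h = subst (_∈< es ++ fs >) (vsolve (κ :: inv κ nz) [ x ] ((⊖ `1) *v (⊖ `0) *v ^0) (^0 +v (`0 *e `1 -e 1k) *v ^0) refl ⇐v (inv-r κ nz s: x)) (∙∈ (- inv κ nz) h)

      inde : Ind es
      inde = ind-tail {x = f0} (ind-tail {x = f1} (ind-tail {x = b2} (ind-gen indS (g3 ∷ g4 ∷ g5 ∷ g2 ∷ g1 :: g0))))

      indf : Ind fs
      indf = ind-tail (ind-tail (ind-tail indS))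

      -- y a1 + z a2 ~ y b2 − z f1, and similarly with a0
      pairing : ∀ {x x' y y' : W} κ → x' ~ y → (∀ r → x <+> r *> x' ~ y' <+> (r * κ) *> y) → ∀ s t → s *> x <+> t *> x' ~ s *> y' <+> (- t) *> ((- κ) *> y)
      pairing {x} {x'} {y} {y'} κ x'y ed s t with s ≟ 0F
      ... | no nz = subst₂ _~_
         (vsolve (s ∷ t :: inv s nz) (x :: x') (`0 *v (^0 +v (`2 *e `1) *v ^1)) ((`0 *v ^0 +v `1 *v ^1) +v (`0 *e `2 -e 1k) *v (`1 *v ^1)) refl ⇐v (inv-r s nz s: (t *> x')))
         (vsolve (s ∷ t ∷ inv s nz :: κ) (y :: y') (`0 *v (^1 +v (`2 *e `1 *e `3) *v ^0)) ((`0 *v ^1 +v (⊖ `1) *v (⊖ `3) *v ^0) +v (`0 *e `2 -e 1k) *v ((`1 *e `3) *v ^0)) refl ⇐v (inv-r s nz s: ((t * κ) *> y)))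
         (~sym (~∙ s (~sym (~∙ s (ed (inv s nz * t))))))
      ... | yes refl = subst₂ _~_
         (vsolve [ t ] (x :: x') (`0 *v ^1) (0k *v ^0 +v `0 *v ^1) refl)
         (vsolve (t :: κ) (y :: y') ((`0 *e `1) *v ^0) (0k *v ^1 +v (⊖ `0) *v (⊖ `1) *v ^0) refl)
         (~sym (~∙ t (~sym (~∙ (t * κ) x'y))))

      nz-e : ∀ {u} → u ≢ 0c → lin u es ≢ 0v
      nz-e nz e = nz (inde _ e)

     opaque
      unfolding indb
      private
       0F≢ : ∀ {z a b} → z ≢ 0F → a ∷ b :: z ≢ 0c
       0F≢ nz e = nz (cong (Vec.head ∘ Vec.tail ∘ Vec.tail) e)

      -- The two edges give the neighbours with coordinates `(0 , - z , y)` and `(- z , 0 , x)`; for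
      -- nonzero `z` they span all vectors perpendicular to `(x , y , z)`.
      orth-z : ∀ x y z p r s → z ≢ 0F → x * p + y * r + z * s ≡ 0F → lin (x ∷ y :: z) es ~ lin (p ∷ r :: s) fs
      orth-z x y z p r s znz e = ~span (nz-e (0F≢ znz)) (~sym h1 :: ~sym h2) (- (inv z znz * r) :: - (inv z znz * p) ,
         (vsolve (x ∷ y ∷ z ∷ p ∷ r ∷ s :: inv z znz) (f0 ∷ f1 :: b2)
          ((⊖ (`6 *e `4)) *v (`1 *v ^2 +v (⊖ `2) *v ^1) +v ((⊖ (`6 *e `3)) *v (`0 *v ^2 +v (⊖ `2) *v ^0) +v 0w))
          ((`3 *v ^0 +v (`4 *v ^1 +v (`5 *v ^2 +v 0w))) +v ((`2 *e `6 -e 1k) *v (`3 *v ^0 +v `4 *v ^1 +v `5 *v ^2) +v (`0 *e `3 +e `1 *e `4 +e `2 *e `5 -e 0k) *v ((⊖ `6) *v ^2))) refl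
         ⇐v (inv-r z znz s: (p *> f0 <+> r *> f1 <+> s *> b2)) &v (e s: ((- inv z znz) *> b2))))
       where
        h1 : y *> b2 <+> (- z) *> f1 ~ lin (x ∷ y :: z) es
        h1 = subst (_ ~_) (vsolve (x ∷ y :: z) (a0 ∷ a1 :: a2) (`0 *v ^0 +v (`1 *v ^1 +v `2 *v ^2)) (`0 *v ^0 +v (`1 *v ^1 +v (`2 *v ^2 +v 0w))) refl)
          (~+ nzg (~∙ x (~sym (~span (fst A0) (c02 :: ~∙ (- κ0) c01) (y :: - z , vsolve (y :: z) (b2 :: f1) (`0 *v ^0 +v ((⊖ `1) *v ^1 +v 0w)) (`0 *v ^0 +v (⊖ `1) *v ^1) refl)))) (~sym (pairing κ0 c21 ed0 y z)))
         where
          nzg : y *> b2 <+> (- z) *> f1 ≢ 0v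
          nzg e = -≢0 znz (coef indf (0F ∷ - z :: y) (vsolve (y :: z) (b2 ∷ f1 :: f0) (0k *v ^2 +v ((⊖ `1) *v ^1 +v (`0 *v ^0 +v 0w))) (`0 *v ^0 +v (⊖ `1) *v ^1) refl >> e) (suc zero))
        h2 : x *> b2 <+> (- z) *> f0 ~ lin (x ∷ y :: z) es
        h2 = subst (_ ~_) (vsolve (x ∷ y :: z) (a0 ∷ a1 :: a2) (`1 *v ^1 +v (`0 *v ^0 +v `2 *v ^2)) (`0 *v ^0 +v (`1 *v ^1 +v (`2 *v ^2 +v 0w))) refl)
          (~+ nzg (~∙ y (~sym (~span (fst A1) (c12 :: ~∙ (- κ1) c10) (x :: - z , vsolve (x :: z) (b2 :: f0) (`0 *v ^0 +v ((⊖ `1) *v ^1 +v 0w)) (`0 *v ^0 +v (⊖ `1) *v ^1) refl)))) (~sym (pairing κ1 c20 ed1 x z)))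
         where
          nzg : x *> b2 <+> (- z) *> f0 ≢ 0v
          nzg e = -≢0 znz (coef indf (- z ∷ 0F :: x) (vsolve (x :: z) (b2 ∷ f0 :: f1) ((⊖ `1) *v ^1 +v (0k *v ^2 +v (`0 *v ^0 +v 0w))) (`0 *v ^0 +v (⊖ `1) *v ^1) refl >> e) zero)

      -- The point with coordinates `(- y , x , 0)` is collinear with `(x , y , 1)` by `orth-z` and
      -- with `a2`, hence with their difference; `b2` is a second neighbour.
      orth-0 : ∀ x y p r s → x ∷ y :: 0F ≢ 0c → x * p + y * r + 0F * s ≡ 0F → lin (x ∷ y :: 0F) es ~ lin (p ∷ r :: s) fs
      orth-0 x y p r s unz e = go (x ≟ 0F) (y ≟ 0F)
       where
        b' : W
        b' = (- y) *> f0 <+> x *> f1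
        b'≡ : lin (- y ∷ x :: 0F) fs ≡ b'
        b'≡ = vsolve (x :: y) (f0 ∷ f1 :: b2) ((⊖ `1) *v ^0 +v (`0 *v ^1 +v (0k *v ^2 +v 0w))) ((⊖ `1) *v ^0 +v `0 *v ^1) refl
        b'nz : b' ≢ 0v
        b'nz z = unz (cong₂ (λ a b → a ∷ b :: 0F) (coef indf (- y ∷ x :: 0F) (b'≡ >> z) (suc zero))
          (sym (-‿involutive y) >> (cong -_ (coef indf (- y ∷ x :: 0F) (b'≡ >> z) zero)) >> -0#≈0#))
        ub : lin (x ∷ y :: 0F) es ~ b'
        ub = ~sym (subst (b' ~_) (vsolve (x :: y) (a0 ∷ a1 :: a2) ((`0 *v ^0 +v (`1 *v ^1 +v (1k *v ^2 +v 0w))) +v -1k *v ^2) (`0 *v ^0 +v (`1 *v ^1 +v (0k *v ^2 +v 0w))) refl)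
          (~+ b'nz (~sym (subst (lin (x ∷ y :: 1F) es ~_) b'≡ (orth-z x y 1F (- y) x 0F 1≢0 (solve (x :: y) (`0 *e (⊖ `1) +e `1 *e `0 +e 1k *e 0k) 0k refl))))
           (~∙ -1F (~sym (~span (fst A2) (~∙ (- κ1) c20 :: ~∙ (- κ0) c21) (- y :: x , vsolve (x :: y) (f0 :: f1) ((⊖ `1) *v ^0 +v (`0 *v ^1 +v 0w)) ((⊖ `1) *v ^0 +v `0 *v ^1) refl))))))
        u2 : lin (x ∷ y :: 0F) es ~ b2
        u2 = ~sym (~span (fst B2) (~sym c02 :: ~sym c12) (x :: y , vsolve (x :: y) (a0 ∷ a1 :: a2) (`0 *v ^0 +v (`1 *v ^1 +v 0w)) (`0 *v ^0 +v (`1 *v ^1 +v (0k *v ^2 +v 0w))) refl))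
        go : Dec (x ≡ 0F) → Dec (y ≡ 0F) → lin (x ∷ y :: 0F) es ~ lin (p ∷ r :: s) fs
        go (no xnz) _ = ~span (nz-e unz) (ub :: u2) (inv x xnz * r :: s ,
         (vsolve (x ∷ y ∷ p ∷ r ∷ s :: inv x xnz) (f0 ∷ f1 :: b2) ((`5 *e `3) *v ((⊖ `1) *v ^0 +v `0 *v ^1) +v (`4 *v ^2 +v 0w))
          ((`2 *v ^0 +v (`3 *v ^1 +v (`4 *v ^2 +v 0w))) +v ((`0 *e `5 -e 1k) *v (`2 *v ^0 +v `3 *v ^1) +v (`0 *e `2 +e `1 *e `3 +e 0k *e `4 -e 0k) *v ((⊖ `5) *v ^0))) refl
          ⇐v (inv-r x xnz s: (p *> f0 <+> r *> f1)) &v (e s: ((- inv x xnz) *> f0))))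
        go (yes refl) (yes refl) = ⊥-elim (unz refl)
        go (yes refl) (no ynz) = ~span (nz-e unz) (ub :: u2) (- (inv y ynz * p) :: s ,
         (vsolve (y ∷ p ∷ r ∷ s :: inv y ynz) (f0 ∷ f1 :: b2) ((⊖ (`4 *e `1)) *v ((⊖ `0) *v ^0 +v 0k *v ^1) +v (`3 *v ^2 +v 0w))
          ((`1 *v ^0 +v (`2 *v ^1 +v (`3 *v ^2 +v 0w))) +v ((`0 *e `4 -e 1k) *v (`1 *v ^0 +v `2 *v ^1) +v (0k *e `1 +e `0 *e `2 +e 0k *e `3 -e 0k) *v ((⊖ `4) *v ^1))) refl
          ⇐v (inv-r y ynz s: (p *> f0 <+> r *> f1)) &v (e s: ((- inv y ynz) *> f1))))

      orth : ∀ u w → u ≢ 0c → w ≢ 0c → dot u w ≡ 0F → lin u es ~ lin w fs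
      orth (x ∷ y :: z) (p ∷ r :: s) unz _ e with z ≟ 0F
      ... | no znz = orth-z x y z p r s znz e
      ... | yes refl = orth-0 x y p r s unz e

      -- Otherwise `lin u es` would be collinear with every point of the plane `fs`. The absence of
      -- quadrangles would then identify both `a0` and `a2` with it.
      orth⁻ : ∀ u w → u ≢ 0c → w ≢ 0c → lin u es ~ lin w fs → dot u w ≡ 0F
      orth⁻ u w unz wnz h with dot u w ≟ 0F
      ... | yes e = e
      ... | no dnz = ⊥-elim (1≢0 (coef inde (1F ∷ 0F :: - c) eq zero))
       where
        hit : ∀ w' → lin u es ~ lin w' fs
        hit w' = subst (lin u es ~_) (cong (lin w″ fs <+>_) (sym (lin-∙ m w fs)) >> sym (lin-+ w″ (m *> w) fs) >> cong (λ z → lin z fs) (vsolve [ m ] (w :: w') ((1k *v ^1 +v (⊖ `0) *v ^0) +v `0 *v ^0) (^1) refl))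
          (~+ (nz-e unz) (h″ (w″ ≟v 0c)) (~∙ m h))
         where
          m : K
          m = dot u w' * inv (dot u w) dnz
          w″ : K3
          w″ = 1F *> w' <+> (- m) *> w
          h″ : Dec (w″ ≡ 0c) → lin u es ~ lin w″ fs
          h″ (yes z) = subst (lin u es ~_) (sym (cong (λ z → lin z fs) z >> lin-0 fs)) (~0 h)
          h″ (no nz) = orth u w″ unz nz (dot-lin u 1F w' (- m) w >> (solve (dot u w' ∷ dot u w :: inv (dot u w) dnz) (1k *e `0 +e (⊖ (`0 *e `2)) *e `1) (0k +e (⊖ `0) *e (`1 *e `2 -e 1k)) refl ⇐ (- dot u w') *: inv-r (dot u w) dnz))
        uf0 : lin u es ~ f0
        uf0 = subst (lin u es ~_) (vsolve [] (f0 ∷ f1 :: b2) (1k *v ^0 +v (0k *v ^1 +v (0k *v ^2 +v 0w))) (^0) refl) (hit (1F ∷ 0F :: 0F))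
        uf1 : lin u es ~ f1
        uf1 = subst (lin u es ~_) (vsolve [] (f0 ∷ f1 :: b2) (0k *v ^0 +v (1k *v ^1 +v (0k *v ^2 +v 0w))) (^1) refl) (hit (0F ∷ 1F :: 0F))
        uf2 : lin u es ~ b2
        uf2 = subst (lin u es ~_) (vsolve [] (f0 ∷ f1 :: b2) (0k *v ^0 +v (0k *v ^1 +v (1k *v ^2 +v 0w))) (^2) refl) (hit (0F ∷ 0F :: 1F))
        P0 : Pnt f0
        P0 = ~P F0 (~sym uf0)
        P1 : Pnt f1
        P1 = ~P F1 (~sym uf1)
        b1∥ : b1 ∥ f1
        b1∥ = par-sym F1 (- κ0 ∷ [] , vsolve [ κ0 ] [ b1 ] ((⊖ `0) *v ^0 +v 0w) ((⊖ `0) *v ^0) refl)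
        e2∥ : a2 ∥ lin u es
        e2∥ = quad P0 P1 (fst A2) (nz-e unz) (~sym (~∙ (- κ1) c20)) (~∙ (- κ0) c21) (~sym uf1) uf0
          λ h → nb01 (~sym (∥~ B1 (par-sym F0 (- κ1 ∷ [] , vsolve [ κ1 ] [ b0 ] ((⊖ `0) *v ^0 +v 0w) ((⊖ `0) *v ^0) refl)) (~sym (∥~ P0 b1∥ h))))
        e0∥ : a0 ∥ lin u es
        e0∥ = quad P1 B2 (fst A0) (nz-e unz) (~sym (~∙ (- κ0) c01)) c02 (~sym uf2) uf1 λ h → nb12 (~sym (∥~ B2 b1∥ (~sym h)))
        par : a0 ∥ a2
        par = span⊆ [ par-sym (fst A2) e2∥ ] e0∥
        c : K
        c = Vec.head (fst par)
        eq : lin (1F ∷ 0F :: - c) es ≡ 0v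
        eq = go par refl
         where
          go : (p : a0 ∥ a2) → Vec.head (fst p) ≡ c → lin (1F ∷ 0F :: - c) es ≡ 0v
          go (d ∷ [] , e) refl = vsolve [ d ] (a0 ∷ a1 :: a2) (1k *v ^0 +v (0k *v ^1 +v ((⊖ `0) *v ^2 +v 0w))) (0w +v -1k *v ((`0 *v ^2 +v 0w) -v ^0)) refl ⇐v -1F ∙: e

     Fr : Frame
     Fr = frame es fs indS orth orth⁻

   opaque
    mkFrame : Apt → Frame
    mkFrame T with edge T | edge (swapApt T)
    ... | κ0 , k0 , ed0 | κ1 , k1 , ed1 = Mk.Fr T κ0 k0 ed0 κ1 k1 ed1

  -- Points of the two planes and their neighbours

  module FrameLemmas (Fr : Frames.Frame) where
   open Frames
   open Frame Fr

   S : Vec W 6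
   S = es ++ fs

   A B : K3 → W
   A u = lin u es
   B w = lin w fs

   opaque
    S⊇ : VAll (_∈< S >) es × VAll (_∈< S >) fs
    S⊇ = VAllₚ.++⁻ es (gens∈ S)

   opaque
    A∈ : ∀ u → A u ∈< S >
    A∈ u = span⊆ (fst S⊇) (u , refl)

   opaque
    B∈ : ∀ w → B w ∈< S >
    B∈ w = span⊆ (snd S⊇) (w , refl)

   opaque
    AB-inj : ∀ {u u' w w'} → A u <+> B w ≡ A u' <+> B w' → u ≡ u' × w ≡ w'
    AB-inj {u} {u'} {w} {w'} e = Vecₚ.++-injective u u' (lin-inj ind (u ++ w) (u' ++ w') (lin-++ u w es fs >> e >> sym (lin-++ u' w' es fs)))

   opaque
    A+0 : ∀ u → A u <+> B 0c ≡ A u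
    A+0 u = cong (A u <+>_) (lin-0 fs) >> (vsolve [] [ A u ] (^0 +v 0w) (^0) refl)

   opaque
    0+B : ∀ w → A 0c <+> B w ≡ B w
    0+B w = cong (_<+> B w) (lin-0 es) >> (vsolve [] [ B w ] (0w +v ^0) (^0) refl)

   opaque
    A-inj : ∀ {u u'} → A u ≡ A u' → u ≡ u'
    A-inj {u} {u'} e = fst (AB-inj {u} {u'} {0c} {0c} (cong (_<+> B 0c) e))

   opaque
    B-inj : ∀ {w w'} → B w ≡ B w' → w ≡ w'
    B-inj {w} {w'} e = snd (AB-inj {0c} {0c} {w} {w'} (cong (A 0c <+>_) e))

   opaque
    nzA : ∀ {u} → u ≢ 0c → A u ≢ 0v
    nzA nz e = nz (A-inj (e >> sym (lin-0 es)))

   opaque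
    nzB : ∀ {w} → w ≢ 0c → B w ≢ 0v
    nzB nz e = nz (B-inj (e >> sym (lin-0 fs)))

   opaque
    indB : ∀ {w w'} → Ind (w :: w') → Ind (B w :: B w')
    indB = ind-lin (λ cs e → B-inj (e >> sym (lin-0 fs)))

   opaque
    indA : ∀ {w w'} → Ind (w :: w') → Ind (A w :: A w')
    indA = ind-lin (λ cs e → A-inj (e >> sym (lin-0 es)))

   opaque
    A∉B : ∀ {u} → u ≢ 0c → ¬ A u ∈< fs >
    A∉B {u} nz (cs , e) = nz (fst (AB-inj {u} {0c} {0c} {cs} (A+0 u >> sym e >> sym (0+B cs))))

   opaque
    pA : ∀ {u} → u ≢ 0c → Pnt (A u)
    pA {u} nz with perp u u
    ... | w , wnz , e , _ = ~P (nzA nz) (orth u w nz wnz e)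

   opaque
    indABB : ∀ {u w w'} → u ≢ 0c → Ind (w :: w') → Ind (B w ∷ B w' :: A u)
    indABB {u} {w} {w'} nz i = ind-gen (ext (indB i) λ p → A∉B nz (span⊆ ((w , refl) :: (w' , refl)) p)) (g2 ∷ g0 :: g1)

   opaque
    planeA : ∀ {u g} → u ≢ 0c → A u ~ g → ∃₂ λ c w → g ≡ c *> A u <+> B w × dot u w ≡ 0F
    planeA {u} {g} nz h with perp-basis u nz
    ... | w , w' , i , d , d' with in-plane (orth u w nz (ind-nonzero i) d) (orth u w' nz (ind-nonzero (ind-tail i)) d') (indABB nz i) h
    ... | s ∷ t :: c , refl = c , s *> w <+> t *> w' , trans (vsolve (s ∷ t :: c) (B w ∷ B w' :: A u) (`0 *v ^0 +v (`1 *v ^1 +v (`2 *v ^2 +v 0w))) (`2 *v ^2 +v (`0 *v ^0 +v `1 *v ^1)) refl)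
        (cong (c *> A u <+>_) (sym (lin-lin fs s w t w'))) ,
       trans (dot-lin u s w t w') (cong₂ (λ x y → s * x + t * y) d d' >> solve (s :: t) (`0 *e 0k +e `1 *e 0k) 0k refl)

   opaque
    fullA : ∀ {k} {D : Vec W k} {u} → VAll (_∈< D >) S → u ≢ 0c → Full D (A u)
    fullA {u = u} h nz with perp-basis u nz
    ... | w , w' , i , d , d' = full2 (orth u w nz (ind-nonzero i) d) (orth u w' nz (ind-nonzero (ind-tail i)) d') (indABB nz i) (span⊆ h (B∈ w)) (span⊆ h (B∈ w')) (span⊆ h (A∈ u))

   -- two A-points have a common B-neighbour, so they are not collinear
   opaque
    noAA : ∀ {u u'} → Ind (u :: u') → ¬ A u ~ A u'
    noAA {u} {u'} i h with perp u u'
    ... | w , wnz , d , d' = tri (orth u w nz wnz d) (~sym (orth u' w nz' wnz d')) h (ext (swap (indA i)) λ p → nzB wnz (ind-disj ind (span⊆ ((u' , refl) :: (u , refl)) p) (w , refl)))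
     where
      nz : u ≢ 0c
      nz = ind-nonzero i
      nz' : u' ≢ 0c
      nz' = ind-nonzero (ind-tail i)

  -- Spreading fullness over the hexagon

  module Closure where
   open Frames public

   opaque
    ind-swap : ∀ (x y : Vec W 3) → Ind (x ++ y) → Ind (y ++ x)
    ind-swap (_ ∷ _ :: _) (_ ∷ _ :: _) i = ind-gen i (g3 ∷ g4 ∷ g5 ∷ g0 ∷ g1 :: g2)

   dual : Frame → Frame
   dual (frame es fs i o o⁻) = frame fs es (ind-swap es fs i)
    (λ u w unz wnz d → ~sym (o w u wnz unz (dot-comm w u >> d))) (λ u w unz wnz h → trans (dot-comm u w) (o⁻ w u wnz unz (~sym h)))

   opaque
    full-par : ∀ {k} {D : Vec W k} {x z} → Full D x → z ≢ 0v → z ∥ x → Full D z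
    full-par {x = x} {z} (full px f) nz p = full (nz , zz) λ {w} h → f (subst (_~ w) (snd xz) (sc h))
     where
      zx : x ~ z
      zx = ∥~ px p (snd px)
      zz : z ~ z
      zz = ~selfˡ (~sym zx)
      xz : ∃ λ c → c *> z ≡ x
      xz with par-sym nz p
      ... | c ∷ [] , e = c , trans (vsolve [ c ] [ z ] (`0 *v ^0) (`0 *v ^0 +v 0w) refl) e
      sc : ∀ {w} → z ~ w → fst xz *> z ~ w
      sc h = ~sym (~∙ (fst xz) (~sym h))

   opaque
    -- Further lines through `u` and `u'` make a grid with centre `p`. The line of its solid through
    -- `e`, together with the line `e p`, spans the plane of `e`, and both lie in the span of `D`.
    complete-edge : ∀ {k} {D : Vec W k} {p u u'} → Full D u → Full D u' → p ~ u → p ~ u' → Ind (u ∷ u' :: p) → ∀ {e} → e ≢ 0v → e ∈< u :: u' > → Full D e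
    complete-edge {D = D} {p} {u} {u'} (full pu fu) (full pu' fu') pu~ pu'~ i {e} enz e∈
     with third (~sym pu~) (swap (ind-tail (ind-gen i (g1 ∷ g0 :: g2)))) | third (~sym pu'~) (swap (ind-tail i))
    ... | g , ug , ig | g' , ug' , ig' = fin (X.cover enz e∈)
     where
      pp : Pnt p
      pp = ~P (ind-nonzero (ind-tail (ind-tail i))) pu~
      G : Grid
      G = record { b = p ; a = u ; a' = u' ; g = g ; g' = g' ; pb = pp ; pa = pu ; pa' = pu' ; pg = ~P (ind-nonzero ig) (~sym ug) ; pg' = ~P (ind-nonzero ig') (~sym ug') ; ba = pu~ ; ba' = pu'~
            ; ag = ug ; ag' = ug' ; naa' = λ h → tri pu~ h pu'~ i ; nbg = λ h → tri ug (~sym h) (~sym pu~) ig ; nbg' = λ h → tri ug' (~sym h) (~sym pu'~) ig' }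
      module X = GridLemmas G
      inD : VAll (_∈< D >) X.σ
      inD = fu (snd pu) ∷ fu ug ∷ fu' (snd pu') :: fu' ug'
      fin : (∃ λ t → e ~ t × t ∈< X.σ > × Ind (t :: e)) → Full D e
      fin (t , et , t∈ , it) = full2 (~sym (~span (fst pp) (pu~ :: pu'~) e∈)) et (ext it λ q → X.b∉σ (span⊆ (t∈ :: span⊆ (g0 :: g2) e∈) q))
        (fu (~sym pu~)) (span⊆ inD t∈) (span⊆ inD (span⊆ (g0 :: g2) e∈))

   module _ {k} {D : Vec W k} where
    private
     line : ∀ {p p₁ p'} → Full D p → Full D p₁ → Full D (p <+> p₁) → Full D p' → p ~ p₁ → p ~ p' → Ind (p₁ ∷ p' :: p) → ∀ {z} → z ≢ 0v → z ∈< p :: p' > → Full D z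
     line {p} {p₁} {p'} fp f1 f2 f' a a' i znz (γ :: δ , refl) with δ ≟ 0F
     ... | yes refl = full-par fp znz (γ ∷ [] , vsolve [ γ ] (p :: p') (`0 *v ^0 +v 0w) (`0 *v ^0 +v (0k *v ^1 +v 0w)) refl)
     ... | no δnz = complete-edge f1 ff a (~span (fst (Full.isP fp)) (pp2 :: a') f∈) i1 znz
        (- γ :: 1F , vsolve (γ :: δ) (p ∷ p' :: p₁) ((⊖ `0) *v ^2 +v (1k *v (`0 *v (^0 +v ^2) +v `1 *v ^1) +v 0w)) (`0 *v ^0 +v (`1 *v ^1 +v 0w)) refl)
      where
       f : W
       f = γ *> (p <+> p₁) <+> δ *> p'
       f∈ : f ∈< p <+> p₁ :: p' >
       f∈ = +∈ (∙∈ γ g0) (∙∈ δ g1)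
       pp2 : p ~ p <+> p₁
       pp2 = ~+ (fst (Full.isP fp)) (snd (Full.isP fp)) a
       i2 : Ind (p <+> p₁ ∷ p' :: p)
       i2 = ind-gen i ((1F ∷ 0F :: - 1F , vsolve [] (p ∷ p' :: p₁) (1k *v (^0 +v ^2) +v (0k *v ^1 +v (-1k *v ^0 +v 0w))) (^2) refl) ∷ g1 :: g2)
       i1 : Ind (p₁ ∷ f :: p)
       i1 = ind-gen i (g0 ∷ (- (inv δ δnz * γ) ∷ inv δ δnz :: - (inv δ δnz * γ) ,
         (vsolve (γ ∷ δ :: inv δ δnz) (p ∷ p' :: p₁) ((⊖ (`2 *e `0)) *v ^2 +v (`2 *v (`0 *v (^0 +v ^2) +v `1 *v ^1) +v ((⊖ (`2 *e `0)) *v ^0 +v 0w))) (^1 +v (`1 *e `2 -e 1k) *v ^1) refl ⇐v (inv-r δ δnz s: p'))) :: g2)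
       ff : Full D f
       ff = complete-edge f2 f' pp2 a' i2 (ind-nonzero (ind-tail {x = p₁} i1)) f∈

    opaque
     -- Full points of π_p are closed under joining by lines not through p; three on one line through p and one off it generate π_p.
     plane-full : ∀ {p p₁ p'} → Full D p → Full D p₁ → Full D (p <+> p₁) → Full D p' → p ~ p₁ → p ~ p' → Ind (p₁ ∷ p' :: p) → ∀ {z} → z ≢ 0v → p ~ z → Full D z
     plane-full {p} {p₁} {p'} fp f1 f2 f' a a' i {z} znz pz with in-plane a a' i pz
     ... | x₁ ∷ x' :: x0 , refl with x' ≟ 0F
     ... | yes refl = line fp f' fpp' f1 a' a (ind-gen i (g1 ∷ g0 :: g2)) znz (x0 :: x₁ , vsolve (x0 :: x₁) (p ∷ p' :: p₁) (`0 *v ^0 +v (`1 *v ^2 +v 0w)) (`1 *v ^2 +v (0k *v ^1 +v (`0 *v ^0 +v 0w))) refl)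
      where
       fpp' : Full D (p <+> p')
       fpp' = line fp f1 f2 f' a a' i (λ e → 1≢0 (coef i (0F ∷ 1F :: 1F) ((vsolve [] (p ∷ p' :: p₁) (0k *v ^2 +v (1k *v ^1 +v (1k *v ^0 +v 0w))) (^0 +v ^1) refl) >> e) (suc zero))) (+∈ g0 g1)
     ... | no xnz = complete-edge f1 (line fp f1 f2 f' a a' i (ind-nonzero (ind-tail i1)) (+∈ (∙∈ x0 g0) (∙∈ x' g1))) a (~span (fst (Full.isP fp)) (snd (Full.isP fp) :: a') (+∈ (∙∈ x0 g0) (∙∈ x' g1))) i1 znz
        (x₁ :: 1F , vsolve (x₁ ∷ x' :: x0) (p ∷ p' :: p₁) (`0 *v ^2 +v (1k *v (`2 *v ^0 +v `1 *v ^1) +v 0w)) (`0 *v ^2 +v (`1 *v ^1 +v (`2 *v ^0 +v 0w))) refl)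
      where
       i1 : Ind (p₁ ∷ x0 *> p <+> x' *> p' :: p)
       i1 = ind-gen i (g0 ∷ (0F ∷ inv x' xnz :: - (inv x' xnz * x0) ,
         (vsolve (x0 ∷ x' :: inv x' xnz) (p ∷ p' :: p₁) (0k *v ^2 +v (`2 *v (`0 *v ^0 +v `1 *v ^1) +v ((⊖ (`2 *e `0)) *v ^0 +v 0w))) (^1 +v (`1 *e `2 -e 1k) *v ^1) refl ⇐v (inv-r x' xnz s: p'))) :: g2)

   module _ (Fr : Frame) {k} {D : Vec W k} where
    open Frame Fr
    open FrameLemmas Fr
    opaque
     -- Fullness spreads from the thin point to all neighbours of `a`, and then to their neighbours;
     -- by `reach` every point is collinear with one of these.
     closure : VAll (_∈< D >) S → ∀ {u w} → u ≢ 0c → w ≢ 0c → dot u w ≡ 0F → Full D (A u <+> B w) → ∀ {x} → Pnt x → x ∈< D >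
     closure S⊆ {u} {w} unz wnz d fw {x} px = fin (reach {m = ln a (B w) ial} px (~L ial aw))
      where
       a : W
       a = A u
       aw : a ~ B w
       aw = orth u w unz wnz d
       pa : Pnt a
       pa = pA unz
       ial : Ind (a :: B w)
       ial = ext (ind1 (nzB wnz)) λ p → A∉B unz (span⊆ [ (w , refl) ] p)
       basis' : ∃₂ λ w w' → Ind (w :: w') × dot u w ≡ 0F × dot u w' ≡ 0F
       basis' = perp-basis u unz
       off : ∀ {y} → ∃ λ w' → w' ≢ 0c × dot u w' ≡ 0F × ¬ B w' ∈< y :: a >
       off {y} with basis'
       ... | w1 , w2 , i , d1 , d2 with ∈? (B w1) (y :: a) | ∈? (B w2) (y :: a)
       ... | no n1 | _ = w1 , ind-nonzero i , d1 , n1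
       ... | yes _ | no n2 = w2 , ind-nonzero (ind-tail i) , d2 , n2
       ... | yes y1 | yes y2 = ⊥-elim (ind-no ℕₚ.≤-refl (y :: a) (indABB unz i) (y1 ∷ y2 :: g1))
       fa : Full D a
       fa = fullA S⊆ unz
       fB : ∀ {w} → w ≢ 0c → Full D (B w)
       fB nz = FrameLemmas.fullA (dual Fr) (VAllₚ.++⁺ (snd (VAllₚ.++⁻ es S⊆)) (fst (VAllₚ.++⁻ es S⊆))) nz
       level1 : ∀ {z} → z ≢ 0v → a ~ z → Full D z
       level1 with off {B w}
       ... | w' , wnz' , d' , n' = plane-full fa (fB wnz) fw (fB wnz') aw (orth u w' unz wnz' d') (ind-gen (ext (swap ial) n') (g1 ∷ g0 :: g2))
       level2 : ∀ {r z} → r ≢ 0v → a ~ r → z ≢ 0v → r ~ z → Full D z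
       level2 {r} {z} rnz ar znz rz with par? r (fst pa)
       ... | inj₁ p = level1 znz (~sym (∥~ (~P znz (~sym rz)) (par-sym rnz p) (~sym rz)))
       ... | inj₂ ira with off {r} | third (~sym ar) (swap ira)
       ... | w' , wnz' , d' , n' | t , rt , it with perp-basis w' wnz'
       ... | u1 , u2 , iu , e1 , e2 = go (pick' (∈? u1 [ u ]) (∈? u2 [ u ]))
        where
         pick' : Dec (u1 ∈< u ∷ [] >) → Dec (u2 ∈< u ∷ [] >) → ∃ λ u' → Ind (u' :: u) × dot w' u' ≡ 0F
         pick' (no n1) _ = u1 , ext (ind1 unz) n1 , e1
         pick' (yes _) (no n2) = u2 , ext (ind1 unz) n2 , e2
         pick' (yes y1) (yes y2) = ⊥-elim (ind-no ℕₚ.≤-refl [ u ] iu (y1 :: y2))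
         irt : Ind (r :: t)
         irt = ind-tail {x = a} (ind-gen it (g2 ∷ g0 :: g1))
         go : (∃ λ u' → Ind (u' :: u) × dot w' u' ≡ 0F) → Full D z
         -- `A u'` is opposite `r`, so reaching from it to the line `r t` gives a neighbour `r'` of
         -- `r` off the line `a r`. It is full, because it is also joined to a neighbour of `A u'`,
         -- and these lie in `S`.
         go (u' , iu' , e') = last (reach {m = ln r t irt} (pA (ind-nonzero iu')) (~L irt rt))
          where
           pr : Pnt r
           pr = ~P rnz rz
           ab' : a ~ B w'
           ab' = orth u w' unz wnz' d'
           b'a' : B w' ~ A u'
           b'a' = ~sym (orth u' w' (ind-nonzero iu') wnz' (dot-comm u' w' >> e'))
           op : ¬ D4 r (A u')
           op = walk pr pa (~P (nzB wnz') b'a') (pA (ind-nonzero iu')) (~sym ar) ab' b'a'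
             (λ h → tri ar h ab' (ind-gen (ext ira n') (g1 ∷ g0 :: g2))) (noAA (swap iu'))
           last : (∃ λ r' → r' ≢ 0v × r' ∈< r :: t > × D4 (A u') r') → Full D z
           last (r' , rnz' , r∈' , s , snz , us , sr') = plane-full (level1 rnz ar) fa (level1 (λ e → 1≢0 (coef ira (1F :: 1F) ((vsolve [] (r :: a) (1k *v ^0 +v (1k *v ^1 +v 0w)) (^0 +v ^1) refl) >> e) zero)) (~+ (fst pa) ar (snd pa))) fr' (~sym ar) rr'
              (ind-gen (ext irr' λ p → ∉-head {x = a} {B = t :: r} (ind-gen it (g1 ∷ g0 :: g2)) (span⊆ (span⊆ (g1 :: g0) r∈' :: g1) p)) (g0 ∷ g1 :: g2)) znz rz
            where
             rr' : r ~ r'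
             rr' = ~on irt rt r∈'
             irr' : Ind (r' :: r)
             irr' = ext (ind1 rnz) λ p → op (s , snz , ~sym (∥~ (~P snz sr') (par-sym rnz' p) sr') , ~sym us)
             fr' : Full D r'
             fr' = full2 (~sym sr') (~sym rr') (ext (swap irr') λ p → op (s , snz , ~on (swap irr') rr' (span⊆ (g0 :: g1) p) , ~sym us)) (Full.sub⊆ (fullA S⊆ (ind-nonzero iu')) us) (self∈ (level1 rnz ar))
               (span⊆ (self∈ (level1 rnz ar) :: Full.sub⊆ (level1 rnz ar) rt) r∈')
       fin : (∃ λ r → r ≢ 0v × r ∈< a :: B w > × D4 x r) → x ∈< D >
       fin (r , rnz , r∈ , s , snz , xs , sr) = Full.sub⊆ (level2 rnz (~on ial aw r∈) snz (~sym sr)) (~sym xs)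

  -- The hyperplane spanned by the two planes

  module Coordinates where
   open Hyp H
   open Closure public
   open Arith

   private
    -- The number of lines of the hexagon exceeds the bound in (Hp') even after the subtracted cube
    -- is dropped from that bound.
    small : ∀ q → 2 ℕ.≤ q → suc (bound q) ℕ.≤ (suc q ℕ.+ (suc q ℕ.* q) ℕ.* q) ℕ.+ (((suc q ℕ.* q) ℕ.* q) ℕ.* q) ℕ.* q
    small (suc (suc k)) (s≤s (s≤s _)) = ℕₚ.≤-trans (s≤s (ℕₚ.+-monoˡ-≤ (2 ℕ.* q') (ℕₚ.+-monoˡ-≤ (3 ℕ.* q' ℕ.^ 2) (ℕₚ.m∸n≤m (q' ℕ.^ 4) (q' ℕ.^ 3)))))
      (ℕₚ.≤-trans (ℕₚ.m≤m+n _ (30 ℕ.+ 83 ℕ.* k ℕ.+ 84 ℕ.* k ℕ.^ 2 ℕ.+ 41 ℕ.* k ℕ.^ 3 ℕ.+ 10 ℕ.* k ℕ.^ 4 ℕ.+ k ℕ.^ 5)) (ℕₚ.≤-reflexive (eq k)))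
     where
      q' : ℕ
      q' = suc (suc k)
      eq : ∀ k → suc ((2 ℕ.+ k) ℕ.^ 4 ℕ.+ 3 ℕ.* (2 ℕ.+ k) ℕ.^ 2 ℕ.+ 2 ℕ.* (2 ℕ.+ k)) ℕ.+ (30 ℕ.+ 83 ℕ.* k ℕ.+ 84 ℕ.* k ℕ.^ 2 ℕ.+ 41 ℕ.* k ℕ.^ 3 ℕ.+ 10 ℕ.* k ℕ.^ 4 ℕ.+ k ℕ.^ 5)
         ≡ (suc (2 ℕ.+ k) ℕ.+ (suc (2 ℕ.+ k) ℕ.* (2 ℕ.+ k)) ℕ.* (2 ℕ.+ k)) ℕ.+ (((suc (2 ℕ.+ k) ℕ.* (2 ℕ.+ k)) ℕ.* (2 ℕ.+ k)) ℕ.* (2 ℕ.+ k)) ℕ.* (2 ℕ.+ k)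
      eq = NS.solve 1 (λ k → let p = NS.con 2 NS.:+ k ; p₁ = NS.con 3 NS.:+ k in
         (NS.con 1 NS.:+ (p NS.:^ 4 NS.:+ NS.con 3 NS.:* p NS.:^ 2 NS.:+ NS.con 2 NS.:* p)) NS.:+ (NS.con 30 NS.:+ NS.con 83 NS.:* k NS.:+ NS.con 84 NS.:* k NS.:^ 2 NS.:+ NS.con 41 NS.:* k NS.:^ 3 NS.:+ NS.con 10 NS.:* k NS.:^ 4 NS.:+ k NS.:^ 5)
         NS.:= (p₁ NS.:+ (p₁ NS.:* p) NS.:* p) NS.:+ (((p₁ NS.:* p) NS.:* p) NS.:* p) NS.:* p) refl
       where module NS = Data.Nat.Solver.+-*-Solver

   opaque
    all-lines : ∀ {x} → Pnt x → LFam L ((suc q ℕ.+ (suc q ℕ.* q) ℕ.* q) ℕ.+ (((suc q ℕ.* q) ℕ.* q) ℕ.* q) ℕ.* q)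
    all-lines {x} px = fam-++ {S = λ k → Thru x k ⊎ S3 x k} {U = L} (fam-++ (pencil px) (lines3 px) (λ (_ , x∈) (_ , x∉ , _) e → x∉ (fst (sub e) x x∈)) inj₁ inj₂) (lines5 px)
      dis (λ { (inj₁ (h , _)) → h ; (inj₂ (h , _)) → h }) (λ (_ , _ , (h , _) , _) → h)
     where
      dis : ∀ {a b} → Thru x a ⊎ S3 x a → (∃ λ y → S2 x y × T5 x y b) → ¬ a ≈ℓ b
      dis (inj₁ (_ , x∈)) (_ , _ , _ , no~) e = no~ (fst px) (fst (sub e) x x∈) (snd px)
      dis (inj₂ (_ , _ , p , pnz , xp , p∈)) (_ , _ , _ , no~) e = no~ pnz (fst (sub e) p p∈) xp

   opaque
    -- If all listed lines of the hexagon lay in a 5-space, (Hp') would be violated there.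
    escape : ∀ {D : Vec W 6} {x} → Ind D → Pnt x → ∃ λ y → Pnt y × ¬ y ∈< D >
    escape {D} i px with all-lines px
    ... | fam l len al di with All.all? (λ k → VAll.all? (λ z → ∈? z D) (bas k)) l
    ... | yes h = ⊥-elim (ℕₚ.<-irrefl refl (ℕₚ.≤-trans (small q q≥2) (ℕₚ.≤-trans (card-bound (fst (snd (hp (subspace D i)))) (fam l len (All.zipWith (λ (a , b) → a , λ x → span⊆ b) (al , h)) di)) (snd (snd (hp (subspace D i)))))))
    ... | no nh = go l al nh
     where
      go : ∀ l → All L l → ¬ All (λ k → VAll (_∈< D >) (bas k)) l → ∃ λ y → Pnt y × ¬ y ∈< D >
      go [] _ nh = ⊥-elim (nh [])
      go (k@(subspace (a :: b) j) ∷ l) (h ∷ al) nh with ∈? a D | ∈? b D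
      ... | no na | _ = a , (ind-nonzero j , L~ {k} h g0 g0) , na
      ... | yes _ | no nb = b , (ind-nonzero (ind-tail j) , L~ {k} h g1 g1) , nb
      ... | yes a∈ | yes b∈ = go l al λ r → nh ((a∈ :: b∈) ∷ r)

   module _ (Fr : Frame) where
    open Frame Fr
    open FrameLemmas Fr
    private
     module Du = FrameLemmas (dual Fr)

     i0 : K3
     i0 = 1F ∷ 0F :: 0F
     i0nz : i0 ≢ 0c
     i0nz e = 1≢0 (cong Vec.head e)

    opaque
     -- A thin point full in `S` would, by `closure`, force all points into `S`, against `escape`.
     no-thin-full : ∀ {u w} → u ≢ 0c → w ≢ 0c → dot u w ≡ 0F → ¬ Full S (A u <+> B w)
     no-thin-full unz wnz d f with escape ind (pA i0nz)
     ... | y , py , y∉ = y∉ (closure Fr (gens∈ S) unz wnz d f py)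

    private
     in-line : ∀ u w u1 w1 c d → A u <+> B w ≡ c *> A u1 <+> d *> B w1 → dot u1 w1 ≡ 0F → dot u w ≡ 0F
     in-line u w u1 w1 c d e z with AB-inj {u} {c *> u1} {w} {d *> w1} (e >> sym (cong₂ _<+>_ (lin-∙ c u1 es) (lin-∙ d w1 fs)))
     ... | refl , refl = cong (dot (c *> u1)) (vsolve [ d ] [ w1 ] (`0 *v ^0) (`0 *v ^0 +v 0k *v ^0) refl) >> dot-lin (c *> u1) d w1 0F w1 >>
       cong (λ z → d * z + 0F * dot (c *> u1) w1) (dot-comm (c *> u1) w1 >> cong (dot w1) (vsolve [ c ] [ u1 ] (`0 *v ^0) (`0 *v ^0 +v 0k *v ^0) refl) >> dot-lin w1 c u1 0F u1 >> cong (λ z → c * z + 0F * z) (dot-comm w1 u1 >> z)) >>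
        solve (c ∷ d :: dot (c *> u1) w1) (`1 *e (`0 *e 0k +e 0k *e 0k) +e 0k *e `2) 0k refl

     one* : ∀ {x : W} → 1F *> x ≡ x
     one* {x} = vsolve [] [ x ] (1k *v ^0) (^0) refl

    opaque
     -- Points of S off the two planes lie on a line joining them.
     via : ∀ {u w u' s} → Pnt (A u <+> B w) → u' ≢ 0c → s ≢ 0v → A u' ~ s → s ~ A u <+> B w → dot u w ≡ 0F
     via {u} {w} {u'} {s} pp u'nz snz us sp with planeA u'nz us
     ... | c , w1 , e , d = cases (∈? (A u <+> B w) (A u' :: s)) (c ≟ 0F) (w1 ≟v 0c)
      where
       ps : Pnt s
       ps = ~P snz sp
       cases : Dec (A u <+> B w ∈< A u' :: s >) → Dec (c ≡ 0F) → Dec (w1 ≡ 0c) → dot u w ≡ 0F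
       cases (yes (x :: y , e')) _ _ = in-line u w u' w1 (x + y * c) y (sym (trans
         (vsolve (x ∷ y :: c) (A u' ∷ B w1 :: s) ((`0 +e `1 *e `2) *v ^0 +v `1 *v ^1) ((`0 *v ^0 +v (`1 *v ^2 +v 0w)) +v (⊖ `1) *v (^2 -v (`2 *v ^0 +v ^1))) refl ⇐v (- y) ∙: e) e')) d
       cases (no _) _ (yes refl) = go (planeA u'nz (~sym (∥~ pp (par-sym snz (c ∷ [] , sym (e >> cong (c *> A u' <+>_) (lin-0 fs) >> refl))) (~sym sp))))
        where
         go : (∃₂ λ c w' → A u <+> B w ≡ c *> A u' <+> B w' × dot u' w' ≡ 0F) → dot u w ≡ 0F
         go (c , w' , e , d) = in-line u w u' w' c 1F (e >> cong (c *> A u' <+>_) (sym one*)) d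
       cases (no _) (yes refl) (no w1nz) = go (Du.planeA w1nz (subst (_~ A u <+> B w) (e >> (vsolve [] (A u' :: B w1) (0k *v ^0 +v ^1) (^1) refl)) sp))
        where
         go : (∃₂ λ c u1 → A u <+> B w ≡ c *> B w1 <+> A u1 × dot w1 u1 ≡ 0F) → dot u w ≡ 0F
         go (c , u1 , e , d) = in-line u w u1 w1 1F c (e >> vsolve [ c ] (B w1 :: A u1) (`0 *v ^0 +v ^1) (1k *v ^1 +v `0 *v ^0) refl) (dot-comm u1 w1 >> d)
       cases (no np) (no cnz) (no w1nz) = ⊥-elim (no-thin-full {c *> u'} {w1} (λ z → u'nz (vsolve (c :: inv c cnz) [ u' ] (^0) (0w +v (`1 *v (`0 *v ^0 -v 0w) +v (`0 *e `1 -e 1k) *v (-1k *v ^0))) refl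
           ⇐v (inv c cnz ∙: z) &v (inv-r c cnz s: (-1F *> u')))) w1nz
          (dot-comm (c *> u') w1 >> cong (dot w1) (vsolve [ c ] [ u' ] (`0 *v ^0) (`0 *v ^0 +v 0k *v ^0) refl) >> dot-lin w1 c u' 0F u' >> cong (λ z → c * z + 0F * z) (dot-comm w1 u' >> d) >> solve [ c ] (`0 *e 0k +e 0k *e 0k) 0k refl)
          (subst (Full S) (e >> cong (_<+> B w1) (sym (lin-∙ c u' es))) (full2 sp (~sym us) (ext ius np) (+∈ (A∈ u) (B∈ w)) (A∈ u') (subst (_∈< S >) (sym e) (+∈ (∙∈ c (A∈ u')) (B∈ w1))))))
        where
         ius : Ind (A u' :: s)
         ius = ind-gen {B = A u' :: B w1} (ext (ind1 (nzB w1nz)) λ p → A∉B u'nz (span⊆ [ (w1 , refl) ] p)) (g0 :: (- c :: 1F ,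
          (vsolve [ c ] (A u' ∷ B w1 :: s) ((⊖ `0) *v ^0 +v (1k *v ^2 +v 0w)) (^1 +v 1k *v (^2 -v (`0 *v ^0 +v ^1))) refl ⇐v 1F ∙: e)))

   module _ (Fr : Frame) where
    open Frame Fr
    open FrameLemmas Fr
    private
     module Du = FrameLemmas (dual Fr)

    opaque
     -- If the point is opposite `B w`, the lines from `B w` to `A u1` and `A u2` carry points `r1`
     -- and `r2` near it. By `trace` the whole line `r1 r2` is near it, and that line meets the line
     -- `A u1 A u2`; this gives the path that `via` needs.
     S-point : ∀ {u w} → u ≢ 0c → w ≢ 0c → Pnt (A u <+> B w) → dot u w ≡ 0F
     S-point {u} {w} unz wnz pp with D4? (A u <+> B w) (B w)
     ... | yes (s , snz , ps , sb) = dot-comm u w >> via (dual Fr) {w} {u} (subst Pnt +c pp) wnz snz (~sym sb) (subst (s ~_) +c (~sym ps))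
      where
       +c : A u <+> B w ≡ B w <+> A u
       +c = vsolve [] (A u :: B w) (^0 +v ^1) (^1 +v ^0) refl
     ... | no nd with perp-basis w wnz
     ... | u1 , u2 , i , d1 , d2 = fin (reach {m = ln (B w) (A u1) j1} pp (~L j1 b₁)) (reach {m = ln (B w) (A u2) j2} pp (~L j2 b₂))
      where
       p : W
       p = A u <+> B w
       b₁ : B w ~ A u1
       b₁ = ~sym (orth u1 w (ind-nonzero i) wnz (dot-comm u1 w >> d1))
       b₂ : B w ~ A u2
       b₂ = ~sym (orth u2 w (ind-nonzero (ind-tail i)) wnz (dot-comm u2 w >> d2))
       i3 : Ind (A u1 ∷ A u2 :: B w)
       i3 = Du.indABB wnz i
       j1 : Ind (B w :: A u1)
       j1 = ind-tail {x = A u2} (ind-gen i3 (g2 ∷ g0 :: g1))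
       j2 : Ind (B w :: A u2)
       j2 = swap (ind-tail i3)
       pB : Pnt (B w)
       pB = Du.pA wnz
       fin : (∃ λ r → r ≢ 0v × r ∈< B w :: A u1 > × D4 p r) → (∃ λ r → r ≢ 0v × r ∈< B w :: A u2 > × D4 p r) → dot u w ≡ 0F
       fin (r1 , nz₁ , r1∈ , dr1) (r2 , nz2 , r2∈ , dr2) = go (meet (A u1 ∷ A u2 :: B w) (ind-tail (ind-gen ir (g1 ∷ g2 :: g0))) (indA i) (span⊆ (g2 :: g0) r1∈ :: span⊆ (g2 :: g1) r2∈) (g0 :: g1) ℕₚ.≤-refl)
        where
         nb : ∀ {r} → r ≢ 0v → D4 p r → ¬ r ∥ B w
         nb rnz (s , snz , ps , sr) q = nd (s , snz , ps , ∥~ (~P snz sr) (par-sym rnz q) sr)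
         ir : Ind (r1 ∷ r2 :: B w)
         ir = ext (ext (ind1 (nzB wnz)) (nb nz2 dr2)) λ q → nb nz₁ dr1 (inter {c = A u1} {d = A u2} i3 (span⊆ (g1 :: g0) r1∈) (span⊆ (span⊆ (g1 :: g0) r2∈ :: g1) q))
         go : (∃ λ z → z ≢ 0v × z ∈< r1 :: r2 > × z ∈< A u1 :: A u2 >) → dot u w ≡ 0F
         go (z , znz , z∈r , c :: d , e) with trace pB pp (nd ∘ D4-sym) (~on j1 b₁ r1∈) (~on j2 b₂ r2∈) ir (D4-sym dr1) (D4-sym dr2) znz z∈r
         ... | s , snz , zs , sp = via Fr {u} {w} {c *> u1 <+> d *> u2} pp (λ q → znz (sym eA >> cong A q >> lin-0 es)) snz (subst (_~ s) (sym eA) zs) sp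
          where
           eA : A (c *> u1 <+> d *> u2) ≡ z
           eA = lin-lin es c u1 d u2 >> vsolve (c :: d) (A u1 :: A u2) (`0 *v ^0 +v `1 *v ^1) (`0 *v ^0 +v (`1 *v ^1 +v 0w)) refl >> e

    private
     i0 i1 : K3
     i0 = 1F ∷ 0F :: 0F
     i1 = 0F ∷ 1F :: 0F

    opaque
     -- S is a hyperplane of the span of all points.
     apex7 : ∃ λ v → Pnt v × ¬ v ∈< S > × (∀ {x} → Pnt x → x ∈< v ∷ S >)
     apex7 = go (planeOf pt0)
      where
       nz0 : i0 ≢ 0c
       nz0 e = 1≢0 (cong Vec.head e)
       nz1 : i1 ≢ 0c
       nz1 e = 1≢0 (cong (Vec.head ∘ Vec.tail) e)
       d : dot i0 i1 ≡ 0F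
       d = solve [] (1k *e 0k +e 0k *e 1k +e 0k *e 0k) 0k refl
       a : W
       a = A i0
       t : W
       t = A i0 <+> B i1
       at' : a ~ t
       at' = ~+ (nzA nz0) (snd (pA nz0)) (orth i0 i1 nz0 nz1 d)
       ita : Ind (a :: t)
       ita = ind-gen {B = a :: B i1} (ext (ind1 (nzB nz1)) λ p → A∉B nz0 (span⊆ [ (i1 , refl) ] p)) (g0 :: (- 1F :: 1F , vsolve [] (a :: B i1) (-1k *v ^0 +v (1k *v (^0 +v ^1) +v 0w)) (^1) refl))
       pt0 : Pnt t
       pt0 = ~P (ind-nonzero (ind-tail ita)) (~sym at')
       t∈ : t ∈< S >
       t∈ = +∈ (A∈ i0) (B∈ i1)
       fin : ∀ {v} → t ~ v → ¬ v ∈< S > → ∃ λ v → Pnt v × ¬ v ∈< S > × (∀ {x} → Pnt x → x ∈< v ∷ S >)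
       fin {y0} tv nv = y0 , ~P (λ { refl → nv 0∈ }) (~sym tv) , nv , closure Fr (VAll.map wk∈ (gens∈ S)) nz0 nz1 d
         (full2 tv (~sym at') (ext ita λ p → nv (span⊆ (A∈ i0 :: t∈) p)) g0 (wk∈ (A∈ i0)) (wk∈ t∈))
       go : Plane t → ∃ λ v → Pnt v × ¬ v ∈< S > × (∀ {x} → Pnt x → x ∈< v ∷ S >)
       go (plane {y} {y'} h h' i) with ∈? y S | ∈? y' S
       ... | no ny | _ = fin h ny
       ... | yes _ | no ny = fin h' ny
       ... | yes m | yes m' = ⊥-elim (no-thin-full Fr nz0 nz1 d (full2 h h' i m m' t∈))

     span7 : ∀ {v x} → Pnt v → ¬ v ∈< S > → Pnt x → x ∈< v ∷ S >
     span7 {y0} pv nv px = dimEq (ext ind nv) (snd (snd (snd apex7)) pv ∷ VAll.map wk∈ (gens∈ S)) (snd (snd (snd apex7)) px)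

  -- The neighbours in `S` of a point off `S`

  module Directions (Fr : Frames.Frame) where
   open Coordinates
   open Cross
   open Frame Fr
   open FrameLemmas Fr
   private
    module Du = FrameLemmas (dual Fr)

   opaque
    S-split : ∀ {z} → z ∈< S > → ∃₂ λ a b → z ≡ A a <+> B b
    S-split (cs , refl) with Vec.splitAt 3 cs
    ... | a , b , refl = a , b , lin-++ a b es fs

   opaque
    AB-lin : ∀ c a b d a' b' → A (c *> a <+> d *> a') <+> B (c *> b <+> d *> b') ≡ c *> (A a <+> B b) <+> d *> (A a' <+> B b')
    AB-lin c a b d a' b' = (cong₂ _<+>_ (lin-lin es c a d a') (lin-lin fs c b d b')) >> vsolve (c :: d) (A a ∷ A a' ∷ B b :: B b')
     ((`0 *v ^0 +v `1 *v ^1) +v (`0 *v ^2 +v `1 *v ^3)) (`0 *v (^0 +v ^2) +v `1 *v (^1 +v ^3)) refl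

   opaque
    fullS-A : ∀ u → u ≢ 0c → Full S (A u)
    fullS-A u = fullA {u = u} (gens∈ S)

   opaque
    fullS-B : ∀ w → w ≢ 0c → Full S (B w)
    fullS-B w = Du.fullA {u = w} (VAllₚ.++⁺ (snd S⊇) (fst S⊇))

   opaque
    -- A point of either plane is full in `S`, so it has no neighbour off `S`.
    both-nz : ∀ {x} a b → ¬ x ∈< S > → x ~ A a <+> B b → A a <+> B b ≢ 0v → a ≢ 0c × b ≢ 0c
    both-nz {x} a b nx h nz = (λ { refl → nx (Full.sub⊆ (fullS-B b (λ { refl → nz (A+0 0c >> lin-0 es) })) (~sym (subst (x ~_) (0+B b) h))) }) ,
      (λ { refl → nx (Full.sub⊆ (fullS-A a (λ { refl → nz (0+B 0c >> lin-0 fs) })) (~sym (subst (x ~_) (A+0 a) h))) })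

   opaque
    dir-dot : ∀ {x} a b → ¬ x ∈< S > → x ~ A a <+> B b → dot a b ≡ 0F
    dir-dot {x} a b nx h with (A a <+> B b) ≟v 0v
    ... | yes e = cong (dot a) (snd (AB-inj {a} {0c} {b} {0c} (e >> sym (A+0 0c >> lin-0 es)))) >> dot-0 a
    ... | no nz = S-point Fr {a} {b} (fst (both-nz a b nx h nz)) (snd (both-nz a b nx h nz)) (~P nz (~sym h))

   record Dir (x : W) (u w : K3) : Set where
    field
     uw : dot u w ≡ 1F
     fwd : ∀ a → dot a w ≡ 0F → x ~ A a <+> B (cross a u)
     bwd : ∀ a b → x ~ A a <+> B b → dot a w ≡ 0F × b ≡ cross a u

   private
    scale-dot : ∀ c a b → dot a (c *> b) ≡ c * dot a b
    scale-dot c a b = cong (dot a) (vsolve [ c ] [ b ] (`0 *v ^0) (`0 *v ^0 +v 0k *v ^0) refl) >> dot-lin a c b 0F b >> solve (c :: dot a b) (`0 *e `1 +e 0k *e `1) (`0 *e `1) refl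
    scale-cross : ∀ c a b → cross a (c *> b) ≡ c *> cross a b
    scale-cross c a b = cong (cross a) (vsolve [ c ] [ b ] (`0 *v ^0) (`0 *v ^0 +v 0k *v ^0) refl) >> cross-linʳ a c b 0F b >> vsolve [ c ] [ cross a b ] (`0 *v ^0 +v 0k *v ^0) (`0 *v ^0) refl

   opaque
    -- Two neighbours `(a₁ , b₁)` and `(a₂ , b₂)` in `S` span the trace of the plane of `x`. All
    -- their combinations satisfy `dir-dot`, so `dot` pairs the coefficients alternatingly, with the
    -- single value `τ`; `u` and `w` are `cross b₁ b₂` and `cross a₁ a₂` divided by `τ`.
    hasDir : ∀ {x} → Pnt x → ¬ x ∈< S > → ∃₂ λ u w → Dir x u w
    hasDir {x} px nx with planeOf px
    ... | plane {y₁} {y₂} h1 h2 i = go (span7 Fr px nx (~P (ind-nonzero i) (~sym h1))) (span7 Fr px nx (~P (ind-nonzero (ind-tail i)) (~sym h2)))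
     where
      go : y₁ ∈< x ∷ S > → y₂ ∈< x ∷ S > → ∃₂ λ u w → Dir x u w
      go (c1 ∷ cs1 , e₁) (c2 ∷ cs2 , e2) = go' (S-split (cs1 , refl)) (S-split (cs2 , refl))
       where
        go' : (∃₂ λ a b → lin cs1 S ≡ A a <+> B b) → (∃₂ λ a b → lin cs2 S ≡ A a <+> B b) → ∃₂ λ u w → Dir x u w
        go' (a₁ , b₁ , E1) (a₂ , b₂ , E2) = it *> cross b₁ b₂ , it *> cross a₁ a₂ , record { uw = uw' ; fwd = fwd' ; bwd = bwd' }
         where
          d1 d2 : W
          d1 = A a₁ <+> B b₁
          d2 = A a₂ <+> B b₂
          sb : ∀ c cs {d y} → lin cs S ≡ d → c *> x <+> lin cs S ≡ y → y <+> (- c) *> x ≡ d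
          sb c cs refl refl = vsolve [ c ] (x :: lin cs S) ((`0 *v ^0 +v ^1) +v (⊖ `0) *v ^0) (^1) refl
          x1 : x ~ d1
          x1 = subst (x ~_) (sb c1 cs1 E1 e₁) (~+ (fst px) h1 (~∙ (- c1) (snd px)))
          x2 : x ~ d2
          x2 = subst (x ~_) (sb c2 cs2 E2 e2) (~+ (fst px) h2 (~∙ (- c2) (snd px)))
          j : Ind (d1 ∷ d2 :: x)
          j = ind-gen i (subst (_∈< d1 ∷ d2 :: x >) (cong (c1 *> x <+>_) (sym E1) >> e₁) (+∈ (∙∈ c1 g2) g0) ∷ subst (_∈< d1 ∷ d2 :: x >) (cong (c2 *> x <+>_) (sym E2) >> e2) (+∈ (∙∈ c2 g2) g1) :: g2)
          comb : ∀ c d → x ~ A (c *> a₁ <+> d *> a₂) <+> B (c *> b₁ <+> d *> b₂)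
          comb c d = subst (x ~_) (sym (AB-lin c a₁ b₁ d a₂ b₂)) (~+ (fst px) (~∙ c x1) (~∙ d x2))
          nzc : ∀ c d → A (c *> a₁ <+> d *> a₂) <+> B (c *> b₁ <+> d *> b₂) ≡ 0v → _≡_ {A = Vec K 2} (c :: d) 0c
          nzc c d e = cong₂ (λ x y → x :: y) (coef j (c ∷ d :: 0F) eq zero) (coef j (c ∷ d :: 0F) eq (suc zero))
           where
            eq : lin (c ∷ d :: 0F) (d1 ∷ d2 :: x) ≡ 0v
            eq = vsolve (c :: d) (d1 ∷ d2 :: x) (`0 *v ^0 +v (`1 *v ^1 +v (0k *v ^2 +v 0w))) (`0 *v ^0 +v `1 *v ^1) refl >> sym (AB-lin c a₁ b₁ d a₂ b₂) >> e
          dec' : ∀ c d → c *> a₁ <+> d *> a₂ ≡ 0c ⊎ c *> b₁ <+> d *> b₂ ≡ 0c → _≡_ {A = Vec K 2} (c :: d) 0c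
          dec' c d h with (A (c *> a₁ <+> d *> a₂) <+> B (c *> b₁ <+> d *> b₂)) ≟v 0v
          ... | yes e = nzc c d e
          ... | no nz with both-nz (c *> a₁ <+> d *> a₂) (c *> b₁ <+> d *> b₂) nx (comb c d) nz | h
          ...   | na , nb | inj₁ e = ⊥-elim (na e)
          ...   | na , nb | inj₂ e = ⊥-elim (nb e)
          cut : ∀ c d (p r : K3) → lin (c :: d) (p :: r) ≡ c *> p <+> d *> r
          cut c d p r = vsolve (c :: d) (p :: r) (`0 *v ^0 +v (`1 *v ^1 +v 0w)) (`0 *v ^0 +v `1 *v ^1) refl
          ia : Ind (a₁ :: a₂)
          ia (c :: d) e = dec' c d (inj₁ (sym (cut c d a₁ a₂) >> e))
          ib : Ind (b₁ :: b₂)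
          ib (c :: d) e = dec' c d (inj₂ (sym (cut c d b₁ b₂) >> e))
          q11 : dot a₁ b₁ ≡ 0F
          q11 = dir-dot a₁ b₁ nx x1
          q22 : dot a₂ b₂ ≡ 0F
          q22 = dir-dot a₂ b₂ nx x2
          τ : K
          τ = dot a₁ b₂
          q21 : dot a₂ b₁ ≡ - τ
          q21 = solve (dot a₁ b₁ ∷ τ ∷ dot a₂ b₁ :: dot a₂ b₂) (`2) (⊖ `1 +e (1k *e (1k *e (1k *e `0 +e 1k *e `2) +e 1k *e (1k *e `1 +e 1k *e `3) -e 0k) +e -1k *e (`0 -e 0k) +e -1k *e (`3 -e 0k))) refl
            ⇐ 1F *: trans (sym (dot-lin (1F *> a₁ <+> 1F *> a₂) 1F b₁ 1F b₂ >> cong₂ (λ x y → 1F * x + 1F * y) (dot-linˡ b₁ 1F a₁ 1F a₂) (dot-linˡ b₂ 1F a₁ 1F a₂))) (dir-dot (1F *> a₁ <+> 1F *> a₂) (1F *> b₁ <+> 1F *> b₂) nx (comb 1F 1F)) & -1F *: q11 & -1F *: q22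
          nza1 : a₁ ≢ 0c
          nza1 = ind-nonzero ia
          nza2 : a₂ ≢ 0c
          nza2 = ind-nonzero (ind-tail ia)
          nzb1 : b₁ ≢ 0c
          nzb1 = ind-nonzero ib
          nzb2 : b₂ ≢ 0c
          nzb2 = ind-nonzero (ind-tail ib)
          -- If `τ` vanished, `A a₁`, `B b₁`, `A a₂` and `B b₂` would form a quadrangle.
          τ≢0 : τ ≢ 0F
          τ≢0 e = ∉-head (indB ib) (quad (pA nza1) (pA nza2) (nzB nzb1) (nzB nzb2) (orth a₁ b₁ nza1 nzb1 q11) (~sym (orth a₂ b₁ nza2 nzb1 (q21 >> (cong -_ e) >> -0#≈0#)))
            (orth a₂ b₂ nza2 nzb2 q22) (~sym (orth a₁ b₂ nza1 nzb2 e)) (noAA ia))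
          it : K
          it = inv τ τ≢0
          ii : τ * it ≡ 1F
          ii = inv-r τ τ≢0
          cu1 : cross a₁ (it *> cross b₁ b₂) ≡ b₁
          cu1 = scale-cross it a₁ (cross b₁ b₂) >> cong (it *>_) (bac′ a₁ b₁ b₂) >> (vsolve (τ ∷ it :: dot a₁ b₁) (b₁ :: b₂) (`1 *v (`0 *v ^0 +v (⊖ `2) *v ^1)) (^0 +v ((`0 *e `1 -e 1k) *v ^0 +v (`2 -e 0k) *v ((⊖ `1) *v ^1))) refl
            ⇐v (ii s: b₁) &v (q11 s: ((- it) *> b₂)))
          cu2 : cross a₂ (it *> cross b₁ b₂) ≡ b₂
          cu2 = scale-cross it a₂ (cross b₁ b₂) >> cong (it *>_) (bac′ a₂ b₁ b₂) >> (vsolve (τ ∷ it ∷ dot a₂ b₂ :: dot a₂ b₁) (b₁ :: b₂) (`1 *v (`2 *v ^0 +v (⊖ `3) *v ^1))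
            (^1 +v ((`0 *e `1 -e 1k) *v ^1 +v (`2 -e 0k) *v (`1 *v ^0) +v (`3 -e (⊖ `0)) *v ((⊖ `1) *v ^1))) refl ⇐v (ii s: b₂) &v (q22 s: (it *> b₁)) &v (q21 s: ((- it) *> b₂)))
          cu : ∀ c d → cross (c *> a₁ <+> d *> a₂) (it *> cross b₁ b₂) ≡ c *> b₁ <+> d *> b₂
          cu c d = cross-lin c a₁ d a₂ (it *> cross b₁ b₂) >> cong₂ (λ x y → c *> x <+> d *> y) cu1 cu2
          w0 : K3
          w0 = it *> cross a₁ a₂
          dw : ∀ c d → dot (c *> a₁ <+> d *> a₂) w0 ≡ 0F
          dw c d = dot-linˡ w0 c a₁ d a₂ >> cong₂ (λ x y → c * x + d * y) (scale-dot it a₁ (cross a₁ a₂) >> cong (it *_) (dot-crossˡ a₁ a₂)) (scale-dot it a₂ (cross a₁ a₂) >> cong (it *_) (dot-crossʳ a₁ a₂)) >>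
            solve (c ∷ d :: it) (`0 *e (`2 *e 0k) +e `1 *e (`2 *e 0k)) 0k refl
          uw' : dot (it *> cross b₁ b₂) w0 ≡ 1F
          uw' = scale-dot it (it *> cross b₁ b₂) (cross a₁ a₂) >> cong (it *_) (dot-comm (it *> cross b₁ b₂) (cross a₁ a₂) >> scale-dot it (cross a₁ a₂) (cross b₁ b₂) >> cong (it *_) (binet a₁ a₂ b₁ b₂)) >>
            (solve (it ∷ dot a₁ b₁ ∷ dot a₂ b₂ ∷ τ :: dot a₂ b₁) (`0 *e (`0 *e (`1 *e `2 -e `3 *e `4))) (1k +e ((`0 *e `0 *e `2) *e (`1 -e 0k) +e (⊖ (`0 *e `0 *e `3)) *e (`4 -e (⊖ `3)) +e (`3 *e `0 +e 1k) *e (`3 *e `0 -e 1k))) refl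
             ⇐ (it * it * dot a₂ b₂) *: q11 & (- (it * it * τ)) *: q21 & (τ * it + 1F) *: ii)
          fwd' : ∀ a → dot a w0 ≡ 0F → x ~ A a <+> B (cross a (it *> cross b₁ b₂))
          fwd' a e = subst (λ z → x ~ A z <+> B (cross z (it *> cross b₁ b₂))) (sym ea) (subst (λ z → x ~ A (c *> a₁ <+> d *> a₂) <+> B z) (sym (cu c d)) (comb c d))
           where
            X : K3
            X = cross a (it *> cross b₁ b₂)
            c d : K
            c = - (it * dot a₂ X)
            d = it * dot a₁ X
            -- a = w0 × (a × u) because w0 · u = 1 and w0 · a = 0
            e1 : cross w0 X ≡ a
            e1 = bac′ w0 a (it *> cross b₁ b₂) >> cong₂ (λ x y → x *> a <+> (- y) *> (it *> cross b₁ b₂)) (dot-comm w0 (it *> cross b₁ b₂) >> uw') (dot-comm w0 a >> e) >>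
               (vsolve [] (a :: it *> cross b₁ b₂) (1k *v ^0 +v (⊖ 0k) *v ^1) (^0) refl)
            ea : a ≡ c *> a₁ <+> d *> a₂
            ea = sym e1 >> (anti w0 X >> cong (-1F *>_) (scale-cross it X (cross a₁ a₂) >> cong (it *>_) (bac′ X a₁ a₂)) >>
                vsolve (it ∷ dot X a₂ :: dot X a₁) (a₁ :: a₂) (-1k *v `0 *v (`1 *v ^0 +v (⊖ `2) *v ^1)) ((⊖ (`0 *e `1)) *v ^0 +v (`0 *e `2) *v ^1) refl) >>
                cong₂ (λ x y → (- (it * x)) *> a₁ <+> (it * y) *> a₂) (dot-comm X a₂) (dot-comm X a₁)
          bwd' : ∀ a b → x ~ A a <+> B b → dot a w0 ≡ 0F × b ≡ cross a (it *> cross b₁ b₂)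
          bwd' a b h = cmp (inter′ nx (+∈ (A∈ a₁) (B∈ b₁) :: +∈ (A∈ a₂) (B∈ b₂)) (span⊆ (g1 ∷ g2 :: g0) (in-plane x1 x2 j h)) (+∈ (A∈ a) (B∈ b)))
           where
            cmp : A a <+> B b ∈< d1 :: d2 > → dot a w0 ≡ 0F × b ≡ cross a (it *> cross b₁ b₂)
            cmp (c :: d , e) = let p , r = AB-inj {c *> a₁ <+> d *> a₂} {a} {c *> b₁ <+> d *> b₂} {b} (AB-lin c a₁ b₁ d a₂ b₂ >> vsolve (c :: d) (d1 :: d2) (`0 *v ^0 +v `1 *v ^1) (`0 *v ^0 +v (`1 *v ^1 +v 0w)) refl >> e) in
             trans (cong (λ z → dot z w0) (sym p)) (dw c d) , trans (sym r) (sym (cu c d) >> cong (λ z → cross z (it *> cross b₁ b₂)) p)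

  -- How `u` changes along a line

  module Steps (Fr : Frames.Frame) where
   open Coordinates
   open Cross
   open Frame Fr
   open FrameLemmas Fr
   open Directions Fr
   private
    module Du = FrameLemmas (dual Fr)

   opaque
    dot-∙ : ∀ c a b → dot (c *> a) b ≡ c * dot a b
    dot-∙ c a b = cong (λ z → dot z b) (vsolve [ c ] [ a ] (`0 *v ^0) (`0 *v ^0 +v 0k *v ^0) refl) >> dot-linˡ b c a 0F a >> solve (c :: dot a b) (`0 *e `1 +e 0k *e `1) (`0 *e `1) refl

   opaque
    dot-+∙ : ∀ a c a' b → dot (a <+> c *> a') b ≡ dot a b + c * dot a' b
    dot-+∙ a c a' b = cong (λ z → dot z b) (vsolve [ c ] (a :: a') (^0 +v `0 *v ^1) (1k *v ^0 +v `0 *v ^1) refl) >> dot-linˡ b 1F a c a' >> solve (c ∷ dot a b :: dot a' b) (1k *e `1 +e `0 *e `2) (`1 +e `0 *e `2) refl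

   opaque
    -- A common neighbour `A y` shows that `B b'` is near `B b` as well. So `B b'` has a neighbour
    -- on the line through `B b` and the thin point, and the first half of that neighbour gives the
    -- equation.
    thin-near : ∀ a b b' → a ≢ 0c → b ≢ 0c → b' ≢ 0c → dot a b ≡ 0F → D4 (A a <+> B b) (B b') → dot a b' ≡ 0F
    thin-near a b b' anz bnz b'nz ab dd with ∈? b' [ b ]
    ... | yes (c ∷ [] , refl) = dot-comm a _ >> cong (λ z → dot z a) (vsolve [ c ] [ b ] (`0 *v ^0 +v 0w) (`0 *v ^0) refl) >> dot-∙ c b a >> cong (c *_) (dot-comm b a >> ab) >> zeroʳ c
    ... | no nb with perp b b'
    ... | y , ynz , yb , yb' = fin (unique-near pb' idB dB (D4-sym dd) (A y , nzA ynz , ~sym (orth y b' ynz b'nz (dot-comm y b' >> yb')) , orth y b ynz bnz (dot-comm y b >> yb)))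
     where
      pb' : Pnt (B b')
      pb' = Du.pA b'nz
      ab~ : A a ~ B b
      ab~ = orth a b anz bnz ab
      dB : A a <+> B b ~ B b
      dB = ~sym (~+ (nzB bnz) (~sym ab~) (snd (Du.pA {b} bnz)))
      idB : Ind (A a <+> B b :: B b)
      idB = ind-gen {B = A a :: B b} (ext (ind1 (nzB bnz)) λ p → A∉B anz (span⊆ [ (b , refl) ] p)) ((1F :: - 1F , vsolve [] (A a :: B b) (1k *v (^0 +v ^1) +v (-1k *v ^1 +v 0w)) (^0) refl) :: g1)
      fin : (∃ λ g → g ≢ 0v × g ∈< A a <+> B b :: B b > × B b' ~ g) → dot a b' ≡ 0F
      fin (g , gnz , (x :: y , refl) , bg) with x ≟ 0F
      ... | yes refl = ⊥-elim (Du.noAA (ext (ind1 bnz) nb) (∥~ pb' (par-sym gnz (y ∷ [] , vsolve [ y ] (A a :: B b) (`0 *v ^1 +v 0w) (0k *v (^0 +v ^1) +v (`0 *v ^1 +v 0w)) refl)) bg))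
      ... | no xnz with Du.planeA b'nz bg
      ...   | c , a″ , e , z = dot-comm a b' >> *-cancel-0 x xnz (sym (dot-comm b' (x *> a) >> dot-∙ x a b' >> cong (x *_) (dot-comm a b')) >> cong (dot b') (fst (AB-inj {x *> a} {a″} {(x + y) *> b} {c *> b'}
          ((cong₂ _<+>_ (lin-∙ x a es) (lin-∙ (x + y) b fs)) >> vsolve (x :: y) (A a :: B b) (`0 *v ^0 +v (`0 +e `1) *v ^1) (`0 *v (^0 +v ^1) +v (`1 *v ^1 +v 0w)) refl >>
           e >> vsolve [ c ] (B b' :: A a″) (`0 *v ^0 +v ^1) (^1 +v `0 *v ^0) refl >> cong (A a″ <+>_) (sym (lin-∙ c b' fs)))))  >> z)

   dd : K3 → K3 → W
   dd u a = A a <+> B (cross a u)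

   module _ {x : W} {u w : K3} (D : Dir x u w) where
    open Dir D
    opaque
     cross-wb : ∀ a → dot a w ≡ 0F → cross w (cross a u) ≡ a
     cross-wb a e = bac′ w a u >> cong₂ (λ x y → x *> a <+> (- y) *> u) (dot-comm w u >> uw) (dot-comm w a >> e) >> (vsolve [] (a :: u) (1k *v ^0 +v (⊖ 0k) *v ^1) (^0) refl)

     cross-au : ∀ b → dot u b ≡ 0F → cross (cross w b) u ≡ b
     cross-au b e = bac w b u >> cong₂ (λ x y → x *> b <+> (- y) *> w) (dot-comm w u >> uw) (dot-comm b u >> e) >> (vsolve [] (b :: w) (1k *v ^0 +v (⊖ 0k) *v ^1) (^0) refl)

     -- Together with `near⁻` this reads `u` off from the position of `x` relative to the points
     -- `B b`.
     near : ¬ x ∈< S > → ∀ b → b ≢ 0c → dot u b ≡ 0F → D4 x (B b)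
     near nx b bnz e = A a <+> B b , dnz , xd , ~sym (~+ (nzB bnz) (~sym (orth a b anz bnz (dot-comm a b >> dot-crossʳ w b))) (snd (Du.pA {b} bnz)))
      where
       a : K3
       a = cross w b
       xd : x ~ A a <+> B b
       xd = subst (λ z → x ~ A a <+> B z) (cross-au b e) (fwd a (dot-comm a w >> dot-crossˡ w b))
       dnz : A a <+> B b ≢ 0v
       dnz z = bnz (snd (AB-inj {a} {0c} {b} {0c} (z >> sym (A+0 0c >> lin-0 es))))
       anz : a ≢ 0c
       anz = fst (both-nz a b nx xd dnz)

     near⁻ : ¬ x ∈< S > → ∀ b → b ≢ 0c → D4 x (B b) → dot u b ≡ 0F
     near⁻ nx b bnz (s , snz , xs , sb) with S-split (Full.sub⊆ (fullS-B b bnz) (~sym sb))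
     ... | a , b₁ , refl with bwd a b₁ xs | both-nz a b₁ nx xs snz | Du.planeA bnz (~sym sb)
     ...   | aw , refl | anz , _ | c , a″ , e , _ = *-cancel-0 c cnz (sym (dot-comm u (c *> b) >> dot-∙ c b u >> cong (c *_) (dot-comm b u)) >> cong (dot u) (sym eb) >> dot-crossʳ a u)
      where
       eb : cross a u ≡ c *> b
       eb = snd (AB-inj {a} {a″} {cross a u} {c *> b} (e >> vsolve [ c ] (B b :: A a″) (`0 *v ^0 +v ^1) (^1 +v `0 *v ^0) refl >> cong (A a″ <+>_) (sym (lin-∙ c b fs))))
       cnz : c ≢ 0F
       cnz refl with cross-∥ a u anz (eb >> (vsolve [] [ b ] (0k *v ^0) 0w refl))
       ... | r , refl = 1≢0 (sym uw >> dot-∙ r a w >> cong (r *_) aw >> zeroʳ r)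

     w-span : ∀ {a₁ a₂ a} → Ind (a₁ :: a₂) → dot a₁ w ≡ 0F → dot a₂ w ≡ 0F → dot a w ≡ 0F → a ∈< a₁ :: a₂ >
     w-span {a₁} {a₂} {a} i e1 e2 e with ∈? a (a₁ :: a₂)
     ... | yes p = p
     ... | no np = ⊥-elim (∉-head i4 u∈)
      where
       std : Vec K3 3
       std = (1F ∷ 0F :: 0F) ∷ (0F ∷ 1F :: 0F) :: (0F ∷ 0F :: 1F)
       all : ∀ y → y ∈< std >
       all y@(p ∷ r :: s) = y , vec3 (solve (p ∷ r :: s) (`0 *e 1k +e (`1 *e 0k +e (`2 *e 0k +e 0k))) (`0) refl) (solve (p ∷ r :: s) (`0 *e 0k +e (`1 *e 1k +e (`2 *e 0k +e 0k))) (`1) refl) (solve (p ∷ r :: s) (`0 *e 0k +e (`1 *e 0k +e (`2 *e 1k +e 0k))) (`2) refl)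
       u∈ : u ∈< a ∷ a₁ :: a₂ >
       u∈ = dimEq (ext i np) (all a ∷ all a₁ :: all a₂) (all u)
       u∉ : ¬ u ∈< a ∷ a₁ :: a₂ >
       u∉ (c ∷ d :: g , refl) = 1≢0 (sym uw >> dot-linˡ-3 c d g >> cong₂ (λ x yz → c * x + yz) e (cong₂ (λ y z → d * y + g * z) e1 e2) >> solve (c ∷ d :: g) (`0 *e 0k +e (`1 *e 0k +e `2 *e 0k)) 0k refl)
        where
         dot-linˡ-3 : ∀ c d g → dot (lin (c ∷ d :: g) (a ∷ a₁ :: a₂)) w ≡ c * dot a w + (d * dot a₁ w + g * dot a₂ w)
         dot-linˡ-3 c d g = cong (λ z → dot z w) (vsolve (c ∷ d :: g) (a ∷ a₁ :: a₂) (`0 *v ^0 +v (`1 *v ^1 +v (`2 *v ^2 +v 0w))) (`0 *v ^0 +v 1k *v (`1 *v ^1 +v `2 *v ^2)) refl) >>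
           dot-linˡ w c a 1F (d *> a₁ <+> g *> a₂) >> cong (λ z → c * dot a w + 1F * z) (dot-linˡ w d a₁ g a₂) >> cong (c * dot a w +_) (*-identityˡ _)
       i4 : Ind (u ∷ a ∷ a₁ :: a₂)
       i4 = ext (ext i np) u∉

     dd-nz : ∀ {a} → a ≢ 0c → dd u a ≢ 0v
     dd-nz {a} anz e = anz (fst (AB-inj {a} {0c} {cross a u} {0c} (e >> sym (A+0 0c >> lin-0 es))))

     cross-nz : ∀ {a} → ¬ x ∈< S > → a ≢ 0c → dot a w ≡ 0F → cross a u ≢ 0c
     cross-nz {a} nx anz e = snd (both-nz a (cross a u) nx (fwd a e) (dd-nz anz))

   opaque
    dd-scale : ∀ t u a → dd u (t *> a) ≡ t *> dd u a
    dd-scale t u a = cong₂ (λ p r → A p <+> B r) e (cong (λ z → cross z u) e >> cross-lin t a 0F a u) >> AB-lin t a (cross a u) 0F a (cross a u) >> vsolve [ t ] [ dd u a ] (`0 *v ^0 +v 0k *v ^0) (`0 *v ^0) refl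
     where
      e : t *> a ≡ t *> a <+> 0F *> a
      e = vsolve [ t ] [ a ] (`0 *v ^0) (`0 *v ^0 +v 0k *v ^0) refl

   opaque
    ind-dd : ∀ {x u a₁ a₂} → ¬ x ∈< S > → Ind (a₁ :: a₂) → Ind (x ∷ dd u a₁ :: dd u a₂)
    ind-dd {x} {u} {a₁} {a₂} nx i = ext j λ p → nx (span⊆ (+∈ (A∈ a₁) (B∈ (cross a₁ u)) :: +∈ (A∈ a₂) (B∈ (cross a₂ u))) p)
     where
      j : Ind (dd u a₁ :: dd u a₂)
      j (c :: d) e = i (c :: d) (vsolve (c :: d) (a₁ :: a₂) (`0 *v ^0 +v (`1 *v ^1 +v 0w)) (`0 *v ^0 +v `1 *v ^1) refl >>
       fst (AB-inj {c *> a₁ <+> d *> a₂} {0c} {c *> cross a₁ u <+> d *> cross a₂ u} {0c} (AB-lin c a₁ (cross a₁ u) d a₂ (cross a₂ u) >> vsolve (c :: d) (dd u a₁ :: dd u a₂) (`0 *v ^0 +v `1 *v ^1) (`0 *v ^0 +v (`1 *v ^1 +v 0w)) refl >> e >> sym (A+0 0c >> lin-0 es))))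

   opaque
    off-S : ∀ {x z} → ¬ x ∈< S > → z ∈< S > → ¬ x <+> z ∈< S >
    off-S {x} {z} nx z∈ p = nx (subst (_∈< S >) (vsolve [] (x :: z) ((^0 +v ^1) -v ^1) (^0) refl) (+∈ p (∙∈ -1F z∈)))

   opaque
    nzS : ∀ {x} → ¬ x ∈< S > → x ≢ 0v
    nzS nx refl = nx 0∈

   opaque
    -- Both points are collinear with `dd u a`, so `cross a u` and `cross a u'` agree.
    same-u : ∀ {x x' u w u' w'} → Dir x u w → Dir x' u' w' → ∀ a → a ≢ 0c → dot a w ≡ 0F → x' ~ dd u a → ∃ λ r → u' ≡ u <+> r *> a
    same-u {u = u} {u' = u'} D D' a anz e h with cross-∥ a (u' <+> -1F *> u) anz (cong (cross a) (vsolve [] (u' :: u) (^0 -v ^1) (1k *v ^0 +v -1k *v ^1) refl) >> cross-linʳ a 1F u' -1F u >> cong (λ z → 1F *> z <+> -1F *> cross a u) (sym (snd (Dir.bwd D' a (cross a u) h))) >> (vsolve [] [ cross a u ] (1k *v ^0 +v -1k *v ^0) 0w refl))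
    ... | r , eq = r , (vsolve [ r ] (u' ∷ u :: a) (^0) ((^1 +v `0 *v ^2) +v 1k *v ((^0 -v ^1) -v `0 *v ^2)) refl ⇐v 1F ∙: eq)

   private
    -- Choose `b` perpendicular to `a₁ - a₂` and to the `u` of `x + d1`. Then `B b` is near `x + d1`
    -- and near `d1 - d2`, but not near `x`; so `trace` makes it near `x + d2`, and `b` is
    -- perpendicular to the `u` of that point as well.
    half : ∀ {x u w w1 w2 ρ1 ρ2 a₁ a₂} → Pnt x → ¬ x ∈< S > → Dir x u w → Ind (a₁ :: a₂) → dot a₁ w ≡ 0F → dot a₂ w ≡ 0F →
        Dir (x <+> dd u a₁) (u <+> ρ1 *> a₁) w1 → Dir (x <+> dd u a₂) (u <+> ρ2 *> a₂) w2 → ρ1 ≢ 0F → ρ1 ≡ ρ2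
    half {x} {u} {w} {w1} {w2} {ρ1} {ρ2} {a₁} {a₂} px nx D i e1 e2 D₁ D₂ ρnz with perp (a₁ <+> -1F *> a₂) (u <+> ρ1 *> a₁)
    ... | b , bnz , eb , eu = -‿injective-0 (*-cancel-0 (dot a₁ b) g≢0 (solve (ρ1 ∷ ρ2 ∷ dot a₁ b ∷ dot a₂ b :: dot u b) (`2 *e (`0 -e `1))
       (0k +e (1k *e (`4 +e `0 *e `2 -e 0k) +e -1k *e (`4 +e `1 *e `3 -e 0k) +e (⊖ `1) *e (`2 +e -1k *e `3 -e 0k))) refl
       ⇐ 1F *: z1 & -1F *: z2 & (- ρ2) *: z0))
     where
      d1 d2 : W
      d1 = dd u a₁
      d2 = dd u a₂
      z0 : dot a₁ b + -1F * dot a₂ b ≡ 0F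
      z0 = sym (dot-+∙ a₁ -1F a₂ b) >> eb
      z1 : dot u b + ρ1 * dot a₁ b ≡ 0F
      z1 = sym (dot-+∙ u ρ1 a₁ b) >> eu
      g≢0 : dot a₁ b ≢ 0F
      g≢0 z with co-vector b bnz
      ... | y , yb = yb (cong (λ z → dot z b) ye >> dot-+∙ (dot y w *> u) 1F y' b >> cong₂ (λ p r → p + 1F * r) (dot-∙ (dot y w) u b >> cong (dot y w *_) ub) (y'b y'∈) >> solve [ dot y w ] (`0 *e 0k +e 1k *e 0k) 0k refl)
       where
        ub : dot u b ≡ 0F
        ub = solve (dot u b ∷ ρ1 :: dot a₁ b) (`0) (0k +e (1k *e (`0 +e `1 *e `2 -e 0k) +e (⊖ `1) *e (`2 -e 0k))) refl ⇐ 1F *: z1 & (- ρ1) *: z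
        y' : K3
        y' = y <+> (- dot y w) *> u
        ye : y ≡ dot y w *> u <+> 1F *> y'
        ye = vsolve [ dot y w ] (y :: u) (^0) (`0 *v ^1 +v 1k *v (^0 +v (⊖ `0) *v ^1)) refl
        y'∈ : y' ∈< a₁ :: a₂ >
        y'∈ = w-span D i e1 e2 (dot-+∙ y (- dot y w) u w >> cong (λ z → dot y w + (- dot y w) * z) (Dir.uw D) >> solve [ dot y w ] (`0 +e (⊖ `0) *e 1k) 0k refl)
        y'b : ∀ {y'} → y' ∈< a₁ :: a₂ > → dot y' b ≡ 0F
        y'b (c :: d , refl) = cong (λ z → dot z b) (vsolve (c :: d) (a₁ :: a₂) (`0 *v ^0 +v (`1 *v ^1 +v 0w)) (`0 *v ^0 +v `1 *v ^1) refl) >> dot-linˡ b c a₁ d a₂ >>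
          (solve (c ∷ d ∷ dot a₁ b :: dot a₂ b) (`0 *e `2 +e `1 *e `3) (0k +e ((`0 +e `1) *e (`2 -e 0k) +e (⊖ `1) *e (`2 +e -1k *e `3 -e 0k))) refl ⇐ (c + d) *: z & (- d) *: z0)
      a₀ : K3
      a₀ = a₁ <+> -1F *> a₂
      a0nz : a₀ ≢ 0c
      a0nz z = 1≢0 (coef i (1F :: - 1F) ((vsolve [] (a₁ :: a₂) (1k *v ^0 +v (-1k *v ^1 +v 0w)) (^0 -v ^1) refl) >> z) zero)
      ea0 : dot a₀ w ≡ 0F
      ea0 = dot-+∙ a₁ -1F a₂ w >> cong₂ (λ p r → p + -1F * r) e1 e2 >> (solve [] (0k +e -1k *e 0k) 0k refl)
      d0 : W
      d0 = dd u a₀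
      d0≡ : d0 ≡ d1 <+> -1F *> d2
      d0≡ = cong₂ (λ p r → A p <+> B r) (vsolve [] (a₁ :: a₂) (^0 -v ^1) (1k *v ^0 +v -1k *v ^1) refl) (cong (λ z → cross z u) (vsolve [] (a₁ :: a₂) (^0 -v ^1) (1k *v ^0 +v -1k *v ^1) refl) >> cross-lin 1F a₁ -1F a₂ u) >>
        AB-lin 1F a₁ (cross a₁ u) -1F a₂ (cross a₂ u) >> (vsolve [] (d1 :: d2) (1k *v ^0 +v -1k *v ^1) (^0 -v ^1) refl)
      xd0 : x ~ d0
      xd0 = Dir.fwd D a₀ ea0
      pa0 : Pnt (A a₀)
      pa0 = pA a0nz
      dd0 : D4 d0 (B b)
      dd0 = A a₀ , nzA a0nz , ~sym (~+ (nzA a0nz) (snd pa0) (orth a₀ (cross a₀ u) a0nz (cross-nz D nx a0nz ea0) (dot-crossˡ a₀ u))) , orth a₀ b a0nz bnz eb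
      ind3 : Ind (x <+> d1 ∷ d0 :: x)
      ind3 = ind-gen (ind-dd nx i) (g2 ∷ (1F ∷ 0F :: - 1F , vsolve [] (x ∷ d1 :: d0) (1k *v (^0 +v ^1) +v (0k *v ^2 +v (-1k *v ^0 +v 0w))) (^1) refl) ∷
        (1F ∷ - 1F :: - 1F , (vsolve [] (x ∷ d1 ∷ d0 :: d2) (1k *v (^0 +v ^1) +v (-1k *v ^2 +v (-1k *v ^0 +v 0w))) (^3 +v -1k *v (^2 -v (^1 -v ^3))) refl ⇐v -1F ∙: d0≡)) ∷ [])
      S1 : dd u a₁ ∈< S >
      S1 = +∈ (A∈ a₁) (B∈ (cross a₁ u))
      S₂ : dd u a₂ ∈< S >
      S₂ = +∈ (A∈ a₂) (B∈ (cross a₂ u))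
      z2 : dot u b + ρ2 * dot a₂ b ≡ 0F
      z2 = sym (dot-+∙ u ρ2 a₂ b) >> near⁻ D₂ (off-S nx S₂) b bnz (trace px (Du.pA bnz)
        (λ h → *≢0 ρnz g≢0 (solve (dot u b ∷ ρ1 :: dot a₁ b) (`1 *e `2) (0k +e (1k *e (`0 +e `1 *e `2 -e 0k) +e -1k *e (`0 -e 0k))) refl ⇐ 1F *: z1 & -1F *: near⁻ D nx b bnz h))
        (~+ (fst px) (snd px) (Dir.fwd D a₁ e1)) xd0 ind3 (near D₁ (off-S nx S1) b bnz eu) dd0 (nzS (off-S nx S₂))
        (1F :: - 1F , (vsolve [] (x ∷ d1 ∷ d0 :: d2) (1k *v (^0 +v ^1) +v (-1k *v ^2 +v 0w)) ((^0 +v ^3) +v -1k *v (^2 -v (^1 -v ^3))) refl ⇐v -1F ∙: d0≡)))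

   -- the multiplier by which u changes along a line is the same for all lines through x
   opaque
    multiplier : ∀ {x u w} → Pnt x → ¬ x ∈< S > → Dir x u w → ∃ λ μ → ∀ a → a ≢ 0c → dot a w ≡ 0F → ∃ λ w' → Dir (x <+> dd u a) (u <+> μ *> a) w'
    multiplier {x} {u} {w} px nx D with perp-basis w (λ { refl → 1≢0 (sym (Dir.uw D) >> dot-0 u) })
    ... | a₁ , a₂ , i , e1 , e2 = ρ a₁ n1 f₁ , all
     where
      n1 : a₁ ≢ 0c
      n1 = ind-nonzero i
      n2 : a₂ ≢ 0c
      n2 = ind-nonzero (ind-tail i)
      f₁ : dot a₁ w ≡ 0F
      f₁ = dot-comm a₁ w >> e1
      f2 : dot a₂ w ≡ 0F
      f2 = dot-comm a₂ w >> e2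
      step : ∀ a → a ≢ 0c → dot a w ≡ 0F → ∃₂ λ r w' → Dir (x <+> dd u a) (u <+> r *> a) w'
      step a anz e with hasDir (~P (nzS nx') (~sym (~+ (fst px) (snd px) (Dir.fwd D a e)))) nx'
       where
        nx' : ¬ x <+> dd u a ∈< S >
        nx' = off-S nx (+∈ (A∈ a) (B∈ (cross a u)))
      ... | u' , w' , D' with same-u D D' a anz e (~sym (~+ (dd-nz D anz) (~sym (Dir.fwd D a e)) (~selfˡ (~sym (Dir.fwd D a e)))))
      ...   | r , refl = r , w' , D'
      ρ : ∀ a → a ≢ 0c → dot a w ≡ 0F → K
      ρ a anz e = fst (step a anz e)
      same-ρ : ∀ {a a'} n e n' e' → Ind (a :: a') → ρ a n e ≡ ρ a' n' e'
      same-ρ {a} {a'} n e n' e' j with ρ a n e ≟ 0F | ρ a' n' e' ≟ 0F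
      ... | no nz | _ = half px nx D j e e' (snd (snd (step a n e))) (snd (snd (step a' n' e'))) nz
      ... | yes z | yes z' = z >> sym z'
      ... | yes _ | no nz = sym (half px nx D (swap j) e' e (snd (snd (step a' n' e'))) (snd (snd (step a n e))) nz)
      eqρ : ∀ a (n : a ≢ 0c) (e : dot a w ≡ 0F) → Dec (a ∈< a₁ ∷ [] >) → ρ a n e ≡ ρ a₁ n1 f₁
      eqρ a n e (no np) = same-ρ {a} {a₁} n e n1 f₁ (ext (ind1 n1) np)
      eqρ a n e (yes p) = same-ρ {a} {a₂} n e n2 f2 (swap (ext (ind1 n) λ p' → ∉-head (swap i) (span⊆ [ p ] p'))) >> same-ρ {a₂} {a₁} n2 f2 n1 f₁ (swap i)
      all : ∀ a → a ≢ 0c → dot a w ≡ 0F → ∃ λ w' → Dir (x <+> dd u a) (u <+> ρ a₁ n1 f₁ *> a) w'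
      all a n e = fst (snd (step a n e)) , subst (λ z → Dir (x <+> dd u a) (u <+> z *> a) (fst (snd (step a n e)))) (eqρ a n e (∈? a [ a₁ ])) (snd (snd (step a n e)))

   opaque
    both≢0 : ∀ {x u w a} → Dir x u w → a ≢ 0c → dot a w ≡ 0F → ∃ λ b → dot u b ≢ 0F × dot a b ≢ 0F
    both≢0 {u = u} {w} {a} D anz e with co-vector a anz
    ... | y , ya with dot u y ≟ 0F
    ... | no n = y , n , λ z → ya (dot-comm y a >> z)
    ... | yes z = y <+> 1F *> w , (λ q → 1≢0 (sym (dot-comm u (y <+> 1F *> w) >> dot-+∙ y 1F w u >> cong₂ (λ p r → p + 1F * r) (dot-comm y u >> z) (dot-comm w u >> Dir.uw D) >> (solve [] (0k +e 1k *e 1k) 1k refl)) >> q)) ,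
      (λ q → ya (sym (dot-comm a (y <+> 1F *> w) >> dot-+∙ y 1F w a >> cong (λ r → dot y a + 1F * r) (dot-comm w a >> e) >> solve [ dot y a ] (`0 +e 1k *e 0k) (`0) refl) >> q))

   opaque
    dot≢⇒nz : ∀ {u b} → dot u b ≢ 0F → b ≢ 0c
    dot≢⇒nz {u} n refl = n (dot-0 u)

   opaque
    -- With multiplier zero, `u` would be constant along the line `x d`. A point `B b` with
    -- `dot u b` and `dot a b` both nonzero would then be near no point of this line, against
    -- `reach`.
    μ≢0 : ∀ {x u w} (px : Pnt x) (nx : ¬ x ∈< S >) (D : Dir x u w) → fst (multiplier px nx D) ≢ 0F
    μ≢0 {x} {u} {w} px nx D z with perp-basis w (λ { refl → 1≢0 (sym (Dir.uw D) >> dot-0 u) })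
    ... | a , _ , i , e , _ with both≢0 D (ind-nonzero i) (dot-comm a w >> e)
    ... | b , ub , ab = fin (reach {m = ln x d ixd} (Du.pA bnz) (~L ixd xd))
     where
      anz : a ≢ 0c
      anz = ind-nonzero i
      ea : dot a w ≡ 0F
      ea = dot-comm a w >> e
      bnz : b ≢ 0c
      bnz = dot≢⇒nz {a} ab
      d : W
      d = dd u a
      xd : x ~ d
      xd = Dir.fwd D a ea
      d∈ : d ∈< S >
      d∈ = +∈ (A∈ a) (B∈ (cross a u))
      ixd : Ind (x :: d)
      ixd = ext (ind1 (dd-nz D anz)) λ p → nx (span⊆ [ d∈ ] p)
      fin : (∃ λ r → r ≢ 0v × r ∈< x :: d > × D4 (B b) r) → ⊥
      fin (r , rnz , (y :: c , eq) , dr) with y ≟ 0F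
      ... | yes refl = ab (thin-near a (cross a u) b anz (cross-nz D nx anz ea) bnz (dot-crossˡ a u) (par-D4 (par-sym rnz (c ∷ [] , trans (vsolve [ c ] (x :: d) (`0 *v ^1 +v 0w) (0k *v ^0 +v (`0 *v ^1 +v 0w)) refl) eq)) dr))
       where
        par-D4 : ∀ {z} → z ∥ r → D4 (B b) r → D4 z (B b)
        par-D4 p (s , snz , bs , sr) = s , snz , ~sym (∥~ (~P snz sr) p sr) , ~sym bs
      ... | no ynz with c ≟ 0F
      ...   | yes refl = ub (near⁻ D nx b bnz (par-D4 (par-sym rnz (y ∷ [] , trans (vsolve [ y ] (x :: d) (`0 *v ^0 +v 0w) (`0 *v ^0 +v (0k *v ^1 +v 0w)) refl) eq)) dr))
       where
        par-D4 : ∀ {z} → z ∥ r → D4 (B b) r → D4 z (B b)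
        par-D4 p (s , snz , bs , sr) = s , snz , ~sym (∥~ (~P snz sr) p sr) , ~sym bs
      ...   | no cnz = ub (sym u≡ >> near⁻ (snd Da) (off-S nx (+∈ (A∈ (t *> a)) (B∈ (cross (t *> a) u)))) b bnz (par-D4 x∥ dr))
       where
        par-D4 : ∀ {z} → z ∥ r → D4 (B b) r → D4 z (B b)
        par-D4 p (s , snz , bs , sr) = s , snz , ~sym (∥~ (~P snz sr) p sr) , ~sym bs
        t : K
        t = inv y ynz * c
        tnz : t *> a ≢ 0c
        tnz q = anz (vsolve (t :: inv t (*≢0 (inv≢0 y ynz) cnz)) [ a ] (^0) (0w +v (`1 *v (`0 *v ^0 -v 0w) +v (`0 *e `1 -e 1k) *v (-1k *v ^0))) refl
            ⇐v (inv t (*≢0 (inv≢0 y ynz) cnz) ∙: q) &v (inv-r t (*≢0 (inv≢0 y ynz) cnz) s: (-1F *> a)))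
        Da : ∃ λ w' → Dir (x <+> dd u (t *> a)) (u <+> fst (multiplier px nx D) *> (t *> a)) w'
        Da = snd (multiplier px nx D) (t *> a) tnz (dot-∙ t a w >> cong (t *_) ea >> zeroʳ t)
        u≡ : dot (u <+> fst (multiplier px nx D) *> (t *> a)) b ≡ dot u b
        u≡ = dot-+∙ u (fst (multiplier px nx D)) (t *> a) b >> (solve (dot u b ∷ fst (multiplier px nx D) :: dot (t *> a) b) (`0 +e `1 *e `2) (`0 +e `2 *e (`1 -e 0k)) refl ⇐ dot (t *> a) b *: z)
        x∥ : x <+> dd u (t *> a) ∥ r
        x∥ = inv y ynz ∷ [] , (vsolve (y ∷ c :: inv y ynz) (x ∷ d ∷ r :: dd u (t *> a)) (`2 *v ^2 +v 0w)
           ((^0 +v ^3) +v ((`0 *e `2 -e 1k) *v ^0 +v (⊖ `2) *v ((`0 *v ^0 +v (`1 *v ^1 +v 0w)) -v ^2) +v -1k *v (^3 -v (`2 *e `1) *v ^1))) refl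
          ⇐v (inv-r y ynz s: x) &v ((- inv y ynz) ∙: eq) &v (-1F ∙: dd-scale t u a))

  -- How `u` changes within the plane of a thin point

  module PlaneStep (Fr : Frames.Frame) where
   open Coordinates
   open Cross
   open Frame Fr
   open FrameLemmas Fr
   open Directions Fr
   open Steps Fr
   private
    module Du = FrameLemmas (dual Fr)

   Mul : W → K3 → K3 → K → Set
   Mul x u w μ = ∀ a → a ≢ 0c → dot a w ≡ 0F → ∃ λ w' → Dir (x <+> dd u a) (u <+> μ *> a) w'

   opaque
    -- All points considered lie in the plane of the thin point `d`. Both `x + r d` and `B b` are
    -- near a suitable `B b'` opposite `d`, so by `trace` is every point of the line joining them,
    -- which contains the given point.
    plane-u : ∀ {x u w μ} → Pnt x → ¬ x ∈< S > → Dir x u w → Mul x u w μ → ∀ a → a ≢ 0c → dot a w ≡ 0F → ∀ r s {u' w'} →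
         Dir (x <+> (r *> A a <+> s *> B (cross a u))) u' w' → u' ≡ u <+> (μ * r) *> a
    plane-u {x} {u} {w} {μ} px nx D M a anz ea r s {u'} {w'} D' = snd su >> cong (λ z → u <+> z *> a) ρ≡
     where
      b : K3
      b = cross a u
      d : W
      d = dd u a
      dnz : d ≢ 0v
      dnz = dd-nz D anz
      xd : x ~ d
      xd = Dir.fwd D a ea
      pd : Pnt d
      pd = ~P dnz (~sym xd)
      bnz : b ≢ 0c
      bnz = cross-nz D nx anz ea
      ab : A a ~ B b
      ab = orth a b anz bnz (dot-crossˡ a u)
      dA : d ~ A a
      dA = ~sym (~+ (nzA anz) (snd (pA anz)) ab)
      dB : d ~ B b
      dB = ~sym (~+ (nzB bnz) (~sym ab) (snd (Du.pA {b} bnz)))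
      x' x₁ : W
      x' = x <+> (r *> A a <+> s *> B b)
      x₁ = x <+> r *> d
      u1 : K3
      u1 = u <+> μ *> (r *> a)
      d∈ : d ∈< S >
      d∈ = +∈ (A∈ a) (B∈ b)
      D₁ : ∃ λ w1 → Dir x₁ u1 w1
      D₁ with r ≟ 0F
      ... | yes refl = w , subst₂ (λ y z → Dir y z w) (vsolve [] (x :: d) (^0) (^0 +v 0k *v ^1) refl) (vsolve [ μ ] (u :: a) (^0) (^0 +v `0 *v 0k *v ^1) refl) D
      ... | no rnz = fst M' , subst (λ z → Dir (x <+> z) u1 (fst M')) (dd-scale r u a) (snd M')
       where
        M' : ∃ λ w' → Dir (x <+> dd u (r *> a)) u1 w'
        M' = M (r *> a) (λ q → anz (vsolve (r :: inv r rnz) [ a ] (^0) (0w +v (`1 *v (`0 *v ^0 -v 0w) +v (`0 *e `1 -e 1k) *v (-1k *v ^0))) refl ⇐v (inv r rnz ∙: q) &v (inv-r r rnz s: (-1F *> a))))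
           (dot-∙ r a w >> cong (r *_) ea >> zeroʳ r)
      w1 : K3
      w1 = fst D₁
      n1 : ¬ x₁ ∈< S >
      n1 = off-S nx (∙∈ r d∈)
      n' : ¬ x' ∈< S >
      n' = off-S nx (+∈ (∙∈ r (A∈ a)) (∙∈ s (B∈ b)))
      dx1 : d ~ x₁
      dx1 = ~+ dnz (~sym xd) (~∙ r (snd pd))
      aw1 : dot a w1 ≡ 0F
      aw1 = fst (Dir.bwd (snd D₁) a b (~sym dx1))
      cv : ∃ λ y → dot y a ≢ 0F
      cv = co-vector a anz
      y : K3
      y = fst cv
      b' : K3
      b' = y <+> (- dot y u1) *> w1
      u1b' : dot u1 b' ≡ 0F
      u1b' = dot-comm u1 b' >> dot-+∙ y (- dot y u1) w1 u1 >> cong (λ z → dot y u1 + (- dot y u1) * z) (dot-comm w1 u1 >> Dir.uw (snd D₁)) >> solve [ dot y u1 ] (`0 +e (⊖ `0) *e 1k) 0k refl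
      ab' : dot a b' ≢ 0F
      ab' z = snd cv (sym (dot-comm a b' >> dot-+∙ y (- dot y u1) w1 a >> cong (λ z → dot y a + (- dot y u1) * z) (dot-comm w1 a >> aw1) >> solve (dot y a :: dot y u1) (`0 +e (⊖ `1) *e 0k) (`0) refl) >> z)
      b'nz : b' ≢ 0c
      b'nz = dot≢⇒nz {a} ab'
      bb' : D4 (B b) (B b')
      bb' with perp b b'
      ... | y , ynz , yb , yb' = A y , nzA ynz , ~sym (orth y b ynz bnz (dot-comm y b >> yb)) , orth y b' ynz b'nz (dot-comm y b' >> yb')
      iBd : Ind (B b :: d)
      iBd = ind-gen {B = A a :: B b} (ext (ind1 (nzB bnz)) λ p → A∉B anz (span⊆ [ (b , refl) ] p)) ((- 1F :: 1F , vsolve [] (A a :: B b) (-1k *v ^1 +v (1k *v (^0 +v ^1) +v 0w)) (^0) refl) :: g0)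
      u'b' : dot u' b' ≡ 0F
      u'b' = near⁻ D' n' b' b'nz (trace pd (Du.pA b'nz) (λ h → ab' (thin-near a b b' anz bnz b'nz (dot-crossˡ a u) h)) dx1 dB (ext iBd λ p → n1 (span⊆ (B∈ b :: d∈) p))
        (near (snd D₁) n1 b' b'nz u1b') bb' (nzS n') (1F :: s - r , vsolve (r :: s) (x ∷ A a :: B b) (1k *v (^0 +v `0 *v (^1 +v ^2)) +v ((`1 -e `0) *v ^2 +v 0w)) (^0 +v (`0 *v ^1 +v `1 *v ^2)) refl))
      su : ∃ λ ρ → u' ≡ u <+> ρ *> a
      su = same-u D D' a anz ea (~sym (~+ dnz (~sym xd) (~+ dnz (~∙ r dA) (~∙ s dB))))
      ρ≡ : fst su ≡ μ * r
      ρ≡ = -‿injective-0 (*-cancel-0 (dot a b') ab' (solve (dot a b' ∷ fst su ∷ μ ∷ r :: dot u b') (`0 *e (`1 -e `2 *e `3)) (0k +e (1k *e (`4 +e `1 *e `0 -e 0k) +e -1k *e (`4 +e (`2 *e `3) *e `0 -e 0k))) refl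
        ⇐ 1F *: trans (sym (dot-+∙ u (fst su) a b')) (cong (λ z → dot z b') (sym (snd su)) >> u'b')
         & -1F *: trans (sym (dot-+∙ u (μ * r) a b')) (cong (λ z → dot z b') (vsolve (μ :: r) (u :: a) (^0 +v (`0 *e `1) *v ^1) (^0 +v `0 *v `1 *v ^1) refl) >> u1b')))

   opaque
    -- One further step along `d` is computed once with the multiplier at the new point, once by
    -- `plane-u` from `x`; comparing the two values identifies the multipliers.
    plane-mul : ∀ {x u w μ} → Pnt x → ¬ x ∈< S > → Dir x u w → Mul x u w μ → ∀ a → a ≢ 0c → dot a w ≡ 0F → ∀ r s → Pnt (x <+> (r *> A a <+> s *> B (cross a u))) → ∀ {w'} →
          Dir (x <+> (r *> A a <+> s *> B (cross a u))) (u <+> (μ * r) *> a) w' → dot a w' ≡ 0F → Mul (x <+> (r *> A a <+> s *> B (cross a u))) (u <+> (μ * r) *> a) w' μ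
    plane-mul {x} {u} {w} {μ} px nx D M a anz ea r s px' {w'} D' ea' = subst (Mul x' u' w') μ≡ (snd mm)
     where
      x' : W
      x' = x <+> (r *> A a <+> s *> B (cross a u))
      u' : K3
      u' = u <+> (μ * r) *> a
      nx' : ¬ x' ∈< S >
      nx' = off-S nx (+∈ (∙∈ r (A∈ a)) (∙∈ s (B∈ (cross a u))))
      mm : ∃ λ μ' → Mul x' u' w' μ'
      mm = multiplier px' nx' D'
      cr : cross a u' ≡ cross a u
      cr = cong (cross a) (vsolve [ μ * r ] (u :: a) (^0 +v `0 *v ^1) (1k *v ^0 +v `0 *v ^1) refl) >> cross-linʳ a 1F u (μ * r) a >> cong (λ z → 1F *> cross a u <+> (μ * r) *> z) (self a) >> vsolve [ μ * r ] [ cross a u ] (1k *v ^0 +v `0 *v 0w) (^0) refl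
       where
        self : ∀ a → cross a a ≡ 0c
        self (p ∷ r :: s) = vec3 (go r s) (go s p) (go p r)
         where
          go : ∀ p r → p * r - r * p ≡ 0F
          go p r = solve (p :: r) (`0 *e `1 -e `1 *e `0) 0k refl
      D″ : ∃ λ w″ → Dir (x' <+> dd u' a) (u' <+> fst mm *> a) w″
      D″ = snd mm a anz ea'
      e : u' <+> fst mm *> a ≡ u <+> (μ * (r + 1F)) *> a
      e = plane-u px nx D M a anz ea (r + 1F) (s + 1F) (subst (λ z → Dir z (u' <+> fst mm *> a) (fst D″)) (cong (λ z → x' <+> (A a <+> B z)) cr >>
         vsolve (r :: s) (x ∷ A a :: B (cross a u)) ((^0 +v (`0 *v ^1 +v `1 *v ^2)) +v (^1 +v ^2)) (^0 +v ((`0 +e 1k) *v ^1 +v (`1 +e 1k) *v ^2)) refl) (snd D″))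
      μ≡ : fst mm ≡ μ
      μ≡ = coefeq (fst mm) μ (vsolve (fst mm ∷ μ :: r) (u :: a) (`0 *v ^1) (`1 *v ^1 +v 1k *v ((^0 +v (`1 *e `2) *v ^1 +v `0 *v ^1) -v (^0 +v (`1 *e (`2 +e 1k)) *v ^1))) refl ⇐v 1F ∙: e)
       where
        coefeq : ∀ p r → p *> a ≡ r *> a → p ≡ r
        coefeq p r q = -‿injective-0 (coef (ind1 anz) [ p - r ] (vsolve (p :: r) [ a ] ((`0 -e `1) *v ^0 +v 0w) (0w +v 1k *v (`0 *v ^0 -v `1 *v ^0)) refl ⇐v 1F ∙: q) zero)

  -- A common normal form for all points off `S`

  module NormalForm (Fr : Frames.Frame) where
   open Coordinates
   open Cross
   open Frame Fr
   open FrameLemmas Fr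
   open Directions Fr
   open Steps Fr
   open PlaneStep Fr
   private
    module Du = FrameLemmas (dual Fr)
    module DD = Directions (dual Fr)
    module SD = Steps (dual Fr)
    module PD = PlaneStep (dual Fr)

   neg : K3 → K3
   neg u = -1F *> u

   opaque
    neg-dot : ∀ a b → dot a (neg b) ≡ - dot a b
    neg-dot a b = dot-comm a (neg b) >> dot-∙ -1F b a >> cong (-1F *_) (dot-comm b a) >> solve [ dot a b ] (-1k *e `0) (⊖ `0) refl

   opaque
    neg-cross : ∀ a b → cross a (neg b) ≡ cross b a
    neg-cross a b = cong (cross a) (vsolve [] [ b ] (-1k *v ^0) (-1k *v ^0 +v 0k *v ^0) refl) >> cross-linʳ a -1F b 0F b >> (vsolve [] [ cross a b ] (-1k *v ^0 +v 0k *v ^0) (-1k *v ^0) refl) >> sym (anti b a)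

   opaque
    neg-zero : ∀ {x : K} → - x ≡ 0F → x ≡ 0F
    neg-zero {x} e = sym (-‿involutive x) >> (cong -_ e) >> -0#≈0#

   opaque
    -- `a = w × b` inverts `b = a × u`, so exchanging the two planes replaces `(u , w)` by
    -- `(- w , - u)`.
    dualDir : ∀ {x u w} → Dir x u w → DD.Dir x (neg w) (neg u)
    dualDir {x} {u} {w} D = record
     { uw = neg-dot (neg w) u >> (cong -_ (dot-comm (neg w) u >> neg-dot u w >> (cong -_ uw))) >> -‿involutive 1F
     ; fwd = λ b e → subst (x ~_) (+c _ _) (subst (λ z → x ~ A z <+> B b) (sym (neg-cross b w)) (subst (λ z → x ~ A (cross w b) <+> B z) (cross-au D b (ub b e))
       (fwd (cross w b) (dot-comm (cross w b) w >> dot-crossˡ w b))))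
     ; bwd = λ b a h → bk a b (bwd a b (subst (x ~_) (+c _ _) h)) }
     where
      open Dir D
      +c : ∀ (p r : W) → p <+> r ≡ r <+> p
      +c p r = vsolve [] (p :: r) (^0 +v ^1) (^1 +v ^0) refl
      ub : ∀ b → dot b (neg u) ≡ 0F → dot u b ≡ 0F
      ub b e = dot-comm u b >> neg-zero (sym (neg-dot b u) >> e)
      bk : ∀ a b → dot a w ≡ 0F × b ≡ cross a u → dot b (neg u) ≡ 0F × a ≡ cross b (neg w)
      bk a _ (e , refl) = trans (neg-dot (cross a u) u) ((cong -_ (dot-comm (cross a u) u >> dot-crossʳ a u)) >> -0#≈0#) , sym (neg-cross (cross a u) w >> cross-wb D a e)

   opaque
    nS : ∀ {x} → ¬ x ∈< S > → ¬ x ∈< Du.S >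
    nS nx p = nx (span⊆ (VAllₚ.++⁺ (snd S⊇) (fst S⊇)) p)

   x0 : W
   x0 = fst (apex7 Fr)

   opaque
    p₀ : Pnt x0
    p₀ = fst (snd (apex7 Fr))

   opaque
    n₀ : ¬ x0 ∈< S >
    n₀ = fst (snd (snd (apex7 Fr)))

   opaque
    dir0 : ∃₂ λ u w → Dir x0 u w
    dir0 = hasDir p₀ n₀

   opaque
    mul0 : ∃ λ μ → μ ≢ 0F × Mul x0 (fst dir0) (fst (snd dir0)) μ
    mul0 = fst m , μ≢0 p₀ n₀ (snd (snd dir0)) , snd m
     where
      m : ∃ λ μ → Mul x0 (fst dir0) (fst (snd dir0)) μ
      m = multiplier p₀ n₀ (snd (snd dir0))

   opaque
    mul1 : ∃ λ ν → ν ≢ 0F × PD.Mul x0 (neg (fst (snd dir0))) (neg (fst dir0)) ν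
    mul1 = fst m , SD.μ≢0 p₀ (nS n₀) (dualDir (snd (snd dir0))) , snd m
     where
      m : ∃ λ ν → PD.Mul x0 (neg (fst (snd dir0))) (neg (fst dir0)) ν
      m = SD.multiplier p₀ (nS n₀) (dualDir (snd (snd dir0)))

   μ ν iμ iν : K
   μ = fst mul0
   ν = fst mul1
   iμ = inv μ (fst (snd mul0))
   iν = inv ν (fst (snd mul1))

   -- Chosen to give `x0` the normal form; moving along lines then preserves it.
   c : W
   c = x0 <+> ((- iμ) *> A (fst dir0) <+> iν *> B (fst (snd dir0)))

   record Good (x : W) : Set where
    field
     {u w} : K3
     px : Pnt x
     nx : ¬ x ∈< S >
     D : Dir x u w
     M : Mul x u w μ
     M̂ : PD.Mul x (neg w) (neg u) ν
     eq : x ≡ c <+> (iμ *> A u <+> (- iν) *> B w)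

   good0 : Good x0
   good0 = record { px = p₀ ; nx = n₀ ; D = snd (snd dir0) ; M = snd (snd mul0) ; M̂ = snd (snd mul1)
    ; eq = vsolve (iμ :: iν) (x0 ∷ A (fst dir0) :: B (fst (snd dir0))) (^0) ((^0 +v ((⊖ `0) *v ^1 +v `1 *v ^2)) +v (`0 *v ^1 +v (⊖ `1) *v ^2)) refl }

   opaque
    -- `plane-u` gives the change of `u` in the frame and that of `w` in the dual frame; after
    -- division by `μ` and `ν` the two changes add up to the displacement of the point, so `c` stays
    -- fixed.
    good-step : ∀ {x} (G : Good x) → ∀ a → a ≢ 0c → dot a (Good.w G) ≡ 0F → ∀ r s → Pnt (x <+> (r *> A a <+> s *> B (cross a (Good.u G)))) →
     Σ (Good (x <+> (r *> A a <+> s *> B (cross a (Good.u G))))) λ G' → Good.u G' ≡ Good.u G <+> (μ * r) *> a × Good.w G' ≡ Good.w G <+> (- (ν * s)) *> cross a (Good.u G)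
    good-step {x} G a anz ea r s px' = go (hasDir px' nx')
     where
      open Good G
      b : K3
      b = cross a u
      x' : W
      x' = x <+> (r *> A a <+> s *> B b)
      nx' : ¬ x' ∈< S >
      nx' = off-S nx (+∈ (∙∈ r (A∈ a)) (∙∈ s (B∈ b)))
      bnz : b ≢ 0c
      bnz = cross-nz D nx anz ea
      eb : dot b (neg u) ≡ 0F
      eb = neg-dot b u >> (cong -_ (dot-comm b u >> dot-crossʳ a u)) >> -0#≈0#
      cb : cross b (neg w) ≡ a
      cb = neg-cross b w >> cross-wb D a ea
      xe : x' ≡ x <+> (s *> B b <+> r *> A (cross b (neg w)))
      xe = vsolve (r :: s) (x ∷ A a :: B b) (^0 +v (`0 *v ^1 +v `1 *v ^2)) (^0 +v (`1 *v ^2 +v `0 *v ^1)) refl >> cong (λ z → x <+> (s *> B b <+> r *> A z)) (sym cb)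
      d : W
      d = dd u a
      dnz : d ≢ 0v
      dnz = dd-nz D anz
      xd : x ~ d
      xd = Dir.fwd D a ea
      ab : A a ~ B b
      ab = orth a b anz bnz (dot-crossˡ a u)
      x'd : x' ~ d
      x'd = ~sym (~+ dnz (~sym xd) (~+ dnz (~∙ r (~sym (~+ (nzA anz) (snd (pA anz)) ab))) (~∙ s (~sym (~+ (nzB bnz) (~sym ab) (snd (Du.pA {b} bnz)))))))
      go : (∃₂ λ u' w' → Dir x' u' w') → Σ (Good x') λ G' → Good.u G' ≡ u <+> (μ * r) *> a × Good.w G' ≡ w <+> (- (ν * s)) *> b
      go (u' , w' , D') = record { u = U ; w = Wv ; px = px' ; nx = nx' ; D = D″ ; M = plane-mul px nx D M a anz ea r s px' D″ (fst (Dir.bwd D″ a b x'd)) ; M̂ = M̂' ; eq = eq' } , refl , refl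
       where
        U Wv : K3
        U = u <+> (μ * r) *> a
        Wv = w <+> (- (ν * s)) *> b
        uE : u' ≡ U
        uE = plane-u px nx D M a anz ea r s D'
        D̂' : DD.Dir (x <+> (s *> B b <+> r *> A (cross b (neg w)))) (neg w') (neg u')
        D̂' = subst (λ z → DD.Dir z (neg w') (neg u')) xe (dualDir D')
        wE' : neg w' ≡ neg w <+> (ν * s) *> b
        wE' = PD.plane-u px (nS nx) (dualDir D) M̂ b bnz eb s r D̂'
        wE : w' ≡ Wv
        wE = vsolve [ ν * s ] (w' ∷ w :: b) (^0) ((^1 +v (⊖ `0) *v ^2) +v -1k *v (-1k *v ^0 -v (-1k *v ^1 +v `0 *v ^2))) refl ⇐v -1F ∙: wE'
        D″ : Dir x' U Wv
        D″ = subst₂ (Dir x') uE wE D'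
        M̂1 : PD.Mul (x <+> (s *> B b <+> r *> A (cross b (neg w)))) (neg w <+> (ν * s) *> b) (neg u') ν
        M̂1 = PD.plane-mul px (nS nx) (dualDir D) M̂ b bnz eb s r (subst Pnt xe px') (subst (λ z → DD.Dir (x <+> (s *> B b <+> r *> A (cross b (neg w)))) z (neg u')) wE' D̂')
          (cong (λ z → dot b (neg z)) uE >> neg-dot b U >> (cong -_ (dot-comm b U >> dot-+∙ u (μ * r) a b >> cong₂ (λ p t → p + μ * r * t) (dot-crossʳ a u) (dot-crossˡ a u) >> solve [ μ * r ] (0k +e `0 *e 0k) 0k refl)) >> -0#≈0#)
        M̂' : PD.Mul x' (neg Wv) (neg U) ν
        M̂' = subst₂ (λ y z → PD.Mul y z (neg U) ν) (sym xe) (sym wE' >> cong neg wE) (subst (λ z → PD.Mul (x <+> (s *> B b <+> r *> A (cross b (neg w)))) (neg w <+> (ν * s) *> b) (neg z) ν) uE M̂1)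
        eq' : x' ≡ c <+> (iμ *> A U <+> (- iν) *> B Wv)
        eq' = (vsolve (r ∷ s ∷ μ ∷ ν ∷ iμ :: iν) (x ∷ A a ∷ B b ∷ c ∷ A u :: B w) (^0 +v (`0 *v ^1 +v `1 *v ^2))
          ((^3 +v (`4 *v (1k *v ^4 +v (`2 *e `0) *v ^1) +v (⊖ `5) *v (1k *v ^5 +v (⊖ (`3 *e `1)) *v ^2))) +v (1k *v (^0 -v (^3 +v (`4 *v ^4 +v (⊖ `5) *v ^5))) +v (`2 *e `4 -e 1k) *v ((⊖ `0) *v ^1) +v (`3 *e `5 -e 1k) *v ((⊖ `1) *v ^2))) refl
          ⇐v 1F ∙: eq &v (inv-r μ (fst (snd mul0)) s: ((- r) *> A a)) &v (inv-r ν (fst (snd mul1)) s: ((- s) *> B b))) >>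
          cong₂ (λ p t → c <+> (iμ *> p <+> (- iν) *> t)) (sym (lin-lin es 1F u (μ * r) a) >> cong A (vsolve [ μ * r ] (u :: a) (1k *v ^0 +v `0 *v ^1) (^0 +v `0 *v ^1) refl))
            (sym (lin-lin fs 1F w (- (ν * s)) b) >> cong B (vsolve [ ν * s ] (w :: b) (1k *v ^0 +v (⊖ `0) *v ^1) (^0 +v (⊖ `0) *v ^1) refl))

   -- The normal form fixes the scalar of a vector, hence the factor `k`.
   Good′ : W → Set
   Good′ y = Pnt y × ¬ y ∈< S > × ∃ λ k → k ≢ 0F × Good (k *> y)

   opaque
    -- `y` lies in the plane of the thin point `d`, which also contains `x`; there one `good-step`
    -- leads from `x` to `y`, up to a scalar.
    thru : ∀ {x y d} → Good′ x → Pnt y → ¬ y ∈< S > → d ∈< S > → d ≢ 0v → x ~ d → y ~ d → Good′ y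
    thru {x} {y} {d} (px , nx , k , knz , G) py ny d∈ dnz xd yd with S-split d∈
    ... | a , b , refl with Dir.bwd (Good.D G) a b Xd | both-nz a b nx xd dnz
     where
      Xd : k *> x ~ A a <+> B b
      Xd = ~sym (~∙ k (~sym xd))
    ... | aw , refl | anz , bnz = go (in-plane dX dA iXA (~sym yd))
     where
      open Good G using (u)
      X d' : W
      X = k *> x
      d' = dd u a
      dX : d' ~ X
      dX = ~∙ k (~sym xd)
      dA : d' ~ A a
      dA = ~sym (~+ (nzA anz) (snd (pA anz)) (orth a (cross a u) anz bnz (dot-crossˡ a u)))
      iXA : Ind (X ∷ A a :: d')
      iXA = ext (ind-gen {B = A a :: B (cross a u)} (ext (ind1 (nzB bnz)) λ p → A∉B anz (span⊆ [ (cross a u , refl) ] p)) (g0 :: (- 1F :: 1F , vsolve [] (A a :: B (cross a u)) (-1k *v ^0 +v (1k *v (^0 +v ^1) +v 0w)) (^1) refl)))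
        λ p → Good.nx G (span⊆ (A∈ a :: d∈) p)
      go : y ∈< X ∷ A a :: d' > → Good′ y
      go (p ∷ r :: s , e) with p ≟ 0F
      ... | yes refl = ⊥-elim (ny (subst (_∈< S >) (vsolve (r :: s) (X ∷ A a :: d') (`0 *v ^1 +v `1 *v ^2) (0k *v ^0 +v (`0 *v ^1 +v (`1 *v ^2 +v 0w))) refl >> e) (+∈ (∙∈ r (A∈ a)) (∙∈ s d∈))))
      ... | no pnz = py , ny , ip , inv≢0 p pnz , subst Good (sym ye) (fst (good-step G a anz aw (ip * (r + s)) (ip * s) (subst Pnt ye (ipy , ~selfˡ (~sym (~∙ ip (~sym (~∙ ip (snd py)))))))))
       where
        ip : K
        ip = inv p pnz
        ye : ip *> y ≡ X <+> ((ip * (r + s)) *> A a <+> (ip * s) *> B (cross a u))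
        ye = vsolve (p ∷ r ∷ s :: ip) (X ∷ A a ∷ B (cross a u) :: y) (`3 *v ^3) ((^0 +v ((`3 *e (`1 +e `2)) *v ^1 +v (`3 *e `2) *v ^2)) +v ((`0 *e `3 -e 1k) *v ^0 +v (⊖ `3) *v ((`0 *v ^0 +v (`1 *v ^1 +v (`2 *v (^1 +v ^2) +v 0w))) -v ^3))) refl
          ⇐v (inv-r p pnz s: X) &v ((- ip) ∙: e)
        ipy : ip *> y ≢ 0v
        ipy z = ny (subst (_∈< S >) (sym (vsolve (p :: ip) [ y ] (^0) (0w +v (`0 *v (`1 *v ^0 -v 0w) +v (`0 *e `1 -e 1k) *v (-1k *v ^0))) refl ⇐v (p ∙: z) &v (inv-r p pnz s: (-1F *> y)))) 0∈)

   opaque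
    foot : ∀ {x y} → Pnt x → ¬ x ∈< S > → Pnt y → Ind (x :: y) → ∃ λ d → d ≢ 0v × d ∈< x :: y > × d ∈< S >
    foot {x} px nx py i = meet (x ∷ S) i ind (g0 :: span7 Fr px nx py) (VAll.map wk∈ (gens∈ S)) ℕₚ.≤-refl

   opaque
    good-adj : ∀ {x y} → Good′ x → Pnt y → ¬ y ∈< S > → x ~ y → Good′ y
    good-adj {x} {y} G@(px , nx , k , knz , g) py ny xy with par? x (fst py)
    ... | inj₁ (r ∷ [] , e) = py , ny , k * r , *≢0 knz (λ { refl → fst px (sym e >> (vsolve [] [ y ] (0k *v ^0 +v 0w) 0w refl)) }) , subst Good (cong (k *>_) (sym e) >> vsolve (k :: r) [ y ] (`0 *v (`1 *v ^0 +v 0w)) ((`0 *e `1) *v ^0) refl) g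
    ... | inj₂ i with foot px nx py i
    ... | d , dnz , d∈ , d∈S = thru G py ny d∈S dnz (~on i xy d∈) (~on (swap i) (~sym xy) (span⊆ (g1 :: g0) d∈))

   opaque
    good-D4 : ∀ {x y} → Good′ x → Pnt y → ¬ y ∈< S > → D4 x y → Good′ y
    good-D4 G py ny (s , snz , xs , sy) with ∈? s S
    ... | yes s∈ = thru G py ny s∈ snz xs (~sym sy)
    ... | no ns = good-adj (good-adj G (~P snz sy) ns xs) py ny sy

   opaque
    -- Goodness passes to points off `S` at distance at most four. Given a neighbour `d` of `y` in
    -- `S` not collinear with `t`, either a point of `y d` off `S` is near `x0` or `x0 + t`, or `d`
    -- is near both and hence collinear with a point of their line. If both available `d` are
    -- collinear with `t`, so is `y`, for lack of quadrangles.
    all-good : ∀ {y} → Pnt y → ¬ y ∈< S > → Good′ y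
    all-good {y} py ny = start (hasDir py ny)
     where
      one* : 1F *> x0 ≡ x0
      one* = vsolve [] [ x0 ] (1k *v ^0) (^0) refl
      G0 : Good′ x0
      G0 = p₀ , n₀ , 1F , 1≢0 , subst Good (sym one*) good0
      feet : ∀ {x u w} → Dir x u w → ∃₂ λ d d' → d ∈< S > × d' ∈< S > × x ~ d × x ~ d' × (¬ x ∈< S > → Ind (x ∷ d :: d'))
      feet {x} {u} {w} D with perp-basis w (λ { refl → 1≢0 (sym (Dir.uw D) >> dot-0 u) })
      ... | a , a' , i , e , e' = dd u a , dd u a' , +∈ (A∈ a) (B∈ (cross a u)) , +∈ (A∈ a') (B∈ (cross a' u)) , Dir.fwd D a (dot-comm a w >> e) , Dir.fwd D a' (dot-comm a' w >> e') , λ nx → ind-dd nx i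
      start : (∃₂ λ u w → Dir y u w) → Good′ y
      start (u , w , D) with feet D | feet (snd (snd dir0))
      ... | d , d' , d∈ , d'∈ , yd , yd' , iy | t , _ , t∈ , _ , xt , _ , ix with iy ny | ix n₀
      ...   | j | j0 = choose (~? t d) (~? t d') (~? t y)
       where
        tnz : t ≢ 0v
        tnz = ind-nonzero (ind-tail j0)
        ptt : Pnt t
        ptt = ~P tnz (~sym xt)
        dnz : d ≢ 0v
        dnz = ind-nonzero (ind-tail j)
        dnz' : d' ≢ 0v
        dnz' = ind-nonzero (ind-tail (ind-tail j))
        ixt : Ind (x0 :: t)
        ixt = ind-tail {x = _} (ind-gen j0 (g1 ∷ g2 :: g0))
        x₁ : W
        x₁ = x0 <+> t
        n1 : ¬ x₁ ∈< S >
        n1 = off-S n₀ t∈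
        x1t : x₁ ~ t
        x1t = ~sym (~+ tnz (~sym xt) (snd ptt))
        G1 : Good′ x₁
        G1 = thru G0 (~P (nzS n1) x1t) n1 t∈ tnz xt x1t
        go : ∀ {d} → d ≢ 0v → d ∈< S > → y ~ d → Ind (y :: d) → ¬ t ~ d → Good′ y
        go {d} dnz d∈ yd iyd ntd = one (reach {m = ln y d iyd} p₀ (~L iyd yd)) (reach {m = ln y d iyd} (fst G1) (~L iyd yd))
         where
          pd : Pnt d
          pd = ~P dnz (~sym yd)
          via-r : ∀ {x r} → Good′ x → r ≢ 0v → ¬ r ∈< S > → r ∈< y :: d > → D4 x r → Good′ y
          via-r {x} {r} G rnz nr r∈ dr = thru (good-D4 G (~P rnz rd) nr dr) py ny d∈ dnz rd yd
           where
            rd : r ~ d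
            rd = ~sym (~on (swap iyd) (~sym yd) (span⊆ (g1 :: g0) r∈))
          to-d : ∀ {x r} → r ≢ 0v → r ∈< S > → r ∈< y :: d > → D4 x r → D4 d x
          to-d {x} {r} rnz r∈S r∈ (s , snz , xs , sr) = s , snz , ~sym (∥~ (~P snz sr) (par-sym rnz (inter′ ny [ d∈ ] r∈ r∈S)) sr) , ~sym xs
          one : (∃ λ r → r ≢ 0v × r ∈< y :: d > × D4 x0 r) → (∃ λ r → r ≢ 0v × r ∈< y :: d > × D4 x₁ r) → Good′ y
          one (r , rnz , r∈ , dr) (r1 , rnz1 , r1∈ , dr1) with ∈? r S | ∈? r1 S
          ... | no nr | _ = via-r G0 rnz nr r∈ dr
          ... | yes _ | no nr1 = via-r G1 rnz1 nr1 r1∈ dr1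
          ... | yes m | yes m1 = two (unique-near pd i01 (~+ (fst p₀) (snd p₀) xt) (to-d rnz m r∈ dr) (to-d rnz1 m1 r1∈ dr1))
           where
            i01 : Ind (x0 :: x₁)
            i01 = ind-gen ixt (g0 :: (- 1F :: 1F , vsolve [] (x0 :: t) (-1k *v ^0 +v (1k *v (^0 +v ^1) +v 0w)) (^1) refl))
            two : (∃ λ g → g ≢ 0v × g ∈< x0 :: x₁ > × d ~ g) → Good′ y
            two (g , gnz , g∈ , dg) with ∈? g S
            ... | yes gS = ⊥-elim (ntd (~sym (∥~ pd (par-sym gnz (inter′ n₀ [ t∈ ] (span⊆ (g0 :: +∈ g0 g1) g∈) gS)) dg)))
            ... | no ng = thru (thru G0 (~P gnz (~sym dg)) ng t∈ tnz xt (~sym (~span tnz (~sym xt :: ~sym x1t) g∈))) py ny d∈ dnz (~sym dg) yd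
        choose : Dec (t ~ d) → Dec (t ~ d') → Dec (t ~ y) → Good′ y
        choose _ _ (yes ty) = thru G0 py ny t∈ tnz xt (~sym ty)
        choose (no n) _ _ = go dnz d∈ yd (ind-tail {x = d'} (ind-gen j (g1 ∷ g2 :: g0))) n
        choose (yes _) (no n) _ = go dnz' d'∈ yd' (ind-tail {x = d} (ind-gen j (g1 ∷ g0 :: g2))) n
        choose (yes td) (yes td') (no nty) = ⊥-elim (∉-head (ind-tail j) (quad ptt py dnz dnz' td (~sym yd) yd' (~sym td') nty))

   module _ where
    private
     At : K3 → K3 → Set
     At u w = ∃ λ x → Σ (Good x) λ G → Good.u G ≡ u × Good.w G ≡ w

     uw1 : ∀ {u w} → At u w → dot u w ≡ 1F
     uw1 (_ , G , refl , refl) = Dir.uw (Good.D G)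

     move : ∀ {u w} → At u w → ∀ a → a ≢ 0c → dot a w ≡ 0F → ∀ r s → At (u <+> (μ * r) *> a) (w <+> (- (ν * s)) *> cross a u)
     move (x , G , refl , refl) a anz ea r s = _ , good-step G a anz ea r s (nz' , ~selfˡ x'd)
      where
       open Good G
       bnz : cross a u ≢ 0c
       bnz = cross-nz D nx anz ea
       dnz : dd u a ≢ 0v
       dnz = dd-nz D anz
       ab : A a ~ B (cross a u)
       ab = orth a (cross a u) anz bnz (dot-crossˡ a u)
       x'd : x <+> (r *> A a <+> s *> B (cross a u)) ~ dd u a
       x'd = ~sym (~+ dnz (~sym (Dir.fwd D a ea)) (~+ dnz (~∙ r (~sym (~+ (nzA anz) (snd (pA anz)) ab))) (~∙ s (~sym (~+ (nzB bnz) (~sym ab) (snd (Du.pA {cross a u} bnz)))))))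
       nz' : x <+> (r *> A a <+> s *> B (cross a u)) ≢ 0v
       nz' = nzS (off-S nx (+∈ (∙∈ r (A∈ a)) (∙∈ s (B∈ (cross a u)))))

     diff0 : ∀ {u u' : K3} → u' <+> -1F *> u ≡ 0c → u ≡ u'
     diff0 {u} {u'} z = vsolve [] (u :: u') (^0) (^1 +v -1k *v ((^1 -v ^0) -v 0w)) refl ⇐v -1F ∙: z

     -- A step with `s = 0` changes only `u`; `to-w` takes the step with `r = 0`, which changes only
     -- `w`.
     to-u : ∀ {u w} u' → At u w → dot u' w ≡ 1F → At u' w
     to-u {u} {w} u' P e with (u' <+> -1F *> u) ≟v 0c
     ... | yes z = subst (λ z → At z w) (diff0 z) P
     ... | no nz = subst₂ At (vsolve (μ :: iμ) (u :: u') (^0 +v (`0 *e `1) *v (^1 -v ^0)) (^1 +v (`0 *e `1 -e 1k) *v (^1 -v ^0)) refl ⇐v (inv-r μ (fst (snd mul0)) s: (u' <+> -1F *> u)))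
        (vsolve [ ν ] (w :: cross (u' <+> -1F *> u) u) (^0 +v (⊖ (`0 *e 0k)) *v ^1) (^0) refl)
        (move P (u' <+> -1F *> u) nz (dot-+∙ u' -1F u w >> cong₂ (λ p r → p + -1F * r) e (uw1 P) >> (solve [] (1k +e -1k *e 1k) 0k refl)) iμ 0F)

     to-w : ∀ {u w} w' → At u w → dot u w' ≡ 1F → At u w'
     to-w {u} {w} w' P e with (w' <+> -1F *> w) ≟v 0c
     ... | yes z = subst (At u) (diff0 z) P
     ... | no bnz = subst₂ At (vsolve [ μ ] (u :: a) (^0 +v (`0 *e 0k) *v ^1) (^0) refl)
        (cong (λ z → w <+> (- (ν * (- iν))) *> z) ca >> (vsolve (ν :: iν) (w :: w') (^0 +v (⊖ (`0 *e (⊖ `1))) *v (^1 -v ^0)) (^1 +v (`0 *e `1 -e 1k) *v (^1 -v ^0)) refl ⇐v (inv-r ν (fst (snd mul1)) s: b)))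
        (move P a (λ z → bnz (sym ca >> cong (λ z → cross z u) z >> cr0 u)) (dot-comm a w >> dot-crossˡ w b) 0F (- iν))
      where
       b a : K3
       b = w' <+> -1F *> w
       a = cross w b
       ca : cross a u ≡ b
       ca = go P
        where
         go : At u w → cross a u ≡ b
         go (_ , G , refl , refl) = cross-au (Good.D G) b (dot-comm u b >> dot-+∙ w' -1F w u >> cong₂ (λ p r → p + -1F * r) (dot-comm w' u >> e) (dot-comm w u >> uw1 P) >> (solve [] (1k +e -1k *e 1k) 0k refl))
       cr0 : ∀ y → cross 0c y ≡ 0c
       cr0 (p ∷ r :: s) = vec3 (z r s) (z s p) (z p r)
        where
         z : ∀ p r → 0F * r - 0F * p ≡ 0F
         z p r = solve (p :: r) (0k *e `1 -e 0k *e `0) 0k refl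

     -- (u , w) → (u1 , w) → (u1 , w') → (u' , w') with u1 · w = u1 · w' = 1
     zigzag : ∀ {u w} u' w' → At u w → dot u' w' ≡ 1F → Ind (w :: w') → At u' w'
     zigzag {u} {w} u' w' P e i = go
      where
       fin : ∀ y → dot y w ≢ 0F → dot y w' ≡ dot y w → At u' w'
       fin y n q = to-u u' (to-w w' (to-u (inv (dot y w) n *> y) P (sc w refl)) (sc w' q)) e
        where
         sc : ∀ z → dot y z ≡ dot y w → dot (inv (dot y w) n *> y) z ≡ 1F
         sc z q = dot-∙ (inv (dot y w) n) y z >> cong (inv (dot y w) n *_) q >> *-comm _ _ >> inv-r (dot y w) n
       eqd : ∀ y → dot (w' <+> -1F *> w) y ≡ 0F → dot y w' ≡ dot y w
       eqd y z = solve (dot y w' :: dot y w) (`0) (`1 +e 1k *e (`0 +e -1k *e `1 -e 0k)) refl ⇐ 1F *: trans (cong₂ (λ p r → p + -1F * r) (dot-comm y w') (dot-comm y w)) (sym (dot-+∙ w' -1F w y) >> z)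
       d : K3
       d = w' <+> -1F *> w
       dnz : d ≢ 0c
       dnz z = 1≢0 (coef i (- 1F :: 1F) ((vsolve [] (w :: w') (-1k *v ^0 +v (1k *v ^1 +v 0w)) (^1 -v ^0) refl) >> z) (suc zero))
       go : At u' w'
       go with perp-basis d dnz
       ... | y₁ , y₂ , iy , e1 , e2 with dot y₁ w ≟ 0F | dot y₂ w ≟ 0F
       ... | no n1 | _ = fin y₁ n1 (eqd y₁ e1)
       ... | yes _ | no n2 = fin y₂ n2 (eqd y₂ e2)
       ... | yes z1 | yes z2 = ⊥-elim (∉-head iy (pr (cross-∥ w (cross y₁ y₂) wnz z) (cross-∥ d (cross y₁ y₂) dnz z')))
        where
         wnz : w ≢ 0c
         wnz = ind-nonzero i
         z : cross w (cross y₁ y₂) ≡ 0c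
         z = bac′ w y₁ y₂ >> cong₂ (λ p r → p *> y₁ <+> (- r) *> y₂) (dot-comm w y₂ >> z2) (dot-comm w y₁ >> z1) >> (vsolve [] (y₁ :: y₂) (0k *v ^0 +v (⊖ 0k) *v ^1) 0w refl)
         z' : cross d (cross y₁ y₂) ≡ 0c
         z' = bac′ d y₁ y₂ >> cong₂ (λ p r → p *> y₁ <+> (- r) *> y₂) e2 e1 >> (vsolve [] (y₁ :: y₂) (0k *v ^0 +v (⊖ 0k) *v ^1) 0w refl)
         pr : (∃ λ r → cross y₁ y₂ ≡ r *> w) → (∃ λ r → cross y₁ y₂ ≡ r *> d) → y₁ ∈< y₂ ∷ [] >
         pr (r , q) (r' , q') with cross-∥ y₂ y₁ (ind-nonzero (ind-tail iy)) (anti y₂ y₁ >> cong (-1F *>_) (q >> cong (_*> w) r0 >> (vsolve [] [ w ] (0k *v ^0) 0w refl)) >> (vsolve [] [] (-1k *v 0w) 0w refl))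
          where
           comb : lin (r + r' :: - r') (w :: w') ≡ 0c
           comb = vsolve (r :: r') (w ∷ w' :: cross y₁ y₂) ((`0 +e `1) *v ^0 +v ((⊖ `1) *v ^1 +v 0w)) (0w +v (-1k *v (^2 -v `0 *v ^0) +v 1k *v (^2 -v `1 *v (^1 -v ^0)))) refl ⇐v (-1F ∙: q) &v (1F ∙: q')
           r0 : r ≡ 0F
           r0 = solve (r :: r') (`0) (0k +e (1k *e (`0 +e `1 -e 0k) +e 1k *e (⊖ `1 -e 0k))) refl ⇐ 1F *: coef i (r + r' :: - r') comb zero & 1F *: coef i (r + r' :: - r') comb (suc zero)
         ... | t , refl = t ∷ [] , vsolve [ t ] [ y₂ ] (`0 *v ^0 +v 0w) (`0 *v ^0) refl

    opaque
     every : ∀ u w → dot u w ≡ 1F → ∃ λ x → Σ (Good x) λ G → Good.u G ≡ u × Good.w G ≡ w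
     every u w e with ∈? (Good.w good0) [ w ]
     ... | no n = zigzag u w (x0 , good0 , refl , refl) e (ext (ind1 wnz) n)
      where
       wnz : w ≢ 0c
       wnz refl = 1≢0 (sym e >> dot-0 u)
     -- `zigzag` needs independent `w`; when the target is proportional to the starting `w0`, that
     -- vector is first moved by some `b` perpendicular to `u0`.
     ... | yes p with perp-basis (Good.u good0) (λ z → 1≢0 (sym (Dir.uw (Good.D good0)) >> cong (λ z → dot z (Good.w good0)) z >> dot-comm 0c (Good.w good0) >> dot-0 (Good.w good0)))
     ...   | b , _ , ib , eb , _ = zigzag u w (to-w w1 (x0 , good0 , refl , refl) uw₁) e (ext (ind1 wnz) n1)
      where
       u0 w0 w1 : K3
       u0 = Good.u good0
       w0 = Good.w good0
       w1 = w0 <+> 1F *> b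
       wnz : w ≢ 0c
       wnz refl = 1≢0 (sym e >> dot-0 u)
       uw₁ : dot u0 w1 ≡ 1F
       uw₁ = dot-comm u0 w1 >> dot-+∙ w0 1F b u0 >> cong₂ (λ p r → p + 1F * r) (dot-comm w0 u0 >> Dir.uw (Good.D good0)) (dot-comm b u0 >> eb) >> (solve [] (1k +e 1k *e 0k) 1k refl)
       w0nz : w0 ≢ 0c
       w0nz z = 1≢0 (sym (Dir.uw (Good.D good0)) >> cong (dot u0) z >> dot-0 u0)
       -- b ∈ ⟨w0> is impossible because u0 · b = 0 and u0 · w0 = 1
       n1 : ¬ w1 ∈< w ∷ [] >
       n1 h with span⊆ [ par-sym w0nz p ] h
       ... | k ∷ [] , q = ind-nonzero ib (b≡ >> cong (_*> w0) k0 >> (vsolve [] [ w0 ] (0k *v ^0) 0w refl))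
        where
         b≡ : b ≡ (k - 1F) *> w0
         b≡ = vsolve [ k ] (b :: w0) (^0) ((`0 -e 1k) *v ^1 +v -1k *v ((`0 *v ^1 +v 0w) -v (^1 +v 1k *v ^0))) refl ⇐v -1F ∙: q
         k0 : k - 1F ≡ 0F
         k0 = sym (dot-∙ (k - 1F) w0 u0 >> cong ((k - 1F) *_) (dot-comm w0 u0 >> Dir.uw (Good.D good0)) >> *-identityʳ _) >> cong (λ z → dot z u0) (sym b≡) >> dot-comm b u0 >> eb

  -- Standard coordinates and the embedding

  module Recover (Fr : Frames.Frame) where
   open Coordinates
   open Cross
   open Frame Fr
   open FrameLemmas Fr
   open Directions Fr
   open Steps Fr
   open NormalForm Fr
   open Octonions using (Q7; _⟂_; module MapLin; solveV)
   open Counting using (spans)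
   open HexLines using (HL; on)
   open HexFlags
   open StandardLines
   private
    module Du = FrameLemmas (dual Fr)

   -- `τ` is forced by the requirement that `dot (μ *> g u) ((- ν) *> h w)` equal `dot u w`.
   τ κ : K
   τ = - (iμ * iν)
   κ = - (τ * iμ)

   opaque
    μ≠0 : μ ≢ 0F
    μ≠0 = fst (snd mul0)

   opaque
    ν≠0 : ν ≢ 0F
    ν≠0 = fst (snd mul1)

   opaque
    τ≢0 : τ ≢ 0F
    τ≢0 = -≢0 (*≢0 (inv≢0 μ μ≠0) (inv≢0 ν ν≠0))

   opaque
    κ≢0 : κ ≢ 0F
    κ≢0 = -≢0 (*≢0 τ≢0 (inv≢0 μ μ≠0))

   -- coordinates of H(q): x ↦ g u on α, e ↦ e c, w ↦ h w on β, where g and h are diagonal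
   g g⁻ h h⁻ : K3 → K3
   g (a ∷ b :: d) = κ * a ∷ b :: d
   g⁻ (a ∷ b :: d) = inv κ κ≢0 * a ∷ b :: d
   h (a ∷ b :: d) = τ * (inv κ κ≢0 * a) ∷ τ * b :: τ * d
   h⁻ (a ∷ b :: d) = inv τ τ≢0 * (κ * a) ∷ inv τ τ≢0 * b :: inv τ τ≢0 * d

   private
    iκ iτ : K
    iκ = inv κ κ≢0
    iτ = inv τ τ≢0
    kk : κ * iκ ≡ 1F
    kk = inv-r κ κ≢0
    tt′ : τ * iτ ≡ 1F
    tt′ = inv-r τ τ≢0

    can : ∀ k k' a → k * k' ≡ 1F → k * (k' * a) ≡ a
    can k k' a e = solve (k ∷ k' :: a) (`0 *e (`1 *e `2)) (`2 +e `2 *e (`0 *e `1 -e 1k)) refl ⇐ a *: e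

    can2 : ∀ a → τ * (iκ * (iτ * (κ * a))) ≡ a
    can2 a = solve (τ ∷ iτ ∷ κ ∷ iκ :: a) (`0 *e (`3 *e (`1 *e (`2 *e `4)))) (`4 +e ((`4 *e `2 *e `3) *e (`0 *e `1 -e 1k) +e `4 *e (`2 *e `3 -e 1k))) refl ⇐ (a * κ * iκ) *: tt′ & a *: kk

   opaque
    gg⁻ : ∀ a → g (g⁻ a) ≡ a
    gg⁻ (a ∷ b :: d) = cong (_∷ b :: d) (can κ iκ a kk)

   opaque
    g⁻g : ∀ a → g⁻ (g a) ≡ a
    g⁻g (a ∷ b :: d) = cong (_∷ b :: d) (can iκ κ a (*-comm iκ κ >> kk))

   opaque
    hh⁻ : ∀ a → h (h⁻ a) ≡ a
    hh⁻ (a ∷ b :: d) = vec3 (can2 a) (can τ iτ b tt′) (can τ iτ d tt′)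

   opaque
    h⁻h : ∀ a → h⁻ (h a) ≡ a
    h⁻h (a ∷ b :: d) = vec3 (solve (τ ∷ iτ ∷ κ ∷ iκ :: a) (`1 *e (`2 *e (`0 *e (`3 *e `4)))) (`0 *e (`3 *e (`1 *e (`2 *e `4)))) refl >> can2 a) (can iτ τ b (*-comm iτ τ >> tt′)) (can iτ τ d (*-comm iτ τ >> tt′))

   opaque
    g-lin : ∀ r a s b → g (r *> a <+> s *> b) ≡ r *> g a <+> s *> g b
    g-lin r (a ∷ _ :: _) s (b ∷ _ :: _) = vec3 (solve (κ ∷ r ∷ a ∷ s :: b) (`0 *e (`1 *e `2 +e `3 *e `4)) (`1 *e (`0 *e `2) +e `3 *e (`0 *e `4)) refl) refl refl

   opaque
    h-lin : ∀ r a s b → h (r *> a <+> s *> b) ≡ r *> h a <+> s *> h b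
    h-lin r (a ∷ a' :: a″) s (b ∷ b' :: b″) = vec3 (solve (τ ∷ iκ ∷ r ∷ a ∷ s :: b) (`0 *e (`1 *e (`2 *e `3 +e `4 *e `5))) (`2 *e (`0 *e (`1 *e `3)) +e `4 *e (`0 *e (`1 *e `5))) refl) (t a' b') (t a″ b″)
     where
      t : ∀ a b → τ * (r * a + s * b) ≡ r * (τ * a) + s * (τ * b)
      t a b = solve (τ ∷ r ∷ a ∷ s :: b) (`0 *e (`1 *e `2 +e `3 *e `4)) (`1 *e (`0 *e `2) +e `3 *e (`0 *e `4)) refl

   opaque
    dot-gh : ∀ a b → dot (g a) (h b) ≡ τ * dot a b
    dot-gh a@(a₀ ∷ a₁ :: a₂) b@(b₀ ∷ b₁ :: b₂) = solve (τ ∷ κ ∷ iκ ∷ a₀ ∷ a₁ ∷ a₂ ∷ b₀ ∷ b₁ :: b₂) (`1 *e `3 *e (`0 *e (`2 *e `6)) +e `4 *e (`0 *e `7) +e `5 *e (`0 *e `8))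
     (`0 *e (`3 *e `6 +e `4 *e `7 +e `5 *e `8) +e (`0 *e `3 *e `6) *e (`1 *e `2 -e 1k)) refl ⇐ (τ * a₀ * b₀) *: kk

   opaque
    cross-g : ∀ a u → τ *> cross (g a) (g u) ≡ κ *> h (cross a u)
    cross-g (a₀ ∷ a₁ :: a₂) (u0 ∷ u1 :: u2) = vec3
     (solve (τ ∷ κ ∷ iκ :: a₁ * u2 - a₂ * u1) (`0 *e `3) (`1 *e (`0 *e (`2 *e `3)) +e (⊖ (`0 *e `3)) *e (`1 *e `2 -e 1k)) refl ⇐ (- (τ * (a₁ * u2 - a₂ * u1))) *: kk)
     (solve (τ ∷ κ ∷ a₂ ∷ u0 ∷ a₀ :: u2) (`0 *e (`2 *e (`1 *e `3) -e `1 *e `4 *e `5)) (`1 *e (`0 *e (`2 *e `3 -e `4 *e `5))) refl)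
     (solve (τ ∷ κ ∷ a₁ ∷ u0 ∷ a₀ :: u1) (`0 *e (`1 *e `4 *e `5 -e `2 *e (`1 *e `3))) (`1 *e (`0 *e (`4 *e `5 -e `2 *e `3))) refl)

   -- this is what the choice of κ is for
   opaque
    cross-gμ : ∀ a u → cross (g a) (μ *> g u) ≡ h (cross u a)
    cross-gμ a u = cong (cross (g a)) (vsolve [ μ ] [ g u ] (`0 *v ^0) (`0 *v ^0 +v 0k *v ^0) refl) >> cross-linʳ (g a) μ (g u) 0F (g u) >>
     (vsolve (μ ∷ iμ ∷ τ :: iτ) (cross (g a) (g u) :: h (cross a u)) (`0 *v ^0 +v 0k *v ^0)
      (-1k *v ^1 +v 0k *v ^1 +v (((`2 *e `3) -e 1k) *v ((⊖ `0) *v ^0 +v (⊖ (`0 *e `1)) *v ^1) +v (`0 *e `3) *v (`2 *v ^0 -v (⊖ (`2 *e `1)) *v ^1) +v (`0 *e `1 -e 1k) *v (-1k *v ^1))) refl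
      ⇐v ((tt′ s: ((- μ) *> cross (g a) (g u) <+> (- (μ * iμ)) *> h (cross a u))) &v ((μ * iτ) ∙: cross-g a u)) &v (inv-r μ μ≠0 s: (-1F *> h (cross a u)))) >>
      sym (h-lin -1F (cross a u) 0F (cross a u)) >> cong h ((vsolve [] [ cross a u ] (-1k *v ^0 +v 0k *v ^0) (-1k *v ^0) refl) >> sym (anti u a))

   ψ : Q7 → W
   ψ (u0 ∷ u1 ∷ u2 ∷ e ∷ w) = A (g (u0 ∷ u1 :: u2)) <+> (e *> c <+> B (h w))

   opaque
    ψ-mk : ∀ u e w → ψ (mk u e w) ≡ A (g u) <+> (e *> c <+> B (h w))
    ψ-mk (_ ∷ _ :: _) e w = refl

   opaque
    ψ-lin : ∀ r x s y → ψ (r *> x <+> s *> y) ≡ r *> ψ x <+> s *> ψ y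
    ψ-lin r x s y with split x | split y
    ... | u , e , w , refl | a , f , b , refl = cong ψ (mk-lin r u e w s a f b) >> ψ-mk (r *> u <+> s *> a) (r * e + s * f) (r *> w <+> s *> b) >> trans
      (cong₂ (λ p z → p <+> ((r * e + s * f) *> c <+> z)) (cong A (g-lin r u s a) >> lin-lin es r (g u) s (g a)) (cong B (h-lin r w s b) >> lin-lin fs r (h w) s (h b)))
      (vsolve (r ∷ s ∷ e :: f) (A (g u) ∷ A (g a) ∷ c ∷ B (h w) :: B (h b)) ((`0 *v ^0 +v `1 *v ^1) +v ((`0 *e `2 +e `1 *e `3) *v ^2 +v (`0 *v ^3 +v `1 *v ^4)))
       (`0 *v (^0 +v (`2 *v ^2 +v ^3)) +v `1 *v (^1 +v (`3 *v ^2 +v ^4))) refl >> cong₂ (λ p z → r *> p <+> s *> z) (sym (ψ-mk u e w)) (sym (ψ-mk a f b)))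

   φ : Vec W 7
   φ = Vec.map ψ (unit 7)

   opaque
    lin-φ : ∀ x → lin x φ ≡ ψ x
    lin-φ x = sym (MapLin.map-lin ψ ψ-lin x (unit 7)) >> cong ψ (unit-lin x)

   opaque
    c∉ : ¬ c ∈< S >
    c∉ m = n₀ (subst (_∈< S >) (sym (Good.eq good0)) (+∈ m (+∈ (∙∈ iμ (A∈ (fst dir0))) (∙∈ (- iν) (B∈ (fst (snd dir0)))))))

   opaque
    g0c : g 0c ≡ 0c
    g0c = cong (_∷ 0F :: 0F) (zeroʳ κ)

   opaque
    h0c : h 0c ≡ 0c
    h0c = vec3 (cong (τ *_) (zeroʳ iκ) >> zeroʳ τ) (zeroʳ τ) (zeroʳ τ)

   opaque
    ψ-A : ∀ u → ψ (mk u 0F 0c) ≡ A (g u)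
    ψ-A u = ψ-mk u 0F 0c >> cong (λ z → A (g u) <+> (0F *> c <+> B z)) h0c >> cong (λ z → A (g u) <+> (0F *> c <+> z)) (lin-0 fs) >> (vsolve [] (A (g u) :: c) (^0 +v (0k *v ^1 +v 0w)) (^0) refl)

   opaque
    ψ-B : ∀ w → ψ (mk 0c 0F w) ≡ B (h w)
    ψ-B w = cong (λ z → A z <+> (0F *> c <+> B (h w))) g0c >> cong (λ z → z <+> (0F *> c <+> B (h w))) (lin-0 es) >> (vsolve [] (c :: B (h w)) (0w +v (0k *v ^0 +v ^1)) (^1) refl)

   opaque
    ψ-S : ∀ u w → ψ (mk u 0F w) ≡ A (g u) <+> B (h w)
    ψ-S u w = ψ-mk u 0F w >> (vsolve [] (A (g u) ∷ c :: B (h w)) (^0 +v (0k *v ^1 +v ^2)) (^0 +v ^2) refl)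

   opaque
    ψ-0 : ∀ x → ψ x ≡ 0v → x ≡ 0v
    ψ-0 x z with split x
    ... | u , e , w , refl = go (e ≟ 0F)
     where
      go : Dec (e ≡ 0F) → mk u e w ≡ 0v
      go (no n) = ⊥-elim (c∉ (subst (_∈< S >) (vsolve (e :: inv e n) (A (g u) ∷ c :: B (h w)) ((⊖ `1) *v (^0 +v ^2)) (^1 +v ((`0 *e `1 -e 1k) *v ^1 +v (⊖ `1) *v ((^0 +v (`0 *v ^1 +v ^2)) -v 0w))) refl
       ⇐v (inv-r e n s: c) &v ((- inv e n) ∙: trans (sym (ψ-mk u e w)) z)) (∙∈ (- inv e n) (+∈ (A∈ (g u)) (B∈ (h w))))))
      go (yes refl) with AB-inj {g u} {0c} {h w} {0c} (sym (ψ-S u w) >> z >> sym (A+0 0c >> lin-0 es))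
      ... | p , r = mk3 (sym (g⁻g u) >> cong g⁻ (p >> sym g0c) >> g⁻g 0c) refl (sym (h⁻h w) >> cong h⁻ (r >> sym h0c) >> h⁻h 0c)

   opaque
    iφ : Ind φ
    iφ cs e = ψ-0 cs (sym (lin-φ cs) >> e)

   private
    dot-w : ∀ a w → dot (g a) ((- ν) *> h w) ≡ (- (ν * τ)) * dot a w
    dot-w a w = dot-comm (g a) ((- ν) *> h w) >> dot-∙ (- ν) (h w) (g a) >> cong ((- ν) *_) (dot-comm (h w) (g a) >> dot-gh a w) >> solve (ν ∷ τ :: dot a w) ((⊖ `0) *e (`1 *e `2)) ((⊖ (`0 *e `1)) *e `2) refl

    Seat : W → K3 → K3 → Set
    Seat x u w = Σ (Good x) λ G → Good.u G ≡ μ *> g u × Good.w G ≡ (- ν) *> h w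

    at-ψ : ∀ u w → dot u w ≡ 1F → Seat (ψ (mk u 1F w)) u w
    at-ψ u w e with every (μ *> g u) ((- ν) *> h w) (dot-∙ μ (g u) ((- ν) *> h w) >> cong (μ *_) (dot-w u w >> cong ((- (ν * τ)) *_) e >> *-identityʳ _) >>
       (solve (μ ∷ ν ∷ iμ :: iν) (`0 *e (⊖ (`1 *e (⊖ (`2 *e `3))))) (1k +e ((`1 *e `3) *e (`0 *e `2 -e 1k) +e 1k *e (`1 *e `3 -e 1k))) refl ⇐ (ν * iν) *: inv-r μ μ≠0 & 1F *: inv-r ν ν≠0))
    ... | x , G , eu , ew = subst (λ x → Seat x u w) (Good.eq G >> cong₂ (λ u w → c <+> (iμ *> A u <+> (- iν) *> B w)) eu ew >> cong₂ (λ p r → c <+> (iμ *> p <+> (- iν) *> r)) (lin-∙ μ (g u) es) (lin-∙ (- ν) (h w) fs) >>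
       (vsolve (μ ∷ ν ∷ iμ :: iν) (A (g u) ∷ c :: B (h w)) (^1 +v (`2 *v `0 *v ^0 +v (⊖ `3) *v (⊖ `1) *v ^2)) ((^0 +v (1k *v ^1 +v ^2)) +v ((`0 *e `2 -e 1k) *v ^0 +v (`1 *e `3 -e 1k) *v ^2)) refl
         ⇐v (inv-r μ μ≠0 s: A (g u)) &v (inv-r ν ν≠0 s: B (h w))) >> sym (ψ-mk u 1F w)) (G , eu , ew)

    at-good : ∀ {x} → Good x → ∃₂ λ u w → dot u w ≡ 1F × x ≡ ψ (mk u 1F w) × Seat x u w
    at-good {x} G = û , ŵ , d , xe , G , sym eu , sym ew
     where
      û ŵ : K3
      û = g⁻ (iμ *> Good.u G)
      ŵ = h⁻ ((- iν) *> Good.w G)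
      eu : μ *> g û ≡ Good.u G
      eu = cong (μ *>_) (gg⁻ (iμ *> Good.u G)) >> (vsolve (μ :: iμ) [ Good.u G ] (`0 *v `1 *v ^0) (^0 +v (`0 *e `1 -e 1k) *v ^0) refl ⇐v (inv-r μ μ≠0 s: Good.u G))
      ew : (- ν) *> h ŵ ≡ Good.w G
      ew = cong ((- ν) *>_) (hh⁻ ((- iν) *> Good.w G)) >> (vsolve (ν :: iν) [ Good.w G ] ((⊖ `0) *v (⊖ `1) *v ^0) (^0 +v (`0 *e `1 -e 1k) *v ^0) refl ⇐v (inv-r ν ν≠0 s: Good.w G))
      xe : x ≡ ψ (mk û 1F ŵ)
      xe = Good.eq G >> cong₂ (λ p r → c <+> (p <+> r)) (sym (lin-∙ iμ (Good.u G) es) >> cong A (sym (gg⁻ (iμ *> Good.u G)))) (sym (lin-∙ (- iν) (Good.w G) fs) >> cong B (sym (hh⁻ ((- iν) *> Good.w G)))) >>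
        (vsolve [] (A (g û) ∷ c :: B (h ŵ)) (^1 +v (^0 +v ^2)) (^0 +v (1k *v ^1 +v ^2)) refl) >> sym (ψ-mk û 1F ŵ)
      d : dot û ŵ ≡ 1F
      d = solve (μ ∷ ν ∷ iμ ∷ iν :: dot û ŵ) (`4) (1k +e (1k *e (`0 *e ((⊖ (`1 *e (⊖ (`2 *e `3)))) *e `4) -e 1k) +e (⊖ (`4 *e `1 *e `3)) *e (`0 *e `2 -e 1k) +e (⊖ `4) *e (`1 *e `3 -e 1k))) refl
       ⇐ 1F *: trans (sym (dot-∙ μ (g û) ((- ν) *> h ŵ) >> cong (μ *_) (dot-w û ŵ))) (cong₂ dot eu ew >> Dir.uw (Good.D G)) & (- (dot û ŵ * ν * iν)) *: inv-r μ μ≠0 & (- dot û ŵ) *: inv-r ν ν≠0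

    forth : ∀ {x u w a b} → Seat x u w → Eqs u 1F w a 0F b → x ~ ψ (mk a 0F b)
    forth {x} {u} {w} {a} {b} (G , eu , ew) E = subst (x ~_) (cong (λ z → A (g a) <+> B z) (cong (cross (g a)) eu >> cross-gμ a u >> cong h (Eqs.ua E >> (vsolve [] (b :: w) (1k *v ^0 +v (⊖ 0k) *v ^1) (^0) refl))) >> sym (ψ-S a b))
     (Dir.fwd (Good.D G) (g a) (cong (dot (g a)) ew >> dot-w a w >> cong ((- (ν * τ)) *_) (dot-comm a w >> Eqs.wa E >> zeroʳ 1F) >> zeroʳ _))

    back : ∀ {x u w} a b → dot u w ≡ 1F → Seat x u w → x ~ A a <+> B b → Eqs u 1F w (g⁻ a) 0F (h⁻ b)
    back {x} {u} {w} a b e (G , eu , ew) r = record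
      { ub = trans (cong (dot u) b≡) (dot-crossˡ u (g⁻ a) >> sym (zeroʳ 1F)) ; wa = wa >> sym (zeroʳ 1F)
      ; ua = sym b≡ >> (vsolve [] (h⁻ b :: w) (^0) (1k *v ^0 +v (⊖ 0k) *v ^1) refl)
      ; wb = trans (cong (cross w) b≡) (bac′ w u (g⁻ a) >> cong₂ (λ p r → p *> u <+> (- r) *> g⁻ a) wa (dot-comm w u >> e)) }
     where
      D : dot a (Good.w G) ≡ 0F × b ≡ cross a (Good.u G)
      D = Dir.bwd (Good.D G) a b r
      wa : dot w (g⁻ a) ≡ 0F
      wa = dot-comm w (g⁻ a) >> *-cancel-0 (- (ν * τ)) (-≢0 (*≢0 ν≠0 τ≢0)) (sym (dot-w (g⁻ a) w) >> cong₂ dot (gg⁻ a) (sym ew) >> fst D)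
      b≡ : h⁻ b ≡ cross u (g⁻ a)
      b≡ = cong h⁻ (snd D >> cong₂ cross (sym (gg⁻ a)) eu >> cross-gμ (g⁻ a) u) >> h⁻h _

    Image : Ln → Set
    Image m = ∃ λ ℓ → HLine F ℓ × SpanEq F (basis m) (Vec.map (λ x → lincomb F x φ) (basis ℓ))

    image : ∀ {m} x y → x ⟂ y → Ind (ψ x :: ψ y) → ψ x ∈< bas m > → ψ y ∈< bas m > → Image m
    image {m} x y h i x∈ y∈ = ln x y j , HL⇒HLine (ln x y j) h , λ z → (λ q → subst₂ (λ p r → z ∈< p :: r >) (sym (lin-φ x)) (sym (lin-φ y)) (dimEq i (x∈ :: y∈) q)) ,
      λ q → span⊆ (x∈ :: y∈) (subst₂ (λ p r → z ∈< p :: r >) (lin-φ x) (lin-φ y) q)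
     where
      j : Ind (x :: y)
      j cs e = i cs (sym (MapLin.map-lin ψ ψ-lin cs (x :: y)) >> cong ψ e >> MapLin.map-0 ψ ψ-lin)

    flag-image : ∀ {m a b} → a ≢ 0c → b ≢ 0c → dot a b ≡ 0F → A a ∈< bas m > → B b ∈< bas m > → Image m
    flag-image {m} {a} {b} an bn e a∈ b∈ = image {m} (mk (g⁻ a) 0F 0c) (mk 0c 0F (h⁻ b)) (eqs⁻ {g⁻ a} {0F} {0c} {0c} {0F} {h⁻ b} E)
      (subst₂ (λ p r → Ind (p :: r)) (sym xe) (sym ye) (ext (ind1 (nzB bn)) (λ p → A∉B an (span⊆ [ (b , refl) ] p)))) (subst (_∈< bas m >) (sym xe) a∈) (subst (_∈< bas m >) (sym ye) b∈)
     where
      xe : ψ (mk (g⁻ a) 0F 0c) ≡ A a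
      xe = ψ-A (g⁻ a) >> cong A (gg⁻ a)
      ye : ψ (mk 0c 0F (h⁻ b)) ≡ B b
      ye = ψ-B (h⁻ b) >> cong B (hh⁻ b)
      cr : ∀ u → cross 0c u ≡ 0c
      cr u@(a ∷ b :: d) = solveV (a ∷ b :: d) (0k *e `2 -e 0k *e `1 ∷ 0k *e `0 -e 0k *e `2 :: 0k *e `1 -e 0k *e `0) (0k ∷ 0k :: 0k) refl
      z3 : ∀ (p r : K3) → 0c ≡ 0F *> p <+> (- 0F) *> r
      z3 p r = vsolve [] (p :: r) 0w (0k *v ^0 +v (⊖ 0k) *v ^1) refl
      E : Eqs (g⁻ a) 0F 0c 0c 0F (h⁻ b)
      E = record { ub = trans (*-cancel-0 τ τ≢0 (sym (dot-gh (g⁻ a) (h⁻ b)) >> cong₂ dot (gg⁻ a) (hh⁻ b) >> e)) (sym (zeroˡ 0F)) ; wa = trans (dot-0 0c) (sym (zeroˡ 0F))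
       ; ua = trans (anti (g⁻ a) 0c) (cong (-1F *>_) (cr (g⁻ a)) >> (vsolve [] [] (-1k *v 0w) 0w refl) >> z3 (h⁻ b) 0c) ; wb = trans (cr (h⁻ b)) (z3 (g⁻ a) 0c) }

    steep-image : ∀ {X Y} (i : Ind (X :: Y)) → L (ln X Y i) → ¬ X ∈< S > → Image (ln X Y i)
    steep-image {X} {Y} i l n = go (foot pX n (ind-nonzero (ind-tail i) , L~ l (wk∈ hd∈) (wk∈ hd∈)) i) (all-good pX n)
     where
      pX : Pnt X
      pX = ind-nonzero i , L~ l hd∈ hd∈
      go : (∃ λ d → d ≢ 0v × d ∈< X :: Y > × d ∈< S >) → Good′ X → Image (ln X Y i)
      go (d , dn , d∈ , dS) (_ , _ , k , kn , G) with S-split dS | at-good G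
      ... | a , b , refl | u , w , e , xe , P = image {ln X Y i} (mk u 1F w) (mk (g⁻ a) 0F (h⁻ b)) (eqs⁻ {u} {1F} {w} {g⁻ a} {0F} {h⁻ b} (back a b e P (~sym (~∙ k (L~ l d∈ hd∈)))))
        (subst₂ (λ p r → Ind (p :: r)) xe (sym ye) (ext (ind1 dn) (λ m → Good.nx G (span⊆ [ dS ] m)))) (subst (_∈< X :: Y >) xe (∙∈ k hd∈)) (subst (_∈< X :: Y >) (sym ye) d∈)
       where
        ye : ψ (mk (g⁻ a) 0F (h⁻ b)) ≡ A a <+> B b
        ye = ψ-S (g⁻ a) (h⁻ b) >> cong₂ (λ p r → A p <+> B r) (gg⁻ a) (hh⁻ b)

    -- on a line inside S the thin points are not full, so the line is spanned by a point of α and one of β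
    flat-image : ∀ {X Y} (i : Ind (X :: Y)) → L (ln X Y i) → X ∈< S > → Y ∈< S > → Image (ln X Y i)
    flat-image {X} {Y} i l XS YS with S-split XS
    ... | a , b , refl = go (a ≟v 0c) (b ≟v 0c)
     where
      X~Y : A a <+> B b ~ Y
      X~Y = L~ l hd∈ (wk∈ hd∈)
      rest : ∀ {p k z} → A a <+> B b ≡ p → Y ≡ k *> p <+> z → z ∈< A a <+> B b :: Y >
      rest {p} {k} {z} refl e = - k :: 1F , (vsolve [ k ] (p ∷ Y :: z) ((⊖ `0) *v ^0 +v (1k *v ^1 +v 0w)) (^2 +v 1k *v (^1 -v (`0 *v ^0 +v ^2))) refl ⇐v 1F ∙: e)
      dep : ∀ {p k} → A a <+> B b ≡ p → Y ≡ k *> p <+> 0v → ⊥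
      dep {p} {k} refl e = ∉-head (swap i) (k ∷ [] , trans (vsolve [ k ] [ p ] (`0 *v ^0 +v 0w) (`0 *v ^0 +v 0w) refl) (sym e))
      go : Dec (a ≡ 0c) → Dec (b ≡ 0c) → Image (ln (A a <+> B b) Y i)
      go (yes refl) (yes refl) = ⊥-elim (ind-nonzero i (A+0 0c >> lin-0 es))
      go (yes refl) (no bn) with Du.planeA bn (subst (_~ Y) (0+B b) X~Y)
      ... | k , w , e , d = flag-image {ln (A 0c <+> B b) Y i} {w} {b} (λ { refl → dep {k = k} (0+B b) (e >> cong (k *> B b <+>_) (lin-0 es)) }) bn (dot-comm w b >> d) (rest {k = k} (0+B b) e) (subst (_∈< A 0c <+> B b :: Y >) (0+B b) hd∈)
      go (no an) (yes refl) with planeA an (subst (_~ Y) (A+0 a) X~Y)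
      ... | k , w , e , d = flag-image {ln (A a <+> B 0c) Y i} {a} {w} an (λ { refl → dep {k = k} (A+0 a) (e >> cong (k *> A a <+>_) (lin-0 fs)) }) d (subst (_∈< A a <+> B 0c :: Y >) (A+0 a) hd∈) (rest {k = k} (A+0 a) e)
      go (no an) (no bn) = fin (ind? (Y ∷ A a :: A a <+> B b))
       where
        ab : dot a b ≡ 0F
        ab = S-point Fr an bn (ind-nonzero i , L~ l hd∈ hd∈)
        A~B : A a ~ B b
        A~B = orth a b an bn ab
        iA : Ind (A a :: A a <+> B b)
        iA = ind-gen {B = A a :: B b} (ext (ind1 (nzB bn)) λ p → A∉B an (span⊆ [ (b , refl) ] p)) (g0 :: (- 1F :: 1F , vsolve [] (A a :: B b) (-1k *v ^0 +v (1k *v (^0 +v ^1) +v 0w)) (^1) refl))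
        fin : Dep (Y ∷ A a :: A a <+> B b) ⊎ Ind (Y ∷ A a :: A a <+> B b) → Image (ln (A a <+> B b) Y i)
        fin (inj₂ j) = ⊥-elim (no-thin-full Fr an bn ab (full2 X~Y (~sym (~+ (nzA an) (snd (pA an)) A~B)) j YS (A∈ a) XS))
        fin (inj₁ dp) = flag-image {ln (A a <+> B b) Y i} {a} {b} an bn ab a∈ (subst (_∈< A a <+> B b :: Y >) (vsolve [] (A a :: B b) ((^0 +v ^1) -v ^0) (^1) refl) (+∈ hd∈ (∙∈ -1F a∈)))
         where
          a∈ : A a ∈< A a <+> B b :: Y >
          a∈ = dimEq i (g1 :: head∈ iA dp) g0

    into : ∀ m → L m → Image m
    into (subspace (X :: Y) i) l with ∈? X S | ∈? Y S
    ... | no n | _ = steep-image i l n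
    ... | yes p | yes r = flat-image i l p r
    ... | yes _ | no n with steep-image (swap i) (L-resp {ln X Y i} {ln Y X (swap i)} (same (sub-eq (ln X Y i) (ln Y X (swap i)) (g1 :: g0))) l) n
    ...   | ℓ , h , e = ℓ , h , λ z → (λ q → fst (e z) (span⊆ (g1 :: g0) q)) , λ q → span⊆ (g1 :: g0) (snd (e z) q)

    -- By `flag` a line of H(q) is spanned either by a point of each plane or by a point with middle
    -- coordinate one and a point with middle coordinate zero; `orth` handles the former, `forth`
    -- the latter.
    onto : ∀ m → Image m → L m
    onto m (ℓ@(subspace (_ :: _) _) , hl , se) = go (flag {ℓ} hℓ)
     where
      hℓ : HL ℓ
      hℓ = HLine⇒HL ℓ hl
      fin : ∀ {x y} → ψ x ~ ψ y → Ind (ψ x :: ψ y) → x ∈< bas ℓ > → y ∈< bas ℓ > → L m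
      fin {x} {y} xy i x∈ y∈ = L-resp (≈-sym (spans i {m} (in-m x∈) (in-m y∈))) (~L i xy)
       where
        in-m : ∀ {z} → z ∈< bas ℓ > → ψ z ∈< bas m >
        in-m {z} z∈ = subst (_∈< bas m >) (lin-φ z) (snd (se (lin z φ)) (MapLin.map-∈ (λ x → lin x φ) (lin-lin φ) z∈))
      go : (∃₂ λ a b → a ≢ 0c × b ≢ 0c × dot a b ≡ 0F × HexFlags.At a b ℓ) → L m
      go (a , b , an , bn , e , inj₁ (x∈ , y∈)) = fin (subst₂ _~_ (sym (ψ-A a)) (sym (ψ-B b)) (orth (g a) (h b) gn hn (dot-gh a b >> cong (τ *_) e >> zeroʳ τ)))
        (subst₂ (λ p r → Ind (p :: r)) (sym (ψ-A a)) (sym (ψ-B b)) (ext (ind1 (nzB hn)) (λ p → A∉B gn (span⊆ [ (h b , refl) ] p)))) x∈ y∈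
       where
        gn : g a ≢ 0c
        gn z = an (sym (g⁻g a) >> cong g⁻ (z >> sym g0c) >> g⁻g 0c)
        hn : h b ≢ 0c
        hn z = bn (sym (h⁻h b) >> cong h⁻ (z >> sym h0c) >> h⁻h 0c)
      go (a , b , an , bn , e , inj₂ (l , ln' , x∈ , u , w , y∈)) = fin (forth P (eqs {u} {1F} {w} {a} {0F} {l *> b} (on {ℓ} hℓ y∈ x∈)))
        (ext (ind1 xn) (λ m → Good.nx (fst P) (span⊆ [ subst (_∈< S >) (sym (ψ-S a (l *> b))) (+∈ (A∈ (g a)) (B∈ (h (l *> b)))) ] m))) y∈ x∈
       where
        P : Seat (ψ (mk u 1F w)) u w
        P = at-ψ u w (Eqs.ub (eqs {u} {1F} {w} {u} {1F} {w} (on {ℓ} hℓ y∈ y∈)) >> *-identityˡ 1F)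
        xn : ψ (mk a 0F (l *> b)) ≢ 0v
        xn z = an (fst (mk-inj {a} {0F} {l *> b} {0c} {0F} {0c} (ψ-0 _ z)))

   opaque
    hexagon : IsHexagonLineSet F n L
    hexagon = φ , iφ , λ m → mk⇔ (into m) (onto m)

  -- Assembling the two directions

  module Conclusion where
   open Frames
   opaque
    hexagon-of : (∃ λ ℓ → L ℓ) → IsHexagonLineSet F n L
    hexagon-of (ℓ@(subspace (x :: y) i) , l) = Recover.hexagon (mkFrame (apt {x} (ind-nonzero i , L~ {ℓ} l hd∈ hd∈)))

theorem2 : (F : FiniteField) (n : ℕ) (L : Line F (ℕ.suc n) → Set) →
    IsLineSet F n L →
    (∃ λ ℓ → L ℓ) →
    IsHexagonLineSet F n L ⇔ AllConditions F n L
theorem2 F n L isLS ne = mk⇔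
   (λ (φ , iφ , e) → HexEmbedding.conditions F n L isLS φ iφ (λ m → Equivalence.to (e m)) (λ m → Equivalence.from (e m)))
   (λ (pt , pl , sd , hp , to) → Conclusion.hexagon-of F n L (record { isLS = isLS ; pt = pt ; pl = pl ; sd = sd ; hp = hp ; to = to }) ne)
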